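{- Let $m,n,k$ be non-negative integers with $1\le k\le n$. The sum over all $(m,n,k)$-Magog trapezoids of $P^{\#\text{maxima}}Q^{\#\text{minima}}$ equals the constant term in $x_1,\dots,x_n$ of $$(-1)^{(m-1)n+\binom{n+1}{2}}\Bigl((-1)^kQ(1+x_{n-k+1}^{ -1})\prod_{j=n-k+2}^n(x_j^{ -1}-x_{n-k+1})+1\Bigr)\prod_{i=1}^{n-k}(1+x_i)^{ -i-k}x_i^{ -m-2n+i+1}\bigl(x_i-P(1+x_i)\bigr)\bigl(x_i-Q(1+x_i)\bigr)$$ $$\times\prod_{i=n-k+1}^n(1+x_i)^{ -n-1}x_i^{ -m-2n+i+2}\bigl(x_i-P(1+x_i)\bigr)\prod_{1\le i<j\le n}(x_i-x_j)(x_i+x_j+x_ix_j)\prod_{n-k+1\le i<j\le n}\frac{1}{1-x_ix_j}.$$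
   Context: For non-negative integers $m,n,k$ with $k\le n$, an $(m,n,k)$-Magog trapezoid is an array $(m_{i,j})$ of positive integers indexed by $1\le j\le i\le n$ with $i-j\le k-1$ (the $k$ rightmost SE-diagonals of a triangular array with $n$ rows), such that $m_{i+1,j}\le m_{i,j}\le m_{i+1,j+1}$ whenever these entries exist and $m_{i,j}\le m+j$. A minimum is an entry equal to $1$ in the leftmost SE-diagonal $\{m_{i,j}:i-j=k-1\}$; a maximum is an entry $m_{j,j}$ with $m_{j,j}=m+j$. $P,Q$ are indeterminates. Negative powers of $(1+x_i)$ and the factors $\frac1{1-x_ix_j}$ are expanded as power series in the $x_i$ with non-negative exponents. -}

module Defs where

open import Data.Nat as ℕ using (ℕ; zero; suc; _+_; _∸_; _≤ᵇ_; _≡ᵇ_)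
open import Data.Nat.Combinatorics using (_C_)
open import Data.Integer as ℤ using (ℤ; +_; -[1+_]; ∣_∣)
open import Data.Bool using (Bool; true; false; _∧_; _∨_; not; if_then_else_)
open import Data.List as List using (List; []; _∷_; map; concatMap; foldr)
open import Data.Vec as Vec using (Vec; []; _∷_)
open import Data.Maybe using (Maybe; just; nothing)
open import Data.Product using (_×_; _,_; proj₁; proj₂)

range : ℕ → ℕ → List ℕ
range a b = map (λ t → a + t) (List.upTo (suc b ∸ a))

pairs : ℕ → ℕ → List (ℕ × ℕ)
pairs a b = concatMap (λ i → map (λ j → (i , j)) (range (suc i) b)) (range a b)

countB : {A : Set} → (A → Bool) → List A → ℕ
countB p []       = 0
countB p (x ∷ xs) = (if p x then 1 else 0) + countB p xs

allB : {A : Set} → (A → Bool) → List A → Bool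
allB p []       = true
allB p (x ∷ xs) = p x ∧ allB p xs

sumℤ : List ℤ → ℤ
sumℤ = foldr ℤ._+_ (+ 0)

negOnePowℕ : ℕ → ℤ
negOnePowℕ zero    = + 1
negOnePowℕ (suc t) = ℤ.- negOnePowℕ t

negOnePowℤ : ℤ → ℤ
negOnePowℤ z = negOnePowℕ ∣ z ∣

vecEq : ∀ {N} → Vec ℕ N → Vec ℕ N → Bool
vecEq []       []       = true
vecEq (a ∷ as) (b ∷ bs) = (a ≡ᵇ b) ∧ vecEq as bs

isZeroV : ∀ {N} → Vec ℕ N → Bool
isZeroV []       = true
isZeroV (a ∷ as) = (a ≡ᵇ 0) ∧ isZeroV as

vsub : ∀ {N} → Vec ℕ N → Vec ℕ N → Maybe (Vec ℕ N)
vsub []       []       = just []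
vsub (e ∷ es) (a ∷ as) with a ≤ᵇ e | vsub es as
... | true  | just d = just ((e ∸ a) ∷ d)
... | _     | _      = nothing

unitV : (N : ℕ) → ℕ → Vec ℕ N
unitV zero    _       = []
unitV (suc N) zero    = 1 ∷ Vec.replicate N 0
unitV (suc N) (suc i) = 0 ∷ unitV N i

nth : ∀ {N} → Vec ℕ N → ℕ → ℕ
nth []       _       = 0
nth (a ∷ as) zero    = a
nth (a ∷ as) (suc i) = nth as i

toNatV : ∀ {N} → Vec ℤ N → Maybe (Vec ℕ N)
toNatV []            = just []
toNatV (+ a ∷ as) with toNatV as
... | just v  = just (a ∷ v)
... | nothing = nothing
toNatV (-[1+ _ ] ∷ _) = nothing

-- Formal power series over ℤ in N variables (non-negative exponents),
-- given by their coefficient functions.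

PS : ℕ → Set
PS N = Vec ℕ N → ℤ

splits : ∀ {N} → Vec ℕ N → List (Vec ℕ N × Vec ℕ N)
splits []       = ([] , []) ∷ []
splits (e ∷ es) =
  concatMap (λ i → map (λ p → (i ∷ proj₁ p , (e ∸ i) ∷ proj₂ p)) (splits es))
            (List.upTo (suc e))

_+ₚ_ : ∀ {N} → PS N → PS N → PS N
(f +ₚ g) e = f e ℤ.+ g e

-ₚ_ : ∀ {N} → PS N → PS N
(-ₚ f) e = ℤ.- f e

_*ₚ_ : ∀ {N} → PS N → PS N → PS N
(f *ₚ g) e = sumℤ (map (λ p → f (proj₁ p) ℤ.* g (proj₂ p)) (splits e))

constₚ : ∀ {N} → ℤ → PS N
constₚ c e = if isZeroV e then c else + 0

monoₚ : ∀ {N} → Vec ℕ N → PS N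
monoₚ a e = if vecEq a e then + 1 else + 0

shiftₚ : ∀ {N} → Vec ℕ N → PS N → PS N
shiftₚ a f e with vsub e a
... | just d  = f d
... | nothing = + 0

-- (1 + x_i)^{-1} = Σ_t (-1)^t x_i^t   (0-based variable index i)
inv1pₚ : (N : ℕ) → ℕ → PS N
inv1pₚ N i e =
  if vecEq e (Vec.map (λ u → nth e i ℕ.* u) (unitV N i)) then negOnePowℕ (nth e i) else + 0

-- 1 / (1 - x_i x_j) = Σ_t x_i^t x_j^t   (0-based, i ≠ j)
geo2ₚ : (N : ℕ) → ℕ → ℕ → PS N
geo2ₚ N i j e =
  if vecEq e (Vec.map (λ u → nth e i ℕ.* u) (Vec.zipWith _+_ (unitV N i) (unitV N j)))
  then + 1 else + 0

-- Laurent series of the form x^s · F with s ∈ ℤ^N and F a power series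

record LS (N : ℕ) : Set where
  constructor _⊙_
  field
    sh : Vec ℤ N
    bd : PS N
open LS public

module Laurent (N : ℕ) where

  fromPS : PS N → LS N
  fromPS F = Vec.replicate N (+ 0) ⊙ F

  constL : ℤ → LS N
  constL c = fromPS (constₚ c)

  oneL : LS N
  oneL = constL (+ 1)

  _*L_ : LS N → LS N → LS N
  (s ⊙ F) *L (t ⊙ G) = Vec.zipWith ℤ._+_ s t ⊙ (F *ₚ G)

  _+L_ : LS N → LS N → LS N
  (s ⊙ F) +L (t ⊙ G) =
    let u = Vec.zipWith ℤ._⊓_ s t
        d = λ v → Vec.zipWith (λ a b → ∣ a ℤ.- b ∣) v u
    in u ⊙ (shiftₚ (d s) F +ₚ shiftₚ (d t) G)

  -L_ : LS N → LS N
  -L (s ⊙ F) = s ⊙ (-ₚ F)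

  _-L_ : LS N → LS N → LS N
  A -L B = A +L (-L B)

  infixl 7 _*L_
  infixl 6 _+L_ _-L_

  powL : LS N → ℕ → LS N
  powL A zero    = oneL
  powL A (suc t) = A *L powL A t

  prodL : {A : Set} → List A → (A → LS N) → LS N
  prodL xs f = foldr (λ a acc → f a *L acc) oneL xs

  varL : ℕ → LS N
  varL i = fromPS (monoₚ (unitV N i))

  varPowL : ℕ → ℤ → LS N
  varPowL i z = Vec.map (λ u → + u ℤ.* z) (unitV N i) ⊙ constₚ (+ 1)

  coeffL : LS N → Vec ℤ N → ℤ
  coeffL (s ⊙ F) t with toNatV (Vec.zipWith ℤ._-_ t s)
  ... | just v  = F v
  ... | nothing = + 0

-- The right-hand side.  Variables (0-based): x_1 … x_n are 0 … n-1,
-- P is n, Q is n+1.  Thus N = n + 2.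

module RHS (m n k : ℕ) where
  open Laurent (n + 2)

  x : ℕ → LS (n + 2)
  x i = varL (i ∸ 1)

  xpow : ℕ → ℤ → LS (n + 2)
  xpow i z = varPowL (i ∸ 1) z

  P Q : LS (n + 2)
  P = varL n
  Q = varL (suc n)

  inv1p : ℕ → LS (n + 2)
  inv1p i = fromPS (inv1pₚ (n + 2) (i ∸ 1))

  geo2 : ℕ → ℕ → LS (n + 2)
  geo2 i j = fromPS (geo2ₚ (n + 2) (i ∸ 1) (j ∸ 1))

  r : ℕ
  r = suc (n ∸ k)

  sign : ℤ
  sign = negOnePowℤ (((+ m) ℤ.- (+ 1)) ℤ.* (+ n) ℤ.+ (+ (suc n C 2)))

  termA : LS (n + 2)
  termA = (constL (negOnePowℕ k) *L Q *L (oneL +L xpow r (ℤ.- (+ 1)))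
            *L prodL (range (suc r) n) (λ j → xpow j (ℤ.- (+ 1)) -L x r))
          +L oneL

  termB : LS (n + 2)
  termB = prodL (range 1 (n ∸ k)) λ i →
    powL (inv1p i) (i + k)
    *L xpow i ((+ (i + 1)) ℤ.- (+ (m + 2 ℕ.* n)))
    *L (x i -L P *L (oneL +L x i))
    *L (x i -L Q *L (oneL +L x i))

  termC : LS (n + 2)
  termC = prodL (range r n) λ i →
    powL (inv1p i) (n + 1)
    *L xpow i ((+ (i + 2)) ℤ.- (+ (m + 2 ℕ.* n)))
    *L (x i -L P *L (oneL +L x i))

  termD : LS (n + 2)
  termD = prodL (pairs 1 n) λ p →
    (x (proj₁ p) -L x (proj₂ p))
    *L (x (proj₁ p) +L x (proj₂ p) +L x (proj₁ p) *L x (proj₂ p))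

  termE : LS (n + 2)
  termE = prodL (pairs r n) λ p → geo2 (proj₁ p) (proj₂ p)

  rhs : LS (n + 2)
  rhs = constL sign *L termA *L termB *L termC *L termD *L termE

  rhsCoeff : ℕ → ℕ → ℤ
  rhsCoeff a b = coeffL rhs (Vec.replicate n (+ 0) Vec.++ ((+ a) ∷ (+ b) ∷ []))

-- Magog trapezoids.  An array is an association list from positions
-- (i , j) to values.

module Magog (m n k : ℕ) where

  positions : List (ℕ × ℕ)
  positions = concatMap (λ i → map (λ j → (i , j)) (range (suc (i ∸ k)) i)) (range 1 n)

  isPos : ℕ → ℕ → Bool
  isPos i j = (1 ≤ᵇ j) ∧ (j ≤ᵇ i) ∧ (i ≤ᵇ n) ∧ (suc i ≤ᵇ j + k)

  Array : Set
  Array = List ((ℕ × ℕ) × ℕ)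

  get : Array → ℕ → ℕ → ℕ
  get []                    i j = 0
  get (((i' , j') , v) ∷ A) i j = if (i ≡ᵇ i') ∧ (j ≡ᵇ j') then v else get A i j

  candidates : List (ℕ × ℕ) → List Array
  candidates []             = [] ∷ []
  candidates ((i , j) ∷ ps) =
    concatMap (λ A → map (λ v → ((i , j) , v) ∷ A) (range 1 (m + j))) (candidates ps)

  _⇒ᵇ_ : Bool → Bool → Bool
  p ⇒ᵇ q = not p ∨ q

  isMagog : Array → Bool
  isMagog A = allB (λ p → let i = proj₁ p ; j = proj₂ p ; v = get A i j in
      (1 ≤ᵇ v) ∧ (v ≤ᵇ m + j)
    ∧ (isPos (suc i) j ⇒ᵇ (get A (suc i) j ≤ᵇ v))
    ∧ (isPos (suc i) (suc j) ⇒ᵇ (v ≤ᵇ get A (suc i) (suc j)))) positions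

  -- entries equal to 1 on the leftmost SE-diagonal i - j = k - 1
  minima : Array → ℕ
  minima A = countB (λ p → (suc (proj₁ p) ≡ᵇ proj₂ p + k) ∧ (get A (proj₁ p) (proj₂ p) ≡ᵇ 1)) positions

  maxima : Array → ℕ
  maxima A = countB (λ p → (proj₁ p ≡ᵇ proj₂ p) ∧ (get A (proj₁ p) (proj₂ p) ≡ᵇ m + proj₂ p)) positions

  -- number of (m,n,k)-Magog trapezoids with a maxima and b minima
  -- (= coefficient of P^a Q^b in Σ_T P^{#max} Q^{#min})
  magogCount : ℕ → ℕ → ℕ
  magogCount a b =
    countB (λ A → isMagog A ∧ (maxima A ≡ᵇ a) ∧ (minima A ≡ᵇ b)) (candidates positions)

{-# OPTIONS --safe #-}

-- The columns of a trapezoid are weakly decreasing, so a trapezoid is a family of n non-intersecting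
-- lattice paths, and its row N shows the paths that are alive at time N. Put X i = - x i. Up to powers
-- of 1 - X i, the product of the (x i - x j) (x i + x j + x i x j) is a Vandermonde determinant in
-- w i = X i ^ 2 / (1 - X i), so the coefficients are alternating in the exponents of the other factors:
-- whatever is symmetric under the exchange of two variables contributes nothing. This is used twice.
-- First, Littlewood's identity unfolds the product of the 1 / (1 - x i x j) into the sum over all bottom
-- rows a of the monomials ∏ X i ^ (a i + i), and the factor with Q singles out the rows with least
-- entry 1. Second, the product of one factor 1 / (1 - X i) for each path telescopes to the sum over all
-- rows that interlace with the given one. Expanding the determinant along the variable of the path that
-- starts in the current row (in all other terms some degree is too small) then removes this variable,
-- so that the constant term obeys the row by row recursion of the trapezoids.

module Submission where

open import Defs
open import Level using (0ℓ)
open import Algebra.Bundles using (CommutativeRing; RawRing; CommutativeMonoid)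
open import Algebra.Structures using (IsAbelianGroup)
import Algebra.Solver.Ring as RingSolver
import Algebra.Solver.Ring.AlmostCommutativeRing as ACR
import Algebra.Solver.CommutativeMonoid as MonoidSolver
import Algebra.Solver.Monoid.Expression as MonoidExpr
import Algebra.Properties.Ring as RingProps
import Algebra.Properties.CommutativeSemiring.Exp as Exponentiation
import Algebra.Properties.Semiring.Mult as SemiringMult
import Relation.Binary.Reasoning.Setoid as SetoidReasoning
open import Data.Bool.Properties using (∧-comm; ∧-identityʳ; ∧-zeroʳ)
open import Data.Bool using (Bool; true; false; _∧_; if_then_else_; T)
open import Data.Empty using (⊥; ⊥-elim)
open import Data.Integer as ℤ using (ℤ; +_; -[1+_]; _⊖_)
import Data.Integer.Properties as ℤₚ
open import Data.List as List using (List; []; _∷_; map; concatMap; _++_; length; upTo; applyUpTo)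
import Data.List.Properties as Listₚ
open import Data.Maybe using (Maybe; just; nothing)
open import Data.Nat as ℕ using (ℕ; zero; suc; _∸_; _≤_; _<_; z≤n; s≤s; _≤ᵇ_; _≡ᵇ_)
import Data.Nat.Properties as ℕₚ
open ℕₚ using
  ( *-monoʳ-≤; +-cancelʳ-≡; +-cancelˡ-<; +-cancelˡ-≡; +-mono-≤; +-monoʳ-<; +-monoʳ-≤; +-monoˡ-<;
    +-monoˡ-≤; +-suc; +-∸-assoc; 0∸n≡0; 1+n≢0; 1+n≢n; <-irrefl; <-trans; <-≤-trans; <⇒≤; <⇒≱; m+[n∸m]≡n;
    m+n∸m≡n; m<m+n; m<n⇒0<n∸m; m∸[m∸n]≡n; m∸n+n≡m; m∸n≤m; m≤m+n; m≤n+m; m≤n+m∸n; m≤n⇒m∸n≡0; n<1+n; n∸n≡0;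
    n≤1+n; suc-injective; ∸-+-assoc; ∸-monoˡ-≤; ≡ᵇ⇒≡; ≡⇒≡ᵇ; ≤-<-trans; ≤-pred; ≤-refl; ≤-reflexive;
    ≤-trans; ≤ᵇ⇒≤; ≤⇒≤ᵇ; ≤∧≢⇒<; ≮⇒≥; ≰⇒> )
import Data.Nat.Combinatorics as Comb
open import Data.Product using (Σ; _×_; _,_; proj₁; proj₂)
open import Data.Sum using (_⊎_; inj₁; inj₂)
open import Data.Unit using (⊤; tt)
open import Data.Vec as Vec using (Vec; []; _∷_)
open import Function using (_∘_; id)
open import Data.Nat.Tactic.RingSolver using (solve-∀)
open import Relation.Binary.PropositionalEquality as ≡ using (_≡_; _≢_; refl; sym; trans; cong; cong₂; subst)
open import Relation.Nullary using (Dec; yes; no)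

-- The constant `C = m + 2n` encodes the bounds on the entries. Each row supplies a factor
-- `X p ^ 2`, which comes from `w p`, for every path `p` that starts above it. When row `N` is
-- reached, `X N` therefore still needs the power `C - 2 (n - N) = (m + N) + N`, and the row itself
-- brings `X N ^ (L + N)`, where `L` is its last entry. If `L` exceeds `m + N`, the power is too
-- large; if `L = m + N`, it is exactly right; if `L` is smaller, a geometric series has to fill the
-- gap. The factor `P + X N / (1 - X N)` gives the weight `P` to an exact hit and the weight 1 to a
-- gap, so that `P` counts the maxima. In the same way `Q + X p / (1 - X p)` marks the entries 1 on
-- the left edge. The obstacle is that the algebra sees a bound only in the row where a path starts.
-- The sums over interlacing rows also run over larger entries, so an excess has to be traced
-- upwards along its column until it meets the bound.

-- Commutative rings with a solver for integer coefficients

module RingKit (R : CommutativeRing 0ℓ 0ℓ) where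
  open CommutativeRing R public hiding (refl; sym; trans)
  open CommutativeRing R public using () renaming (refl to ≈-refl; sym to ≈-sym; trans to ≈-trans)
  open RingProps ring public using (-‿distribˡ-*; -‿distribʳ-*; -0#≈0#; -‿involutive; -‿+-comm)
  open SemiringMult semiring using (×-homo-+; ×1-homo-*) renaming (_×_ to _·_)
  open SetoidReasoning setoid public

  ιℤ : ℤ → Carrier
  ιℤ (+ n)    = n · 1#
  ιℤ -[1+ n ] = - (suc n · 1#)

  private
    ι-⊖ : ∀ m n → ιℤ (m ⊖ n) ≈ m · 1# - n · 1#
    ι-⊖ m zero = ≈-sym (≈-trans (+-congˡ -0#≈0#) (+-identityʳ _))
    ι-⊖ zero (suc n) = ≈-sym (+-identityˡ _)
    ι-⊖ (suc m) (suc n) = begin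
      ιℤ (suc m ⊖ suc n)                  ≡⟨ cong ιℤ (ℤₚ.[1+m]⊖[1+n]≡m⊖n m n) ⟩
      ιℤ (m ⊖ n)                          ≈⟨ ι-⊖ m n ⟩
      m · 1# - n · 1#                     ≈⟨ ≈-sym (+-congʳ (≈-trans (+-congʳ (-‿inverseʳ 1#)) (+-identityˡ _))) ⟩
      1# - 1# + m · 1# - n · 1#           ≈⟨ +-congʳ (+-assoc _ _ _) ⟩
      1# + (- 1# + m · 1#) - n · 1#       ≈⟨ +-congʳ (+-congˡ (+-comm _ _)) ⟩
      1# + (m · 1# - 1#) - n · 1#         ≈⟨ +-congʳ (≈-sym (+-assoc _ _ _)) ⟩
      1# + m · 1# - 1# - n · 1#           ≈⟨ +-assoc _ _ _ ⟩
      1# + m · 1# + (- 1# - n · 1#)       ≈⟨ +-congˡ (-‿+-comm _ _) ⟩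
      suc m · 1# - suc n · 1#             ∎

    ι-+ : ∀ i j → ιℤ (i ℤ.+ j) ≈ ιℤ i + ιℤ j
    ι-+ (+ m) (+ n) = ×-homo-+ 1# m n
    ι-+ (+ m) -[1+ n ] = ι-⊖ m (suc n)
    ι-+ -[1+ m ] (+ n) = ≈-trans (ι-⊖ n (suc m)) (+-comm _ _)
    ι-+ -[1+ m ] -[1+ n ] = begin
      - (suc (suc (m ℕ.+ n)) · 1#)        ≡⟨ cong (λ t → - (suc t · 1#)) (sym (+-suc m n)) ⟩
      - ((suc m ℕ.+ suc n) · 1#)          ≈⟨ -‿cong (×-homo-+ 1# (suc m) (suc n)) ⟩
      - (suc m · 1# + suc n · 1#)         ≈⟨ ≈-sym (-‿+-comm _ _) ⟩
      - (suc m · 1#) - suc n · 1#         ∎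

    ι-neg : ∀ i → ιℤ (ℤ.- i) ≈ - ιℤ i
    ι-neg (+ zero) = ≈-sym -0#≈0#
    ι-neg (+ suc n) = ≈-refl
    ι-neg -[1+ n ] = ≈-sym (-‿involutive _)

    ι-*ᵖ : ∀ m j → ιℤ (+ m ℤ.* j) ≈ m · 1# * ιℤ j
    ι-*ᵖ m (+ n) = ≈-trans (reflexive (cong ιℤ (sym (ℤₚ.pos-* m n)))) (×1-homo-* m n)
    ι-*ᵖ m -[1+ n ] = begin
      ιℤ (+ m ℤ.* -[1+ n ])               ≡⟨ cong ιℤ (sym (ℤₚ.neg-distribʳ-* (+ m) (+ suc n))) ⟩
      ιℤ (ℤ.- (+ m ℤ.* + suc n))          ≈⟨ ι-neg (+ m ℤ.* + suc n) ⟩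
      - ιℤ (+ m ℤ.* + suc n)              ≈⟨ -‿cong (ι-*ᵖ m (+ suc n)) ⟩
      - (m · 1# * (suc n · 1#))           ≈⟨ -‿distribʳ-* _ _ ⟩
      m · 1# * - (suc n · 1#)             ∎

    ι-* : ∀ i j → ιℤ (i ℤ.* j) ≈ ιℤ i * ιℤ j
    ι-* (+ m) j = ι-*ᵖ m j
    ι-* -[1+ m ] j = begin
      ιℤ (-[1+ m ] ℤ.* j)                 ≡⟨ cong ιℤ (sym (ℤₚ.neg-distribˡ-* (+ suc m) j)) ⟩
      ιℤ (ℤ.- (+ suc m ℤ.* j))            ≈⟨ ι-neg (+ suc m ℤ.* j) ⟩
      - ιℤ (+ suc m ℤ.* j)                ≈⟨ -‿cong (ι-*ᵖ (suc m) j) ⟩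
      - (suc m · 1# * ιℤ j)               ≈⟨ -‿distribˡ-* _ _ ⟩
      - (suc m · 1#) * ιℤ j               ∎

    coeffRing : RawRing 0ℓ 0ℓ
    coeffRing = CommutativeRing.rawRing ℤₚ.+-*-commutativeRing

    acr : ACR.AlmostCommutativeRing 0ℓ 0ℓ
    acr = ACR.fromCommutativeRing R

    -- Agrees with ιℤ, but the solver's constants 0 and 1 reduce to 0# and 1#.
    κℤ : ℤ → Carrier
    κℤ (+ 0) = 0#
    κℤ (+ 1) = 1#
    κℤ z     = ιℤ z

    κ≈ι : ∀ z → κℤ z ≈ ιℤ z
    κ≈ι (+ 0)           = ≈-refl
    κ≈ι (+ 1)           = ≈-sym (+-identityʳ 1#)
    κ≈ι (+ suc (suc _)) = ≈-refl
    κ≈ι -[1+ _ ]        = ≈-refl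

    κ-morphism : coeffRing ACR.-Raw-AlmostCommutative⟶ acr
    κ-morphism = record
      { ⟦_⟧    = κℤ
      ; +-homo = λ i j → ≈-trans (κ≈ι (i ℤ.+ j)) (≈-trans (ι-+ i j) (≈-sym (+-cong (κ≈ι i) (κ≈ι j))))
      ; *-homo = λ i j → ≈-trans (κ≈ι (i ℤ.* j)) (≈-trans (ι-* i j) (≈-sym (*-cong (κ≈ι i) (κ≈ι j))))
      ; -‿homo = λ i → ≈-trans (κ≈ι (ℤ.- i)) (≈-trans (ι-neg i) (≈-sym (-‿cong (κ≈ι i))))
      ; 0-homo = ≈-refl
      ; 1-homo = ≈-refl
      }

    weakDec : ∀ i j → Maybe (κℤ i ≈ κℤ j)
    weakDec i j with i ℤ.≟ j
    ... | yes i≡j = just (reflexive (cong κℤ i≡j))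
    ... | no _    = nothing

  open RingSolver coeffRing acr κ-morphism weakDec public using (solve; con; _:=_; _:+_; _:*_; _:-_; :-_)
  open MonoidSolver *-commutativeMonoid public using (_⊜_) renaming (solve to solve*)
  open MonoidExpr (CommutativeMonoid.rawMonoid *-commutativeMonoid) public using () renaming (_⊕_ to infixl 7 _⊗_)

-- Power series form a commutative ring

module Conv (R : CommutativeRing 0ℓ 0ℓ) where
  open RingKit R

  conv : (ℕ → Carrier) → (ℕ → Carrier) → ℕ → Carrier
  conv f g zero    = f 0 * g 0
  conv f g (suc e) = f 0 * g (suc e) + conv (f ∘ suc) g e

  conv-cong : ∀ {f f′ g g′} → (∀ i → f i ≈ f′ i) → (∀ i → g i ≈ g′ i) → ∀ e → conv f g e ≈ conv f′ g′ e
  conv-cong p q zero    = *-cong (p 0) (q 0)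
  conv-cong p q (suc e) = +-cong (*-cong (p 0) (q (suc e))) (conv-cong (p ∘ suc) q e)

  conv-distribʳ : ∀ f f′ g e → conv (λ i → f i + f′ i) g e ≈ conv f g e + conv f′ g e
  conv-distribʳ f f′ g zero    = distribʳ (g 0) (f 0) (f′ 0)
  conv-distribʳ f f′ g (suc e) = begin
    (f 0 + f′ 0) * g (suc e) + conv (λ i → f (suc i) + f′ (suc i)) g e
      ≈⟨ +-congˡ (conv-distribʳ (f ∘ suc) (f′ ∘ suc) g e) ⟩
    (f 0 + f′ 0) * g (suc e) + (conv (f ∘ suc) g e + conv (f′ ∘ suc) g e)
      ≈⟨ solve 5 (λ a b c x y → (a :+ b) :* c :+ (x :+ y) := (a :* c :+ x) :+ (b :* c :+ y)) ≈-refl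
           (f 0) (f′ 0) (g (suc e)) (conv (f ∘ suc) g e) (conv (f′ ∘ suc) g e) ⟩
    conv f g (suc e) + conv f′ g (suc e) ∎

  conv-scale : ∀ c f g e → conv (λ i → c * f i) g e ≈ c * conv f g e
  conv-scale c f g zero    = *-assoc c (f 0) (g 0)
  conv-scale c f g (suc e) = begin
    c * f 0 * g (suc e) + conv (λ i → c * f (suc i)) g e  ≈⟨ +-cong (*-assoc _ _ _) (conv-scale c (f ∘ suc) g e) ⟩
    c * (f 0 * g (suc e)) + c * conv (f ∘ suc) g e        ≈⟨ ≈-sym (distribˡ _ _ _) ⟩
    c * conv f g (suc e)                                  ∎

  -- The recursion of `conv` peels off the first coefficient of the left factor. Commutativity needs
  -- this mirror image, which peels off the first coefficient of the right factor.
  conv-last : ∀ f g e → conv f g (suc e) ≈ f (suc e) * g 0 + conv f (g ∘ suc) e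
  conv-last f g zero    = +-comm _ _
  conv-last f g (suc e) = begin
    f 0 * g (suc (suc e)) + conv (f ∘ suc) g (suc e)
      ≈⟨ +-congˡ (conv-last (f ∘ suc) g e) ⟩
    f 0 * g (suc (suc e)) + (f (suc (suc e)) * g 0 + conv (f ∘ suc) (g ∘ suc) e)
      ≈⟨ solve 3 (λ a b c → a :+ (b :+ c) := b :+ (a :+ c)) ≈-refl _ _ _ ⟩
    f (suc (suc e)) * g 0 + conv f (g ∘ suc) (suc e) ∎

  conv-comm : ∀ f g e → conv f g e ≈ conv g f e
  conv-comm f g zero    = *-comm _ _
  conv-comm f g (suc e) = ≈-trans (+-cong (*-comm _ _) (conv-comm (f ∘ suc) g e)) (≈-sym (conv-last g f e))

  conv-assoc : ∀ f g h e → conv (conv f g) h e ≈ conv f (conv g h) e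
  conv-assoc f g h zero    = *-assoc _ _ _
  conv-assoc f g h (suc e) = begin
    f 0 * g 0 * h (suc e) + conv (conv f g ∘ suc) h e
      ≈⟨ +-congˡ (≈-trans (conv-distribʳ (λ i → f 0 * g (suc i)) (conv (f ∘ suc) g) h e)
           (+-cong (conv-scale (f 0) (g ∘ suc) h e) (conv-assoc (f ∘ suc) g h e))) ⟩
    f 0 * g 0 * h (suc e) + (f 0 * conv (g ∘ suc) h e + conv (f ∘ suc) (conv g h) e)
      ≈⟨ solve 5 (λ a b c d x → a :* b :* c :+ (a :* d :+ x) := a :* (b :* c :+ d) :+ x) ≈-refl
           (f 0) (g 0) (h (suc e)) (conv (g ∘ suc) h e) (conv (f ∘ suc) (conv g h) e) ⟩
    f 0 * (g 0 * h (suc e) + conv (g ∘ suc) h e) + conv (f ∘ suc) (conv g h) e ∎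

  conv-zero : ∀ f g → (∀ i → f i ≈ 0#) → ∀ e → conv f g e ≈ 0#
  conv-zero f g p zero    = ≈-trans (*-congʳ (p 0)) (zeroˡ _)
  conv-zero f g p (suc e) = ≈-trans (+-cong (≈-trans (*-congʳ (p 0)) (zeroˡ _)) (conv-zero (f ∘ suc) g (p ∘ suc) e)) (+-identityˡ _)

  conv-head : ∀ f g → (∀ i → f (suc i) ≈ 0#) → ∀ e → conv f g e ≈ f 0 * g e
  conv-head f g p zero    = ≈-refl
  conv-head f g p (suc e) = ≈-trans (+-congˡ (conv-zero (f ∘ suc) g p e)) (+-identityʳ _)

sumℤ-++ : ∀ xs ys → sumℤ (xs ++ ys) ≡ sumℤ xs ℤ.+ sumℤ ys
sumℤ-++ []       ys = sym (ℤₚ.+-identityˡ _)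
sumℤ-++ (x ∷ xs) ys = trans (cong (ℤ._+_ x) (sumℤ-++ xs ys)) (sym (ℤₚ.+-assoc x (sumℤ xs) (sumℤ ys)))

sumℤ-concatMap : ∀ {A B : Set} (h : B → ℤ) (k : A → List B) xs →
  sumℤ (map h (concatMap k xs)) ≡ sumℤ (map (λ x → sumℤ (map h (k x))) xs)
sumℤ-concatMap h k []       = refl
sumℤ-concatMap h k (x ∷ xs) = begin
  sumℤ (map h (k x ++ concatMap k xs))            ≡⟨ cong sumℤ (Listₚ.map-++ h (k x) (concatMap k xs)) ⟩
  sumℤ (map h (k x) ++ map h (concatMap k xs))    ≡⟨ sumℤ-++ (map h (k x)) _ ⟩
  sumℤ (map h (k x)) ℤ.+ sumℤ (map h (concatMap k xs)) ≡⟨ cong (ℤ._+_ (sumℤ (map h (k x)))) (sumℤ-concatMap h k xs) ⟩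
  sumℤ (map h (k x)) ℤ.+ sumℤ (map (λ x → sumℤ (map h (k x))) xs) ∎
  where open ≡.≡-Reasoning

infix 4 _≐_

_≐_ : ∀ {N} → PS N → PS N → Set
f ≐ g = ∀ e → f e ≡ g e

constₚ-0 : ∀ {N} (e : Vec ℕ N) → constₚ (+ 0) e ≡ + 0
constₚ-0 e with isZeroV e
... | true  = refl
... | false = refl

+ₚ-isAbelianGroup : ∀ N → IsAbelianGroup (_≐_ {N}) _+ₚ_ (constₚ (+ 0)) -ₚ_
+ₚ-isAbelianGroup N = record
  { isGroup = record
    { isMonoid = record
      { isSemigroup = record
        { isMagma = record
          { isEquivalence = record { refl = λ _ → refl ; sym = λ p e → sym (p e) ; trans = λ p q e → trans (p e) (q e) }
          ; ∙-cong = λ p q e → cong₂ ℤ._+_ (p e) (q e) }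
        ; assoc = λ f g h e → ℤₚ.+-assoc (f e) (g e) (h e) }
      ; identity = (λ f e → trans (cong (ℤ._+ f e) (constₚ-0 e)) (ℤₚ.+-identityˡ (f e)))
                 , (λ f e → trans (cong (ℤ._+_ (f e)) (constₚ-0 e)) (ℤₚ.+-identityʳ (f e))) }
    ; inverse = (λ f e → trans (ℤₚ.+-inverseˡ (f e)) (sym (constₚ-0 e)))
              , (λ f e → trans (ℤₚ.+-inverseʳ (f e)) (sym (constₚ-0 e)))
    ; ⁻¹-cong = λ p e → cong ℤ.-_ (p e) }
  ; comm = λ f g e → ℤₚ.+-comm (f e) (g e) }

-- The multiplicative laws are kept apart from the ring to allow an induction on the number of
-- variables: a series in `suc N` variables is a sequence of series in `N` variables, and the
-- product is the convolution of such sequences over the ring already constructed.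
record MulLaws (N : ℕ) : Set where
  field
    cong*   : ∀ {f f′ g g′ : PS N} → f ≐ f′ → g ≐ g′ → f *ₚ g ≐ f′ *ₚ g′
    assoc*  : ∀ (f g h : PS N) → (f *ₚ g) *ₚ h ≐ f *ₚ (g *ₚ h)
    comm*   : ∀ (f g : PS N) → f *ₚ g ≐ g *ₚ f
    one*    : ∀ (f : PS N) → constₚ (+ 1) *ₚ f ≐ f
    distr*  : ∀ (h f g : PS N) → (f +ₚ g) *ₚ h ≐ (f *ₚ h) +ₚ (g *ₚ h)

psRingFrom : ∀ N → MulLaws N → CommutativeRing 0ℓ 0ℓ
psRingFrom N L = record
  { Carrier = PS N ; _≈_ = _≐_ ; _+_ = _+ₚ_ ; _*_ = _*ₚ_ ; -_ = -ₚ_ ; 0# = constₚ (+ 0) ; 1# = constₚ (+ 1)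
  ; isCommutativeRing = record
    { isRing = record
      { +-isAbelianGroup = +ₚ-isAbelianGroup N
      ; *-cong     = cong*
      ; *-assoc    = assoc*
      ; *-identity = one* , λ f e → trans (comm* f (constₚ (+ 1)) e) (one* f e)
      ; distrib    = (λ f g h e → trans (comm* f (g +ₚ h) e) (trans (distr* f g h e) (cong₂ ℤ._+_ (comm* g f e) (comm* h f e))))
                   , distr* }
    ; *-comm = comm* } }
  where open MulLaws L

cur : ∀ {N} → PS (suc N) → ℕ → PS N
cur f i es = f (i ∷ es)

*ₚ-sum : ∀ {N} (f g : PS (suc N)) e es →
  (f *ₚ g) (e ∷ es) ≡ sumℤ (applyUpTo (λ i → (cur f i *ₚ cur g (e ∸ i)) es) (suc e))
*ₚ-sum f g e es = begin
  sumℤ (map (λ p → f (proj₁ p) ℤ.* g (proj₂ p)) (splits (e ∷ es)))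
    ≡⟨ sumℤ-concatMap (λ p → f (proj₁ p) ℤ.* g (proj₂ p))
         (λ i → map (λ p → (i ∷ proj₁ p , (e ∸ i) ∷ proj₂ p)) (splits es)) (upTo (suc e)) ⟩
  sumℤ (map (λ i → sumℤ (map (λ p → f (proj₁ p) ℤ.* g (proj₂ p)) (map (λ p → (i ∷ proj₁ p , (e ∸ i) ∷ proj₂ p)) (splits es)))) (upTo (suc e)))
    ≡⟨ cong sumℤ (Listₚ.map-cong (λ i → cong sumℤ (sym (Listₚ.map-∘ (splits es)))) (upTo (suc e))) ⟩
  sumℤ (map (λ i → (cur f i *ₚ cur g (e ∸ i)) es) (upTo (suc e)))
    ≡⟨ cong sumℤ (Listₚ.map-applyUpTo id (λ i → (cur f i *ₚ cur g (e ∸ i)) es) (suc e)) ⟩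
  sumℤ (applyUpTo (λ i → (cur f i *ₚ cur g (e ∸ i)) es) (suc e)) ∎
  where open ≡.≡-Reasoning

module _ {N} (L : MulLaws N) where
  private module C = Conv (psRingFrom N L)
  open C using (conv)

  private
    sum-conv : ∀ (f g : ℕ → PS N) e es → sumℤ (applyUpTo (λ i → (f i *ₚ g (e ∸ i)) es) (suc e)) ≡ conv f g e es
    sum-conv f g zero    es = ℤₚ.+-identityʳ _
    sum-conv f g (suc e) es = cong (ℤ._+_ ((f 0 *ₚ g (suc e)) es)) (sum-conv (f ∘ suc) g e es)

  *ₚ-conv : ∀ (f g : PS (suc N)) e es → (f *ₚ g) (e ∷ es) ≡ conv (cur f) (cur g) e es
  *ₚ-conv f g e es = trans (*ₚ-sum f g e es) (sum-conv (cur f) (cur g) e es)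

  mulLaws-suc : MulLaws (suc N)
  mulLaws-suc = record
    { cong* = λ { {f} {f′} {g} {g′} p q (e ∷ es) → begin
        (f *ₚ g) (e ∷ es)            ≡⟨ *ₚ-conv f g e es ⟩
        conv (cur f) (cur g) e es    ≡⟨ C.conv-cong (λ i es → p (i ∷ es)) (λ i es → q (i ∷ es)) e es ⟩
        conv (cur f′) (cur g′) e es  ≡⟨ *ₚ-conv f′ g′ e es ⟨
        (f′ *ₚ g′) (e ∷ es)          ∎ }
    ; assoc* = λ { f g h (e ∷ es) → begin
        ((f *ₚ g) *ₚ h) (e ∷ es)                    ≡⟨ *ₚ-conv (f *ₚ g) h e es ⟩
        conv (cur (f *ₚ g)) (cur h) e es            ≡⟨ C.conv-cong (*ₚ-conv f g) (λ i es → refl) e es ⟩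
        conv (conv (cur f) (cur g)) (cur h) e es    ≡⟨ C.conv-assoc (cur f) (cur g) (cur h) e es ⟩
        conv (cur f) (conv (cur g) (cur h)) e es    ≡⟨ C.conv-cong (λ i es → refl) (λ i es → sym (*ₚ-conv g h i es)) e es ⟩
        conv (cur f) (cur (g *ₚ h)) e es            ≡⟨ *ₚ-conv f (g *ₚ h) e es ⟨
        (f *ₚ (g *ₚ h)) (e ∷ es)                    ∎ }
    ; comm* = λ { f g (e ∷ es) → begin
        (f *ₚ g) (e ∷ es)            ≡⟨ *ₚ-conv f g e es ⟩
        conv (cur f) (cur g) e es    ≡⟨ C.conv-comm (cur f) (cur g) e es ⟩
        conv (cur g) (cur f) e es    ≡⟨ *ₚ-conv g f e es ⟨
        (g *ₚ f) (e ∷ es)            ∎ }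
    ; one* = λ { f (e ∷ es) → begin
        (constₚ (+ 1) *ₚ f) (e ∷ es)              ≡⟨ *ₚ-conv (constₚ (+ 1)) f e es ⟩
        conv (cur (constₚ (+ 1))) (cur f) e es    ≡⟨ C.conv-head (cur (constₚ (+ 1))) (cur f) (λ i es → sym (constₚ-0 es)) e es ⟩
        (constₚ (+ 1) *ₚ cur f e) es              ≡⟨ MulLaws.one* L (cur f e) es ⟩
        f (e ∷ es)                                ∎ }
    ; distr* = λ { h f g (e ∷ es) → begin
        ((f +ₚ g) *ₚ h) (e ∷ es)                  ≡⟨ *ₚ-conv (f +ₚ g) h e es ⟩
        conv (cur (f +ₚ g)) (cur h) e es          ≡⟨ C.conv-distribʳ (cur f) (cur g) (cur h) e es ⟩
        conv (cur f) (cur h) e es ℤ.+ conv (cur g) (cur h) e es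
          ≡⟨ cong₂ ℤ._+_ (sym (*ₚ-conv f h e es)) (sym (*ₚ-conv g h e es)) ⟩
        ((f *ₚ h) +ₚ (g *ₚ h)) (e ∷ es)           ∎ }
    }
    where open ≡.≡-Reasoning

mulLaws : ∀ N → MulLaws N
mulLaws zero    = record
  { cong*  = λ { p q [] → cong (ℤ._+ + 0) (cong₂ ℤ._*_ (p []) (q [])) }
  ; assoc* = λ { f g h [] → cong (ℤ._+ + 0) (trans (cong (ℤ._* h []) (ℤₚ.+-identityʳ (f [] ℤ.* g [])))
                 (trans (ℤₚ.*-assoc (f []) (g []) (h [])) (cong (ℤ._*_ (f [])) (sym (ℤₚ.+-identityʳ (g [] ℤ.* h [])))))) }
  ; comm*  = λ { f g [] → cong (ℤ._+ + 0) (ℤₚ.*-comm (f []) (g [])) }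
  ; one*   = λ { f [] → trans (ℤₚ.+-identityʳ _) (ℤₚ.*-identityˡ _) }
  ; distr* = λ { h f g [] → trans (cong (ℤ._+ + 0) (ℤₚ.*-distribʳ-+ (h []) (f []) (g [])))
                 (trans (ℤₚ.+-identityʳ _) (sym (cong₂ ℤ._+_ (ℤₚ.+-identityʳ (f [] ℤ.* h [])) (ℤₚ.+-identityʳ (g [] ℤ.* h []))))) } }
mulLaws (suc N) = mulLaws-suc (mulLaws N)

psRing : ℕ → CommutativeRing 0ℓ 0ℓ
psRing N = psRingFrom N (mulLaws N)

-- Vandermonde determinants

iota : ℕ → ℕ → List ℕ
iota a zero    = []
iota a (suc l) = a ∷ iota (suc a) l

length-iota : ∀ a l → length (iota a l) ≡ l
length-iota a zero    = refl
length-iota a (suc l) = cong suc (length-iota (suc a) l)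

module Products (R : CommutativeRing 0ℓ 0ℓ) where
  open RingKit R

  open Exponentiation commutativeSemiring public using (_^_) renaming (^-congˡ to ^-cong; ^-homo-* to ^-+; ^-distrib-* to *-^)

  1^ : ∀ t → 1# ^ t ≈ 1#
  1^ zero    = ≈-refl
  1^ (suc t) = ≈-trans (*-identityˡ _) (1^ t)

  Π : ℕ → ℕ → (ℕ → Carrier) → Carrier
  Π a zero    f = 1#
  Π a (suc l) f = f a * Π (suc a) l f

  Π-cong : ∀ a l {f g} → (∀ i → a ≤ i → i < a ℕ.+ l → f i ≈ g i) → Π a l f ≈ Π a l g
  Π-cong a zero    p = ≈-refl
  Π-cong a (suc l) p = *-cong (p a ≤-refl (m<m+n a (s≤s z≤n)))
    (Π-cong (suc a) l (λ i a<i i<b → p i (<⇒≤ a<i) (subst (i <_) (sym (+-suc a l)) i<b)))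

  Π-cong′ : ∀ a l {f g} → (∀ i → f i ≈ g i) → Π a l f ≈ Π a l g
  Π-cong′ a l p = Π-cong a l (λ i _ _ → p i)

  Π-* : ∀ a l f g → Π a l (λ i → f i * g i) ≈ Π a l f * Π a l g
  Π-* a zero    f g = ≈-sym (*-identityˡ _)
  Π-* a (suc l) f g = ≈-trans (*-congˡ (Π-* (suc a) l f g))
    (solve 4 (λ x y z w → x :* y :* (z :* w) := x :* z :* (y :* w)) ≈-refl (f a) (g a) (Π (suc a) l f) (Π (suc a) l g))

  Π-split : ∀ a l l′ f → Π a (l ℕ.+ l′) f ≈ Π a l f * Π (a ℕ.+ l) l′ f
  Π-split a zero    l′ f = ≈-trans (reflexive (cong (λ t → Π t l′ f) (sym (ℕₚ.+-identityʳ a)))) (≈-sym (*-identityˡ _))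
  Π-split a (suc l) l′ f = ≈-trans (*-congˡ (Π-split (suc a) l l′ f))
    (≈-trans (≈-sym (*-assoc _ _ _)) (*-congˡ (reflexive (cong (λ t → Π t l′ f) (sym (+-suc a l))))))

  Π-snoc : ∀ a l f → Π a (suc l) f ≈ Π a l f * f (a ℕ.+ l)
  Π-snoc a l f = ≈-trans (reflexive (cong (λ t → Π a t f) (ℕₚ.+-comm 1 l)))
    (≈-trans (Π-split a l 1 f) (*-congˡ (*-identityʳ _)))

  Π-1 : ∀ a l → Π a l (λ _ → 1#) ≈ 1#
  Π-1 a zero    = ≈-refl
  Π-1 a (suc l) = ≈-trans (*-identityˡ _) (Π-1 (suc a) l)

  pairsΠ : ℕ → ℕ → (ℕ → ℕ → Carrier) → Carrier
  pairsΠ a zero    f = 1#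
  pairsΠ a (suc l) f = Π (suc a) l (f a) * pairsΠ (suc a) l f

  pairsΠ-cong : ∀ a l {f g} → (∀ i j → a ≤ i → i < j → j < a ℕ.+ l → f i j ≈ g i j) → pairsΠ a l f ≈ pairsΠ a l g
  pairsΠ-cong a zero    p = ≈-refl
  pairsΠ-cong a (suc l) p = *-cong
    (Π-cong (suc a) l (λ j a<j j<b → p a j ≤-refl a<j (subst (j <_) (sym (+-suc a l)) j<b)))
    (pairsΠ-cong (suc a) l (λ i j a<i i<j j<b → p i j (<⇒≤ a<i) i<j (subst (j <_) (sym (+-suc a l)) j<b)))

  pairsΠ-snoc : ∀ a l f → pairsΠ a (suc l) f ≈ pairsΠ a l f * Π a l (λ i → f i (a ℕ.+ l))
  pairsΠ-snoc a zero    f = ≈-refl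
  pairsΠ-snoc a (suc l) f = begin
    Π (suc a) (suc l) (f a) * pairsΠ (suc a) (suc l) f
      ≈⟨ *-cong (Π-snoc (suc a) l (f a)) (pairsΠ-snoc (suc a) l f) ⟩
    Π (suc a) l (f a) * f a (suc a ℕ.+ l) * (pairsΠ (suc a) l f * Π (suc a) l (λ i → f i (suc a ℕ.+ l)))
      ≈⟨ solve 4 (λ x y z w → x :* y :* (z :* w) := x :* z :* (y :* w)) ≈-refl _ _ _ _ ⟩
    Π (suc a) l (f a) * pairsΠ (suc a) l f * (f a (suc a ℕ.+ l) * Π (suc a) l (λ i → f i (suc a ℕ.+ l)))
      ≡⟨ cong (λ t → Π (suc a) l (f a) * pairsΠ (suc a) l f * (f a t * Π (suc a) l (λ i → f i t))) (sym (+-suc a l)) ⟩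
    pairsΠ a (suc l) f * Π a (suc l) (λ i → f i (a ℕ.+ suc l)) ∎

-- Generalised Vandermonde determinants D E ws = det (w ^ e), expanded along the variables.
module Vandermonde (R : CommutativeRing 0ℓ 0ℓ) where
  open RingKit R
  open Products R

  Fun : Set
  Fun = List ℕ → Carrier

  infixl 9 _∣_

  _∣_ : Fun → ℕ → Fun
  (F ∣ e) E = F (e ∷ E)

  -- Laplace expansion along one row `b`: some exponent is taken out for `b`, the others stay for
  -- `F`. The minus sign of the recursion produces the alternating signs.
  lap : (ℕ → Carrier) → Fun → List ℕ → Carrier
  lap b F []      = 0#
  lap b F (e ∷ E) = b e * F E - lap b (F ∣ e) E

  D : List ℕ → List Carrier → Carrier
  D E []       = if List.null E then 1# else 0#
  D E (w ∷ ws) = lap (w ^_) (λ E′ → D E′ ws) E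

  lap-cong : ∀ {b b′ F G} E → (∀ e → b e ≈ b′ e) → (∀ E′ → suc (length E′) ≡ length E → F E′ ≈ G E′) → lap b F E ≈ lap b′ G E
  lap-cong []      p q = ≈-refl
  lap-cong (e ∷ E) p q = +-cong (*-cong (p e) (q E refl)) (-‿cong (lap-cong E p (λ E′ l → q (e ∷ E′) (cong suc l))))

  lap-scale : ∀ c d b F E → c * d * lap b F E ≈ lap (λ e → c * b e) (λ E′ → d * F E′) E
  lap-scale c d b F []      = zeroʳ _
  lap-scale c d b F (e ∷ E) = begin
    c * d * (b e * F E - lap b (F ∣ e) E)
      ≈⟨ solve 5 (λ c d x y z → c :* d :* (x :* y :- z) := c :* x :* (d :* y) :- c :* d :* z) ≈-refl c d (b e) (F E) _ ⟩
    c * b e * (d * F E) - c * d * lap b (F ∣ e) E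
      ≈⟨ +-congˡ (-‿cong (lap-scale c d b (F ∣ e) E)) ⟩
    lap (λ e → c * b e) (λ E′ → d * F E′) (e ∷ E) ∎

  lap-linear : ∀ z b F G E → lap b (λ E′ → F E′ - z * G E′) E ≈ lap b F E - z * lap b G E
  lap-linear z b F G []      = solve 1 (λ z → con (+ 0) := con (+ 0) :- z :* con (+ 0)) ≈-refl z
  lap-linear z b F G (e ∷ E) = begin
    b e * (F E - z * G E) - lap b (λ E′ → F (e ∷ E′) - z * G (e ∷ E′)) E
      ≈⟨ +-congˡ (-‿cong (lap-linear z b (F ∣ e) (G ∣ e) E)) ⟩
    b e * (F E - z * G E) - (lap b (F ∣ e) E - z * lap b (G ∣ e) E)
      ≈⟨ solve 6 (λ z b f g x y → b :* (f :- z :* g) :- (x :- z :* y) := (b :* f :- x) :- z :* (b :* g :- y)) ≈-refl z (b e) (F E) (G E) _ _ ⟩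
    lap b F (e ∷ E) - z * lap b G (e ∷ E) ∎

  lap-zero : ∀ b F E → (∀ E′ → F E′ ≈ 0#) → lap b F E ≈ 0#
  lap-zero b F []      p = ≈-refl
  lap-zero b F (e ∷ E) p = ≈-trans (+-cong (≈-trans (*-congˡ (p E)) (zeroʳ _)) (≈-trans (-‿cong (lap-zero b (F ∣ e) E (p ∘ (e ∷_)))) -0#≈0#)) (+-identityʳ _)

  -- Multiplication by ∏ (w - z) moves each exponent up by one or leaves it in place at the cost of - z.
  move : Carrier → Fun → List ℕ → Carrier
  move z F []      = F []
  move z F (e ∷ E) = move z (F ∣ suc e) E - z * move z (F ∣ e) E

  move-linear : ∀ z c F G E → move z (λ E′ → c * F E′ - G E′) E ≈ c * move z F E - move z G E
  move-linear z c F G []      = ≈-refl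
  move-linear z c F G (e ∷ E) = ≈-trans
    (+-cong (move-linear z c (F ∣ suc e) (G ∣ suc e) E) (-‿cong (*-congˡ (move-linear z c (F ∣ e) (G ∣ e) E))))
    (solve 6 (λ z c x y u v → (c :* x :- y) :- z :* (c :* u :- v) := c :* (x :- z :* u) :- (y :- z :* v)) ≈-refl z c _ _ _ _)

  move-zero : ∀ z F E → (∀ E′ → F E′ ≈ 0#) → move z F E ≈ 0#
  move-zero z F []      p = p []
  move-zero z F (e ∷ E) p = ≈-trans
    (+-cong (move-zero z (F ∣ suc e) E (p ∘ (suc e ∷_))) (-‿cong (*-congˡ (move-zero z (F ∣ e) E (p ∘ (e ∷_))))))
    (solve 1 (λ z → con (+ 0) :- z :* con (+ 0) := con (+ 0)) ≈-refl z)

  -- Each column of a determinant may be moved separately: in every term of the expansion, the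
  -- exponent taken out turns `b e` into `b (suc e) - z * b e`, and the others are moved inside `F`.
  move-lap : ∀ z b F E → move z (lap b F) E ≈ lap (λ e → b (suc e) - z * b e) (move z F) E
  move-lap z b F []      = ≈-refl
  move-lap z b F (e ∷ E) = begin
    move z (λ E′ → b (suc e) * F E′ - lap b (F ∣ suc e) E′) E - z * move z (λ E′ → b e * F E′ - lap b (F ∣ e) E′) E
      ≈⟨ +-cong (move-linear z _ F _ E) (-‿cong (*-congˡ (move-linear z _ F _ E))) ⟩
    (b (suc e) * move z F E - move z (lap b (F ∣ suc e)) E) - z * (b e * move z F E - move z (lap b (F ∣ e)) E)
      ≈⟨ +-cong (+-congˡ (-‿cong (move-lap z b (F ∣ suc e) E))) (-‿cong (*-congˡ (+-congˡ (-‿cong (move-lap z b (F ∣ e) E))))) ⟩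
    (b (suc e) * move z F E - lap b′ (move z (F ∣ suc e)) E) - z * (b e * move z F E - lap b′ (move z (F ∣ e)) E)
      ≈⟨ solve 6 (λ z b₁ b₀ m x y → (b₁ :* m :- x) :- z :* (b₀ :* m :- y) := (b₁ :- z :* b₀) :* m :- (x :- z :* y)) ≈-refl z _ _ _ _ _ ⟩
    b′ e * move z F E - (lap b′ (move z (F ∣ suc e)) E - z * lap b′ (move z (F ∣ e)) E)
      ≈⟨ +-congˡ (-‿cong (≈-sym (lap-linear z b′ (move z (F ∣ suc e)) (move z (F ∣ e)) E))) ⟩
    lap b′ (move z F) (e ∷ E) ∎
    where b′ = λ e → b (suc e) - z * b e

  ∏- : Carrier → List Carrier → Carrier
  ∏- z []       = 1#
  ∏- z (w ∷ ws) = (w - z) * ∏- z ws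

  -- Multiplying the row of `w` by `w - z` replaces every `w ^ e` by `w ^ suc e - z * w ^ e`; read
  -- column by column, this is `move`.
  D-move : ∀ z ws E → length E ≡ length ws → ∏- z ws * D E ws ≈ move z (λ E′ → D E′ ws) E
  D-move z []       []      l = *-identityˡ _
  D-move z (w ∷ ws) E       l = begin
    (w - z) * ∏- z ws * lap (w ^_) F E
      ≈⟨ lap-scale (w - z) (∏- z ws) (w ^_) F E ⟩
    lap (λ e → (w - z) * w ^ e) (λ E′ → ∏- z ws * F E′) E
      ≈⟨ lap-cong E (λ e → solve 3 (λ w z x → (w :- z) :* x := w :* x :- z :* x) ≈-refl w z (w ^ e))
                    (λ E′ l′ → D-move z ws E′ (suc-injective (trans l′ l))) ⟩
    lap (λ e → w ^ suc e - z * w ^ e) (move z F) E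
      ≈⟨ ≈-sym (move-lap z (w ^_) F E) ⟩
    move z (lap (w ^_) F) E ∎
    where F = λ E′ → D E′ ws

  -- Neighbours are enough: among consecutive exponents, one that moves collides with its right
  -- neighbour unless that one moves too.
  Vanishing : Fun → Set
  Vanishing F = ∀ pre a post → F (pre ++ a ∷ a ∷ post) ≈ 0#

  lap-vanishing : ∀ b F → Vanishing F → Vanishing (lap b F)
  lap-vanishing b F v []        a post = ≈-trans
    (+-congˡ (-‿cong (+-congˡ (-‿cong (lap-zero b (F ∣ a ∣ a) post (λ E′ → v [] a E′))))))
    (solve 1 (λ x → x :- (x :- con (+ 0)) := con (+ 0)) ≈-refl (b a * F (a ∷ post)))
  lap-vanishing b F v (x ∷ pre) a post = ≈-trans
    (+-cong (≈-trans (*-congˡ (v pre a post)) (zeroʳ _)) (≈-trans (-‿cong (lap-vanishing b (F ∣ x) (λ p → v (x ∷ p)) pre a post)) -0#≈0#))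
    (+-identityʳ _)

  D-vanishing : ∀ ws → Vanishing (λ E → D E ws)
  D-vanishing []       []      a post = ≈-refl
  D-vanishing []       (_ ∷ _) a post = ≈-refl
  D-vanishing (w ∷ ws) pre a post = lap-vanishing (w ^_) (λ E → D E ws) (D-vanishing ws) pre a post

  -- Once the first of consecutive exponents moves, all the others are pushed.
  move-pushed : ∀ z F a l → Vanishing F → (∀ E → F (a ∷ E) ≈ 0#) → move z F (iota a l) ≈ F (iota (suc a) l)
  move-pushed z F a zero    v p = ≈-refl
  move-pushed z F a (suc l) v p = begin
    move z (F ∣ suc a) (iota (suc a) l) - z * move z (F ∣ a) (iota (suc a) l)
      ≈⟨ +-cong (move-pushed z (F ∣ suc a) (suc a) l (λ pre → v (suc a ∷ pre)) (λ E → v [] (suc a) E))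
           (-‿cong (*-congˡ (move-zero z (F ∣ a) (iota (suc a) l) p))) ⟩
    F (iota (suc a) (suc l)) - z * 0#
      ≈⟨ solve 2 (λ x z → x :- z :* con (+ 0) := x) ≈-refl _ z ⟩
    F (iota (suc a) (suc l)) ∎

  -- The surviving terms are indexed by the first exponent that moves. Those before it stay, at the
  -- cost of `- z` each, and those after it are pushed; the gap left behind is the exponent that
  -- `lap` gives to `z`.
  move-iota : ∀ z F a l → Vanishing F → z ^ a * move z F (iota a l) ≈ lap (z ^_) F (iota a (suc l))
  move-iota z F a zero    v = solve 1 (λ x → x := x :- con (+ 0)) ≈-refl _
  move-iota z F a (suc l) v = begin
    z ^ a * (move z (F ∣ suc a) (iota (suc a) l) - z * move z (F ∣ a) (iota (suc a) l))
      ≈⟨ solve 4 (λ p x z y → p :* (x :- z :* y) := p :* x :- z :* p :* y) ≈-refl (z ^ a) _ z _ ⟩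
    z ^ a * move z (F ∣ suc a) (iota (suc a) l) - z ^ suc a * move z (F ∣ a) (iota (suc a) l)
      ≈⟨ +-cong (*-congˡ (move-pushed z (F ∣ suc a) (suc a) l (λ pre → v (suc a ∷ pre)) (λ E → v [] (suc a) E)))
           (-‿cong (move-iota z (F ∣ a) (suc a) l (λ pre → v (a ∷ pre)))) ⟩
    lap (z ^_) F (iota a (suc (suc l))) ∎

  D-snoc : ∀ z ws → ∏- z ws * D (iota 0 (length ws)) ws ≈ D (iota 0 (suc (length ws))) (z ∷ ws)
  D-snoc z ws = begin
    ∏- z ws * D (iota 0 (length ws)) ws
      ≈⟨ D-move z ws (iota 0 (length ws)) (length-iota 0 (length ws)) ⟩
    move z (λ E → D E ws) (iota 0 (length ws))
      ≈⟨ ≈-sym (*-identityˡ _) ⟩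
    z ^ 0 * move z (λ E → D E ws) (iota 0 (length ws))
      ≈⟨ move-iota z _ 0 (length ws) (D-vanishing ws) ⟩
    D (iota 0 (suc (length ws))) (z ∷ ws) ∎

  move-0# : ∀ F E → move 0# F E ≈ F (map suc E)
  move-0# F []      = ≈-refl
  move-0# F (e ∷ E) = ≈-trans (+-cong (move-0# (F ∣ suc e) E) (-‿cong (zeroˡ _))) (≈-trans (+-congˡ -0#≈0#) (+-identityʳ _))

  map-suc-iota : ∀ a l → map suc (iota a l) ≡ iota (suc a) l
  map-suc-iota a zero    = refl
  map-suc-iota a (suc l) = cong (suc a ∷_) (map-suc-iota (suc a) l)

  -- If the new variable takes the exponent 0, all other exponents are at least 1, and a factor of
  -- every `w` comes out. In the remaining terms the exponent 0 is left to one of the old variables.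
  D-snoc-split : ∀ z ws → D (iota 0 (suc (length ws))) (z ∷ ws)
    ≈ ∏- 0# ws * D (iota 0 (length ws)) ws - lap (z ^_) (λ E → D (0 ∷ E) ws) (iota 1 (length ws))
  D-snoc-split z ws = +-congʳ (begin
    1# * D (iota 1 (length ws)) ws                   ≈⟨ *-identityˡ _ ⟩
    D (iota 1 (length ws)) ws                        ≡⟨ cong (λ E → D E ws) (sym (map-suc-iota 0 (length ws))) ⟩
    D (map suc (iota 0 (length ws))) ws              ≈⟨ ≈-sym (move-0# (λ E → D E ws) (iota 0 (length ws))) ⟩
    move 0# (λ E → D E ws) (iota 0 (length ws))      ≈⟨ ≈-sym (D-move 0# ws _ (length-iota 0 (length ws))) ⟩
    ∏- 0# ws * D (iota 0 (length ws)) ws             ∎)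

-- Alternating coefficients

sumr : ℕ → ℕ → (ℕ → ℤ) → ℤ
sumr a zero    f = + 0
sumr a (suc l) f = f a ℤ.+ sumr (suc a) l f

sumr-cong : ∀ a l {f g} → (∀ i → a ≤ i → i < a ℕ.+ l → f i ≡ g i) → sumr a l f ≡ sumr a l g
sumr-cong a zero    p = refl
sumr-cong a (suc l) p = cong₂ ℤ._+_ (p a ≤-refl (m<m+n a (s≤s z≤n)))
  (sumr-cong (suc a) l (λ i a<i i<b → p i (<⇒≤ a<i) (subst (i <_) (sym (+-suc a l)) i<b)))

sumr-zero : ∀ a l {f} → (∀ i → a ≤ i → i < a ℕ.+ l → f i ≡ + 0) → sumr a l f ≡ + 0
sumr-zero a zero    p = refl
sumr-zero a (suc l) p = cong₂ ℤ._+_ (p a ≤-refl (m<m+n a (s≤s z≤n)))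
  (sumr-zero (suc a) l (λ i a<i i<b → p i (<⇒≤ a<i) (subst (i <_) (sym (+-suc a l)) i<b)))

-- The sum over all rows as interlacing with x ∷ b from above: x ≤ a₁ ≤ b₁ ≤ a₂ ≤ b₂ ≤ …
rsum : ℕ → List ℕ → (List ℕ → ℤ) → ℤ
rsum x []      F = F []
rsum x (y ∷ b) F = sumr x (suc y ∸ x) (λ a → rsum y b (λ as → F (a ∷ as)))

Inter : ℕ → List ℕ → List ℕ → Set
Inter x []      []       = ⊤
Inter x []      (_ ∷ _)  = ⊥
Inter x (y ∷ b) []       = ⊥
Inter x (y ∷ b) (a ∷ as) = x ≤ a × a ≤ y × Inter y b as

rsum-cong : ∀ x b {F G} → (∀ as → Inter x b as → F as ≡ G as) → rsum x b F ≡ rsum x b G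
rsum-cong x []      p = p [] tt
rsum-cong x (y ∷ b) p = sumr-cong x (suc y ∸ x) λ a x≤a a<y →
  rsum-cong y b (λ as int → p (a ∷ as) (x≤a , bound a x≤a a<y , int))
  where
  bound : ∀ a → x ≤ a → a < x ℕ.+ (suc y ∸ x) → a ≤ y
  bound a x≤a a<y with x ℕₚ.≤? suc y
  ... | yes x≤y = ≤-pred (subst (a <_) (m+[n∸m]≡n x≤y) a<y)
  ... | no  x≰y = ⊥-elim (<⇒≱ (subst (a <_) (trans (cong (x ℕ.+_) (m≤n⇒m∸n≡0 (<⇒≤ (≰⇒> x≰y)))) (ℕₚ.+-identityʳ x)) a<y) x≤a)

Sorted : ℕ → List ℕ → Set
Sorted x []      = ⊤
Sorted x (y ∷ b) = x ≤ y × Sorted y b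

τ : ℕ → ℕ → ℕ
τ s i with i ℕ.≟ s | i ℕ.≟ suc s
... | yes _ | _     = suc s
... | no _  | yes _ = s
... | no _  | no _  = i

τ-left : ∀ s → τ s s ≡ suc s
τ-left s with s ℕ.≟ s | s ℕ.≟ suc s
... | yes _ | _ = refl
... | no ¬p | _ = ⊥-elim (¬p refl)

τ-right : ∀ s → τ s (suc s) ≡ s
τ-right s with suc s ℕ.≟ s | suc s ℕ.≟ suc s
... | yes p | _     = ⊥-elim (1+n≢n p)
... | no _  | yes _ = refl
... | no _  | no ¬p = ⊥-elim (¬p refl)

τ-other : ∀ s i → i ≢ s → i ≢ suc s → τ s i ≡ i
τ-other s i p q with i ℕ.≟ s | i ℕ.≟ suc s
... | yes r | _     = ⊥-elim (p r)
... | no _  | yes r = ⊥-elim (q r)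
... | no _  | no _  = refl

τ-involutive : ∀ s i → τ s (τ s i) ≡ i
τ-involutive s i with i ℕ.≟ s | i ℕ.≟ suc s
... | yes refl | _        = τ-right s
... | no _     | yes refl = τ-left s
... | no p     | no q     = τ-other s i p q

τ-injective : ∀ s {i j} → i ≢ j → τ s i ≢ τ s j
τ-injective s {i} {j} i≢j eq = i≢j (trans (sym (τ-involutive s i)) (trans (cong (τ s) eq) (τ-involutive s j)))

≡-neg⇒≡0 : ∀ z → z ≡ ℤ.- z → z ≡ + 0
≡-neg⇒≡0 (+ zero)  p = refl
≡-neg⇒≡0 (+ suc n) ()
≡-neg⇒≡0 -[1+ n ]  ()

-- A ring of power series in X 1 , … , X n with coefficients in ℤ[P,Q], abstracted to what the argument uses:
-- I i = 1/(1 - X i), g i j = 1/(1 - X i X j), κ is the coefficient of (X 1 ⋯ X n) ^ C times a fixed monomial in P and Q,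
-- σ s exchanges X s and X (suc s), and Deg p d x says that x has degree at most d in X p.
record Setting (n C : ℕ) : Set₁ where
  field
    series : CommutativeRing 0ℓ 0ℓ
  open RingKit series using (Carrier; _≈_; _+_; _*_; -_; _-_; 0#; 1#)
  open Products series using (_^_)
  field
    X I        : ℕ → Carrier
    g          : ℕ → ℕ → Carrier
    P Q        : Carrier
    X-inverse  : ∀ i → (1# - X i) * I i ≈ 1#
    XX-inverse : ∀ i j → i ≢ j → (1# - X i * X j) * g i j ≈ 1#
    κ          : Carrier → ℤ
    κ-cong     : ∀ {x y} → x ≈ y → κ x ≡ κ y
    κ-+        : ∀ x y → κ (x + y) ≡ κ x ℤ.+ κ y
    κ-neg      : ∀ x → κ (- x) ≡ ℤ.- κ x
    κ-X        : ∀ p x → 1 ≤ p → p ≤ n → κ (X p ^ suc C * x) ≡ + 0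
    σ          : ℕ → Carrier → Carrier
    σ-cong     : ∀ s {x y} → x ≈ y → σ s x ≈ σ s y
    σ-+        : ∀ s x y → σ s (x + y) ≈ σ s x + σ s y
    σ-*        : ∀ s x y → σ s (x * y) ≈ σ s x * σ s y
    σ-neg      : ∀ s x → σ s (- x) ≈ - σ s x
    σ-1        : ∀ s → σ s 1# ≈ 1#
    σ-X        : ∀ s i → 1 ≤ s → s < n → σ s (X i) ≈ X (τ s i)
    σ-P        : ∀ s → s < n → σ s P ≈ P
    σ-Q        : ∀ s → s < n → σ s Q ≈ Q
    κ-σ        : ∀ s x → 1 ≤ s → s < n → κ (σ s x) ≡ κ x
    Deg        : ℕ → ℕ → Carrier → Set
    Deg-cong   : ∀ {p d x y} → x ≈ y → Deg p d x → Deg p d y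
    Deg-≤      : ∀ {p d e x} → d ≤ e → Deg p d x → Deg p e x
    Deg-+      : ∀ {p d x y} → Deg p d x → Deg p d y → Deg p d (x + y)
    Deg-neg    : ∀ {p d x} → Deg p d x → Deg p d (- x)
    Deg-*      : ∀ {p d e x y} → Deg p d x → Deg p e y → Deg p (d ℕ.+ e) (x * y)
    Deg-1      : ∀ {p} → Deg p 0 1#
    Deg-X      : ∀ p → Deg p 1 (X p)
    Deg-X-≢    : ∀ {p q} → p ≢ q → Deg p 0 (X q)
    Deg-I-≢    : ∀ {p q} → p ≢ q → Deg p 0 (I q)
    Deg-P      : ∀ {p} → p ≤ n → Deg p 0 P
    Deg-Q      : ∀ {p} → p ≤ n → Deg p 0 Q
    κ-Deg      : ∀ {p d x} → 1 ≤ p → p ≤ n → d < C → Deg p d x → κ x ≡ + 0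

module Antisymmetry {n C : ℕ} (S : Setting n C) where
  open Setting S
  open RingKit series
  open Products series

  κ-0 : κ 0# ≡ + 0
  κ-0 = ≡-neg⇒≡0 _ (trans (κ-cong (≈-sym -0#≈0#)) (κ-neg 0#))

  Swap : ℕ → Set
  Swap s = 1 ≤ s × s < n

  Fix Anti : ℕ → Carrier → Set
  Fix s x  = σ s x ≈ x
  Anti s x = σ s x ≈ - x

  σ-- : ∀ s x y → σ s (x - y) ≈ σ s x - σ s y
  σ-- s x y = ≈-trans (σ-+ s x (- y)) (+-congˡ (σ-neg s y))

  -- `I` and `g` are known only through the equations that they satisfy, so their behaviour under
  -- exchanges has to come from the uniqueness of inverses.
  inverse-unique : ∀ a x y → a * x ≈ 1# → a * y ≈ 1# → x ≈ y
  inverse-unique a x y p q = begin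
    x              ≈⟨ ≈-sym (≈-trans (*-congˡ q) (*-identityʳ x)) ⟩
    x * (a * y)    ≈⟨ solve 3 (λ a x y → x :* (a :* y) := a :* x :* y) ≈-refl a x y ⟩
    a * x * y      ≈⟨ ≈-trans (*-congʳ p) (*-identityˡ y) ⟩
    y              ∎

  σ-I : ∀ s i → Swap s → σ s (I i) ≈ I (τ s i)
  σ-I s i (l , u) = inverse-unique (1# - X (τ s i)) _ _
    (begin
      (1# - X (τ s i)) * σ s (I i)     ≈⟨ *-congʳ (+-cong (≈-sym (σ-1 s)) (-‿cong (≈-sym (σ-X s i l u)))) ⟩
      (σ s 1# - σ s (X i)) * σ s (I i) ≈⟨ *-congʳ (≈-sym (σ-- s 1# (X i))) ⟩
      σ s (1# - X i) * σ s (I i)       ≈⟨ ≈-sym (σ-* s _ _) ⟩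
      σ s ((1# - X i) * I i)           ≈⟨ ≈-trans (σ-cong s (X-inverse i)) (σ-1 s) ⟩
      1#                               ∎)
    (X-inverse (τ s i))

  σ-g : ∀ s i j → Swap s → i ≢ j → σ s (g i j) ≈ g (τ s i) (τ s j)
  σ-g s i j (l , u) i≢j = inverse-unique (1# - X (τ s i) * X (τ s j)) _ _
    (begin
      (1# - X (τ s i) * X (τ s j)) * σ s (g i j)
        ≈⟨ *-congʳ (+-cong (≈-sym (σ-1 s)) (-‿cong (≈-sym (≈-trans (σ-* s _ _) (*-cong (σ-X s i l u) (σ-X s j l u)))))) ⟩
      (σ s 1# - σ s (X i * X j)) * σ s (g i j)  ≈⟨ *-congʳ (≈-sym (σ-- s 1# _)) ⟩
      σ s (1# - X i * X j) * σ s (g i j)        ≈⟨ ≈-sym (σ-* s _ _) ⟩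
      σ s ((1# - X i * X j) * g i j)            ≈⟨ ≈-trans (σ-cong s (XX-inverse i j i≢j)) (σ-1 s) ⟩
      1#                                        ∎)
    (XX-inverse (τ s i) (τ s j) (τ-injective s i≢j))

  g-sym : ∀ i j → i ≢ j → g j i ≈ g i j
  g-sym i j i≢j = inverse-unique (1# - X i * X j) _ _
    (≈-trans (*-congʳ (+-congˡ (-‿cong (*-comm _ _)))) (XX-inverse j i (i≢j ∘ sym)))
    (XX-inverse i j i≢j)

  fix-1 : ∀ {s} → Fix s 1#
  fix-1 = σ-1 _

  fix-* : ∀ {s x y} → Fix s x → Fix s y → Fix s (x * y)
  fix-* p q = ≈-trans (σ-* _ _ _) (*-cong p q)

  fix-+ : ∀ {s x y} → Fix s x → Fix s y → Fix s (x + y)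
  fix-+ p q = ≈-trans (σ-+ _ _ _) (+-cong p q)

  fix-neg : ∀ {s x} → Fix s x → Fix s (- x)
  fix-neg p = ≈-trans (σ-neg _ _) (-‿cong p)

  fix-^ : ∀ {s x} t → Fix s x → Fix s (x ^ t)
  fix-^ zero    p = fix-1
  fix-^ (suc t) p = fix-* p (fix-^ t p)

  fix-X : ∀ {s} i → Swap s → i ≢ s → i ≢ suc s → Fix s (X i)
  fix-X {s} i (l , u) p q = ≈-trans (σ-X s i l u) (reflexive (cong X (τ-other s i p q)))

  fix-I : ∀ {s} i → Swap s → i ≢ s → i ≢ suc s → Fix s (I i)
  fix-I {s} i sw p q = ≈-trans (σ-I s i sw) (reflexive (cong I (τ-other s i p q)))

  σ-^ : ∀ s x t → σ s (x ^ t) ≈ σ s x ^ t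
  σ-^ s x zero    = σ-1 s
  σ-^ s x (suc t) = ≈-trans (σ-* s x (x ^ t)) (*-congˡ (σ-^ s x t))

  anti-* : ∀ {s x y} → Fix s x → Anti s y → Anti s (x * y)
  anti-* p q = ≈-trans (σ-* _ _ _) (≈-trans (*-cong p q) (≈-sym (-‿distribʳ-* _ _)))

  anti-*ʳ : ∀ {s x y} → Anti s x → Fix s y → Anti s (x * y)
  anti-*ʳ p q = ≈-trans (σ-* _ _ _) (≈-trans (*-cong p q) (≈-sym (-‿distribˡ-* _ _)))

  κ-swap : ∀ s F G → Swap s → Anti s G → κ (F * G) ≡ ℤ.- κ (σ s F * G)
  κ-swap s F G (l , u) p = trans (sym (κ-σ s _ l u))
    (trans (κ-cong (≈-trans (σ-* s F G) (≈-trans (*-congˡ p) (≈-sym (-‿distribʳ-* _ _))))) (κ-neg _))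

  -- The exchange preserves `κ` but reverses the sign of `F * G`, so the value is its own negative.
  κ-fixed : ∀ s F G → Swap s → Fix s F → Anti s G → κ (F * G) ≡ + 0
  κ-fixed s F G sw p q = ≡-neg⇒≡0 _ (trans (κ-swap s F G sw q) (cong ℤ.-_ (κ-cong (*-congʳ p))))

  κ-- : ∀ x y → κ (x - y) ≡ κ x ℤ.- κ y
  κ-- x y = trans (κ-+ x (- y)) (cong (ℤ._+_ (κ x)) (κ-neg y))

  fix-Π : ∀ {s} a l f → (∀ i → a ≤ i → i < a ℕ.+ l → Fix s (f i)) → Fix s (Π a l f)
  fix-Π a zero    f p = fix-1
  fix-Π a (suc l) f p = fix-* (p a ≤-refl (m<m+n a (s≤s z≤n)))
    (fix-Π (suc a) l f (λ i a<i i<b → p i (<⇒≤ a<i) (subst (i <_) (sym (+-suc a l)) i<b)))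

  σ-Π : ∀ s a l f → σ s (Π a l f) ≈ Π a l (σ s ∘ f)
  σ-Π s a zero    f = σ-1 s
  σ-Π s a (suc l) f = ≈-trans (σ-* s _ _) (*-congˡ (σ-Π s (suc a) l f))

  fix-Π-in : ∀ {s} a l f → (∀ i → a ≤ i → σ s (f i) ≈ f (τ s i)) → a ≤ s → suc s < a ℕ.+ l → Fix s (Π a l f)
  fix-Π-in {s} a zero f p a≤s s<b = ⊥-elim (<⇒≱ (subst (suc s <_) (ℕₚ.+-identityʳ a) s<b) (≤-trans a≤s (n≤1+n s)))
  fix-Π-in {s} a (suc l) f p a≤s s<b with a ℕ.≟ s
  fix-Π-in {s} a (suc zero) f p a≤s s<b | yes refl = ⊥-elim (<-irrefl refl (subst (suc a <_) (ℕₚ.+-comm a 1) s<b))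
  fix-Π-in {s} a (suc (suc l)) f p a≤s s<b | yes refl = begin
    σ a (f a * (f (suc a) * Π (2 ℕ.+ a) l f))
      ≈⟨ ≈-trans (σ-* a _ _) (*-congˡ (σ-* a _ _)) ⟩
    σ a (f a) * (σ a (f (suc a)) * σ a (Π (2 ℕ.+ a) l f))
      ≈⟨ *-cong (≈-trans (p a ≤-refl) (reflexive (cong f (τ-left a))))
          (*-cong (≈-trans (p (suc a) (n≤1+n a)) (reflexive (cong f (τ-right a))))
            (fix-Π (2 ℕ.+ a) l f (λ i a<i _ → ≈-trans (p i (≤-trans (m≤n+m a 2) a<i))
              (reflexive (cong f (τ-other a i (λ { refl → <-irrefl refl (≤-trans (n≤1+n _) a<i) }) (λ { refl → <-irrefl refl a<i }))))))) ⟩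
    f (suc a) * (f a * Π (2 ℕ.+ a) l f)
      ≈⟨ solve 3 (λ x y z → x :* (y :* z) := y :* (x :* z)) ≈-refl _ _ _ ⟩
    f a * (f (suc a) * Π (2 ℕ.+ a) l f) ∎
  ... | no a≢s = fix-*
    (≈-trans (p a ≤-refl) (reflexive (cong f (τ-other s a a≢s (λ { refl → <-irrefl refl a≤s })))))
    (fix-Π-in (suc a) l f (λ i a<i → p i (<⇒≤ a<i)) (≤∧≢⇒< a≤s a≢s) (subst (suc s <_) (+-suc a l) s<b))

  -- Only the pair `(s , suc s)` itself is reversed, all other pairs are permuted among themselves.
  -- The sign `e` is `1#` for `g` and `- 1#` for `v`.
  σ-pairsΠ-in : ∀ {s} e a l f → (∀ i j → i ≢ j → σ s (f i j) ≈ f (τ s i) (τ s j)) → (∀ i j → i ≢ j → f j i ≈ e * f i j) →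
    a ≤ s → suc s < a ℕ.+ l → σ s (pairsΠ a l f) ≈ e * pairsΠ a l f
  σ-pairsΠ-in {s} e a zero f p r a≤s s<b = ⊥-elim (<⇒≱ (subst (suc s <_) (ℕₚ.+-identityʳ a) s<b) (≤-trans a≤s (n≤1+n s)))
  σ-pairsΠ-in {s} e a (suc l) f p r a≤s s<b with a ℕ.≟ s
  σ-pairsΠ-in {s} e a (suc zero) f p r a≤s s<b | yes refl = ⊥-elim (<-irrefl refl (subst (suc a <_) (ℕₚ.+-comm a 1) s<b))
  σ-pairsΠ-in {s} e a (suc (suc l)) f p r a≤s s<b | yes refl = begin
    σ a (f a (suc a) * Π b l (f a) * (Π b l (f (suc a)) * pairsΠ b l f))
      ≈⟨ ≈-trans (σ-* a _ _) (*-cong (σ-* a _ _) (σ-* a _ _)) ⟩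
    σ a (f a (suc a)) * σ a (Π b l (f a)) * (σ a (Π b l (f (suc a))) * σ a (pairsΠ b l f))
      ≈⟨ *-cong (*-cong (≈-trans (p a (suc a) (1+n≢n ∘ sym)) (≈-trans (reflexive (cong₂ f (τ-left a) (τ-right a))) (r a (suc a) (1+n≢n ∘ sym))))
            (≈-trans (σ-Π a b l (f a)) (Π-cong b l (λ i b≤i _ → ≈-trans (p a i (a≢ i b≤i)) (reflexive (cong₂ f (τ-left a) (τ-other a i (a≢ i b≤i ∘ sym) (sa≢ i b≤i ∘ sym))))))))
          (*-cong (≈-trans (σ-Π a b l (f (suc a))) (Π-cong b l (λ i b≤i _ → ≈-trans (p (suc a) i (sa≢ i b≤i)) (reflexive (cong₂ f (τ-right a) (τ-other a i (a≢ i b≤i ∘ sym) (sa≢ i b≤i ∘ sym)))))))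
            (fixed b l ≤-refl)) ⟩
    e * f a (suc a) * Π b l (f (suc a)) * (Π b l (f a) * pairsΠ b l f)
      ≈⟨ solve 5 (λ e x y z w → e :* x :* y :* (z :* w) := e :* (x :* z :* (y :* w))) ≈-refl e _ _ _ _ ⟩
    e * (f a (suc a) * Π b l (f a) * (Π b l (f (suc a)) * pairsΠ b l f)) ∎
    where
    b = 2 ℕ.+ a
    a≢ : ∀ i → b ≤ i → a ≢ i
    a≢ i b≤i refl = <-irrefl refl (≤-trans (n≤1+n _) b≤i)
    sa≢ : ∀ i → b ≤ i → suc a ≢ i
    sa≢ i b≤i refl = <-irrefl refl b≤i
    fixed : ∀ c l → b ≤ c → σ a (pairsΠ c l f) ≈ pairsΠ c l f
    fixed c zero    b≤c = fix-1
    fixed c (suc l) b≤c = fix-*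
      (fix-Π (suc c) l (f c) (λ i c<i _ → ≈-trans (p c i (λ { refl → <-irrefl refl c<i }))
        (reflexive (cong₂ f (τ-other a c (a≢ c b≤c ∘ sym) (sa≢ c b≤c ∘ sym))
          (τ-other a i (a≢ i (≤-trans b≤c (<⇒≤ c<i)) ∘ sym) (sa≢ i (≤-trans b≤c (<⇒≤ c<i)) ∘ sym))))))
      (fixed (suc c) l (≤-trans b≤c (n≤1+n c)))
  ... | no a≢s = begin
    σ s (Π (suc a) l (f a) * pairsΠ (suc a) l f)           ≈⟨ σ-* s _ _ ⟩
    σ s (Π (suc a) l (f a)) * σ s (pairsΠ (suc a) l f)
      ≈⟨ *-cong (fix-Π-in (suc a) l (f a) (λ i a<i → ≈-trans (p a i (λ { refl → <-irrefl refl a<i })) (reflexive (cong (λ t → f t (τ s i)) τa))) a<s s<b′)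
               (σ-pairsΠ-in e (suc a) l f p r a<s s<b′) ⟩
    Π (suc a) l (f a) * (e * pairsΠ (suc a) l f)           ≈⟨ solve 3 (λ x e y → x :* (e :* y) := e :* (x :* y)) ≈-refl _ e _ ⟩
    e * (Π (suc a) l (f a) * pairsΠ (suc a) l f)           ∎
    where
    a<s = ≤∧≢⇒< a≤s a≢s
    s<b′ = subst (suc s <_) (+-suc a l) s<b
    τa : τ s a ≡ a
    τa = τ-other s a a≢s (λ { refl → <-irrefl refl a≤s })

-- Telescoping: from products of geometric series to interlacing rows

module Telescoping {n C : ℕ} (S : Setting n C) where
  open Setting S
  open RingKit series
  open Products series
  open Antisymmetry S public

  I-unfold : ∀ i → I i ≈ 1# + X i * I i
  I-unfold i = begin
    I i                             ≈⟨ solve 2 (λ x y → y := (con (+ 1) :- x) :* y :+ x :* y) ≈-refl (X i) (I i) ⟩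
    (1# - X i) * I i + X i * I i    ≈⟨ +-congʳ (X-inverse i) ⟩
    1# + X i * I i                  ∎

  geometric : ∀ s t d l x → κ (d * (X s ^ (x ℕ.+ t) * I s))
    ≡ sumr x l (λ a → κ (d * X s ^ (a ℕ.+ t))) ℤ.+ κ (d * (X s ^ (x ℕ.+ l ℕ.+ t) * I s))
  geometric s t d zero    x = trans (cong (λ y → κ (d * (X s ^ (y ℕ.+ t) * I s))) (sym (ℕₚ.+-identityʳ x))) (sym (ℤₚ.+-identityˡ _))
  geometric s t d (suc l) x = E.begin
    κ (d * (X s ^ (x ℕ.+ t) * I s))
      E.≡⟨ κ-cong (≈-trans (*-congˡ (*-congˡ (I-unfold s)))
            (solve 4 (λ d p x i → d :* (p :* (con (+ 1) :+ x :* i)) := d :* p :+ d :* (x :* p :* i)) ≈-refl d _ (X s) (I s))) ⟩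
    κ (d * X s ^ (x ℕ.+ t) + d * (X s ^ suc (x ℕ.+ t) * I s))
      E.≡⟨ κ-+ _ _ ⟩
    κ (d * X s ^ (x ℕ.+ t)) ℤ.+ κ (d * (X s ^ suc (x ℕ.+ t) * I s))
      E.≡⟨ cong (ℤ._+_ (κ (d * X s ^ (x ℕ.+ t)))) (geometric s t d l (suc x)) ⟩
    κ (d * X s ^ (x ℕ.+ t)) ℤ.+ (sumr (suc x) l (λ a → κ (d * X s ^ (a ℕ.+ t))) ℤ.+ κ (d * (X s ^ (suc x ℕ.+ l ℕ.+ t) * I s)))
      E.≡⟨ sym (ℤₚ.+-assoc (κ (d * X s ^ (x ℕ.+ t))) _ _) ⟩
    sumr x (suc l) (λ a → κ (d * X s ^ (a ℕ.+ t))) ℤ.+ κ (d * (X s ^ (suc x ℕ.+ l ℕ.+ t) * I s))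
      E.≡⟨ cong (λ y → sumr x (suc l) (λ a → κ (d * X s ^ (a ℕ.+ t))) ℤ.+ κ (d * (X s ^ (y ℕ.+ t) * I s))) (sym (+-suc x l)) ⟩
    sumr x (suc l) (λ a → κ (d * X s ^ (a ℕ.+ t))) ℤ.+ κ (d * (X s ^ (x ℕ.+ suc l ℕ.+ t) * I s)) E.∎
    where module E = ≡.≡-Reasoning

  -- Adding the index to the entry turns weakly increasing rows into strictly increasing exponents.
  mon : ℕ → List ℕ → Carrier
  mon s []       = 1#
  mon s (a ∷ as) = X s ^ (a ℕ.+ s) * mon (suc s) as

  geom : ℕ → ℕ → List ℕ → Carrier
  geom s x []      = X s ^ (x ℕ.+ s) * I s
  geom s x (y ∷ b) = X s ^ (x ℕ.+ s) * I s * geom (suc s) y b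

  lastG : ℕ → ℕ → List ℕ → Carrier
  lastG s x []      = X s ^ (x ℕ.+ s) * I s
  lastG s x (y ∷ b) = lastG (suc s) y b

  afterG : ℕ → List ℕ → Carrier
  afterG s []      = 1#
  afterG s (y ∷ b) = geom (suc s) y b

  geom-head : ∀ s x b → geom s x b ≈ X s ^ (x ℕ.+ s) * I s * afterG s b
  geom-head s x []      = ≈-sym (*-identityʳ _)
  geom-head s x (y ∷ b) = ≈-refl

  fix-geom : ∀ {t} s x b → Swap t → suc t < s → Fix t (geom s x b)
  fix-geom {t} s x b sw t<s = go s x b t<s
    where
    factor : ∀ s x → suc t < s → Fix t (X s ^ (x ℕ.+ s) * I s)
    factor s x t<s = fix-* (fix-^ (x ℕ.+ s) (fix-X s sw ≢t ≢st)) (fix-I s sw ≢t ≢st)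
      where
      ≢t : s ≢ t
      ≢t refl = <-irrefl refl (<-trans (n<1+n s) t<s)
      ≢st : s ≢ suc t
      ≢st refl = <-irrefl refl t<s
    go : ∀ s x b → suc t < s → Fix t (geom s x b)
    go s x []      p = factor s x p
    go s x (y ∷ b) p = fix-* (factor s x p) (go (suc s) y b (<-trans p (n<1+n s)))

  fix-afterG : ∀ {t} s b → Swap t → t < s → Fix t (afterG s b)
  fix-afterG s []      sw t<s = fix-1
  fix-afterG s (y ∷ b) sw t<s = fix-geom (suc s) y b sw (s≤s t<s)

  weightQ : ℕ → Carrier
  weightQ a = if a ≡ᵇ 1 then Q else 1#

  rowWeight : List ℕ → Carrier
  rowWeight []      = 1#
  rowWeight (a ∷ _) = weightQ a

  -- `Q * X s ^ (1 + s) + X s ^ (2 + s) / (1 - X s)`: the generating function of the entry of a path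
  -- that joins the row on the left, with `Q` for the entry 1.
  headQ : ℕ → Carrier
  headQ s = X s ^ suc s * (Q + X s * I s)

  module _ (G : Carrier) where

    Admissible : ℕ → List ℕ → Carrier → Set
    Admissible s b c = ∀ t → s ≤ t → t < s ℕ.+ length b → Swap t × Fix t c × Anti t G

    private
      admissible-tail : ∀ {s y b c} d → (∀ t → Swap t → suc s ≤ t → Fix t d) → Admissible s (y ∷ b) c → Admissible (suc s) b (c * d)
      admissible-tail {s} {y} {b} d f h t s<t t<b with h t (<⇒≤ s<t) (subst (t <_) (sym (+-suc s (length b))) t<b)
      ... | sw , fc , an = sw , fix-* fc (f t sw s<t) , an

      fix-X^ : ∀ s e t → Swap t → suc s ≤ t → Fix t (X s ^ e)
      fix-X^ s e t sw s<t = fix-^ e (fix-X s sw (λ { refl → <-irrefl refl s<t }) (λ { refl → <-irrefl refl (<-trans (n<1+n t) s<t) }))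

      -- The part of the series of path `s` beyond the entry `y` begins with `X s ^ (y + 1 + s)`,
      -- which is the exponent with which the series of path `suc s` begins. The two factors
      -- together are symmetric in `X s` and `X (suc s)`.
      symmetric-tail : ∀ s y b c → Admissible s (y ∷ b) c → κ (c * (geom (suc s) y b * G) * (X s ^ (suc y ℕ.+ s) * I s)) ≡ + 0
      symmetric-tail s y b c h with h s ≤-refl (m<m+n s (s≤s z≤n))
      ... | sw@(l , u) , fc , an = trans
        (κ-cong (≈-trans (*-congʳ (*-congˡ (*-congʳ (geom-head (suc s) y b))))
          (≈-trans (*-congˡ (*-congʳ (reflexive (cong (X s ^_) (sym (+-suc y s))))))
          (solve* 7 (λ c p i a g q j → c ⊗ (p ⊗ i ⊗ a ⊗ g) ⊗ (q ⊗ j) ⊜ c ⊗ (q ⊗ p) ⊗ (j ⊗ i) ⊗ a ⊗ g) ≈-refl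
            c (X (suc s) ^ (y ℕ.+ suc s)) (I (suc s)) (afterG (suc s) b) G (X s ^ (y ℕ.+ suc s)) (I s)))))
        (κ-fixed s _ G sw (fix-* (fix-* (fix-* fc pairX) pairI) (fix-afterG (suc s) b sw ≤-refl)) an)
        where
        pairX : Fix s (X s ^ (y ℕ.+ suc s) * X (suc s) ^ (y ℕ.+ suc s))
        pairX = ≈-trans (σ-* s _ _) (≈-trans (*-cong
          (≈-trans (σ-^ s (X s) (y ℕ.+ suc s)) (^-cong (y ℕ.+ suc s) (≈-trans (σ-X s s l u) (reflexive (cong X (τ-left s))))))
          (≈-trans (σ-^ s (X (suc s)) (y ℕ.+ suc s)) (^-cong (y ℕ.+ suc s) (≈-trans (σ-X s (suc s) l u) (reflexive (cong X (τ-right s)))))))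
          (*-comm _ _))
        pairI : Fix s (I s * I (suc s))
        pairI = ≈-trans (σ-* s _ _) (≈-trans (*-cong
          (≈-trans (σ-I s s sw) (reflexive (cong I (τ-left s))))
          (≈-trans (σ-I s (suc s) sw) (reflexive (cong I (τ-right s)))))
          (*-comm _ _))

    -- The series of each path is cut off where its right neighbour begins. The last path has no
    -- such neighbour, so its whole series remains as `lastG`.
    telescope : ∀ s x b c → Sorted x b → Admissible s b c →
      κ (c * (geom s x b * G)) ≡ rsum x b (λ as → κ (c * (mon s as * (lastG s x b * G))))
    telescope-one : ∀ s a y b c → Sorted y b → Admissible s (y ∷ b) c →
      κ (c * (geom (suc s) y b * G) * X s ^ (a ℕ.+ s)) ≡ rsum y b (λ as → κ (c * (mon s (a ∷ as) * (lastG (suc s) y b * G))))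

    telescope s x []      c so h = κ-cong (*-congˡ (≈-sym (*-identityˡ _)))
    telescope s x (y ∷ b) c (x≤y , so) h = E.begin
      κ (c * (X s ^ (x ℕ.+ s) * I s * geom (suc s) y b * G))
        E.≡⟨ κ-cong (solve 4 (λ c p q g → c :* (p :* q :* g) := c :* (q :* g) :* p) ≈-refl c (X s ^ (x ℕ.+ s) * I s) (geom (suc s) y b) G) ⟩
      κ (c * (geom (suc s) y b * G) * (X s ^ (x ℕ.+ s) * I s))
        E.≡⟨ geometric s s _ (suc y ∸ x) x ⟩
      sumr x (suc y ∸ x) (λ a → κ (c * (geom (suc s) y b * G) * X s ^ (a ℕ.+ s))) ℤ.+ κ (c * (geom (suc s) y b * G) * (X s ^ (x ℕ.+ (suc y ∸ x) ℕ.+ s) * I s))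
        E.≡⟨ cong₂ ℤ._+_ (sumr-cong x (suc y ∸ x) (λ a _ _ → telescope-one s a y b c so h))
              (trans (cong (λ e → κ (c * (geom (suc s) y b * G) * (X s ^ (e ℕ.+ s) * I s))) (m+[n∸m]≡n (≤-trans x≤y (n≤1+n y))))
                (symmetric-tail s y b c h)) ⟩
      rsum x (y ∷ b) (λ as → κ (c * (mon s as * (lastG s x (y ∷ b) * G)))) ℤ.+ + 0
        E.≡⟨ ℤₚ.+-identityʳ _ ⟩
      rsum x (y ∷ b) (λ as → κ (c * (mon s as * (lastG s x (y ∷ b) * G)))) E.∎
      where module E = ≡.≡-Reasoning

    telescope-one s a y b c so h = trans
      (κ-cong (solve 3 (λ c q p → c :* q :* p := c :* p :* q) ≈-refl c (geom (suc s) y b * G) (X s ^ (a ℕ.+ s))))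
      (trans (telescope (suc s) y b (c * X s ^ (a ℕ.+ s)) so (admissible-tail {y = y} {b = b} (X s ^ (a ℕ.+ s)) (λ t sw s<t → fix-X^ s (a ℕ.+ s) t sw s<t) h))
        (rsum-cong y b (λ as _ → κ-cong (solve 4 (λ c p q r → c :* p :* (q :* r) := c :* (p :* q :* r)) ≈-refl c (X s ^ (a ℕ.+ s)) (mon (suc s) as) (lastG (suc s) y b * G)))))

    telescopeQ : ∀ s y b c → 1 ≤ y → Sorted y b → Admissible s (y ∷ b) c →
      κ (c * (headQ s * geom (suc s) y b * G)) ≡ rsum 1 (y ∷ b) (λ as → κ (c * rowWeight as * (mon s as * (lastG (suc s) y b * G))))
    telescopeQ s (suc y) b c _ so h = E.begin
      κ (c * (headQ s * geom (suc s) (suc y) b * G))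
        E.≡⟨ κ-cong (solve 6 (λ c p q t r g → c :* (p :* (q :+ t) :* r :* g) := c :* q :* (r :* g) :* p :+ c :* (r :* g) :* (p :* t)) ≈-refl
              c (X s ^ suc s) Q (X s * I s) (geom (suc s) (suc y) b) G) ⟩
      κ (c * Q * W * X s ^ suc s + c * W * (X s ^ suc s * (X s * I s)))
        E.≡⟨ κ-+ _ _ ⟩
      κ (c * Q * W * X s ^ suc s) ℤ.+ κ (c * W * (X s ^ suc s * (X s * I s)))
        E.≡⟨ cong₂ ℤ._+_ (telescope-one s 1 (suc y) b (c * Q) so (λ t l u → let (sw , fc , an) = h t l u in sw , fix-* fc (σ-Q t (proj₂ sw)) , an))
              (trans (κ-cong (*-congˡ (solve 3 (λ p x i → p :* (x :* i) := x :* p :* i) ≈-refl (X s ^ suc s) (X s) (I s))))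
              (trans (geometric s s (c * W) y 2)
              (cong₂ ℤ._+_ (sumr-cong 2 y step) (symmetric-tail s (suc y) b c h)))) ⟩
      row 1 ℤ.+ (sumr 2 y row ℤ.+ + 0)
        E.≡⟨ cong (ℤ._+_ (row 1)) (ℤₚ.+-identityʳ _) ⟩
      row 1 ℤ.+ sumr 2 y row E.∎
      where
      module E = ≡.≡-Reasoning
      W = geom (suc s) (suc y) b * G
      row : ℕ → ℤ
      row a = rsum (suc y) b (λ as → κ (c * weightQ a * (mon s (a ∷ as) * (lastG (suc s) (suc y) b * G))))
      step : ∀ a → 2 ≤ a → a < 2 ℕ.+ y → κ (c * W * X s ^ (a ℕ.+ s)) ≡ row a
      step (suc zero)    (s≤s ()) _
      step (suc (suc a)) _        _ = trans (telescope-one s (suc (suc a)) (suc y) b c so h)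
        (rsum-cong (suc y) b (λ as _ → κ-cong (*-congʳ (≈-sym (*-identityʳ c)))))

module Degrees {n C : ℕ} (S : Setting n C) where
  open Setting S
  open RingKit series
  open Products series
  open Vandermonde series

  Deg-0# : ∀ {p} → Deg p 0 0#
  Deg-0# = Deg-cong (-‿inverseʳ 1#) (Deg-+ Deg-1 (Deg-neg Deg-1))

  Deg-^ : ∀ {p x} t → Deg p 0 x → Deg p 0 (x ^ t)
  Deg-^ zero    h = Deg-1
  Deg-^ (suc t) h = Deg-* h (Deg-^ t h)

  Deg-X^ : ∀ p t → Deg p t (X p ^ t)
  Deg-X^ p zero    = Deg-1
  Deg-X^ p (suc t) = Deg-* (Deg-X p) (Deg-X^ p t)

  Deg-Π : ∀ {p} a l f → (∀ i → a ≤ i → i < a ℕ.+ l → Deg p 0 (f i)) → Deg p 0 (Π a l f)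
  Deg-Π a zero    f h = Deg-1
  Deg-Π a (suc l) f h = Deg-* (h a ≤-refl (m<m+n a (s≤s z≤n)))
    (Deg-Π (suc a) l f (λ i a<i i<b → h i (<⇒≤ a<i) (subst (i <_) (sym (+-suc a l)) i<b)))

  Deg-lap : ∀ {p} b F E → (∀ e → Deg p 0 (b e)) → (∀ E′ → Deg p 0 (F E′)) → Deg p 0 (lap b F E)
  Deg-lap b F []      h k = Deg-0#
  Deg-lap b F (e ∷ E) h k = Deg-+ (Deg-* (h e) (k E)) (Deg-neg (Deg-lap b (F ∣ e) E h (k ∘ (e ∷_))))

-- Removal of the variable of the path that starts in the current row

module Birth (m n : ℕ) (S : Setting n (m ℕ.+ 2 ℕ.* n)) where
  C : ℕ
  C = m ℕ.+ 2 ℕ.* n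

  open Setting S
  open RingKit series
  open Products series
  open Vandermonde series
  open Telescoping S public
  open Degrees S public

  -- Divided by `1 - X p`, this is `P + X p / (1 - X p)`: an exact hit has weight `P`, and the
  -- geometric series after it has weight 1.
  α : ℕ → Carrier
  α p = X p + P * (1# - X p)

  v : ℕ → ℕ → Carrier
  v i j = (X i - X j) * (X i + X j - X i * X j)

  V : ℕ → Carrier
  V N = pairsΠ 1 N v

  -- v i j = (1 - X i) (1 - X j) (w i - w j), so V is a Vandermonde product in the w i.
  w : ℕ → Carrier
  w p = X p * X p * I p

  ws : ℕ → List Carrier
  ws zero    = []
  ws (suc N) = w (suc N) ∷ ws N

  length-ws : ∀ N → length (ws N) ≡ N
  length-ws zero    = refl
  length-ws (suc N) = cong suc (length-ws N)

  v-w : ∀ i j → I i * I j * v i j ≈ w i - w j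
  v-w i j = begin
    I i * I j * v i j
      ≈⟨ solve 4 (λ x y a b → a :* b :* ((x :- y) :* (x :+ y :- x :* y))
           := ((con (+ 1) :- y) :* b) :* (x :* x :* a) :- ((con (+ 1) :- x) :* a) :* (y :* y :* b)) ≈-refl (X i) (X j) (I i) (I j) ⟩
    (1# - X j) * I j * w i - (1# - X i) * I i * w j
      ≈⟨ +-cong (≈-trans (*-congʳ (X-inverse j)) (*-identityˡ _)) (-‿cong (≈-trans (*-congʳ (X-inverse i)) (*-identityˡ _))) ⟩
    w i - w j ∎

  ∏-ws : ∀ z N → ∏- z (ws N) ≈ Π 1 N (λ p → w p - z)
  ∏-ws z zero    = ≈-refl
  ∏-ws z (suc N) = ≈-trans (*-congˡ (∏-ws z N)) (≈-trans (*-comm _ _) (≈-sym (Π-snoc 1 N _)))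

  Π-const : ∀ a l x → Π a l (λ _ → x) ≈ x ^ l
  Π-const a zero    x = ≈-refl
  Π-const a (suc l) x = *-congˡ (Π-const (suc a) l x)

  -- The truncation in `M ∸ 1` is harmless: for `M = 0` both products are empty.
  Π-I-pred : ∀ M → Π 1 M (λ p → I p ^ M) ≈ Π 1 M I * Π 1 M (λ p → I p ^ (M ∸ 1))
  Π-I-pred M = ≈-trans (Π-cong 1 M (λ p l u → I^M p (≤-trans l (≤-pred u)))) (Π-* 1 M I _)
    where
    I^M : ∀ p → 1 ≤ M → I p ^ M ≈ I p * I p ^ (M ∸ 1)
    I^M p (s≤s _) = ≈-refl

  -- Each factor `v i j` needs one `I i` and one `I j` to become `w i - w j`, and each index occurs
  -- in `N - 1` pairs.
  vandermonde : ∀ N → Π 1 N (λ p → I p ^ (N ∸ 1)) * V N ≈ D (iota 0 N) (ws N)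
  vandermonde zero    = *-identityˡ _
  vandermonde (suc M) = begin
    Π 1 N (λ p → I p ^ M) * V N
      ≈⟨ *-cong (Π-snoc 1 M _) (pairsΠ-snoc 1 M v) ⟩
    Π 1 M (λ p → I p ^ M) * I N ^ M * (V M * Π 1 M (λ p → v p N))
      ≈⟨ *-congʳ (*-cong (Π-I-pred M) (≈-sym (Π-const 1 M (I N)))) ⟩
    Π 1 M I * Π 1 M (λ p → I p ^ (M ∸ 1)) * Π 1 M (λ _ → I N) * (V M * Π 1 M (λ p → v p N))
      ≈⟨ solve 5 (λ a b c d e → a :* b :* c :* (d :* e) := a :* c :* e :* (b :* d)) ≈-refl _ _ _ _ _ ⟩
    Π 1 M I * Π 1 M (λ _ → I N) * Π 1 M (λ p → v p N) * (Π 1 M (λ p → I p ^ (M ∸ 1)) * V M)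
      ≈⟨ *-cong (≈-trans (*-congʳ (≈-sym (Π-* 1 M I _))) (≈-trans (≈-sym (Π-* 1 M _ _)) (Π-cong′ 1 M (λ p → v-w p N)))) (vandermonde M) ⟩
    Π 1 M (λ p → w p - w N) * D (iota 0 M) (ws M)
      ≈⟨ *-congʳ (≈-sym (∏-ws (w N) M)) ⟩
    ∏- (w N) (ws M) * D (iota 0 M) (ws M)
      ≈⟨ D-top (D-snoc (w N) (ws M)) ⟩
    D (iota 0 N) (ws N) ∎
    where
    N = suc M
    D-top : ∏- (w N) (ws M) * D (iota 0 (length (ws M))) (ws M) ≈ D (iota 0 (suc (length (ws M)))) (ws N) →
            ∏- (w N) (ws M) * D (iota 0 M) (ws M) ≈ D (iota 0 N) (ws N)
    D-top rewrite length-ws M = id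

  vandermonde-split : ∀ M → D (iota 0 (suc M)) (ws (suc M))
    ≈ Π 1 M w * D (iota 0 M) (ws M) - lap (w (suc M) ^_) (λ E → D (0 ∷ E) (ws M)) (iota 1 M)
  vandermonde-split M = ≈-trans (split (D-snoc-split (w (suc M)) (ws M)))
    (+-congʳ (*-congʳ (≈-trans (∏-ws 0# M) (Π-cong′ 1 M (λ p → ≈-trans (+-congˡ -0#≈0#) (+-identityʳ _))))))
    where
    split : D (iota 0 (suc (length (ws M)))) (ws (suc M)) ≈ ∏- 0# (ws M) * D (iota 0 (length (ws M))) (ws M)
              - lap (w (suc M) ^_) (λ E → D (0 ∷ E) (ws M)) (iota 1 (length (ws M))) →
            D (iota 0 (suc M)) (ws (suc M)) ≈ ∏- 0# (ws M) * D (iota 0 M) (ws M)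
              - lap (w (suc M) ^_) (λ E → D (0 ∷ E) (ws M)) (iota 1 M)
    split rewrite length-ws M = id

  Deg-w : ∀ {p q} → p ≢ q → Deg p 0 (w q)
  Deg-w p≢q = Deg-* (Deg-* (Deg-X-≢ p≢q) (Deg-X-≢ p≢q)) (Deg-I-≢ p≢q)

  Deg-D : ∀ {p} M E → M < p → Deg p 0 (D E (ws M))
  Deg-D zero    []      M<p = Deg-1
  Deg-D zero    (_ ∷ _) M<p = Deg-0#
  Deg-D (suc M) E       M<p = Deg-lap (w (suc M) ^_) _ E
    (λ e → Deg-^ e (Deg-w (λ { refl → <-irrefl refl M<p }))) (λ E′ → Deg-D M E′ (<-trans (n<1+n M) M<p))

  κ-lap : ∀ b F E c → (∀ e E′ → κ (c * (b e * F E′)) ≡ + 0) → κ (c * lap b F E) ≡ + 0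
  κ-lap b F []      c h = trans (κ-cong (zeroʳ c)) κ-0
  κ-lap b F (e ∷ E) c h = trans (κ-cong (solve 3 (λ c x y → c :* (x :- y) := c :* x :- c :* y) ≈-refl c _ _))
    (trans (κ-- _ _) (cong₂ ℤ._-_ (h e E) (κ-lap b (F ∣ e) E c (λ e′ E′ → h e′ (e ∷ E′)))))

  Small : ℕ → Carrier → Set
  Small p x = Σ ℕ λ d → d < C × Deg p d x

  -- Every term of D (0 ∷ E) has a variable that occurs only in φ, in degree too small for κ.
  κ-missing : ∀ M E c φ → M ≤ n →
    (∀ p → 1 ≤ p → p ≤ M → Small p (φ p)) →
    (∀ p q → p ≢ q → 1 ≤ p → p ≤ M → Deg p 0 (φ q)) →
    (∀ p → 1 ≤ p → p ≤ M → Deg p 0 c) →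
    κ (c * (Π 1 M φ * D (0 ∷ E) (ws M))) ≡ + 0
  κ-missing zero    E c φ M≤n sm off fr = trans (κ-cong (solve 1 (λ c → c :* (con (+ 1) :* con (+ 0)) := con (+ 0)) ≈-refl c)) κ-0
  κ-missing (suc M) E c φ M≤n sm off fr with sm (suc M) (s≤s z≤n) ≤-refl
  ... | d , d<C , dg = trans (κ-cong (≈-trans (*-congˡ (*-congʳ (Π-snoc 1 M φ)))
      (solve 5 (λ c x y z t → c :* (x :* y :* (con (+ 1) :* z :- t)) := c :* x :* z :* y :- (c :* x :* y) :* t) ≈-refl
        c (Π 1 M φ) (φ (suc M)) (D E (ws M)) (lap (w (suc M) ^_) (λ E′ → D (0 ∷ E′) (ws M)) E))))
    (trans (κ-- _ _) (cong₂ ℤ._-_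
      (κ-Deg (s≤s z≤n) M≤n d<C (Deg-* (Deg-* (Deg-* (fr (suc M) (s≤s z≤n) ≤-refl)
        (Deg-Π 1 M φ (λ i _ i<b → off (suc M) i (λ { refl → <-irrefl refl i<b }) (s≤s z≤n) ≤-refl)))
        (Deg-D M E ≤-refl)) dg))
      (κ-lap (w (suc M) ^_) (λ E′ → D (0 ∷ E′) (ws M)) E _ rest)))
    where
    rest : ∀ e E′ → κ (c * Π 1 M φ * φ (suc M) * (w (suc M) ^ e * D (0 ∷ E′) (ws M))) ≡ + 0
    rest e E′ = trans
      (κ-cong (solve 5 (λ c x y z t → c :* x :* y :* (z :* t) := c :* y :* z :* (x :* t)) ≈-refl c (Π 1 M φ) (φ (suc M)) (w (suc M) ^ e) (D (0 ∷ E′) (ws M))))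
      (κ-missing M E′ (c * φ (suc M) * w (suc M) ^ e) φ (≤-trans (n≤1+n M) M≤n)
        (λ p l u → sm p l (≤-trans u (n≤1+n M)))
        (λ p q p≢q l u → off p q p≢q l (≤-trans u (n≤1+n M)))
        (λ p l u → let p≢ : p ≢ suc M
                       p≢ = λ { refl → <-irrefl refl u }
                       u′ = ≤-trans u (n≤1+n M)
                   in Deg-* (Deg-* (fr p l u′) (off p (suc M) p≢ l u′)) (Deg-^ e (Deg-w p≢))))

  -- X N ^ e / (1 - X N) acts as X N ^ C on series that do not involve X N.
  κ-fill : ∀ p B l → 1 ≤ p → p ≤ n → Deg p 0 B → ∀ e → e ℕ.+ l ≡ C → κ (B * (X p ^ e * I p)) ≡ κ (B * X p ^ C)
  κ-fill p B zero    lo hi dg e eq = trans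
    (κ-cong (≈-trans (*-congˡ (*-congˡ (I-unfold p)))
      (solve 4 (λ b y x i → b :* (y :* (con (+ 1) :+ x :* i)) := b :* y :+ x :* y :* (b :* i)) ≈-refl B (X p ^ e) (X p) (I p))))
    (trans (κ-+ _ _) (trans (cong₂ ℤ._+_ (cong (λ t → κ (B * X p ^ t)) e≡C)
      (trans (cong (λ t → κ (X p ^ suc t * (B * I p))) e≡C) (κ-X p _ lo hi))) (ℤₚ.+-identityʳ _)))
    where e≡C = trans (sym (ℕₚ.+-identityʳ e)) eq
  κ-fill p B (suc l) lo hi dg e eq = trans
    (κ-cong (≈-trans (*-congˡ (*-congˡ (I-unfold p)))
      (solve 4 (λ b y x i → b :* (y :* (con (+ 1) :+ x :* i)) := b :* y :+ b :* (x :* y :* i)) ≈-refl B (X p ^ e) (X p) (I p))))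
    (trans (κ-+ _ _) (trans (cong₂ ℤ._+_
      (κ-Deg lo hi (subst (e <_) eq (m<m+n e (s≤s z≤n))) (Deg-* dg (Deg-X^ p e)))
      (κ-fill p B l lo hi dg (suc e) (trans (sym (+-suc e l)) eq))) (ℤₚ.+-identityˡ _)))

  -- The paths 1, …, M have started; the factors X p ^ C pin the remaining d paths to their starting points.
  Tail : ℕ → ℕ → Carrier
  Tail M d = Π 1 M (λ p → α p * X p ^ (2 ℕ.* d)) * V M * Π (suc M) d (λ p → X p ^ C)

  tail-suc : ∀ M d → Π 1 M (λ p → α p * X p ^ (2 ℕ.* suc d)) ≈ Π 1 M (λ p → α p * X p ^ (2 ℕ.* d)) * Π 1 M (λ p → X p * X p)
  tail-suc M d = ≈-trans (Π-cong′ 1 M (λ p → ≈-trans (*-congˡ (reflexive (cong (X p ^_) (eq d))))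
      (solve 3 (λ a x y → a :* (x :* (x :* y)) := a :* y :* (x :* x)) ≈-refl (α p) (X p) (X p ^ (2 ℕ.* d)))))
    (Π-* 1 M _ _)
    where
    eq : ∀ d → 2 ℕ.* suc d ≡ suc (suc (2 ℕ.* d))
    eq = solve-∀

  module _ (M d : ℕ) (n≡ : n ≡ suc M ℕ.+ d) where
    private
      N = suc M
      1≤N : 1 ≤ N
      1≤N = s≤s z≤n
      N≤n : N ≤ n
      N≤n = subst (N ≤_) (sym n≡) (m≤m+n N d)
      C≡ : C ≡ m ℕ.+ 2 ℕ.* N ℕ.+ 2 ℕ.* d
      C≡ = trans (cong (λ t → m ℕ.+ 2 ℕ.* t) n≡) (eq m N d)
        where
        eq : ∀ m N d → m ℕ.+ 2 ℕ.* (N ℕ.+ d) ≡ m ℕ.+ 2 ℕ.* N ℕ.+ 2 ℕ.* d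
        eq = solve-∀
      K : Carrier
      K = Π (suc N) d (λ p → X p ^ C)

    -- `before` is one term of the telescoped row `N`: `φ` collects the factors of the paths
    -- `1, …, M`, and `u` is the exponent of path `N`. In `after`, path `N` is pinned by the factor
    -- `X N ^ C` inside `Tail M (suc d)`.
    before after : Carrier → (ℕ → Carrier) → ℕ → Carrier
    before A φ u = A * (Π 1 M φ * (X N ^ u * I N * (Π 1 N (λ p → I p ^ M) * Tail N d)))
    after  A φ _ = A * (Π 1 M φ * (Π 1 M (λ p → I p ^ M) * Tail M (suc d)))

    private
      collect-low : ∀ a k f r x i j v y → a * k * (f * r * (x * i * (j * v))) * y ≈ a * (f * ((i * j) * (r * x * v * (y * k))))
      collect-low = solve* 9 (λ a k f r x i j v y → a ⊗ k ⊗ (f ⊗ r ⊗ (x ⊗ i ⊗ (j ⊗ v))) ⊗ y ⊜ a ⊗ (f ⊗ ((i ⊗ j) ⊗ (r ⊗ x ⊗ v ⊗ (y ⊗ k))))) ≈-refl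

      expand-low : ∀ a f y i j r z x v k → a * (f * (y * i * (j * (r * (z * x) * v * k)))) ≈ a * k * (y * x) * (i * z) * ((f * r) * (j * v))
      expand-low = solve* 10 (λ a f y i j r z x v k → a ⊗ (f ⊗ (y ⊗ i ⊗ (j ⊗ (r ⊗ (z ⊗ x) ⊗ v ⊗ k))))
               ⊜ a ⊗ k ⊗ (y ⊗ x) ⊗ (i ⊗ z) ⊗ ((f ⊗ r) ⊗ (j ⊗ v))) ≈-refl

      split-low : ∀ c f x l → c * (f * (x - l)) ≈ c * (f * x) - c * f * l
      split-low = solve 4 (λ c f x l → c :* (f :* (x :- l)) := c :* (f :* x) :- c :* f :* l) ≈-refl

      main-low : ∀ a y p x i r → a * y * (p + x * i) * r ≈ a * r * (p * y) + a * r * (x * y * i)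
      main-low = solve 6 (λ a y p x i r → a :* y :* (p :+ x :* i) :* r := a :* r :* (p :* y) :+ a :* r :* (x :* y :* i)) ≈-refl

      expand-top : ∀ a f y i j h r z x v s k → a * (f * (y * i * (j * h * (r * (z * x) * (v * s) * k)))) ≈ a * f * j * r * v * k * (y * x) * (i * h * z * s)
      expand-top = solve* 12 (λ a f y i j h r z x v s k → a ⊗ (f ⊗ (y ⊗ i ⊗ (j ⊗ h ⊗ (r ⊗ (z ⊗ x) ⊗ (v ⊗ s) ⊗ k))))
               ⊜ a ⊗ f ⊗ j ⊗ r ⊗ v ⊗ k ⊗ (y ⊗ x) ⊗ (i ⊗ h ⊗ z ⊗ s)) ≈-refl

      collect-top : ∀ a f j r v k y q s → a * f * j * r * v * k * y * (q * s) ≈ a * q * (f * (j * (r * s * v * (y * k))))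
      collect-top = solve* 9 (λ a f j r v k y q s → a ⊗ f ⊗ j ⊗ r ⊗ v ⊗ k ⊗ y ⊗ (q ⊗ s) ⊜ a ⊗ q ⊗ (f ⊗ (j ⊗ (r ⊗ s ⊗ v ⊗ (y ⊗ k))))) ≈-refl

      mod-top : ∀ b y q s x z → b * y * (1# * q * s + x * z) ≈ b * y * (q * s) + x * y * (b * z)
      mod-top = solve 6 (λ b y q s x z → b :* y :* (con (+ 1) :* q :* s :+ x :* z) := b :* y :* (q :* s) :+ x :* y :* (b :* z)) ≈-refl

    -- Here `u + 2 d < C`. In the main term of the determinant, the summand `P` of `I N * α N`
    -- leaves the degree in `X N` too small, and the summand `X N * I N` reaches `X N ^ C` exactly
    -- once. In the other terms the exponent 0 falls to a path `p ≤ M`, whose factor `φ p` has too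
    -- small a degree.
    birth-low : ∀ A φ u → u < m ℕ.+ 2 ℕ.* N →
      (∀ p → 1 ≤ p → p ≤ M → Deg p (m ℕ.+ 2 ℕ.* M) (φ p)) →
      (∀ p q → p ≢ q → 1 ≤ p → p ≤ n → Deg p 0 (φ q)) →
      (∀ p → 1 ≤ p → p ≤ n → Deg p 0 A) →
      κ (before A φ u) ≡ κ (after A φ u)
    birth-low A φ u u<top sm off fr = E.begin
      κ (before A φ u)
        E.≡⟨ κ-cong expand ⟩
      κ (c * (Π 1 M φ′ * (Π 1 M w * D₀)) - c * Π 1 M φ′ * L)
        E.≡⟨ κ-- _ _ ⟩
      κ (c * (Π 1 M φ′ * (Π 1 M w * D₀))) ℤ.- κ (c * Π 1 M φ′ * L)
        E.≡⟨ cong₂ ℤ._-_ main missing ⟩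
      κ (B * X N ^ C) ℤ.- + 0
        E.≡⟨ ℤₚ.+-identityʳ _ ⟩
      κ (B * X N ^ C)
        E.≡⟨ κ-cong collect ⟩
      κ (after A φ u) E.∎
      where
      module E = ≡.≡-Reasoning
      e = u ℕ.+ 2 ℕ.* d
      e<C : e < C
      e<C = subst (e <_) (sym C≡) (+-monoˡ-< (2 ℕ.* d) u<top)
      φ′ = λ p → φ p * (α p * X p ^ (2 ℕ.* d))
      D₀ = D (iota 0 M) (ws M)
      L = lap (w N ^_) (λ E → D (0 ∷ E) (ws M)) (iota 1 M)
      c = A * K * X N ^ e * (P + X N * I N)
      B = A * K * (Π 1 M φ′ * (Π 1 M w * D₀))
      Iα : I N * α N ≈ P + X N * I N
      Iα = ≈-trans (solve 3 (λ i x p → i :* (x :+ p :* (con (+ 1) :- x)) := p :* ((con (+ 1) :- x) :* i) :+ x :* i) ≈-refl (I N) (X N) P)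
        (+-congʳ (≈-trans (*-congˡ (X-inverse N)) (*-identityʳ P)))
      expand : before A φ u ≈ c * (Π 1 M φ′ * (Π 1 M w * D₀)) - c * Π 1 M φ′ * L
      expand = begin
        A * (Π 1 M φ * (X N ^ u * I N * (Π 1 N (λ p → I p ^ M) * (Π 1 N (λ p → α p * X p ^ (2 ℕ.* d)) * V N * K))))
          ≈⟨ *-congˡ (*-congˡ (*-congˡ (*-congˡ (*-congʳ (*-congʳ (Π-snoc 1 M _)))))) ⟩
        A * (Π 1 M φ * (X N ^ u * I N * (Π 1 N (λ p → I p ^ M) * (Π 1 M (λ p → α p * X p ^ (2 ℕ.* d)) * (α N * X N ^ (2 ℕ.* d)) * V N * K))))
          ≈⟨ expand-low A (Π 1 M φ) (X N ^ u) (I N) (Π 1 N (λ p → I p ^ M)) (Π 1 M (λ p → α p * X p ^ (2 ℕ.* d))) (α N) (X N ^ (2 ℕ.* d)) (V N) K ⟩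
        A * K * (X N ^ u * X N ^ (2 ℕ.* d)) * (I N * α N) * ((Π 1 M φ * Π 1 M (λ p → α p * X p ^ (2 ℕ.* d))) * (Π 1 N (λ p → I p ^ M) * V N))
          ≈⟨ *-cong (*-cong (*-congˡ (≈-sym (^-+ (X N) u (2 ℕ.* d)))) Iα)
                   (*-cong (≈-sym (Π-* 1 M φ _)) (≈-trans (vandermonde N) (vandermonde-split M))) ⟩
        c * (Π 1 M φ′ * (Π 1 M w * D₀ - L))
          ≈⟨ split-low c (Π 1 M φ′) (Π 1 M w * D₀) L ⟩
        c * (Π 1 M φ′ * (Π 1 M w * D₀)) - c * Π 1 M φ′ * L ∎
      M<p : ∀ {p} → p ≤ M → p ≢ N
      M<p p≤M refl = <-irrefl refl p≤M
      M≤n = ≤-trans (n≤1+n M) N≤n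
      off′ : ∀ p q → p ≢ q → 1 ≤ p → p ≤ n → Deg p 0 (φ′ q)
      off′ p q p≢q lo hi = Deg-* (off p q p≢q lo hi) (Deg-* (Deg-+ (Deg-X-≢ p≢q) (Deg-* (Deg-P hi) (Deg-+ Deg-1 (Deg-neg (Deg-X-≢ p≢q))))) (Deg-^ (2 ℕ.* d) (Deg-X-≢ p≢q)))
      sm′ : ∀ p → 1 ≤ p → p ≤ M → Small p (φ′ p)
      sm′ p lo hi = m ℕ.+ 2 ℕ.* M ℕ.+ (1 ℕ.+ 2 ℕ.* d)
        , subst (λ t → m ℕ.+ 2 ℕ.* M ℕ.+ (1 ℕ.+ 2 ℕ.* d) < t) (sym C≡) (≤-reflexive (eq m M d))
        , Deg-* (sm p lo hi) (Deg-* (Deg-+ (Deg-X p) (Deg-* (Deg-P (≤-trans hi M≤n)) (Deg-+ (Deg-≤ z≤n Deg-1) (Deg-neg (Deg-X p))))) (Deg-X^ p (2 ℕ.* d)))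
        where
        eq : ∀ m M d → suc (m ℕ.+ 2 ℕ.* M ℕ.+ (1 ℕ.+ 2 ℕ.* d)) ≡ m ℕ.+ 2 ℕ.* suc M ℕ.+ 2 ℕ.* d
        eq = solve-∀
      K-free : ∀ p → p ≤ N → Deg p 0 K
      K-free p p≤N = Deg-Π (suc N) d _ (λ i N<i _ → Deg-^ C (Deg-X-≢ (λ { refl → <-irrefl refl (≤-trans N<i p≤N) })))
      missing : κ (c * Π 1 M φ′ * L) ≡ + 0
      missing = κ-lap (w N ^_) (λ E → D (0 ∷ E) (ws M)) (iota 1 M) (c * Π 1 M φ′) λ t E → trans
        (κ-cong (solve 4 (λ c f x y → c :* f :* (x :* y) := c :* x :* (f :* y)) ≈-refl c (Π 1 M φ′) (w N ^ t) (D (0 ∷ E) (ws M))))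
        (κ-missing M E (c * w N ^ t) φ′ M≤n sm′
          (λ p q p≢q lo hi → off′ p q p≢q lo (≤-trans hi M≤n))
          (λ p lo hi → Deg-* (Deg-* (Deg-* (Deg-* (fr p lo (≤-trans hi M≤n)) (K-free p (≤-trans hi (n≤1+n M))))
              (Deg-^ e (Deg-X-≢ (M<p hi)))) (Deg-+ (Deg-P (≤-trans hi M≤n)) (Deg-* (Deg-X-≢ (M<p hi)) (Deg-I-≢ (M<p hi))))) (Deg-^ t (Deg-w (M<p hi)))))
      B-free : Deg N 0 B
      B-free = Deg-* (Deg-* (fr N 1≤N N≤n) (K-free N ≤-refl))
        (Deg-* (Deg-Π 1 M φ′ (λ i _ i<N → off′ N i (λ { refl → <-irrefl refl i<N }) 1≤N N≤n))
          (Deg-* (Deg-Π 1 M w (λ i _ i<N → Deg-w (λ { refl → <-irrefl refl i<N }))) (Deg-D M (iota 0 M) ≤-refl)))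
      main : κ (c * (Π 1 M φ′ * (Π 1 M w * D₀))) ≡ κ (B * X N ^ C)
      main = trans (κ-cong (main-low (A * K) (X N ^ e) P (X N) (I N) (Π 1 M φ′ * (Π 1 M w * D₀))))
        (trans (κ-+ _ _) (trans (cong₂ ℤ._+_
          (κ-Deg 1≤N N≤n e<C (Deg-* B-free (Deg-* (Deg-P N≤n) (Deg-X^ N e))))
          (κ-fill N B (C ∸ suc e) 1≤N N≤n B-free (suc e) (m+[n∸m]≡n e<C))) (ℤₚ.+-identityˡ _)))
      collect : B * X N ^ C ≈ after A φ u
      collect = begin
        A * K * (Π 1 M φ′ * (Π 1 M w * D₀)) * X N ^ C
          ≈⟨ *-congʳ (*-congˡ (*-cong (Π-* 1 M φ _) (*-cong (Π-* 1 M (λ p → X p * X p) I) (≈-sym (vandermonde M))))) ⟩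
        A * K * (Π 1 M φ * Π 1 M (λ p → α p * X p ^ (2 ℕ.* d)) * (Π 1 M (λ p → X p * X p) * Π 1 M I * (Π 1 M (λ p → I p ^ (M ∸ 1)) * V M))) * X N ^ C
          ≈⟨ collect-low A K (Π 1 M φ) (Π 1 M (λ p → α p * X p ^ (2 ℕ.* d))) (Π 1 M (λ p → X p * X p)) (Π 1 M I) (Π 1 M (λ p → I p ^ (M ∸ 1))) (V M) (X N ^ C) ⟩
        A * (Π 1 M φ * ((Π 1 M I * Π 1 M (λ p → I p ^ (M ∸ 1))) * (Π 1 M (λ p → α p * X p ^ (2 ℕ.* d)) * Π 1 M (λ p → X p * X p) * V M * (X N ^ C * K))))
          ≈⟨ *-congˡ (*-congˡ (*-cong (≈-sym (Π-I-pred M)) (*-congʳ (*-congʳ (≈-sym (tail-suc M d)))))) ⟩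
        after A φ u ∎

    infix 4 _≃_

    -- Congruence modulo `X N`. Next to `X N ^ C`, multiples of `X N` contribute nothing, so the
    -- cofactor may be evaluated at `X N = 0`.
    _≃_ : Carrier → Carrier → Set
    x ≃ y = Σ Carrier λ z → x ≈ y + X N * z

    ≃-* : ∀ {x x′ y y′} → x ≃ x′ → y ≃ y′ → x * y ≃ x′ * y′
    ≃-* {x} {x′} {y} {y′} (z , p) (t , q) = z * y′ + x′ * t + X N * (z * t) ,
      ≈-trans (*-cong p q) (solve 5 (λ a b x z t → (a :+ x :* z) :* (b :+ x :* t) := a :* b :+ x :* (z :* b :+ a :* t :+ x :* (z :* t))) ≈-refl x′ y′ (X N) z t)

    I≃1 : ∀ t → I N ^ t ≃ 1#
    I≃1 zero    = 0# , solve 1 (λ x → con (+ 1) := con (+ 1) :+ x :* con (+ 0)) ≈-refl (X N)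
    I≃1 (suc t) with ≃-* (I N , I-unfold N) (I≃1 t)
    ... | z , p = z , ≈-trans p (+-congʳ (*-identityˡ 1#))

    Π-v≃ : ∀ a l → Π a l (λ p → v p N) ≃ Π a l (λ p → X p * X p)
    Π-v≃ a zero    = 0# , solve 1 (λ x → con (+ 1) := con (+ 1) :+ x :* con (+ 0)) ≈-refl (X N)
    Π-v≃ a (suc l) = ≃-* (- (X a * X a) - X N + X a * X N ,
      solve 2 (λ x y → (x :- y) :* (x :+ y :- x :* y) := x :* x :+ y :* (:- (x :* x) :- y :+ x :* y)) ≈-refl (X a) (X N)) (Π-v≃ (suc a) l)

    α≃P : α N ≃ P
    α≃P = 1# - P , solve 2 (λ x p → x :+ p :* (con (+ 1) :- x) := p :+ x :* (con (+ 1) :- p)) ≈-refl (X N) P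

    -- The power `X N ^ C` is already complete, so no determinant has to be expanded: at `X N = 0`
    -- the factor `α N` becomes `P`, powers of `I N` become 1, and `v p N` becomes the `X p * X p`
    -- that `w p` supplies in `birth-low`.
    birth-top : ∀ A φ → κ (before A φ (m ℕ.+ 2 ℕ.* N)) ≡ κ (after (A * P) φ 0)
    birth-top A φ = E.begin
      κ (before A φ u)
        E.≡⟨ κ-cong expand ⟩
      κ (B * (1# * P * Π 1 M (λ p → X p * X p) + X N * z))
        E.≡⟨ κ-cong (mod-top (A * Π 1 M φ * Π 1 M (λ p → I p ^ M) * Π 1 M (λ p → α p * X p ^ (2 ℕ.* d)) * V M * K) (X N ^ C) P (Π 1 M (λ p → X p * X p)) (X N) z) ⟩
      κ (B * (P * Π 1 M (λ p → X p * X p)) + X N ^ suc C * (B′ * z))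
        E.≡⟨ trans (κ-+ _ _) (trans (cong (ℤ._+_ (κ (B * (P * Π 1 M (λ p → X p * X p))))) (κ-X N (B′ * z) 1≤N N≤n)) (ℤₚ.+-identityʳ _)) ⟩
      κ (B * (P * Π 1 M (λ p → X p * X p)))
        E.≡⟨ κ-cong collect ⟩
      κ (after (A * P) φ 0) E.∎
      where
      module E = ≡.≡-Reasoning
      u = m ℕ.+ 2 ℕ.* N
      mod : I N ^ N * α N * Π 1 M (λ p → v p N) ≃ 1# * P * Π 1 M (λ p → X p * X p)
      mod = ≃-* (≃-* (I≃1 N) α≃P) (Π-v≃ 1 M)
      z = proj₁ mod
      p = proj₂ mod
      B′ = A * Π 1 M φ * Π 1 M (λ p → I p ^ M) * Π 1 M (λ p → α p * X p ^ (2 ℕ.* d)) * V M * K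
      B = B′ * X N ^ C
      expand : before A φ u ≈ B * (1# * P * Π 1 M (λ p → X p * X p) + X N * z)
      expand = begin
        A * (Π 1 M φ * (X N ^ u * I N * (Π 1 N (λ p → I p ^ M) * (Π 1 N (λ p → α p * X p ^ (2 ℕ.* d)) * V N * K))))
          ≈⟨ *-congˡ (*-congˡ (*-congˡ (*-cong (Π-snoc 1 M _) (*-congʳ (*-cong (Π-snoc 1 M _) (pairsΠ-snoc 1 M v)))))) ⟩
        A * (Π 1 M φ * (X N ^ u * I N * (Π 1 M (λ p → I p ^ M) * I N ^ M *
          (Π 1 M (λ p → α p * X p ^ (2 ℕ.* d)) * (α N * X N ^ (2 ℕ.* d)) * (V M * Π 1 M (λ p → v p N)) * K))))
          ≈⟨ expand-top A (Π 1 M φ) (X N ^ u) (I N) (Π 1 M (λ p → I p ^ M)) (I N ^ M) (Π 1 M (λ p → α p * X p ^ (2 ℕ.* d))) (α N) (X N ^ (2 ℕ.* d)) (V M) (Π 1 M (λ p → v p N)) K ⟩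
        B′ * (X N ^ u * X N ^ (2 ℕ.* d)) * (I N ^ N * α N * Π 1 M (λ p → v p N))
          ≈⟨ *-cong (*-congˡ (≈-trans (≈-sym (^-+ (X N) u (2 ℕ.* d))) (reflexive (cong (X N ^_) (sym C≡))))) p ⟩
        B * (1# * P * Π 1 M (λ p → X p * X p) + X N * z) ∎
      collect : B * (P * Π 1 M (λ p → X p * X p)) ≈ after (A * P) φ 0
      collect = begin
        B * (P * Π 1 M (λ p → X p * X p))
          ≈⟨ collect-top A (Π 1 M φ) (Π 1 M (λ p → I p ^ M)) (Π 1 M (λ p → α p * X p ^ (2 ℕ.* d))) (V M) K (X N ^ C) P (Π 1 M (λ p → X p * X p)) ⟩
        A * P * (Π 1 M φ * (Π 1 M (λ p → I p ^ M) * (Π 1 M (λ p → α p * X p ^ (2 ℕ.* d)) * Π 1 M (λ p → X p * X p) * V M * (X N ^ C * K))))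
          ≈⟨ *-congˡ (*-congˡ (*-congˡ (*-congʳ (*-congʳ (≈-sym (tail-suc M d)))))) ⟩
        after (A * P) φ 0 ∎

-- From a row to the row above

lastOf : ℕ → List ℕ → ℕ
lastOf x []      = x
lastOf x (y ∷ b) = lastOf y b

nthL : List ℕ → ℕ → ℕ
nthL []       _       = 0
nthL (a ∷ as) zero    = a
nthL (a ∷ as) (suc t) = nthL as t

Sorted-last : ∀ x b → Sorted x b → x ≤ lastOf x b
Sorted-last x []      _         = ≤-refl
Sorted-last x (y ∷ b) (x≤y , h) = ≤-trans x≤y (Sorted-last y b h)

Inter-length : ∀ x b as → Inter x b as → length as ≡ length b
Inter-length x []      []       _           = refl
Inter-length x (y ∷ b) (a ∷ as) (_ , _ , h) = cong suc (Inter-length y b as h)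

Inter-nth : ∀ x b as → Sorted x b → Inter x b as → ∀ t → nthL as t ≤ lastOf x b
Inter-nth x []      []       so       _           t       = z≤n
Inter-nth x (y ∷ b) (a ∷ as) (_ , so) (_ , q , h) zero    = ≤-trans q (Sorted-last y b so)
Inter-nth x (y ∷ b) (a ∷ as) (_ , so) (_ , q , h) (suc t) = Inter-nth y b as so h t

SortedL : List ℕ → Set
SortedL []      = ⊤
SortedL (x ∷ b) = Sorted x b

Inter-sorted : ∀ x b as → Inter x b as → SortedL as
Inter-sorted x []          []            _                           = tt
Inter-sorted x (y ∷ [])    (a ∷ [])      _                           = tt
Inter-sorted x (y ∷ z ∷ b) (a ∷ a′ ∷ as) (_ , a≤y , h@(y≤a′ , _ , _)) =
  ≤-trans a≤y y≤a′ , Inter-sorted y (z ∷ b) (a′ ∷ as) h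

-- `1 ≤ p` excludes the case `M < k`, in which the truncated difference is 0.
≤∸⇒+≤ : ∀ p M k → 1 ≤ p → p ≤ M ∸ k → p ℕ.+ k ≤ M
≤∸⇒+≤ p M k 1≤p p≤ with k ℕₚ.≤? M
... | yes k≤M = subst (p ℕ.+ k ≤_) (m∸n+n≡m k≤M) (+-monoˡ-≤ k p≤)
... | no k≰M  = ⊥-elim (<⇒≱ 1≤p (subst (p ≤_) (m≤n⇒m∸n≡0 (<⇒≤ (≰⇒> k≰M))) p≤))

module Step (m n k : ℕ) (1≤k : 1 ≤ k) (S : Setting n (m ℕ.+ 2 ℕ.* n)) where
  open Setting S
  open RingKit series
  open Products series
  open Birth m n S public

  -- What the argument needs of a monomial in `P` and `Q`: it is a constant with respect to all
  -- `X p`.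
  Coefficient : Carrier → Set
  Coefficient A = (∀ s → s < n → Fix s A) × (∀ p → p ≤ n → Deg p 0 A)

  coeff-1 : Coefficient 1#
  coeff-1 = (λ _ _ → fix-1) , (λ _ _ → Deg-1)

  coeff-P : Coefficient P
  coeff-P = σ-P , λ _ → Deg-P

  coeff-Q : Coefficient Q
  coeff-Q = σ-Q , λ _ → Deg-Q

  coeff-* : ∀ {x y} → Coefficient x → Coefficient y → Coefficient (x * y)
  coeff-* (f , d) (f′ , d′) = (λ s h → fix-* (f s h) (f′ s h)) , (λ p h → Deg-* (d p h) (d′ p h))

  weightP : ℕ → ℕ → Carrier
  weightP N y = if y ≡ᵇ m ℕ.+ N then P else 1#

  coeff-weightQ : ∀ a → Coefficient (weightQ a)
  coeff-weightQ a with a ≡ᵇ 1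
  ... | true  = coeff-Q
  ... | false = coeff-1

  -- Path `p` is absent from the rows from `p + k` on. The power of `1 - X p` cancels the factors
  -- `I p` that the rows `p + k + 1, …, N` spend. In the step from row `p + k` to the row above, the
  -- factor that remains, times `I p`, is `headQ p`, and the path reappears.
  dead : ℕ → ℕ → Carrier
  dead N p = X p ^ suc p * (1# - X p) ^ (N ∸ (p ℕ.+ k)) * (X p + Q * (1# - X p))

  -- Of the `N` factors `I p`, one drives the telescoping (or is absorbed by `dead`), and the other
  -- `N - 1` turn `V N` into a Vandermonde determinant.
  Ψ : ℕ → ℕ → List ℕ → Carrier
  Ψ N d as = Π 1 (N ∸ k) (dead N) * mon (suc (N ∸ k)) as * (Π 1 N (λ p → I p ^ N) * Tail N d)

  v-anti : ∀ i j → v j i ≈ (- 1#) * v i j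
  v-anti i j = solve 2 (λ x y → (y :- x) :* (y :+ x :- y :* x) := (:- con (+ 1)) :* ((x :- y) :* (x :+ y :- x :* y))) ≈-refl (X i) (X j)

  σ-α : ∀ s i → Swap s → σ s (α i) ≈ α (τ s i)
  σ-α s i (l , u) = ≈-trans (σ-+ s _ _) (+-cong (σ-X s i l u)
    (≈-trans (σ-* s _ _) (*-cong (σ-P s u) (≈-trans (σ-- s _ _) (+-cong (σ-1 s) (-‿cong (σ-X s i l u)))))))

  σ-v : ∀ s i j → Swap s → σ s (v i j) ≈ v (τ s i) (τ s j)
  σ-v s i j (l , u) = ≈-trans (σ-* s _ _) (*-cong
    (≈-trans (σ-- s _ _) (+-cong (σ-X s i l u) (-‿cong (σ-X s j l u))))
    (≈-trans (σ-- s _ _) (+-cong (≈-trans (σ-+ s _ _) (+-cong (σ-X s i l u) (σ-X s j l u)))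
      (-‿cong (≈-trans (σ-* s _ _) (*-cong (σ-X s i l u) (σ-X s j l u)))))))

  anti-V : ∀ s N → Swap s → suc s < 1 ℕ.+ N → Anti s (V N)
  anti-V s N sw@(l , _) s<N = ≈-trans (σ-pairsΠ-in (- 1#) 1 N v (λ i j _ → σ-v s i j sw) (λ i j _ → v-anti i j) l s<N)
    (solve 1 (λ x → (:- con (+ 1)) :* x := :- x) ≈-refl _)

  anti-Tail : ∀ s N d → Swap s → suc s < 1 ℕ.+ N → Anti s (Tail N d)
  anti-Tail s N d sw@(l , u) s<N = anti-*ʳ (anti-* (fix-Π-in 1 N _ equi l s<N) (anti-V s N sw s<N))
    (fix-Π (suc N) d _ (λ i N<i _ → fix-^ C (fix-X i sw
      (λ { refl → <⇒≱ s<N (≤-trans N<i (n≤1+n _)) }) (λ { refl → <⇒≱ s<N N<i }))))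
    where
    equi : ∀ i → 1 ≤ i → σ s (α i * X i ^ (2 ℕ.* d)) ≈ α (τ s i) * X (τ s i) ^ (2 ℕ.* d)
    equi i _ = ≈-trans (σ-* s _ _) (*-cong (σ-α s i sw) (≈-trans (σ-^ s (X i) (2 ℕ.* d)) (^-cong (2 ℕ.* d) (σ-X s i l u))))

  fix-dead : ∀ {s} N p → Swap s → p ≢ s → p ≢ suc s → Fix s (dead N p)
  fix-dead N p sw@(_ , u) a b = fix-* (fix-* (fix-^ (suc p) fX) (fix-^ (N ∸ (p ℕ.+ k)) f1-X)) (fix-+ fX (fix-* (σ-Q _ u) f1-X))
    where
    fX = fix-X p sw a b
    f1-X = fix-+ fix-1 (fix-neg fX)

  Deg-pow : ∀ {p x} t → Deg p 1 x → Deg p t (x ^ t)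
  Deg-pow zero    h = Deg-1
  Deg-pow (suc t) h = Deg-* h (Deg-pow t h)

  Deg-dead : ∀ N p → p ≤ n → Deg p (suc p ℕ.+ (N ∸ (p ℕ.+ k)) ℕ.+ 1) (dead N p)
  Deg-dead N p p≤n = Deg-* (Deg-* (Deg-X^ p (suc p)) (Deg-pow (N ∸ (p ℕ.+ k)) d1-X)) (Deg-+ (Deg-X p) (Deg-* (Deg-Q p≤n) d1-X))
    where d1-X = Deg-+ (Deg-≤ z≤n Deg-1) (Deg-neg (Deg-X p))

  Deg-dead-≢ : ∀ N p q → p ≢ q → p ≤ n → Deg p 0 (dead N q)
  Deg-dead-≢ N p q p≢q p≤n = Deg-* (Deg-* (Deg-^ (suc q) dX) (Deg-^ (N ∸ (q ℕ.+ k)) d1-X)) (Deg-+ dX (Deg-* (Deg-Q p≤n) d1-X))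
    where
    dX = Deg-X-≢ p≢q
    d1-X = Deg-+ Deg-1 (Deg-neg dX)

  mon-Π : ∀ s as → mon s as ≈ Π s (length as) (λ p → X p ^ (nthL as (p ∸ s) ℕ.+ p))
  mon-Π s []       = ≈-refl
  mon-Π s (a ∷ as) = *-cong
    (reflexive (cong (λ t → X s ^ (nthL (a ∷ as) t ℕ.+ s)) (sym (n∸n≡0 s))))
    (≈-trans (mon-Π (suc s) as) (Π-cong (suc s) (length as) (λ p s<p _ →
      reflexive (cong (λ t → X p ^ (nthL (a ∷ as) t ℕ.+ p)) (sym (shift p s<p))))))
    where
    shift : ∀ p → suc s ≤ p → p ∸ s ≡ suc (p ∸ suc s)
    shift p s<p = +-∸-assoc 1 s<p

  lastG-eq : ∀ s x b → lastG s x b ≡ X (s ℕ.+ length b) ^ (lastOf x b ℕ.+ (s ℕ.+ length b)) * I (s ℕ.+ length b)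
  lastG-eq s x []      = cong (λ t → X t ^ (x ℕ.+ t) * I t) (sym (ℕₚ.+-identityʳ s))
  lastG-eq s x (y ∷ b) = trans (lastG-eq (suc s) y b) (cong (λ t → X t ^ (lastOf y b ℕ.+ t) * I t) (sym (+-suc s (length b))))

  mon-geom : ∀ s x b → mon s (x ∷ b) * Π s (suc (length b)) I ≈ geom s x b
  mon-geom s x []      = solve 2 (λ a b → a :* con (+ 1) :* (b :* con (+ 1)) := a :* b) ≈-refl _ (I s)
  mon-geom s x (y ∷ b) = ≈-trans
    (solve 4 (λ a b c d → a :* b :* (c :* d) := a :* c :* (b :* d)) ≈-refl (X s ^ (x ℕ.+ s)) (mon (suc s) (y ∷ b)) (I s) (Π (suc s) (suc (length b)) I))
    (*-congˡ (mon-geom (suc s) y b))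

  module _ (M d : ℕ) (n≡ : n ≡ suc M ℕ.+ d) where
    private
      N = suc M
      r = M ∸ k
      M≤n : M ≤ n
      M≤n = subst (M ≤_) (sym n≡) (≤-trans (n≤1+n M) (m≤m+n N d))
      N≤n : N ≤ n
      N≤n = subst (N ≤_) (sym n≡) (m≤m+n N d)
      G : Carrier
      G = Π 1 N (λ p → I p ^ M) * Tail N d

    anti-G : ∀ s → Swap s → s < N → Anti s G
    anti-G s sw s<N = anti-* (fix-Π-in 1 N (λ p → I p ^ M) (λ i _ → ≈-trans (σ-^ s (I i) M) (^-cong M (σ-I s i sw))) (proj₁ sw) (s≤s s<N)) (anti-Tail s N d sw (s≤s s<N))

    private
      -- Absent and present paths form a single family, as the removal of path `N` treats their
      -- factors alike and only asks for degree bounds.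
      φ : List ℕ → ℕ → Carrier
      φ as p with p ℕₚ.≤? r
      ... | yes _ = dead M p
      ... | no _  = X p ^ (nthL as (p ∸ suc r) ℕ.+ p)

      φ-low : ∀ as p → p ≤ r → φ as p ≡ dead M p
      φ-low as p p≤r with p ℕₚ.≤? r
      ... | yes _  = refl
      ... | no p≰r = ⊥-elim (p≰r p≤r)

      φ-high : ∀ as p → r < p → φ as p ≡ X p ^ (nthL as (p ∸ suc r) ℕ.+ p)
      φ-high as p r<p with p ℕₚ.≤? r
      ... | yes p≤r = ⊥-elim (<⇒≱ r<p p≤r)
      ... | no _    = refl

      φ-Π : ∀ as → r ℕ.+ length as ≡ M → Π 1 M (φ as) ≈ Π 1 r (dead M) * mon (suc r) as
      φ-Π as eq = ≈-trans (reflexive (cong (λ t → Π 1 t (φ as)) (sym eq)))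
        (≈-trans (Π-split 1 r (length as) (φ as)) (*-cong
          (Π-cong 1 r (λ i _ i≤r → reflexive (φ-low as i (≤-pred i≤r))))
          (≈-trans (Π-cong (suc r) (length as) (λ i r<i _ → reflexive (φ-high as i r<i))) (≈-sym (mon-Π (suc r) as)))))

      -- An absent path has degree at most `2 M`, because `1 ≤ k`. A present one has degree at most
      -- `(m + M) + M`, because no entry of the upper row exceeds the last entry `L` of the lower
      -- row, which is below its bound.
      φ-deg : ∀ as L → L < m ℕ.+ N → (∀ t → nthL as t ≤ L) → ∀ p → 1 ≤ p → p ≤ M → Deg p (m ℕ.+ 2 ℕ.* M) (φ as p)
      φ-deg as L L< bd p 1≤p p≤M with p ℕₚ.≤? r
      ... | yes p≤r = Deg-≤ bound (Deg-dead M p (≤-trans p≤M M≤n))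
        where
        p+k≤M : p ℕ.+ k ≤ M
        p+k≤M = ≤∸⇒+≤ p M k 1≤p p≤r
        e = M ∸ (p ℕ.+ k)
        bound : suc p ℕ.+ e ℕ.+ 1 ≤ m ℕ.+ 2 ℕ.* M
        bound = ≤-trans (+-mono-≤ sp+e≤M (≤-trans 1≤p p≤M))
          (≤-trans (≤-reflexive (cong (M ℕ.+_) (sym (ℕₚ.+-identityʳ M)))) (m≤n+m (2 ℕ.* M) m))
          where
          sp+e≤M : suc p ℕ.+ e ≤ M
          sp+e≤M = ≤-trans (+-monoˡ-≤ e (≤-trans (≤-reflexive (ℕₚ.+-comm 1 p)) (+-monoʳ-≤ p 1≤k)))
            (≤-reflexive (m+[n∸m]≡n p+k≤M))
      ... | no p≰r = Deg-≤ bound (Deg-X^ p (nthL as (p ∸ suc r) ℕ.+ p))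
        where
        bound : nthL as (p ∸ suc r) ℕ.+ p ≤ m ℕ.+ 2 ℕ.* M
        bound = ≤-trans (+-mono-≤ (≤-trans (bd (p ∸ suc r)) (≤-pred (subst (L <_) (+-suc m M) L<))) p≤M)
          (≤-reflexive (eq m M))
          where
          eq : ∀ m M → m ℕ.+ M ℕ.+ M ≡ m ℕ.+ 2 ℕ.* M
          eq = solve-∀

      φ-off : ∀ as p q → p ≢ q → 1 ≤ p → p ≤ n → Deg p 0 (φ as q)
      φ-off as p q p≢q _ p≤n with q ℕₚ.≤? r
      ... | yes _ = Deg-dead-≢ M p q p≢q p≤n
      ... | no _  = Deg-^ (nthL as (q ∸ suc r) ℕ.+ q) (Deg-X-≢ p≢q)

      finish : ∀ A as L → Coefficient A → r ℕ.+ length as ≡ M → L ≤ m ℕ.+ N → (∀ t → nthL as t ≤ L) →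
        κ (A * (Π 1 r (dead M) * mon (suc r) as * (X N ^ (L ℕ.+ N) * I N * G))) ≡ κ (A * weightP N L * Ψ M (suc d) as)
      finish A as L cA len L≤ bd with L ℕ.≟ m ℕ.+ N
      ... | no L≢ = E.begin
        κ (A * (Π 1 r (dead M) * mon (suc r) as * (X N ^ (L ℕ.+ N) * I N * G)))
          E.≡⟨ κ-cong (*-congˡ (*-congʳ (≈-sym (φ-Π as len)))) ⟩
        κ (before M d n≡ A (φ as) (L ℕ.+ N))
          E.≡⟨ birth-low M d n≡ A (φ as) (L ℕ.+ N) (subst (L ℕ.+ N <_) (eq m N) (+-monoˡ-< N L<))
                 (φ-deg as L L< bd) (φ-off as) (λ p _ → proj₂ cA p) ⟩
        κ (after M d n≡ A (φ as) (L ℕ.+ N))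
          E.≡⟨ κ-cong (*-cong (≈-sym (≈-trans (*-congˡ (reflexive weight)) (*-identityʳ A))) (*-congʳ (φ-Π as len))) ⟩
        κ (A * weightP N L * Ψ M (suc d) as) E.∎
        where
        module E = ≡.≡-Reasoning
        L< = ≤∧≢⇒< L≤ L≢
        weight : weightP N L ≡ 1#
        weight with L ≡ᵇ m ℕ.+ N in eq′
        ... | false = refl
        ... | true  = ⊥-elim (L≢ (≡ᵇ⇒≡ L (m ℕ.+ N) (subst T (sym eq′) tt)))
        eq : ∀ m N → m ℕ.+ N ℕ.+ N ≡ m ℕ.+ 2 ℕ.* N
        eq = solve-∀
      ... | yes refl = E.begin
        κ (A * (Π 1 r (dead M) * mon (suc r) as * (X N ^ (L ℕ.+ N) * I N * G)))
          E.≡⟨ κ-cong (*-congˡ (*-cong (≈-sym (φ-Π as len)) (*-congʳ (*-congʳ (reflexive (cong (X N ^_) (eq m N))))))) ⟩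
        κ (before M d n≡ A (φ as) (m ℕ.+ 2 ℕ.* N))
          E.≡⟨ birth-top M d n≡ A (φ as) ⟩
        κ (after M d n≡ (A * P) (φ as) 0)
          E.≡⟨ κ-cong (*-cong (*-congˡ (reflexive (sym weight))) (*-congʳ (φ-Π as len))) ⟩
        κ (A * weightP N L * Ψ M (suc d) as) E.∎
        where
        module E = ≡.≡-Reasoning
        weight : weightP N (m ℕ.+ N) ≡ P
        weight with m ℕ.+ N ≡ᵇ m ℕ.+ N in eq′
        ... | true  = refl
        ... | false = ⊥-elim (subst T eq′ (≡⇒≡ᵇ (m ℕ.+ N) (m ℕ.+ N) refl))
        eq : ∀ m N → m ℕ.+ N ℕ.+ N ≡ m ℕ.+ 2 ℕ.* N
        eq = solve-∀

      peel-I : Π 1 N (λ p → I p ^ N) * Tail N d ≈ Π 1 N I * G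
      peel-I = ≈-trans (*-congʳ (Π-* 1 N I _)) (*-assoc _ _ _)

    -- As long as `N ≤ k`, no path is absent, and the first entry `x` of row `N` bounds the first
    -- entry of the row above from below.
    step-growing : ∀ A x b → Coefficient A → N ≤ k → length b ≡ M → Sorted x b → lastOf x b ≤ m ℕ.+ N →
      κ (A * Ψ N d (x ∷ b)) ≡ rsum x b (λ as → κ (A * weightP N (lastOf x b) * Ψ M (suc d) as))
    step-growing A x b cA N≤k len so L≤ = E.begin
      κ (A * Ψ N d (x ∷ b))
        E.≡⟨ κ-cong (*-congˡ rearrange) ⟩
      κ (A * (geom 1 x b * G))
        E.≡⟨ telescope G 1 x b A so admissible ⟩
      rsum x b (λ as → κ (A * (mon 1 as * (lastG 1 x b * G))))
        E.≡⟨ rsum-cong x b (λ as int → trans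
               (κ-cong (*-congˡ (*-cong (≈-trans (≈-sym (*-identityˡ _)) (reflexive (cong (λ t → Π 1 t (dead M) * mon (suc t) as) (sym r≡0))))
                 (*-congʳ (reflexive (trans (lastG-eq 1 x b) (cong (λ t → X (suc t) ^ (lastOf x b ℕ.+ suc t) * I (suc t)) len)))))))
               (finish A as (lastOf x b) cA (trans (cong (ℕ._+ length as) r≡0) (trans (Inter-length x b as int) len)) L≤ (Inter-nth x b as so int))) ⟩
      rsum x b (λ as → κ (A * weightP N (lastOf x b) * Ψ M (suc d) as)) E.∎
      where
      module E = ≡.≡-Reasoning
      r≡0 : r ≡ 0
      r≡0 = m≤n⇒m∸n≡0 (≤-trans (n≤1+n M) N≤k)
      admissible : Admissible G 1 b A
      admissible t 1≤t t<N = (1≤t , <-≤-trans t<N′ N≤n) , proj₁ cA t (<-≤-trans t<N′ N≤n) , anti-G t (1≤t , <-≤-trans t<N′ N≤n) t<N′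
        where t<N′ = subst (λ l → t < suc l) len t<N
      rearrange : Ψ N d (x ∷ b) ≈ geom 1 x b * G
      rearrange = begin
        Π 1 (N ∸ k) (dead N) * mon (suc (N ∸ k)) (x ∷ b) * (Π 1 N (λ p → I p ^ N) * Tail N d)
          ≈⟨ *-cong (reflexive (cong (λ t → Π 1 t (dead N) * mon (suc t) (x ∷ b)) (m≤n⇒m∸n≡0 N≤k))) peel-I ⟩
        1# * mon 1 (x ∷ b) * (Π 1 N I * G)
          ≈⟨ solve 3 (λ a b c → con (+ 1) :* a :* (b :* c) := a :* b :* c) ≈-refl (mon 1 (x ∷ b)) (Π 1 N I) G ⟩
        mon 1 (x ∷ b) * Π 1 N I * G
          ≈⟨ *-congʳ (≈-trans (*-congˡ (reflexive (cong (λ t → Π 1 (suc t) I) (sym len)))) (mon-geom 1 x b)) ⟩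
        geom 1 x b * G ∎

    -- Rows `N` and `M` both have `k` entries: path `N` ends its way up, and path `N - k` reappears
    -- on the left. Its entry has no entry below it, so it is only bounded below by 1, and `headQ`
    -- gives it the weight `Q` if it is 1.
    step-full : ∀ A y b → Coefficient A → k ≤ M → suc (length b) ≡ k → 1 ≤ y → Sorted y b → lastOf y b ≤ m ℕ.+ N →
      κ (A * Ψ N d (y ∷ b)) ≡ rsum 1 (y ∷ b) (λ as → κ (A * rowWeight as * weightP N (lastOf y b) * Ψ M (suc d) as))
    step-full A y b cA k≤M len 1≤y so L≤ = E.begin
      κ (A * Ψ N d (y ∷ b))
        E.≡⟨ κ-cong rearrange ⟩
      κ (c * (headQ q * geom (suc q) y b * G))
        E.≡⟨ telescopeQ G q y b c 1≤y so admissible ⟩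
      rsum 1 (y ∷ b) (λ as → κ (c * rowWeight as * (mon q as * (lastG (suc q) y b * G))))
        E.≡⟨ rsum-cong 1 (y ∷ b) row-step ⟩
      rsum 1 (y ∷ b) (λ as → κ (A * rowWeight as * weightP N (lastOf y b) * Ψ M (suc d) as)) E.∎
      where
      module E = ≡.≡-Reasoning
      q = suc r
      c = A * Π 1 r (dead M)
      q≡ : N ∸ k ≡ q
      q≡ = +-∸-assoc 1 k≤M
      q+k : q ℕ.+ k ≡ N
      q+k = cong suc (m∸n+n≡m k≤M)
      q+b : suc q ℕ.+ length b ≡ N
      q+b = trans (sym (+-suc q (length b))) (trans (cong (q ℕ.+_) len) q+k)
      last-eq : lastG (suc q) y b ≡ X N ^ (lastOf y b ℕ.+ N) * I N
      last-eq = trans (lastG-eq (suc q) y b) (cong (λ t → X t ^ (lastOf y b ℕ.+ t) * I t) q+b)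
      row-step : ∀ as → Inter 1 (y ∷ b) as → κ (c * rowWeight as * (mon q as * (lastG (suc q) y b * G)))
        ≡ κ (A * rowWeight as * weightP N (lastOf y b) * Ψ M (suc d) as)
      row-step (a ∷ as) int@(_ , _ , int′) = trans
        (κ-cong (≈-trans (*-congˡ (*-congˡ (*-congʳ (reflexive last-eq))))
          (solve* 6 (λ a d w m l g → a ⊗ d ⊗ w ⊗ (m ⊗ (l ⊗ g)) ⊜ a ⊗ w ⊗ (d ⊗ m ⊗ (l ⊗ g))) ≈-refl
            A (Π 1 r (dead M)) (weightQ a) (mon q (a ∷ as)) (X N ^ (lastOf y b ℕ.+ N) * I N) G)))
        (finish (A * weightQ a) (a ∷ as) (lastOf y b) (coeff-* cA (coeff-weightQ a))
          (trans (cong (λ t → r ℕ.+ suc t) (Inter-length y b as int′)) (trans (cong (r ℕ.+_) len) (m∸n+n≡m k≤M)))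
          L≤ (Inter-nth 1 (y ∷ b) (a ∷ as) (1≤y , so) int))
      admissible : Admissible G q (y ∷ b) c
      admissible t q≤t t< = sw , fix-* (proj₁ cA t (proj₂ sw)) (fix-Π 1 r (dead M) (λ i _ i<q → fix-dead M i sw
          (λ { refl → <⇒≱ i<q q≤t }) (λ { refl → <⇒≱ i<q (≤-trans q≤t (n≤1+n t)) }))) , anti-G t sw t<N
        where
        t<N = subst (t <_) (trans (+-suc q (length b)) q+b) t<
        sw : Swap t
        sw = ≤-trans (s≤s z≤n) q≤t , <-≤-trans t<N N≤n
      dead-I : ∀ p → p ≤ r → 1 ≤ p → dead N p * I p ≈ dead M p
      dead-I p p≤r 1≤p = begin
        X p ^ suc p * (1# - X p) ^ (N ∸ (p ℕ.+ k)) * (X p + Q * (1# - X p)) * I p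
          ≡⟨ cong (λ t → X p ^ suc p * (1# - X p) ^ t * (X p + Q * (1# - X p)) * I p) (+-∸-assoc 1 (≤∸⇒+≤ p M k 1≤p p≤r)) ⟩
        X p ^ suc p * ((1# - X p) * (1# - X p) ^ (M ∸ (p ℕ.+ k))) * (X p + Q * (1# - X p)) * I p
          ≈⟨ solve* 5 (λ x o t f i → x ⊗ (o ⊗ t) ⊗ f ⊗ i ⊜ o ⊗ i ⊗ (x ⊗ t ⊗ f)) ≈-refl (X p ^ suc p) (1# - X p) _ (X p + Q * (1# - X p)) (I p) ⟩
        (1# - X p) * I p * dead M p
          ≈⟨ ≈-trans (*-congʳ (X-inverse p)) (*-identityˡ _) ⟩
        dead M p ∎
      head-I : dead N q * I q ≈ headQ q
      head-I = begin
        X q ^ suc q * (1# - X q) ^ (N ∸ (q ℕ.+ k)) * (X q + Q * (1# - X q)) * I q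
          ≡⟨ cong (λ t → X q ^ suc q * (1# - X q) ^ t * (X q + Q * (1# - X q)) * I q) (trans (cong (N ∸_) q+k) (n∸n≡0 N)) ⟩
        X q ^ suc q * 1# * (X q + Q * (1# - X q)) * I q
          ≈⟨ solve 4 (λ t x q i → t :* con (+ 1) :* (x :+ q :* (con (+ 1) :- x)) :* i := t :* (q :* ((con (+ 1) :- x) :* i) :+ x :* i)) ≈-refl (X q ^ suc q) (X q) Q (I q) ⟩
        X q ^ suc q * (Q * ((1# - X q) * I q) + X q * I q)
          ≈⟨ *-congˡ (+-congʳ (≈-trans (*-congˡ (X-inverse q)) (*-identityʳ Q))) ⟩
        headQ q ∎
      deads : Π 1 q (dead N) * Π 1 q I ≈ Π 1 r (dead M) * headQ q
      deads = ≈-trans (*-cong (Π-snoc 1 r (dead N)) (Π-snoc 1 r I))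
        (≈-trans (solve 4 (λ a b c d → a :* b :* (c :* d) := a :* c :* (b :* d)) ≈-refl (Π 1 r (dead N)) (dead N q) (Π 1 r I) (I q))
          (*-cong (≈-trans (≈-sym (Π-* 1 r (dead N) I)) (Π-cong 1 r (λ i 1≤i i<q → dead-I i (≤-pred i<q) 1≤i))) head-I))
      split-I : Π 1 N I ≈ Π 1 q I * Π (suc q) (suc (length b)) I
      split-I = ≈-trans (reflexive (cong (λ t → Π 1 t I) (sym (trans (+-suc q (length b)) q+b)))) (Π-split 1 q (suc (length b)) I)
      rearrange : A * Ψ N d (y ∷ b) ≈ c * (headQ q * geom (suc q) y b * G)
      rearrange = begin
        A * (Π 1 (N ∸ k) (dead N) * mon (suc (N ∸ k)) (y ∷ b) * (Π 1 N (λ p → I p ^ N) * Tail N d))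
          ≈⟨ *-congˡ (*-cong (reflexive (cong (λ t → Π 1 t (dead N) * mon (suc t) (y ∷ b)) q≡)) (≈-trans peel-I (*-congʳ split-I))) ⟩
        A * (Π 1 q (dead N) * mon (suc q) (y ∷ b) * (Π 1 q I * Π (suc q) (suc (length b)) I * G))
          ≈⟨ solve* 6 (λ a x y z w g → a ⊗ (x ⊗ y ⊗ (z ⊗ w ⊗ g)) ⊜ a ⊗ ((x ⊗ z) ⊗ (y ⊗ w) ⊗ g)) ≈-refl
               A (Π 1 q (dead N)) (mon (suc q) (y ∷ b)) (Π 1 q I) (Π (suc q) (suc (length b)) I) G ⟩
        A * ((Π 1 q (dead N) * Π 1 q I) * (mon (suc q) (y ∷ b) * Π (suc q) (suc (length b)) I) * G)
          ≈⟨ *-congˡ (*-congʳ (*-cong deads (mon-geom (suc q) y b))) ⟩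
        A * (Π 1 r (dead M) * headQ q * geom (suc q) y b * G)
          ≈⟨ solve* 5 (λ a d h g t → a ⊗ (d ⊗ h ⊗ g ⊗ t) ⊜ a ⊗ d ⊗ (h ⊗ g ⊗ t)) ≈-refl A (Π 1 r (dead M)) (headQ q) (geom (suc q) y b) G ⟩
        c * (headQ q * geom (suc q) y b * G) ∎

rsum-zero : ∀ x b {F} → (∀ as → Inter x b as → F as ≡ + 0) → rsum x b F ≡ + 0
rsum-zero x b p = trans (rsum-cong x b p) (go x b)
  where
  go : ∀ x b → rsum x b (λ _ → + 0) ≡ + 0
  go x []      = refl
  go x (y ∷ b) = sumr-zero x (suc y ∸ x) (λ _ _ _ → go y b)

Positive : List ℕ → Set
Positive []      = ⊤
Positive (x ∷ _) = 1 ≤ x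

Inter-positive : ∀ x b as → 1 ≤ x → Inter x b as → Positive as
Inter-positive x []      []       _   _           = tt
Inter-positive x (y ∷ b) (a ∷ as) 1≤x (x≤a , _) = ≤-trans 1≤x x≤a

-- Some entry exceeds the bound of its column, the columns being numbered from `s`. Interlacing
-- alone does not exclude such rows.
TooLarge : ℕ → ℕ → List ℕ → Set
TooLarge m s []      = ⊥
TooLarge m s (x ∷ b) = m ℕ.+ s < x ⊎ TooLarge m (suc s) b

-- Columns grow upwards, so an excess persists in its column. Only the last entry has nothing above
-- it, and there the excess is excluded by hypothesis.
Inter-tooLarge : ∀ m s x b as → Inter x b as → lastOf x b ≤ m ℕ.+ (s ℕ.+ length b) → TooLarge m s (x ∷ b) → TooLarge m s as
Inter-tooLarge m s x []      []       _             L≤ (inj₁ p) =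
  ⊥-elim (<⇒≱ p (subst (λ t → x ≤ m ℕ.+ t) (ℕₚ.+-identityʳ s) L≤))
Inter-tooLarge m s x (y ∷ b) (a ∷ as) (x≤a , _)     L≤ (inj₁ p) = inj₁ (<-≤-trans p x≤a)
Inter-tooLarge m s x (y ∷ b) (a ∷ as) (_ , _ , int) L≤ (inj₂ p) =
  inj₂ (Inter-tooLarge m (suc s) y b as int (subst (λ t → lastOf y b ≤ m ℕ.+ t) (+-suc s (length b)) L≤) p)

-- Rows that exceed the bounds contribute nothing

module Vanish (m n k : ℕ) (1≤k : 1 ≤ k) (S : Setting n (m ℕ.+ 2 ℕ.* n)) where
  open Setting S
  open RingKit series
  open Products series
  open Step m n k 1≤k S public

  mon-last : ∀ s x b → Σ Carrier λ z → mon s (x ∷ b) ≈ X (s ℕ.+ length b) ^ (lastOf x b ℕ.+ (s ℕ.+ length b)) * z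
  mon-last s x []      = 1# , *-congʳ (reflexive (cong (λ t → X t ^ (x ℕ.+ t)) (sym (ℕₚ.+-identityʳ s))))
  mon-last s x (y ∷ b) with mon-last (suc s) y b
  ... | z , p = X s ^ (x ℕ.+ s) * z , ≈-trans (*-congˡ p)
    (≈-trans (solve 3 (λ a b c → a :* (b :* c) := b :* (a :* c)) ≈-refl (X s ^ (x ℕ.+ s)) _ z)
      (*-congʳ (reflexive (cong (λ t → X t ^ (lastOf y b ℕ.+ t)) (sym (+-suc s (length b)))))))

  -- The exponent of `X N` is at least `L + N + 2 d`, which exceeds `C = m + 2 N + 2 d`.
  last-too-large : ∀ M d A x b → n ≡ suc M ℕ.+ d → (suc M ∸ k) ℕ.+ suc (length b) ≡ suc M → m ℕ.+ suc M < lastOf x b →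
    κ (A * Ψ (suc M) d (x ∷ b)) ≡ + 0
  last-too-large M d A x b n≡ len L> = trans (κ-cong expand) (κ-X N _ (s≤s z≤n) (subst (N ≤_) (sym n≡) (m≤m+n N d)))
    where
    N = suc M
    q = N ∸ k
    L = lastOf x b
    z = proj₁ (mon-last (suc q) x b)
    e = L ℕ.+ N ℕ.+ 2 ℕ.* d
    C<e : suc C ≤ e
    C<e = subst (_< e) (sym (trans (cong (λ t → m ℕ.+ 2 ℕ.* t) n≡) (eq m N d))) (+-monoˡ-< (2 ℕ.* d) (+-monoˡ-< N L>))
      where
      eq : ∀ m N d → m ℕ.+ 2 ℕ.* (N ℕ.+ d) ≡ m ℕ.+ N ℕ.+ N ℕ.+ 2 ℕ.* d
      eq = solve-∀
    rest : Carrier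
    rest = A * (Π 1 q (dead N) * z) * (Π 1 N (λ p → I p ^ N) * (Π 1 M (λ p → α p * X p ^ (2 ℕ.* d)) * α N * V N * Π (suc N) d (λ p → X p ^ C)))
    index : suc q ℕ.+ length b ≡ N
    index = trans (sym (+-suc q (length b))) len
    power : X N ^ (L ℕ.+ N) * X N ^ (2 ℕ.* d) ≈ X N ^ suc C * X N ^ (e ∸ suc C)
    power = ≈-trans (≈-sym (^-+ (X N) (L ℕ.+ N) (2 ℕ.* d)))
      (≈-trans (reflexive (cong (X N ^_) (sym (m+[n∸m]≡n C<e)))) (^-+ (X N) (suc C) (e ∸ suc C)))
    pull : ∀ a f z y i r l w v k → a * (f * (y * z) * (i * (r * (l * w) * v * k))) ≈ y * w * (a * (f * z) * (i * (r * l * v * k)))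
    pull = solve* 10 (λ a f z y i r l w v k → a ⊗ (f ⊗ (y ⊗ z) ⊗ (i ⊗ (r ⊗ (l ⊗ w) ⊗ v ⊗ k))) ⊜ y ⊗ w ⊗ (a ⊗ (f ⊗ z) ⊗ (i ⊗ (r ⊗ l ⊗ v ⊗ k)))) ≈-refl
    expand : A * Ψ N d (x ∷ b) ≈ X N ^ suc C * (X N ^ (e ∸ suc C) * rest)
    expand = begin
      A * Ψ N d (x ∷ b)
        ≈⟨ *-congˡ (*-cong (*-congˡ (≈-trans (proj₂ (mon-last (suc q) x b)) (*-congʳ (reflexive (cong (λ t → X t ^ (L ℕ.+ t)) index)))))
             (*-congˡ (*-congʳ (*-congʳ (Π-snoc 1 M (λ p → α p * X p ^ (2 ℕ.* d))))))) ⟩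
      A * (Π 1 q (dead N) * (X N ^ (L ℕ.+ N) * z) * (Π 1 N (λ p → I p ^ N) *
        (Π 1 M (λ p → α p * X p ^ (2 ℕ.* d)) * (α N * X N ^ (2 ℕ.* d)) * V N * Π (suc N) d (λ p → X p ^ C))))
        ≈⟨ pull A (Π 1 q (dead N)) z (X N ^ (L ℕ.+ N)) (Π 1 N (λ p → I p ^ N)) (Π 1 M (λ p → α p * X p ^ (2 ℕ.* d))) (α N) (X N ^ (2 ℕ.* d)) (V N) (Π (suc N) d (λ p → X p ^ C)) ⟩
      X N ^ (L ℕ.+ N) * X N ^ (2 ℕ.* d) * rest
        ≈⟨ *-congʳ power ⟩
      X N ^ suc C * X N ^ (e ∸ suc C) * rest
        ≈⟨ *-assoc _ _ _ ⟩
      X N ^ suc C * (X N ^ (e ∸ suc C) * rest) ∎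

  coeff-weightP : ∀ N y → Coefficient (weightP N y)
  coeff-weightP N y with y ≡ᵇ m ℕ.+ N
  ... | true  = coeff-P
  ... | false = coeff-1

  coeff-rowWeight : ∀ as → Coefficient (rowWeight as)
  coeff-rowWeight []       = coeff-1
  coeff-rowWeight (a ∷ as) = coeff-weightQ a

  -- By induction upwards: an excess stays in its column, and in the row where the path of this
  -- column starts it is the last entry, where the power of `X N` is too large.
  vanish : ∀ N d A b → n ≡ N ℕ.+ d → (N ∸ k) ℕ.+ length b ≡ N → SortedL b → Positive b → Coefficient A →
    TooLarge m (suc (N ∸ k)) b → κ (A * Ψ N d b) ≡ + 0
  vanish zero    d A (x ∷ b) n≡ len so po cA bad = ⊥-elim (1+n≢0 (trans (sym (+-suc (0 ∸ k) (length b))) len))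
  vanish (suc M) d A (x ∷ b) n≡ len so po cA bad with lastOf x b ℕₚ.≤? m ℕ.+ suc M | suc M ℕₚ.≤? k
  ... | no L≰  | _ = last-too-large M d A x b n≡ len (≰⇒> L≰)
  ... | yes L≤ | yes N≤k = trans (step-growing M d n≡ A x b cA N≤k (suc-injective len′) so L≤)
    (rsum-zero x b (λ as int → vanish M (suc d) (A * weightP (suc M) (lastOf x b)) as (trans n≡ (sym (+-suc M d)))
      (trans (cong₂ ℕ._+_ M∸k≡0 (Inter-length x b as int)) (suc-injective len′))
      (Inter-sorted x b as int) (Inter-positive x b as po int) (coeff-* cA (coeff-weightP (suc M) (lastOf x b)))
      (subst (λ t → TooLarge m (suc t) as) (sym M∸k≡0)
        (Inter-tooLarge m 1 x b as int (subst (λ t → lastOf x b ≤ m ℕ.+ t) (sym len′) L≤)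
          (subst (λ t → TooLarge m (suc t) (x ∷ b)) N∸k≡0 bad)))))
    where
    N∸k≡0 : suc M ∸ k ≡ 0
    N∸k≡0 = m≤n⇒m∸n≡0 N≤k
    M∸k≡0 : M ∸ k ≡ 0
    M∸k≡0 = m≤n⇒m∸n≡0 (≤-trans (n≤1+n M) N≤k)
    len′ : suc (length b) ≡ suc M
    len′ = trans (cong (ℕ._+ suc (length b)) (sym N∸k≡0)) len
  ... | yes L≤ | no N≰k = trans (step-full M d n≡ A x b cA k≤M len′ po so L≤)
    (rsum-zero 1 (x ∷ b) {λ as → κ (A * rowWeight as * weightP (suc M) (lastOf x b) * Ψ M (suc d) as)} (λ { (a ∷ as) int@(_ , _ , int′) → vanish M (suc d) (A * weightQ a * weightP (suc M) (lastOf x b)) (a ∷ as) (trans n≡ (sym (+-suc M d)))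
      (trans (cong (λ t → (M ∸ k) ℕ.+ suc t) (Inter-length x b as int′)) (trans (cong ((M ∸ k) ℕ.+_) len′) (m∸n+n≡m k≤M)))
      (Inter-sorted 1 (x ∷ b) (a ∷ as) int) (Inter-positive 1 (x ∷ b) (a ∷ as) ≤-refl int)
      (coeff-* (coeff-* cA (coeff-weightQ a)) (coeff-weightP (suc M) (lastOf x b)))
      (inj₂ (Inter-tooLarge m (suc (suc (M ∸ k))) x b as int′
        (subst (λ t → lastOf x b ≤ m ℕ.+ t) (sym (trans (sym (+-suc (suc (M ∸ k)) (length b))) (trans (cong (suc (M ∸ k) ℕ.+_) len′) (cong suc (m∸n+n≡m k≤M))))) L≤)
        (subst (λ t → TooLarge m (suc t) (x ∷ b)) q≡ bad))) }))
    where
    k≤M : k ≤ M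
    k≤M = ≤-pred (≰⇒> N≰k)
    q≡ : suc M ∸ k ≡ suc (M ∸ k)
    q≡ = +-∸-assoc 1 k≤M
    len′ : suc (length b) ≡ k
    len′ = +-cancelˡ-≡ (suc M ∸ k) _ _ (trans len (sym (m∸n+n≡m (≤-trans k≤M (n≤1+n M)))))

-- Littlewood's identity

negOnePowℕ-+ : ∀ a b → negOnePowℕ (a ℕ.+ b) ≡ negOnePowℕ a ℤ.* negOnePowℕ b
negOnePowℕ-+ zero    b = sym (ℤₚ.*-identityˡ _)
negOnePowℕ-+ (suc a) b = trans (cong ℤ.-_ (negOnePowℕ-+ a b)) (ℤₚ.neg-distribˡ-* (negOnePowℕ a) (negOnePowℕ b))

negOnePowℕ-double : ∀ a → negOnePowℕ (a ℕ.+ a) ≡ + 1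
negOnePowℕ-double zero    = refl
negOnePowℕ-double (suc a) = trans (cong (ℤ.-_ ∘ negOnePowℕ) (+-suc a a)) (trans (ℤₚ.neg-involutive _) (negOnePowℕ-double a))

iota-split : ∀ a l l′ → iota a (l ℕ.+ l′) ≡ iota a l ++ iota (a ℕ.+ l) l′
iota-split a zero    l′ = cong (λ t → iota t l′) (sym (ℕₚ.+-identityʳ a))
iota-split a (suc l) l′ = cong (a ∷_) (trans (iota-split (suc a) l l′) (cong (λ t → iota (suc a) l ++ iota t l′) (sym (+-suc a l))))

iota-at : ∀ a l v → a ≤ v → v < a ℕ.+ l → Σ (List ℕ) λ post → iota a l ≡ iota a (v ∸ a) ++ v ∷ post
iota-at a l v a≤v v<b = iota (suc v) (l ∸ suc d) , (begin
  iota a l                                  ≡⟨ cong (iota a) (sym (m+[n∸m]≡n d<l)) ⟩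
  iota a (suc d ℕ.+ (l ∸ suc d))            ≡⟨ cong (iota a) (sym (+-suc d _)) ⟩
  iota a (d ℕ.+ suc (l ∸ suc d))            ≡⟨ iota-split a d (suc (l ∸ suc d)) ⟩
  iota a d ++ iota (a ℕ.+ d) (suc (l ∸ suc d)) ≡⟨ cong (λ t → iota a d ++ iota t (suc (l ∸ suc d))) a+d ⟩
  iota a d ++ v ∷ iota (suc v) (l ∸ suc d)  ∎)
  where
  open ≡.≡-Reasoning
  d = v ∸ a
  a+d : a ℕ.+ d ≡ v
  a+d = m+[n∸m]≡n a≤v
  d<l : d < l
  d<l = +-cancelˡ-< a d l (subst (_< a ℕ.+ l) (sym a+d) v<b)

record Alternating (K : ℕ) (g : List ℕ → ℤ) : Set where
  constructor alternating
  field
    swap : ∀ pre a b post → length (pre ++ a ∷ b ∷ post) ≡ K → g (pre ++ a ∷ b ∷ post) ≡ ℤ.- g (pre ++ b ∷ a ∷ post)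
open Alternating

alternating-tail : ∀ {K g} x → Alternating (suc K) g → Alternating K (g ∘ (x ∷_))
alternating-tail x alt = alternating λ pre a b post len → swap alt (x ∷ pre) a b post (cong suc len)

alternating-equal : ∀ {K g} → Alternating K g → ∀ a post → suc (suc (length post)) ≡ K → g (a ∷ a ∷ post) ≡ + 0
alternating-equal alt a post len = ≡-neg⇒≡0 _ (swap alt [] a a post len)

alternating-move : ∀ {K g} → Alternating K g → ∀ v pre post → suc (length (pre ++ post)) ≡ K →
  g (v ∷ pre ++ post) ≡ negOnePowℕ (length pre) ℤ.* g (pre ++ v ∷ post)
alternating-move alt v []        post len = sym (ℤₚ.*-identityˡ _)
alternating-move {suc K} {g} alt v (x ∷ pre) post len = begin
  g (v ∷ x ∷ pre ++ post)                                                    ≡⟨ swap alt [] v x (pre ++ post) len ⟩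
  ℤ.- g (x ∷ v ∷ pre ++ post)                                                ≡⟨ cong ℤ.-_ (alternating-move (alternating-tail x alt) v pre post (suc-injective len)) ⟩
  ℤ.- (negOnePowℕ (length pre) ℤ.* g (x ∷ pre ++ v ∷ post))                  ≡⟨ ℤₚ.neg-distribˡ-* (negOnePowℕ (length pre)) _ ⟩
  (ℤ.- negOnePowℕ (length pre)) ℤ.* g (x ∷ pre ++ v ∷ post)                  ∎
  where open ≡.≡-Reasoning

alternating-repeat : ∀ {K g} → Alternating K g → ∀ v pre post → suc (length (pre ++ v ∷ post)) ≡ K → g (v ∷ pre ++ v ∷ post) ≡ + 0
alternating-repeat alt v []        post len = alternating-equal alt v post len
alternating-repeat {suc K} {g} alt v (x ∷ pre) post len = trans (swap alt [] v x (pre ++ v ∷ post) len)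
  (cong ℤ.-_ (alternating-repeat (alternating-tail x alt) v pre post (suc-injective len)))

-- Multiplication of the monomial with exponents c ∷ ds in z ∷ zs by ∏ (1 - z zⱼ).
spread : (ℕ → List ℕ → ℤ) → ℕ → List ℕ → ℤ
spread g c []       = g c []
spread g c (d ∷ ds) = spread (λ c′ E → g c′ (d ∷ E)) c ds ℤ.- spread (λ c′ E → g c′ (suc d ∷ E)) (suc c) ds

spread-cong : ∀ {g h} c ds → (∀ c E → length E ≡ length ds → g c E ≡ h c E) → spread g c ds ≡ spread h c ds
spread-cong c []       p = p c [] refl
spread-cong c (d ∷ ds) p = cong₂ ℤ._-_ (spread-cong c ds (λ c′ E l → p c′ (d ∷ E) (cong suc l))) (spread-cong (suc c) ds (λ c′ E l → p c′ (suc d ∷ E) (cong suc l)))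

spread-zero : ∀ {g} c ds → (∀ c E → length E ≡ length ds → g c E ≡ + 0) → spread g c ds ≡ + 0
spread-zero c []       p = p c [] refl
spread-zero c (d ∷ ds) p = cong₂ ℤ._-_ (spread-zero c ds (λ c′ E l → p c′ (d ∷ E) (cong suc l))) (spread-zero (suc c) ds (λ c′ E l → p c′ (suc d ∷ E) (cong suc l)))

-- The exponent before has already moved to `a`, so each of the following exponents must move away
-- from a collision; every move costs a sign and adds 1 to the exponent of `z`.
spread-pushed : ∀ g c a l → (∀ c → Alternating l (g c)) → (∀ c E → suc (length E) ≡ l → g c (a ∷ E) ≡ + 0) →
  spread g c (iota a l) ≡ negOnePowℕ l ℤ.* g (c ℕ.+ l) (iota (suc a) l)
spread-pushed g c a zero    alt z = trans (cong (λ t → g t []) (sym (ℕₚ.+-identityʳ c))) (sym (ℤₚ.*-identityˡ _))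
spread-pushed g c a (suc l) alt z = begin
  spread (λ c′ E → g c′ (a ∷ E)) c (iota (suc a) l) ℤ.- spread (λ c′ E → g c′ (suc a ∷ E)) (suc c) (iota (suc a) l)
    ≡⟨ cong₂ ℤ._-_ (spread-zero c (iota (suc a) l) (λ c′ E len → z c′ E (cong suc (trans len (length-iota (suc a) l)))))
         (spread-pushed (λ c′ E → g c′ (suc a ∷ E)) (suc c) (suc a) l (λ c′ → alternating-tail (suc a) (alt c′))
           (λ c′ E len → alternating-equal (alt c′) (suc a) E (cong suc len))) ⟩
  + 0 ℤ.- negOnePowℕ l ℤ.* g (suc c ℕ.+ l) (iota (suc a) (suc l))
    ≡⟨ trans (ℤₚ.+-identityˡ _) (ℤₚ.neg-distribˡ-* (negOnePowℕ l) _) ⟩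
  (ℤ.- negOnePowℕ l) ℤ.* g (suc c ℕ.+ l) (iota (suc a) (suc l))
    ≡⟨ cong (λ t → (ℤ.- negOnePowℕ l) ℤ.* g t (iota (suc a) (suc l))) (sym (+-suc c l)) ⟩
  negOnePowℕ (suc l) ℤ.* g (c ℕ.+ suc l) (iota (suc a) (suc l)) ∎
  where open ≡.≡-Reasoning

module Staircase (l : ℕ) (g : List ℕ → ℤ) (alt : Alternating (suc l) g) where
  private
    -- The staircase `1, 2, …` after all exponents from `suc i` on have moved; the value `suc i` is
    -- missing.
    hole : ℕ → ℕ → List ℕ
    hole i l′ = iota 1 i ++ iota (suc (suc i)) l′

    length-hole : ∀ i l′ → length (hole i l′) ≡ i ℕ.+ l′
    length-hole i l′ = trans (Listₚ.length-++ (iota 1 i)) (cong₂ ℕ._+_ (length-iota 1 i) (length-iota (suc (suc i)) l′))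

    Full : ℤ
    Full = g (iota 1 (suc l))

  hole-fill : ∀ i l′ → i ℕ.+ l′ ≡ l → g (suc i ∷ hole i l′) ≡ negOnePowℕ i ℤ.* Full
  hole-fill i l′ eq = begin
    g (suc i ∷ iota 1 i ++ iota (suc (suc i)) l′)
      ≡⟨ alternating-move alt (suc i) (iota 1 i) _ (cong suc (trans (length-hole i l′) eq)) ⟩
    negOnePowℕ (length (iota 1 i)) ℤ.* g (iota 1 i ++ iota (suc i) (suc l′))
      ≡⟨ cong₂ (λ s E → negOnePowℕ s ℤ.* g E) (length-iota 1 i) (trans (sym (iota-split 1 i (suc l′))) (cong (iota 1) (trans (+-suc i l′) (cong suc eq)))) ⟩
    negOnePowℕ i ℤ.* Full ∎
    where open ≡.≡-Reasoning

  hole-clash : ∀ i l′ v → i ℕ.+ l′ ≡ l → 1 ≤ v → v ≤ suc l → v ≢ suc i → g (v ∷ hole i l′) ≡ + 0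
  hole-clash i l′ v eq 1≤v v≤ v≢ with v ℕₚ.≤? i
  ... | yes v≤i with iota-at 1 i v 1≤v (s≤s v≤i)
  ...   | post , p = trans (cong (λ t → g (v ∷ t)) reshape)
          (alternating-repeat alt v (iota 1 (v ∸ 1)) _ (cong suc (trans (cong length (sym reshape)) (trans (length-hole i l′) eq))))
          where
          reshape : hole i l′ ≡ iota 1 (v ∸ 1) ++ v ∷ (post ++ iota (suc (suc i)) l′)
          reshape = trans (cong (_++ iota (suc (suc i)) l′) p) (Listₚ.++-assoc (iota 1 (v ∸ 1)) (v ∷ post) _)
  hole-clash i l′ v eq 1≤v v≤ v≢ | no v≰i with iota-at (suc (suc i)) l′ v (≤∧≢⇒< (≰⇒> v≰i) (v≢ ∘ sym)) (s≤s (subst (v ≤_) (cong suc (sym eq)) v≤))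
  ...   | post , p = trans (cong (λ t → g (v ∷ t)) reshape)
          (alternating-repeat alt v (iota 1 i ++ iota (suc (suc i)) (v ∸ suc (suc i))) post (cong suc (trans (cong length (sym reshape)) (trans (length-hole i l′) eq))))
          where
          reshape : hole i l′ ≡ (iota 1 i ++ iota (suc (suc i)) (v ∸ suc (suc i))) ++ v ∷ post
          reshape = trans (cong (iota 1 i ++_) p) (sym (Listₚ.++-assoc (iota 1 i) _ (v ∷ post)))

  -- The first `i` exponents stay and the other `l - i` move. One of their `l - i` signs is the
  -- minus sign in front of the sum in `spread-sum`.
  term : ℕ → ℕ → ℤ
  term c i = negOnePowℕ (l ∸ suc i) ℤ.* g ((c ℕ.+ (l ∸ i)) ∷ hole i (l ∸ i))

  spread-sum : ∀ c i l′ → i ℕ.+ l′ ≡ l → spread (λ c′ E → g (c′ ∷ iota 1 i ++ E)) c (iota (suc i) l′) ≡ g (c ∷ iota 1 l) ℤ.- sumr i l′ (term c)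
  spread-sum c i zero eq = trans (cong (λ t → g (c ∷ t)) (trans (Listₚ.++-identityʳ (iota 1 i)) (cong (iota 1) (trans (sym (ℕₚ.+-identityʳ i)) eq))))
    (sym (ℤₚ.+-identityʳ _))
  spread-sum c i (suc l′) eq = begin
    spread (λ c′ E → g (c′ ∷ iota 1 i ++ suc i ∷ E)) c (iota (suc (suc i)) l′) ℤ.- spread (λ c′ E → g (c′ ∷ iota 1 i ++ suc (suc i) ∷ E)) (suc c) (iota (suc (suc i)) l′)
      ≡⟨ cong₂ ℤ._-_
           (trans (spread-cong c (iota (suc (suc i)) l′) (λ c′ E _ → cong (λ t → g (c′ ∷ t)) (trans (sym (Listₚ.++-assoc (iota 1 i) (suc i ∷ []) E)) (cong (_++ E) (snoc i)))))
             (spread-sum c (suc i) l′ (trans (sym (+-suc i l′)) eq)))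
           pushed ⟩
    g (c ∷ iota 1 l) ℤ.- sumr (suc i) l′ (term c) ℤ.- term c i
      ≡⟨ trans (ℤₚ.+-assoc (g (c ∷ iota 1 l)) _ _) (cong (ℤ._+_ (g (c ∷ iota 1 l))) (trans (sym (ℤₚ.neg-distrib-+ (sumr (suc i) l′ (term c)) (term c i))) (cong ℤ.-_ (ℤₚ.+-comm _ (term c i))))) ⟩
    g (c ∷ iota 1 l) ℤ.- sumr i (suc l′) (term c) ∎
    where
    open ≡.≡-Reasoning
    snoc : ∀ i → iota 1 i ++ suc i ∷ [] ≡ iota 1 (suc i)
    snoc i = trans (sym (iota-split 1 i 1)) (cong (iota 1) (ℕₚ.+-comm i 1))
    l∸i : l ∸ i ≡ suc l′
    l∸i = trans (cong (_∸ i) (sym eq)) (m+n∸m≡n i (suc l′))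
    l∸si : l ∸ suc i ≡ l′
    l∸si = trans (cong (_∸ suc i) (trans (sym eq) (+-suc i l′))) (m+n∸m≡n (suc i) l′)
    alt-after : ∀ c → Alternating l′ (λ E → g (c ∷ iota 1 i ++ suc (suc i) ∷ E))
    alt-after c = alternating λ pre a b post len → let assoc = after-assoc pre in trans (cong (λ t → g (c ∷ t)) (assoc (a ∷ b ∷ post)))
      (trans (swap alt (c ∷ iota 1 i ++ suc (suc i) ∷ pre) a b post
        (cong suc (trans (cong length (sym (assoc (a ∷ b ∷ post)))) (trans (Listₚ.length-++ (iota 1 i)) (trans (cong₂ (λ x y → x ℕ.+ suc y) (length-iota 1 i) len) eq)))))
        (cong (λ t → ℤ.- g (c ∷ t)) (sym (assoc (b ∷ a ∷ post)))))
      where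
      after-assoc : ∀ pre E → iota 1 i ++ suc (suc i) ∷ (pre ++ E) ≡ (iota 1 i ++ suc (suc i) ∷ pre) ++ E
      after-assoc pre E = sym (Listₚ.++-assoc (iota 1 i) (suc (suc i) ∷ pre) E)
    pushed : spread (λ c′ E → g (c′ ∷ iota 1 i ++ suc (suc i) ∷ E)) (suc c) (iota (suc (suc i)) l′) ≡ term c i
    pushed = begin
      spread (λ c′ E → g (c′ ∷ iota 1 i ++ suc (suc i) ∷ E)) (suc c) (iota (suc (suc i)) l′)
        ≡⟨ spread-pushed (λ c′ E → g (c′ ∷ iota 1 i ++ suc (suc i) ∷ E)) (suc c) (suc (suc i)) l′ alt-after
             (λ c′ E len → ≡-neg⇒≡0 _ (swap alt (c′ ∷ iota 1 i) (suc (suc i)) (suc (suc i)) E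
               (cong suc (trans (Listₚ.length-++ (iota 1 i)) (trans (cong₂ (λ x y → x ℕ.+ suc y) (length-iota 1 i) len) eq))))) ⟩
      negOnePowℕ l′ ℤ.* g ((suc c ℕ.+ l′) ∷ iota 1 i ++ iota (suc (suc i)) (suc l′))
        ≡⟨ cong₂ (λ s t → negOnePowℕ s ℤ.* g (t ∷ iota 1 i ++ iota (suc (suc i)) (suc l′))) (sym l∸si) (trans (sym (+-suc c l′)) (cong (c ℕ.+_) (sym l∸i))) ⟩
      negOnePowℕ (l ∸ suc i) ℤ.* g ((c ℕ.+ (l ∸ i)) ∷ iota 1 i ++ iota (suc (suc i)) (suc l′))
        ≡⟨ cong (λ t → negOnePowℕ (l ∸ suc i) ℤ.* g ((c ℕ.+ (l ∸ i)) ∷ hole i t)) (sym l∸i) ⟩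
      term c i ∎

  -- For `c ≤ 1` the exponent of `z` lies between 1 and `suc l`, where `suc i` is the only value
  -- that is not already taken. It equals `suc i` just if `c + l = 2 i + 1`.
  term-clash : ∀ c i → c ≤ 1 → i < l → c ℕ.+ l ≢ suc (i ℕ.+ i) → term c i ≡ + 0
  term-clash c i c≤1 i<l ne = trans (cong (ℤ._*_ (negOnePowℕ (l ∸ suc i))) (hole-clash i (l ∸ i) (c ℕ.+ (l ∸ i)) (m+[n∸m]≡n (<⇒≤ i<l))
      (≤-trans (m<n⇒0<n∸m i<l) (m≤n+m (l ∸ i) c)) (+-mono-≤ c≤1 (m∸n≤m l i))
      (λ eq → ne (trans (cong (c ℕ.+_) (sym (m∸n+n≡m (<⇒≤ i<l)))) (trans (sym (ℕₚ.+-assoc c (l ∸ i) i)) (cong (ℕ._+ i) eq))))))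
    (ℤₚ.*-zeroʳ (negOnePowℕ (l ∸ suc i)))

  -- Moving `z` into the hole takes `i` exchanges, so the total sign is that of `l - 1`, whatever
  -- `i` is.
  term-match : ∀ c i → i < l → c ℕ.+ l ≡ suc (i ℕ.+ i) → term c i ≡ negOnePowℕ (l ∸ 1) ℤ.* Full
  term-match c i i<l eq = begin
    negOnePowℕ (l ∸ suc i) ℤ.* g ((c ℕ.+ (l ∸ i)) ∷ hole i (l ∸ i))
      ≡⟨ cong (λ v → negOnePowℕ (l ∸ suc i) ℤ.* g (v ∷ hole i (l ∸ i))) v≡ ⟩
    negOnePowℕ (l ∸ suc i) ℤ.* g (suc i ∷ hole i (l ∸ i))
      ≡⟨ cong (ℤ._*_ (negOnePowℕ (l ∸ suc i))) (hole-fill i (l ∸ i) (m+[n∸m]≡n (<⇒≤ i<l))) ⟩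
    negOnePowℕ (l ∸ suc i) ℤ.* (negOnePowℕ i ℤ.* Full)
      ≡⟨ sym (ℤₚ.*-assoc (negOnePowℕ (l ∸ suc i)) (negOnePowℕ i) Full) ⟩
    negOnePowℕ (l ∸ suc i) ℤ.* negOnePowℕ i ℤ.* Full
      ≡⟨ cong (ℤ._* Full) (trans (sym (negOnePowℕ-+ (l ∸ suc i) i)) (cong negOnePowℕ sum)) ⟩
    negOnePowℕ (l ∸ 1) ℤ.* Full ∎
    where
    open ≡.≡-Reasoning
    v≡ : c ℕ.+ (l ∸ i) ≡ suc i
    v≡ = +-cancelʳ-≡ i _ _ (trans (ℕₚ.+-assoc c (l ∸ i) i) (trans (cong (c ℕ.+_) (m∸n+n≡m (<⇒≤ i<l))) eq))
    sum : l ∸ suc i ℕ.+ i ≡ l ∸ 1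
    sum = trans (cong (ℕ._+ i) (sym (∸-+-assoc l 1 i))) (m∸n+n≡m (∸-monoˡ-≤ 1 i<l))

sumr-single : ∀ a l f h → a ≤ h → h < a ℕ.+ l → (∀ i → a ≤ i → i < a ℕ.+ l → i ≢ h → f i ≡ + 0) → sumr a l f ≡ f h
sumr-single a zero    f h a≤h h<b p = ⊥-elim (<⇒≱ (subst (h <_) (ℕₚ.+-identityʳ a) h<b) a≤h)
sumr-single a (suc l) f h a≤h h<b p with a ℕ.≟ h
... | yes refl = trans (cong (ℤ._+_ (f a)) (sumr-zero (suc a) l (λ i a<i i<b → p i (<⇒≤ a<i) (subst (i <_) (sym (+-suc a l)) i<b) (λ { refl → <-irrefl refl a<i })))) (ℤₚ.+-identityʳ _)
... | no a≢h = trans (cong₂ ℤ._+_ (p a ≤-refl (m<m+n a (s≤s z≤n)) a≢h)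
    (sumr-single (suc a) l f h (≤∧≢⇒< a≤h a≢h) (subst (h <_) (+-suc a l) h<b) (λ i a<i i<b → p i (<⇒≤ a<i) (subst (i <_) (sym (+-suc a l)) i<b))))
  (ℤₚ.+-identityˡ _)

half : ∀ l → Σ ℕ λ h → l ≡ h ℕ.+ h ⊎ l ≡ suc (h ℕ.+ h)
half zero    = 0 , inj₁ refl
half (suc l) with half l
... | h , inj₁ p = h , inj₂ (cong suc p)
... | h , inj₂ p = suc h , inj₁ (cong suc (trans p (sym (+-suc h h))))

double-injective : ∀ a b → a ℕ.+ a ≡ b ℕ.+ b → a ≡ b
double-injective zero    zero    _  = refl
double-injective (suc a) (suc b) eq = cong suc (double-injective a b
  (suc-injective (suc-injective (trans (cong suc (sym (+-suc a a))) (trans eq (cong suc (+-suc b b)))))))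

even≢odd : ∀ a b → a ℕ.+ a ≢ suc (b ℕ.+ b)
even≢odd (suc a) zero    eq = 1+n≢0 (trans (sym (+-suc a a)) (suc-injective eq))
even≢odd (suc a) (suc b) eq = even≢odd a b (suc-injective (suc-injective (trans (cong suc (sym (+-suc a a))) (trans eq (cong (suc ∘ suc) (+-suc b b))))))

-- (1 - z) ∏ (1 - z zⱼ) acts on the staircase monomial z⁰ z₁¹ ⋯ z_l^l as 1 - z z₁ ⋯ z_l:
-- of all other terms at most one has distinct exponents, and whether it stems from 1 or from - z depends on the parity of l.
staircase : ∀ l (g : List ℕ → ℤ) → Alternating (suc l) g →
  spread (λ c E → g (c ∷ E)) 0 (iota 1 l) ℤ.- spread (λ c E → g (c ∷ E)) 1 (iota 1 l) ≡ g (iota 0 (suc l)) ℤ.- g (iota 1 (suc l))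
staircase zero    g alt = refl
staircase (suc l) g alt with half l
-- Here `L = 2 h + 1`: for `c = 0` only `i = h` solves `c + L = 2 i + 1`, and for `c = 1` there is
-- no solution.
... | h , inj₁ refl = begin
  spread (λ c E → g (c ∷ E)) 0 (iota 1 L) ℤ.- spread (λ c E → g (c ∷ E)) 1 (iota 1 L)
    ≡⟨ cong₂ ℤ._-_ (spread-sum 0 0 L refl) (spread-sum 1 0 L refl) ⟩
  (g (0 ∷ iota 1 L) ℤ.- sumr 0 L (term 0)) ℤ.- (g (1 ∷ iota 1 L) ℤ.- sumr 0 L (term 1))
    ≡⟨ cong₂ ℤ._-_ (cong (ℤ._-_ (g (0 ∷ iota 1 L)))
         (trans (sumr-single 0 L (term 0) h z≤n (s≤s (m≤m+n h h)) (λ i _ i<L i≢h → term-clash 0 i z≤n i<L (λ eq → i≢h (double-injective i h (suc-injective (sym eq))))))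
           (trans (term-match 0 h (s≤s (m≤m+n h h)) refl) (trans (cong (ℤ._* g (iota 1 (suc L))) (negOnePowℕ-double h)) (ℤₚ.*-identityˡ _)))))
         (cong₂ ℤ._-_ (alternating-equal alt 1 (iota 2 l) (cong (suc ∘ suc) (length-iota 2 l)))
           (sumr-zero 0 L (λ i _ i<L → term-clash 1 i ≤-refl i<L (λ eq → even≢odd i h (sym (suc-injective eq)))))) ⟩
  (g (0 ∷ iota 1 L) ℤ.- g (iota 1 (suc L))) ℤ.- (+ 0 ℤ.- + 0)
    ≡⟨ ℤₚ.+-identityʳ _ ⟩
  g (0 ∷ iota 1 L) ℤ.- g (iota 1 (suc L)) ∎
  where
  open ≡.≡-Reasoning
  L = suc l
  open Staircase L g alt
-- Here `L = 2 h + 2`: there is no solution for `c = 0`, and `i = h + 1` is the only one for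
-- `c = 1`.
... | h , inj₂ refl = begin
  spread (λ c E → g (c ∷ E)) 0 (iota 1 L) ℤ.- spread (λ c E → g (c ∷ E)) 1 (iota 1 L)
    ≡⟨ cong₂ ℤ._-_ (spread-sum 0 0 L refl) (spread-sum 1 0 L refl) ⟩
  (g (0 ∷ iota 1 L) ℤ.- sumr 0 L (term 0)) ℤ.- (g (1 ∷ iota 1 L) ℤ.- sumr 0 L (term 1))
    ≡⟨ cong₂ ℤ._-_ (cong (ℤ._-_ (g (0 ∷ iota 1 L)))
           (sumr-zero 0 L (λ i _ i<L → term-clash 0 i z≤n i<L (λ eq → even≢odd i h (sym (suc-injective eq))))))
         (cong₂ ℤ._-_ (alternating-equal alt 1 (iota 2 l) (cong (suc ∘ suc) (length-iota 2 l)))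
           (trans (sumr-single 0 L (term 1) (suc h) z≤n h<L (λ i _ i<L i≢h → term-clash 1 i ≤-refl i<L (λ eq → i≢h (double-injective i (suc h) (trans (suc-injective (sym eq)) (cong suc (sym (+-suc h h))))))))
             (trans (term-match 1 (suc h) h<L (cong (suc ∘ suc) (sym (+-suc h h)))) (cong (ℤ._* g (iota 1 (suc L))) (cong ℤ.-_ (negOnePowℕ-double h)))))) ⟩
  (g (0 ∷ iota 1 L) ℤ.- + 0) ℤ.- (+ 0 ℤ.- (ℤ.- + 1) ℤ.* g (iota 1 (suc L)))
    ≡⟨ cong₂ ℤ._-_ {x = g (0 ∷ iota 1 L) ℤ.- + 0} (ℤₚ.+-identityʳ (g (0 ∷ iota 1 L))) (trans (ℤₚ.+-identityˡ _) (trans (cong ℤ.-_ (ℤₚ.-1*i≡-i (g (iota 1 (suc L))))) (ℤₚ.neg-involutive _))) ⟩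
  g (0 ∷ iota 1 L) ℤ.- g (iota 1 (suc L)) ∎
  where
  open ≡.≡-Reasoning
  L = suc l
  open Staircase L g alt
  h<L : suc h < L
  h<L = s≤s (s≤s (m≤m+n h h))

-- The cut-off `U` makes the sum over weakly increasing rows finite. With `U = suc C` nothing is
-- lost, since `κ` annihilates all powers above `C`.
msum : ℕ → ℕ → ℕ → (List ℕ → ℤ) → ℤ
msum U zero    x F = F []
msum U (suc l) x F = sumr x (U ∸ x) (λ a → msum U l a (F ∘ (a ∷_)))

msum-cong : ∀ U l x {F G} → (∀ as → length as ≡ l → F as ≡ G as) → msum U l x F ≡ msum U l x G
msum-cong U zero    x p = p [] refl
msum-cong U (suc l) x p = sumr-cong x (U ∸ x) (λ a _ _ → msum-cong U l a (λ as len → p (a ∷ as) (cong suc len)))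

module Littlewood {n C : ℕ} (S : Setting n C) where
  open Setting S
  open RingKit series
  open Products series
  open Telescoping S

  pmon : ℕ → List ℕ → Carrier
  pmon p []       = 1#
  pmon p (e ∷ es) = X p ^ e * pmon (suc p) es

  fix-pmon : ∀ {s} p es → Swap s → suc s < p → Fix s (pmon p es)
  fix-pmon p []       sw s<p = fix-1
  fix-pmon p (e ∷ es) sw s<p = fix-*
    (fix-^ e (fix-X p sw (λ { refl → <-irrefl refl (<-trans (n<1+n _) s<p) }) (λ { refl → <-irrefl refl s<p })))
    (fix-pmon (suc p) es sw (<-trans s<p (n<1+n p)))

  σ-pmon : ∀ s p pre a b post → s ≡ p ℕ.+ length pre → Swap s → σ s (pmon p (pre ++ a ∷ b ∷ post)) ≈ pmon p (pre ++ b ∷ a ∷ post)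
  σ-pmon s p [] a b post eq sw@(lo , hi) = begin
    σ s (X p ^ a * (X (suc p) ^ b * pmon (suc (suc p)) post))
      ≈⟨ ≈-trans (σ-* s _ _) (*-cong (σ-^ s (X p) a) (≈-trans (σ-* s _ _) (*-cong (σ-^ s (X (suc p)) b)
           (fix-pmon (suc (suc p)) post sw (subst (λ t → suc t < suc (suc p)) (sym p≡s) ≤-refl))))) ⟩
    σ s (X p) ^ a * (σ s (X (suc p)) ^ b * pmon (suc (suc p)) post)
      ≈⟨ *-cong (^-cong a (≈-trans (σ-X s p lo hi) (reflexive (cong X (trans (cong (λ t → τ t p) p≡s) (τ-left p))))))
           (*-congʳ (^-cong b (≈-trans (σ-X s (suc p) lo hi) (reflexive (cong X (trans (cong (λ t → τ t (suc p)) p≡s) (τ-right p))))))) ⟩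
    X (suc p) ^ a * (X p ^ b * pmon (suc (suc p)) post)
      ≈⟨ solve 3 (λ x y z → x :* (y :* z) := y :* (x :* z)) ≈-refl _ _ _ ⟩
    X p ^ b * (X (suc p) ^ a * pmon (suc (suc p)) post) ∎
    where
    p≡s : s ≡ p
    p≡s = trans eq (ℕₚ.+-identityʳ p)
  σ-pmon s p (x ∷ pre) a b post eq sw = ≈-trans (σ-* s _ _) (*-cong
    (fix-^ x (fix-X p sw (λ { refl → <-irrefl refl p<s }) (λ { refl → <-irrefl refl (<-trans (n<1+n s) p<s) })))
    (σ-pmon s (suc p) pre a b post eq′ sw))
    where
    eq′ : s ≡ suc p ℕ.+ length pre
    eq′ = trans eq (+-suc p (length pre))
    p<s : p < s
    p<s = subst (p <_) (sym eq′) (s≤s (m≤m+n p (length pre)))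

  Swappable : ℕ → Carrier → Carrier → Set
  Swappable p c G = ∀ s → p ≤ s → s < n → Swap s × Fix s c × Anti s G

  factor : ℕ → ℕ → Carrier
  factor p j = 1# - X p * X j

  module _ (p l : ℕ) (n≡ : p ℕ.+ l ≡ n) (c G : Carrier) (h : Swappable p c G) where
    private
      coefficient : List ℕ → ℤ
      coefficient es = κ (c * (pmon p es * G))

      alternates : Alternating (suc l) coefficient
      alternates = alternating λ pre a b post len →
        let s   = p ℕ.+ length pre
            s<n = subst (s <_) n≡ (+-monoʳ-< p (≤-pred (subst (suc (suc (length pre)) ≤_) len
                    (subst (suc (suc (length pre)) ≤_) (sym (Listₚ.length-++ pre)) (short (length pre) (length post))))))
            sw , fc , an = h s (m≤m+n p _) s<n
        in trans (κ-cong (≈-sym (*-assoc c _ G)))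
          (trans (κ-swap s _ G sw an) (cong ℤ.-_ (κ-cong (≈-trans (*-congʳ (≈-trans (σ-* s c _) (*-cong fc (σ-pmon s p pre a b post refl sw)))) (*-assoc c _ G)))))
        where
        short : ∀ a b → suc (suc a) ≤ a ℕ.+ suc (suc b)
        short a b = subst (suc (suc a) ≤_) (sym (trans (+-suc a (suc b)) (cong suc (+-suc a b)))) (s≤s (s≤s (m≤m+n a b)))

      spread-κ : ∀ ds s e A → κ (A * (X p ^ e * (pmon s ds * Π s (length ds) (factor p)) * G)) ≡ spread (λ e′ E → κ (A * (X p ^ e′ * pmon s E * G))) e ds
      spread-κ []       s e A = κ-cong (*-congˡ (*-congʳ (*-congˡ (*-identityˡ 1#))))
      spread-κ (d ∷ ds) s e A = trans
        (κ-cong (solve 8 (λ a x z y m f t g → a :* (z :* (y :* m :* ((con (+ 1) :- x :* t) :* f)) :* g)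
            := (a :* y) :* (z :* (m :* f) :* g) :- (a :* (t :* y)) :* (x :* z :* (m :* f) :* g)) ≈-refl
          A (X p) (X p ^ e) (X s ^ d) (pmon (suc s) ds) (Π (suc s) (length ds) (factor p)) (X s) G))
        (trans (κ-- _ _) (cong₂ ℤ._-_
          (trans (spread-κ ds (suc s) e (A * X s ^ d)) (spread-cong e ds (λ e′ E _ → κ-cong (move A (X s ^ d) (X p ^ e′) (pmon (suc s) E)))))
          (trans (spread-κ ds (suc s) (suc e) (A * X s ^ suc d)) (spread-cong (suc e) ds (λ e′ E _ → κ-cong (move A (X s ^ suc d) (X p ^ e′) (pmon (suc s) E)))))))
        where
        move : ∀ a y z m → (a * y) * (z * m * G) ≈ a * (z * (y * m) * G)
        move a y z m = solve* 5 (λ a y z m g → (a ⊗ y) ⊗ (z ⊗ m ⊗ g) ⊜ a ⊗ (z ⊗ (y ⊗ m) ⊗ g)) ≈-refl a y z m G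

    -- Next to the antisymmetric `G`, the value of `κ` alternates in the exponents of the monomial,
    -- so the staircase identity applies to it.
    staircase-κ : κ (c * (pmon p (iota 0 (suc l)) * ((1# - X p) * Π (suc p) l (factor p)) * G))
      ≡ κ (c * (pmon p (iota 0 (suc l)) * G)) ℤ.- κ (c * (pmon p (iota 1 (suc l)) * G))
    staircase-κ = trans
      (κ-cong (solve 5 (λ c x m f g → c :* (con (+ 1) :* m :* ((con (+ 1) :- x) :* f) :* g)
         := c :* (con (+ 1) :* (m :* f) :* g) :- c :* (x :* con (+ 1) :* (m :* f) :* g)) ≈-refl c (X p) (pmon (suc p) E₁) (Π (suc p) l (factor p)) G))
      (trans (κ-- _ _) (trans (cong₂ ℤ._-_ (expand 0) (expand 1)) (staircase l coefficient alternates)))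
      where
      E₁ = iota 1 l
      expand : ∀ e → κ (c * (X p ^ e * (pmon (suc p) E₁ * Π (suc p) l (factor p)) * G)) ≡ spread (λ e′ E → coefficient (e′ ∷ E)) e E₁
      expand e = trans (cong (λ t → κ (c * (X p ^ e * (pmon (suc p) E₁ * Π (suc p) t (factor p)) * G))) (sym (length-iota 1 l)))
        (spread-κ E₁ (suc p) e c)

  Π-pmon : ∀ s l t e x → t ℕ.+ e ≡ x ℕ.+ s → Π s l (λ i → X i ^ t) * pmon s (iota e l) ≈ Π s l (λ i → X i ^ (x ℕ.+ i))
  Π-pmon s zero    t e x eq = *-identityˡ _
  Π-pmon s (suc l) t e x eq = ≈-trans
    (solve 4 (λ a b c d → a :* b :* (c :* d) := a :* c :* (b :* d)) ≈-refl (X s ^ t) (Π (suc s) l (λ i → X i ^ t)) (X s ^ e) (pmon (suc s) (iota (suc e) l)))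
    (*-cong (≈-trans (≈-sym (^-+ (X s) t e)) (reflexive (cong (X s ^_) eq)))
      (Π-pmon (suc s) l t (suc e) x (trans (+-suc t e) (trans (cong suc eq) (sym (+-suc x s))))))

  -- By the Littlewood identity, W p l x is up to antisymmetrisation the sum of X p ^ (a₁ + p) X (p + 1) ^ (a₂ + p + 1) ⋯ over x ≤ a₁ ≤ a₂ ≤ ….
  Sym : ℕ → ℕ → Carrier
  Sym p l = Π p l I * pairsΠ p l g

  W : ℕ → ℕ → ℕ → Carrier
  W p l x = Π p l (λ i → X i ^ (x ℕ.+ i)) * Sym p l

  fix-Sym : ∀ s p l → Swap s → p ≤ s → suc s < p ℕ.+ l → Fix s (Sym p l)
  fix-Sym s p l sw p≤s s<b = fix-*
    (fix-Π-in p l I (λ i _ → σ-I s i sw) p≤s s<b)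
    (≈-trans (σ-pairsΠ-in 1# p l g (λ i j → σ-g s i j sw) (λ i j i≢j → ≈-trans (g-sym i j i≢j) (≈-sym (*-identityˡ _))) p≤s s<b) (*-identityˡ _))

  Sym-peel : ∀ p l → (1# - X p) * Π (suc p) l (factor p) * Sym p (suc l) ≈ Sym (suc p) l
  Sym-peel p l = begin
    (1# - X p) * Π (suc p) l (factor p) * (I p * Π (suc p) l I * (Π (suc p) l (g p) * pairsΠ (suc p) l g))
      ≈⟨ solve* 6 (λ o f i j y z → o ⊗ f ⊗ (i ⊗ j ⊗ (y ⊗ z)) ⊜ (o ⊗ i) ⊗ (f ⊗ y) ⊗ (j ⊗ z)) ≈-refl
           (1# - X p) (Π (suc p) l (factor p)) (I p) (Π (suc p) l I) (Π (suc p) l (g p)) (pairsΠ (suc p) l g) ⟩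
    ((1# - X p) * I p) * (Π (suc p) l (factor p) * Π (suc p) l (g p)) * Sym (suc p) l
      ≈⟨ *-congʳ (*-cong (X-inverse p) (≈-trans (≈-sym (Π-* (suc p) l (factor p) (g p)))
           (≈-trans (Π-cong (suc p) l (λ j p<j _ → XX-inverse p j (λ { refl → <-irrefl refl p<j }))) (Π-1 (suc p) l)))) ⟩
    1# * 1# * Sym (suc p) l
      ≈⟨ solve 1 (λ x → con (+ 1) :* con (+ 1) :* x := x) ≈-refl _ ⟩
    Sym (suc p) l ∎

  W-peel : ∀ p l x → (1# - X p) * Π (suc p) l (factor p) * W p (suc l) x ≈ X p ^ (x ℕ.+ p) * W (suc p) l x
  W-peel p l x = ≈-trans (solve 4 (λ a y z s → a :* (y :* z :* s) := y :* (z :* (a :* s))) ≈-refl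
      ((1# - X p) * Π (suc p) l (factor p)) (X p ^ (x ℕ.+ p)) (Π (suc p) l (λ i → X i ^ (x ℕ.+ i))) (Sym p (suc l)))
    (*-congˡ (*-congˡ (Sym-peel p l)))

  W-raise : ∀ p l x → Π p l X * W p l x ≈ W p l (suc x)
  W-raise p l x = ≈-trans (≈-sym (*-assoc _ _ _)) (*-congʳ (≈-sym (Π-* p l X _)))

  module _ (G : Carrier) where

    -- Modulo symmetric contributions, `(1 - X p) ∏ (1 - X p X j)` acts as `1 - X p ⋯ X (p + l)`. On
    -- `W p (suc l) x` the former cancels all denominators with `X p`, and the latter gives the
    -- difference of the values at `x` and `suc x`. The two summands are the rows with `a₁ = x` and
    -- those with `a₁ > x`.
    W-step : ∀ p l c x → p ℕ.+ l ≡ n → 1 ≤ p → Swappable p c G →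
      κ (c * (W p (suc l) x * G)) ≡ κ (c * X p ^ (x ℕ.+ p) * (W (suc p) l x * G)) ℤ.+ κ (c * (W p (suc l) (suc x) * G))
    W-step p l c x n≡ 1≤p h = recombine _ _ _ (trans (sym peel) (trans (staircase-κ p l n≡ c Ĝ swappable)
      (cong₂ ℤ._-_ (absorb 0 x (ℕₚ.+-identityʳ t)) (absorb 1 (suc x) (ℕₚ.+-comm t 1)))))
      where
      t = x ℕ.+ p
      K = suc l
      -- The common power `t = x + p` is symmetric and joins `Ĝ`; the exponents that remain of
      -- `x + i` form the staircase `0, 1, …, l`.
      Πt = Π p K (λ i → X i ^ t)
      Ĝ = Πt * Sym p K * G
      swappable : Swappable p c Ĝ
      swappable s p≤s s<n = sw , proj₁ (proj₂ (h s p≤s s<n)) , anti-*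
          (fix-* (fix-Π-in p K _ (λ i _ → ≈-trans (σ-^ s (X i) t) (^-cong t (σ-X s i (proj₁ sw) s<n))) p≤s s<b) (fix-Sym s p K sw p≤s s<b))
          (proj₂ (proj₂ (h s p≤s s<n)))
        where
        sw = proj₁ (h s p≤s s<n)
        s<b : suc s < p ℕ.+ K
        s<b = subst (suc s <_) (trans (cong suc (sym n≡)) (sym (+-suc p l))) (s≤s s<n)
      absorb : ∀ e y → t ℕ.+ e ≡ y ℕ.+ p → κ (c * (pmon p (iota e K) * Ĝ)) ≡ κ (c * (W p K y * G))
      absorb e y eq = κ-cong (*-congˡ (≈-trans (solve 4 (λ m t s g → m :* (t :* s :* g) := (t :* m) :* s :* g) ≈-refl (pmon p (iota e K)) Πt (Sym p K) G)
        (*-congʳ (*-congʳ (Π-pmon p K t e y eq)))))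
      peel : κ (c * (pmon p (iota 0 K) * ((1# - X p) * Π (suc p) l (factor p)) * Ĝ)) ≡ κ (c * X p ^ t * (W (suc p) l x * G))
      peel = κ-cong (≈-trans (*-congˡ (≈-trans
          (solve 5 (λ m f t s g → m :* f :* (t :* s :* g) := f :* ((t :* m) :* s) :* g) ≈-refl (pmon p (iota 0 K)) ((1# - X p) * Π (suc p) l (factor p)) Πt (Sym p K) G)
          (*-congʳ (≈-trans (*-congˡ (*-congʳ (Π-pmon p K t 0 x (ℕₚ.+-identityʳ t)))) (W-peel p l x)))))
        (solve 4 (λ c y w g → c :* (y :* w :* g) := c :* y :* (w :* g)) ≈-refl c (X p ^ t) (W (suc p) l x) G))
      recombine : ∀ a b d → a ≡ b ℤ.- d → b ≡ a ℤ.+ d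
      recombine a b d refl = sym (trans (ℤₚ.+-assoc b (ℤ.- d) d) (trans (cong (ℤ._+_ b) (ℤₚ.+-inverseˡ d)) (ℤₚ.+-identityʳ b)))

    W-large : ∀ p l c x → 1 ≤ p → p ≤ n → suc C ≤ x → κ (c * (W p (suc l) x * G)) ≡ + 0
    W-large p l c x 1≤p p≤n C<x = trans (κ-cong (≈-trans
        (*-congˡ (*-congʳ (*-congʳ (*-congʳ (≈-trans (reflexive (cong (X p ^_) (sym (m+[n∸m]≡n C<)))) (^-+ (X p) (suc C) _))))))
        (solve* 6 (λ c y z r s g → c ⊗ (y ⊗ z ⊗ r ⊗ s ⊗ g) ⊜ y ⊗ (c ⊗ (z ⊗ r ⊗ s ⊗ g))) ≈-refl c (X p ^ suc C) (X p ^ (x ℕ.+ p ∸ suc C)) _ (Sym p (suc l)) G)))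
      (κ-X p _ 1≤p p≤n)
      where
      C< : suc C ≤ x ℕ.+ p
      C< = ≤-trans C<x (m≤m+n x p)

    -- Iterating `W-step` raises `x` until what remains is a multiple of `X p ^ suc C`; `B` is the
    -- number of iterations.
    W-sum : ∀ B p l c x → p ℕ.+ l ≡ n → 1 ≤ p → Swappable p c G → suc C ≤ x ℕ.+ B →
      κ (c * (W p (suc l) x * G)) ≡ sumr x B (λ a → κ (c * X p ^ (a ℕ.+ p) * (W (suc p) l a * G)))
    W-sum zero    p l c x n≡ 1≤p h C< = W-large p l c x 1≤p (subst (p ≤_) n≡ (m≤m+n p l)) (subst (suc C ≤_) (ℕₚ.+-identityʳ x) C<)
    W-sum (suc B) p l c x n≡ 1≤p h C< = trans (W-step p l c x n≡ 1≤p h)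
      (cong (ℤ._+_ (κ (c * X p ^ (x ℕ.+ p) * (W (suc p) l x * G)))) (W-sum B p l c (suc x) n≡ 1≤p h (subst (suc C ≤_) (+-suc x B) C<)))

    littlewood : ∀ l p c x → p ℕ.+ l ≡ suc n → 1 ≤ p → Swappable p c G →
      κ (c * (W p l x * G)) ≡ msum (suc C) l x (λ as → κ (c * (mon p as * G)))
    littlewood zero    p c x n≡ 1≤p h = κ-cong (*-congˡ (*-congʳ (solve 0 (con (+ 1) :* (con (+ 1) :* con (+ 1)) := con (+ 1)) ≈-refl)))
    littlewood (suc l) p c x n≡ 1≤p h = trans (W-sum (suc C ∸ x) p l c x n≡′ 1≤p h (m≤n+m∸n (suc C) x))
      (sumr-cong x (suc C ∸ x) (λ a _ _ → trans
        (littlewood l (suc p) (c * X p ^ (a ℕ.+ p)) a (cong suc n≡′) (s≤s z≤n) (λ s p<s s<n →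
          let sw , fc , an = h s (<⇒≤ p<s) s<n
          in sw , fix-* fc (fix-^ (a ℕ.+ p) (fix-X p sw (λ { refl → <-irrefl refl p<s }) (λ { refl → <-irrefl refl (<-trans (n<1+n s) p<s) }))) , an))
        (msum-cong (suc C) l a (λ as _ → κ-cong (solve 4 (λ c y m g → c :* y :* (m :* g) := c :* (y :* m :* g)) ≈-refl c (X p ^ (a ℕ.+ p)) (mon (suc p) as) G)))))
      where
      n≡′ : p ℕ.+ l ≡ n
      n≡′ = suc-injective (trans (sym (+-suc p l)) n≡)

-- The bottom row

module BottomRow (m n k : ℕ) (k<n : suc k ≤ n) (S : Setting n (m ℕ.+ 2 ℕ.* n)) where
  open Setting S
  open RingKit series
  open Products series
  open Vanish m n (suc k) (s≤s z≤n) S public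
  open Littlewood S public using (factor; Sym; W; W-peel; W-raise; littlewood; Swappable)

  q r : ℕ
  q = n ∸ suc k
  r = suc q

  -- The product next to `Q` reduces `W r (suc k) 1` to `X r ^ (1 + r) * W (suc r) k 1`, which are
  -- the rows with least entry 1; the product of the `X i` raises it to `W r (suc k) 2`, which are
  -- all other rows.
  bottomSeries : Carrier
  bottomSeries = Π 1 q (dead n) * ((Q * ((1# - X r) * Π (suc r) k (factor r)) + Π r (suc k) X) * W r (suc k) 1 * (Π 1 n (λ p → I p ^ n) * Tail n 0))

  bottom-row : ∀ A → Coefficient A → κ (A * bottomSeries) ≡ msum (suc C) (suc k) 1 (λ as → κ (A * rowWeight as * Ψ n 0 as))
  bottom-row A cA = E.begin
    κ (A * bottomSeries)
      E.≡⟨ κ-cong (≈-trans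
            (solve 7 (λ a d t f y w g → a :* (d :* ((t :* f :+ y) :* w :* g)) := a :* d :* t :* (f :* w :* g) :+ a :* d :* (y :* w :* g)) ≈-refl
              A (Π 1 q (dead n)) Q ((1# - X r) * Π (suc r) k (factor r)) (Π r (suc k) X) (W r (suc k) 1) G)
            (+-cong (*-congˡ (*-congʳ (W-peel r k 1))) (*-congˡ (*-congʳ (W-raise r (suc k) 1))))) ⟩
    κ (c * Q * (X r ^ suc r * W (suc r) k 1 * G) + c * (W r (suc k) 2 * G))
      E.≡⟨ κ-+ _ _ ⟩
    κ (c * Q * (X r ^ suc r * W (suc r) k 1 * G)) ℤ.+ κ (c * (W r (suc k) 2 * G))
      E.≡⟨ cong₂ ℤ._+_ least (trans (littlewood G (suc k) r c 2 r+k (s≤s z≤n) swappable) others) ⟩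
    row 1 ℤ.+ sumr 2 (C ∸ 1) row
      E.≡⟨ cong (λ t → sumr 1 t row) C≡ ⟩
    msum (suc C) (suc k) 1 (λ as → κ (A * rowWeight as * Ψ n 0 as)) E.∎
    where
    module E = ≡.≡-Reasoning
    G = Π 1 n (λ p → I p ^ n) * Tail n 0
    c = A * Π 1 q (dead n)
    row : ℕ → ℤ
    row a = msum (suc C) k a (λ as → κ (A * weightQ a * Ψ n 0 (a ∷ as)))
    C≡ : suc (C ∸ 1) ≡ C
    C≡ = m+[n∸m]≡n {1} {C} (≤-trans (≤-trans (s≤s z≤n) k<n) (≤-trans (m≤m+n n (n ℕ.+ 0)) (m≤n+m (2 ℕ.* n) m)))
    q+k : q ℕ.+ suc k ≡ n
    q+k = m∸n+n≡m k<n
    r+k : r ℕ.+ suc k ≡ suc n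
    r+k = cong suc q+k
    anti : ∀ s → Swap s → s < n → Anti s G
    anti s sw s<n = anti-* (fix-Π-in 1 n (λ p → I p ^ n) (λ i _ → ≈-trans (σ-^ s (I i) n) (^-cong n (σ-I s i sw))) (proj₁ sw) (s≤s s<n)) (anti-Tail s n 0 sw (s≤s s<n))
    swappable : Swappable r c G
    swappable s r≤s s<n = sw , fix-* (proj₁ cA s s<n) (fix-Π 1 q (dead n) (λ i _ i<r → fix-dead n i sw
        (λ { refl → <⇒≱ i<r r≤s }) (λ { refl → <⇒≱ i<r (≤-trans r≤s (n≤1+n s)) }))) , anti s sw s<n
      where
      sw : Swap s
      sw = ≤-trans (s≤s z≤n) r≤s , s<n
    least : κ (c * Q * (X r ^ suc r * W (suc r) k 1 * G)) ≡ row 1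
    least = trans (κ-cong (solve 4 (λ c y w g → c :* (y :* w :* g) := c :* y :* (w :* g)) ≈-refl (c * Q) (X r ^ suc r) (W (suc r) k 1) G))
      (trans (littlewood G k (suc r) (c * Q * X r ^ suc r) 1 (trans (sym (+-suc r k)) r+k) (s≤s z≤n)
          (λ s r<s s<n → let sw , fc , an = swappable s (<⇒≤ r<s) s<n
            in sw , fix-* (fix-* fc (σ-Q s s<n)) (fix-^ (suc r) (fix-X r sw (λ { refl → <-irrefl refl r<s }) (λ { refl → <-irrefl refl (<-trans (n<1+n s) r<s) }))) , an))
        (msum-cong (suc C) k 1 (λ as _ → κ-cong (solve* 6 (λ a d t y m g → a ⊗ d ⊗ t ⊗ y ⊗ (m ⊗ g) ⊜ a ⊗ t ⊗ (d ⊗ (y ⊗ m) ⊗ g)) ≈-refl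
          A (Π 1 q (dead n)) Q (X r ^ suc r) (mon (suc r) as) G))))
    others : msum (suc C) (suc k) 2 (λ as → κ (c * (mon r as * G))) ≡ sumr 2 (C ∸ 1) row
    others = sumr-cong 2 (C ∸ 1) step
      where
      step : ∀ a → 2 ≤ a → a < 2 ℕ.+ (C ∸ 1) → msum (suc C) k a (λ as → κ (c * (mon r (a ∷ as) * G))) ≡ row a
      step (suc zero)    (s≤s ()) _
      step (suc (suc a)) _        _ = msum-cong (suc C) k (suc (suc a)) (λ as _ → κ-cong
        (solve 4 (λ a d m g → a :* d :* (m :* g) := a :* con (+ 1) :* (d :* m :* g)) ≈-refl A (Π 1 q (dead n)) (mon r (suc (suc a) ∷ as)) G))

-- Sums over arrays

ifℤ : Bool → ℤ → ℤ
ifℤ c z = if c then z else + 0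

sumr-split : ∀ a l l′ f → sumr a (l ℕ.+ l′) f ≡ sumr a l f ℤ.+ sumr (a ℕ.+ l) l′ f
sumr-split a zero    l′ f = trans (cong (λ t → sumr t l′ f) (sym (ℕₚ.+-identityʳ a))) (sym (ℤₚ.+-identityˡ _))
sumr-split a (suc l) l′ f = trans (cong (ℤ._+_ (f a)) (trans (sumr-split (suc a) l l′ f) (cong (λ t → sumr (suc a) l f ℤ.+ sumr t l′ f) (sym (+-suc a l)))))
  (sym (ℤₚ.+-assoc (f a) _ _))

sumr-+ : ∀ a l f g → sumr a l (λ v → f v ℤ.+ g v) ≡ sumr a l f ℤ.+ sumr a l g
sumr-+ a zero    f g = refl
sumr-+ a (suc l) f g = trans (cong (ℤ._+_ (f a ℤ.+ g a)) (sumr-+ (suc a) l f g)) (interchange (f a) (g a) _ _)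
  where
  interchange : ∀ x y z w → (x ℤ.+ y) ℤ.+ (z ℤ.+ w) ≡ (x ℤ.+ z) ℤ.+ (y ℤ.+ w)
  interchange x y z w = trans (ℤₚ.+-assoc x y _) (trans (cong (ℤ._+_ x) (trans (sym (ℤₚ.+-assoc y z w)) (trans (cong (ℤ._+ w) (ℤₚ.+-comm y z)) (ℤₚ.+-assoc z y w))))
    (sym (ℤₚ.+-assoc x z _)))

sumr-extend : ∀ h L L′ → L ≤ L′ → (∀ v → L < v → v ≤ L′ → h v ≡ + 0) → sumr 1 L′ h ≡ sumr 1 L h
sumr-extend h L L′ L≤L′ p = trans (cong (λ t → sumr 1 t h) (sym (m+[n∸m]≡n L≤L′)))
  (trans (sumr-split 1 L (L′ ∸ L) h) (trans (cong (ℤ._+_ (sumr 1 L h))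
    (sumr-zero (suc L) (L′ ∸ L) (λ v L<v v< → p v L<v (≤-pred (subst (v <_) (cong suc (m+[n∸m]≡n L≤L′)) v<))))) (ℤₚ.+-identityʳ _)))

-- Both sides sum f over the same set of indices, up to indices where f vanishes.
sumr-window : ∀ L x l (p : ℕ → Bool) f → 1 ≤ x →
  (∀ v → p v ≡ true → x ≤ v × v < x ℕ.+ l) → (∀ v → x ≤ v → v < x ℕ.+ l → p v ≡ true) →
  (∀ v → p v ≡ true → L < v → f v ≡ + 0) →
  sumr 1 L (λ v → ifℤ (p v) (f v)) ≡ sumr x l f
sumr-window L (suc x) l p f _ to from z = trans reach
  (trans (sumr-split 1 x l h) (trans (cong₂ ℤ._+_ (sumr-zero 1 x (λ v _ v≤x → off v (λ eq → <⇒≱ v≤x (proj₁ (to v eq)))))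
    (sumr-cong (suc x) l (λ v x<v v< → cong (λ c → ifℤ c (f v)) (from v x<v v<)))) (ℤₚ.+-identityˡ _)))
  where
  h = λ v → ifℤ (p v) (f v)
  off : ∀ v → p v ≢ true → h v ≡ + 0
  off v ne with p v
  ... | true  = ⊥-elim (ne refl)
  ... | false = refl
  large : ∀ v → L < v → h v ≡ + 0
  large v L<v with p v in eq
  ... | true  = z v eq L<v
  ... | false = refl
  reach : sumr 1 L h ≡ sumr 1 (x ℕ.+ l) h
  reach with L ℕₚ.≤? x ℕ.+ l
  ... | yes L≤ = sym (sumr-extend h L (x ℕ.+ l) L≤ (λ v L<v _ → large v L<v))
  ... | no L≰  = sumr-extend h (x ℕ.+ l) L (<⇒≤ (≰⇒> L≰)) (λ v <v _ → off v (λ eq → <⇒≱ (proj₂ (to v eq)) <v))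

≤ᵇ-true : ∀ {a b} → a ≤ b → (a ≤ᵇ b) ≡ true
≤ᵇ-true {a} {b} p with a ≤ᵇ b in eq
... | true  = refl
... | false = ⊥-elim (subst T eq (≤⇒≤ᵇ p))

≤ᵇ-false : ∀ {a b} → b < a → (a ≤ᵇ b) ≡ false
≤ᵇ-false {a} {b} p with a ≤ᵇ b in eq
... | false = refl
... | true  = ⊥-elim (<⇒≱ p (≤ᵇ⇒≤ a b (subst T (sym eq) tt)))

≤ᵇ-sound : ∀ {a b} → (a ≤ᵇ b) ≡ true → a ≤ b
≤ᵇ-sound {a} {b} eq = ≤ᵇ⇒≤ a b (subst T (sym eq) tt)

≡ᵇ-refl : ∀ a → (a ≡ᵇ a) ≡ true
≡ᵇ-refl a with a ≡ᵇ a in eq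
... | true  = refl
... | false = ⊥-elim (subst T eq (≡⇒≡ᵇ a a refl))

≡ᵇ-false : ∀ {a b} → a ≢ b → (a ≡ᵇ b) ≡ false
≡ᵇ-false {a} {b} p with a ≡ᵇ b in eq
... | false = refl
... | true  = ⊥-elim (p (≡ᵇ⇒≡ a b (subst T (sym eq) tt)))

∧-true : ∀ {a b} → a ∧ b ≡ true → a ≡ true × b ≡ true
∧-true {true} eq = refl , eq

interB : ℕ → List ℕ → List ℕ → Bool
interB x []      []       = true
interB x []      (_ ∷ _)  = false
interB x (_ ∷ _) []       = false
interB x (y ∷ b) (a ∷ as) = ((x ≤ᵇ a) ∧ (a ≤ᵇ y)) ∧ interB y b as

interB-sound : ∀ x b as → interB x b as ≡ true → Inter x b as
interB-sound x []      []       eq = tt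
interB-sound x (y ∷ b) (a ∷ as) eq =
  let p , q = ∧-true eq ; p₁ , p₂ = ∧-true p in ≤ᵇ-sound p₁ , ≤ᵇ-sound {a} p₂ , interB-sound y b as q

sortedB : ℕ → List ℕ → Bool
sortedB x []      = true
sortedB x (y ∷ b) = (x ≤ᵇ y) ∧ sortedB y b

sortedLB : List ℕ → Bool
sortedLB []      = true
sortedLB (x ∷ b) = sortedB x b

sortedB-sound : ∀ x b → sortedB x b ≡ true → Sorted x b
sortedB-sound x []      eq = tt
sortedB-sound x (y ∷ b) eq = let p , q = ∧-true eq in ≤ᵇ-sound p , sortedB-sound y b q

sortedB-complete : ∀ x b → Sorted x b → sortedB x b ≡ true
sortedB-complete x []      _       = refl
sortedB-complete x (y ∷ b) (p , q) = cong₂ _∧_ (≤ᵇ-true p) (sortedB-complete y b q)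

sortedLB-complete : ∀ b → SortedL b → sortedLB b ≡ true
sortedLB-complete []      _ = refl
sortedLB-complete (x ∷ b) p = sortedB-complete x b p

Inter-Sorted : ∀ x b as → Inter x b as → Sorted x b
Inter-Sorted x []      []       _             = tt
Inter-Sorted x (y ∷ b) (a ∷ as) (p , q , int) = ≤-trans p q , Inter-Sorted y b as int

rowSum : ℕ → ℕ → ℕ → (List ℕ → ℤ) → ℤ
rowSum m s zero    F = F []
rowSum m s (suc l) F = sumr 1 (m ℕ.+ s) (λ v → rowSum m (suc s) l (F ∘ (v ∷_)))

InRange : ℕ → ℕ → List ℕ → Set
InRange m s []       = ⊤
InRange m s (v ∷ vs) = (1 ≤ v × v ≤ m ℕ.+ s) × InRange m (suc s) vs

rowSum-cong : ∀ m s l {F G} → (∀ vs → length vs ≡ l → InRange m s vs → F vs ≡ G vs) → rowSum m s l F ≡ rowSum m s l G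
rowSum-cong m s zero    p = p [] refl tt
rowSum-cong m s (suc l) p = sumr-cong 1 (m ℕ.+ s) (λ v 1≤v v≤ → rowSum-cong m (suc s) l (λ vs len r → p (v ∷ vs) (cong suc len) ((1≤v , ≤-pred v≤) , r)))

rowSum-zero : ∀ m s l {F} → (∀ vs → length vs ≡ l → InRange m s vs → F vs ≡ + 0) → rowSum m s l F ≡ + 0
rowSum-zero m s l p = trans (rowSum-cong m s l p) (go s l)
  where
  go : ∀ s l → rowSum m s l (λ _ → + 0) ≡ + 0
  go s zero    = refl
  go s (suc l) = sumr-zero 1 (m ℕ.+ s) (λ _ _ _ → go (suc s) l)

rowSum-+ : ∀ m s l F G → rowSum m s l (λ vs → F vs ℤ.+ G vs) ≡ rowSum m s l F ℤ.+ rowSum m s l G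
rowSum-+ m s zero    F G = refl
rowSum-+ m s (suc l) F G = trans (sumr-cong 1 (m ℕ.+ s) (λ v _ _ → rowSum-+ m (suc s) l (F ∘ (v ∷_)) (G ∘ (v ∷_)))) (sumr-+ 1 (m ℕ.+ s) _ _)

rowSum-sumr : ∀ m s l a c (F : ℕ → List ℕ → ℤ) → rowSum m s l (λ vs → sumr a c (λ v → F v vs)) ≡ sumr a c (λ v → rowSum m s l (F v))
rowSum-sumr m s l a zero    F = rowSum-zero m s l (λ _ _ _ → refl)
rowSum-sumr m s l a (suc c) F = trans (rowSum-+ m s l (F a) _) (cong (ℤ._+_ (rowSum m s l (F a))) (rowSum-sumr m s l (suc a) c F))

ifℤ-∧ : ∀ a b z → ifℤ (a ∧ b) z ≡ ifℤ a (ifℤ b z)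
ifℤ-∧ true  b z = refl
ifℤ-∧ false b z = refl

ifℤ-cong : ∀ c {x y} → (c ≡ true → x ≡ y) → ifℤ c x ≡ ifℤ c y
ifℤ-cong true  p = p refl
ifℤ-cong false p = refl

rowSum-ifℤ : ∀ m s l c F → rowSum m s l (λ vs → ifℤ c (F vs)) ≡ ifℤ c (rowSum m s l F)
rowSum-ifℤ m s l true  F = refl
rowSum-ifℤ m s l false F = rowSum-zero m s l (λ _ _ _ → refl)

-- Entries of arrays obey the bounds of their columns, entries of the telescoped sum need not. The
-- sums agree because `F` vanishes on the rows in excess.
rowSum-inter : ∀ m s x b F → 1 ≤ x → (∀ as → Inter x b as → TooLarge m s as → F as ≡ + 0) →
  rowSum m s (length b) (λ vs → ifℤ (interB x b vs) (F vs)) ≡ rsum x b F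
rowSum-inter m s x []      F 1≤x z = refl
rowSum-inter m s x (y ∷ b) F 1≤x z = trans
  (sumr-cong 1 (m ℕ.+ s) (λ v _ _ → trans
    (rowSum-cong m (suc s) (length b) (λ vs _ _ → ifℤ-∧ ((x ≤ᵇ v) ∧ (v ≤ᵇ y)) (interB y b vs) (F (v ∷ vs))))
    (trans (rowSum-ifℤ m (suc s) (length b) ((x ≤ᵇ v) ∧ (v ≤ᵇ y)) _)
      (ifℤ-cong ((x ≤ᵇ v) ∧ (v ≤ᵇ y)) (λ eq → let x≤v , v≤y = bounds v eq in
        rowSum-inter m (suc s) y b (F ∘ (v ∷_)) (≤-trans 1≤x (≤-trans x≤v v≤y)) (λ as int t → z (v ∷ as) (x≤v , v≤y , int) (inj₂ t)))))))
  (sumr-window (m ℕ.+ s) x (suc y ∸ x) (λ v → (x ≤ᵇ v) ∧ (v ≤ᵇ y)) _ 1≤x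
    (λ v eq → let x≤v , v≤y = bounds v eq in x≤v , ≤-trans (s≤s v≤y) (m≤n+m∸n (suc y) x))
    (λ v x≤v v< → cong₂ _∧_ (≤ᵇ-true x≤v) (≤ᵇ-true (v≤y v x≤v v<)))
    (λ v eq L<v → let x≤v , v≤y = bounds v eq in rsum-zero y b (λ as int → z (v ∷ as) (x≤v , v≤y , int) (inj₁ L<v))))
  where
  bounds : ∀ v → (x ≤ᵇ v) ∧ (v ≤ᵇ y) ≡ true → x ≤ v × v ≤ y
  bounds v eq = let p , q = ∧-true eq in ≤ᵇ-sound p , ≤ᵇ-sound {v} q
  v≤y : ∀ v → x ≤ v → v < x ℕ.+ (suc y ∸ x) → v ≤ y
  v≤y v x≤v v< with x ℕₚ.≤? suc y
  ... | yes x≤y = ≤-pred (subst (v <_) (m+[n∸m]≡n x≤y) v<)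
  ... | no  x≰y = ⊥-elim (<⇒≱ (subst (v <_) (trans (cong (x ℕ.+_) (m≤n⇒m∸n≡0 (<⇒≤ (≰⇒> x≰y)))) (ℕₚ.+-identityʳ x)) v<) x≤v)

rowSum-sorted : ∀ m U s l x F → 1 ≤ x → m ℕ.+ (s ℕ.+ l) ≤ U → (∀ as → length as ≡ l → Sorted x as → TooLarge m s as → F as ≡ + 0) →
  rowSum m s l (λ vs → ifℤ (sortedB x vs) (F vs)) ≡ msum U l x F
rowSum-sorted m U s zero    x F 1≤x L<U z = refl
rowSum-sorted m U s (suc l) x F 1≤x L<U z = trans
  (sumr-cong 1 (m ℕ.+ s) (λ v _ _ → trans
    (rowSum-cong m (suc s) l (λ vs _ _ → ifℤ-∧ (x ≤ᵇ v) (sortedB v vs) (F (v ∷ vs))))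
    (trans (rowSum-ifℤ m (suc s) l (x ≤ᵇ v) _)
      (trans (ifℤ-cong (x ≤ᵇ v) (λ eq → let x≤v = ≤ᵇ-sound eq in
        rowSum-sorted m U (suc s) l v (F ∘ (v ∷_)) (≤-trans 1≤x x≤v) L<U′ (λ as len so t → z (v ∷ as) (cong suc len) (x≤v , so) (inj₂ t))))
      (clip v)))))
  (sumr-window (m ℕ.+ s) x (U ∸ x) (λ v → (x ≤ᵇ v) ∧ (suc v ≤ᵇ U)) _ 1≤x
    (λ v eq → let p , q = ∧-true eq in ≤ᵇ-sound p , ≤-trans (≤ᵇ-sound {suc v} q) (m≤n+m∸n U x))
    (λ v x≤v v< → cong₂ _∧_ (≤ᵇ-true x≤v) (≤ᵇ-true (v<U v x≤v v<)))
    (λ v eq L<v → msum-zero l v (λ as len so → z (v ∷ as) (cong suc len) (≤ᵇ-sound (proj₁ (∧-true eq)) , so) (inj₁ L<v))))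
  where
  L<U′ : m ℕ.+ (suc s ℕ.+ l) ≤ U
  L<U′ = subst (λ t → m ℕ.+ t ≤ U) (+-suc s l) L<U
  msum-zero : ∀ l v {G} → (∀ as → length as ≡ l → Sorted v as → G as ≡ + 0) → msum U l v G ≡ + 0
  msum-zero zero    v p = p [] refl tt
  msum-zero (suc l) v p = sumr-zero v (U ∸ v) (λ a v≤a _ → msum-zero l a (λ as len so → p (a ∷ as) (cong suc len) (v≤a , so)))
  v<U : ∀ v → x ≤ v → v < x ℕ.+ (U ∸ x) → v < U
  v<U v x≤v v< with x ℕₚ.≤? U
  ... | yes x≤U = subst (v <_) (m+[n∸m]≡n x≤U) v<
  ... | no  x≰U = ⊥-elim (<⇒≱ (subst (v <_) (trans (cong (x ℕ.+_) (m≤n⇒m∸n≡0 (<⇒≤ (≰⇒> x≰U)))) (ℕₚ.+-identityʳ x)) v<) x≤v)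
  clip : ∀ v → ifℤ (x ≤ᵇ v) (msum U l v (F ∘ (v ∷_))) ≡ ifℤ ((x ≤ᵇ v) ∧ (suc v ≤ᵇ U)) (msum U l v (F ∘ (v ∷_)))
  clip v with suc v ℕₚ.≤? U
  ... | yes v<U = cong (λ c → ifℤ c _) (sym (trans (cong ((x ≤ᵇ v) ∧_) (≤ᵇ-true v<U)) (∧-identityʳ (x ≤ᵇ v))))
  ... | no v≮U = trans (ifℤ-cong (x ≤ᵇ v) {y = + 0} (λ eq → msum-zero l v (λ as len so → z (v ∷ as) (cong suc len) (≤ᵇ-sound eq , so)
      (inj₁ (<-≤-trans (<-≤-trans (+-monoʳ-< m (subst (s <_) (sym (+-suc s l)) (s≤s (m≤m+n s l)))) L<U) (≤-pred (≰⇒> v≮U)))))))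
    (trans (zero-if (x ≤ᵇ v)) (sym (trans (cong (λ c → ifℤ ((x ≤ᵇ v) ∧ c) (msum U l v (F ∘ (v ∷_)))) (≤ᵇ-false (≰⇒> v≮U))) (zero-∧ (x ≤ᵇ v)))))
    where
    zero-if : ∀ c → ifℤ c (+ 0) ≡ + 0
    zero-if true  = refl
    zero-if false = refl
    zero-∧ : ∀ c {z} → ifℤ (c ∧ false) z ≡ + 0
    zero-∧ true  = refl
    zero-∧ false = refl

applyUpTo-iota : ∀ (h : ℕ → ℕ) a l → (∀ t → h t ≡ a ℕ.+ t) → applyUpTo h l ≡ iota a l
applyUpTo-iota h a zero    p = refl
applyUpTo-iota h a (suc l) p = cong₂ _∷_ (trans (p 0) (ℕₚ.+-identityʳ a)) (applyUpTo-iota (h ∘ suc) (suc a) l (λ t → trans (p (suc t)) (+-suc a t)))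

range-iota : ∀ a b → range a b ≡ iota a (suc b ∸ a)
range-iota a b = trans (Listₚ.map-applyUpTo id (a ℕ.+_) (suc b ∸ a)) (applyUpTo-iota (a ℕ.+_) a (suc b ∸ a) (λ _ → refl))

sumr-iota : ∀ (f : ℕ → ℤ) a l → sumℤ (map f (iota a l)) ≡ sumr a l f
sumr-iota f a zero    = refl
sumr-iota f a (suc l) = cong (ℤ._+_ (f a)) (sumr-iota f (suc a) l)

allB-++ : ∀ {A : Set} (p : A → Bool) xs ys → allB p (xs ++ ys) ≡ allB p xs ∧ allB p ys
allB-++ p []       ys = refl
allB-++ p (x ∷ xs) ys with p x
... | true  = allB-++ p xs ys
... | false = refl

countB-++ : ∀ {A : Set} (p : A → Bool) xs ys → countB p (xs ++ ys) ≡ countB p xs ℕ.+ countB p ys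
countB-++ p []       ys = refl
countB-++ p (x ∷ xs) ys = trans (cong ((if p x then 1 else 0) ℕ.+_) (countB-++ p xs ys)) (sym (ℕₚ.+-assoc (if p x then 1 else 0) (countB p xs) (countB p ys)))

countB-sum : ∀ {A : Set} (p : A → Bool) xs → + countB p xs ≡ sumℤ (map (λ x → ifℤ (p x) (+ 1)) xs)
countB-sum p []       = refl
countB-sum p (x ∷ xs) with p x
... | true  = cong (ℤ._+_ (+ 1)) (countB-sum p xs)
... | false = trans (countB-sum p xs) (sym (ℤₚ.+-identityˡ _))

module Arrays (m n k : ℕ) where
  open Magog m n k public

  Pos : Set
  Pos = ℕ × ℕ

  -- `candidates` extends arrays at the front, so the first position is the innermost sum. As rows
  -- are listed from the top, the inner sum over a row is taken with all rows below it fixed.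
  Σc : List Pos → (Array → ℤ) → ℤ
  Σc []             f = f []
  Σc ((i , j) ∷ ps) f = Σc ps (λ A → sumr 1 (m ℕ.+ j) (λ v → f (((i , j) , v) ∷ A)))

  Σc-cong : ∀ ps {f g} → (∀ A → f A ≡ g A) → Σc ps f ≡ Σc ps g
  Σc-cong []             p = p []
  Σc-cong ((i , j) ∷ ps) p = Σc-cong ps (λ A → sumr-cong 1 (m ℕ.+ j) (λ v _ _ → p (((i , j) , v) ∷ A)))

  candidates-sum : ∀ ps f → sumℤ (map f (candidates ps)) ≡ Σc ps f
  candidates-sum []             f = ℤₚ.+-identityʳ _
  candidates-sum ((i , j) ∷ ps) f = begin
    sumℤ (map f (concatMap (λ A → map (λ v → ((i , j) , v) ∷ A) (range 1 (m ℕ.+ j))) (candidates ps)))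
      ≡⟨ sumℤ-concatMap f (λ A → map (λ v → ((i , j) , v) ∷ A) (range 1 (m ℕ.+ j))) (candidates ps) ⟩
    sumℤ (map (λ A → sumℤ (map f (map (λ v → ((i , j) , v) ∷ A) (range 1 (m ℕ.+ j))))) (candidates ps))
      ≡⟨ cong sumℤ (Listₚ.map-cong (λ A → trans (cong sumℤ (trans (sym (Listₚ.map-∘ (range 1 (m ℕ.+ j)))) (cong (map _) (range-iota 1 (m ℕ.+ j)))))
           (sumr-iota (λ v → f (((i , j) , v) ∷ A)) 1 (m ℕ.+ j))) (candidates ps)) ⟩
    sumℤ (map (λ A → sumr 1 (m ℕ.+ j) (λ v → f (((i , j) , v) ∷ A))) (candidates ps))
      ≡⟨ candidates-sum ps _ ⟩
    Σc ((i , j) ∷ ps) f ∎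
    where open ≡.≡-Reasoning

  count-Σc : ∀ p ps → + countB p (candidates ps) ≡ Σc ps (λ A → ifℤ (p A) (+ 1))
  count-Σc p ps = trans (countB-sum p (candidates ps)) (candidates-sum ps _)

  zipRow : ℕ → ℕ → List ℕ → Array
  zipRow i s []       = []
  zipRow i s (v ∷ vs) = ((i , s) , v) ∷ zipRow i (suc s) vs

  Σc-row : ∀ i s l ps f → Σc (map (λ j → (i , j)) (iota s l) ++ ps) f ≡ Σc ps (λ A → rowSum m s l (λ vs → f (zipRow i s vs ++ A)))
  Σc-row i s zero    ps f = refl
  Σc-row i s (suc l) ps f = trans (Σc-row i (suc s) l ps _)
    (Σc-cong ps (λ A → rowSum-sumr m (suc s) l 1 (m ℕ.+ s) (λ v vs → f (((i , s) , v) ∷ zipRow i (suc s) vs ++ A))))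

  get-skip : ∀ i s vs A i′ j → i′ ≢ i → get (zipRow i s vs ++ A) i′ j ≡ get A i′ j
  get-skip i s []       A i′ j p = refl
  get-skip i s (v ∷ vs) A i′ j p rewrite ≡ᵇ-false p = get-skip i (suc s) vs A i′ j p

  get-row : ∀ i s vs A → map (get (zipRow i s vs ++ A) i) (iota s (length vs)) ≡ vs
  get-row i s []       A = refl
  get-row i s (v ∷ vs) A = cong₂ _∷_ here (trans (there (suc s) (length vs) ≤-refl) (get-row i (suc s) vs A))
    where
    here : get (((i , s) , v) ∷ zipRow i (suc s) vs ++ A) i s ≡ v
    here rewrite ≡ᵇ-refl i | ≡ᵇ-refl s = refl
    there : ∀ t l → s < t → map (get (((i , s) , v) ∷ zipRow i (suc s) vs ++ A) i) (iota t l) ≡ map (get (zipRow i (suc s) vs ++ A) i) (iota t l)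
    there t zero    s<t = refl
    there t (suc l) s<t = cong₂ _∷_ skip (there (suc t) l (<-trans s<t (n<1+n t)))
      where
      skip : get (((i , s) , v) ∷ zipRow i (suc s) vs ++ A) i t ≡ get (zipRow i (suc s) vs ++ A) i t
      skip rewrite ≡ᵇ-refl i | ≡ᵇ-false {t} {s} (λ { refl → <-irrefl refl s<t }) = refl

  local : ℕ → ℕ → ℕ → Array → Bool
  local i j v A = (1 ≤ᵇ v) ∧ (v ≤ᵇ m ℕ.+ j)
    ∧ (isPos (suc i) j ⇒ᵇ (get A (suc i) j ≤ᵇ v))
    ∧ (isPos (suc i) (suc j) ⇒ᵇ (v ≤ᵇ get A (suc i) (suc j)))

  cond isMin isMax : Array → Pos → Bool
  cond  A (i , j) = local i j (get A i j) A
  isMin A (i , j) = (suc i ≡ᵇ j ℕ.+ k) ∧ (get A i j ≡ᵇ 1)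
  isMax A (i , j) = (i ≡ᵇ j) ∧ (get A i j ≡ᵇ m ℕ.+ j)

  rowPos : ℕ → List Pos
  rowPos i = map (λ j → (i , j)) (iota (suc (i ∸ k)) (i ∸ (i ∸ k)))

  rowsFrom : ℕ → ℕ → List Pos
  rowsFrom i l = concatMap rowPos (iota i l)

  -- The empty row 0 is added as the end point of the induction over the rows.
  positions-rows : positions ≡ rowsFrom 0 (suc n)
  positions-rows = trans
    (trans (cong (concatMap _) (range-iota 1 n)) (Listₚ.concatMap-cong (λ i → cong (map (λ j → (i , j))) (range-iota (suc (i ∸ k)) i)) (iota 1 n)))
    (cong (_++ rowsFrom 1 n) (sym row0))
    where
    row0 : rowPos 0 ≡ []
    row0 rewrite 0∸n≡0 (0 ∸ k) = refl

  allB-rows : ∀ i l {p q : Pos → Bool} → (∀ x j → i ≤ x → p (x , j) ≡ q (x , j)) → allB p (rowsFrom i l) ≡ allB q (rowsFrom i l)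
  allB-rows i zero    h = refl
  allB-rows i (suc l) {p} {q} h = trans (allB-++ p (rowPos i) _) (trans (cong₂ _∧_ (go (iota (suc (i ∸ k)) (i ∸ (i ∸ k)))) (allB-rows (suc i) l (λ x j i<x → h x j (<⇒≤ i<x))))
    (sym (allB-++ q (rowPos i) _)))
    where
    go : ∀ js → allB p (map (λ j → (i , j)) js) ≡ allB q (map (λ j → (i , j)) js)
    go []       = refl
    go (j ∷ js) = cong₂ _∧_ (h i j ≤-refl) (go js)

  countB-rows : ∀ i l {p q : Pos → Bool} → (∀ x j → i ≤ x → p (x , j) ≡ q (x , j)) → countB p (rowsFrom i l) ≡ countB q (rowsFrom i l)
  countB-rows i zero    h = refl
  countB-rows i (suc l) {p} {q} h = trans (countB-++ p (rowPos i) _) (trans (cong₂ ℕ._+_ (go (iota (suc (i ∸ k)) (i ∸ (i ∸ k)))) (countB-rows (suc i) l (λ x j i<x → h x j (<⇒≤ i<x))))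
    (sym (countB-++ q (rowPos i) _)))
    where
    go : ∀ js → countB p (map (λ j → (i , j)) js) ≡ countB q (map (λ j → (i , j)) js)
    go []       = refl
    go (j ∷ js) = cong₂ (λ c x → (if c then 1 else 0) ℕ.+ x) (h i j ≤-refl) (go js)

  allB-iota : ∀ i s l (p : Pos → Bool) → allB p (map (λ j → (i , j)) (iota s l)) ≡ true → ∀ j → s ≤ j → j < s ℕ.+ l → p (i , j) ≡ true
  allB-iota i s zero    p eq j s≤j j< = ⊥-elim (<⇒≱ (subst (j <_) (ℕₚ.+-identityʳ s) j<) s≤j)
  allB-iota i s (suc l) p eq j s≤j j< with s ℕ.≟ j
  ... | yes refl = proj₁ (∧-true eq)
  ... | no s≢j   = allB-iota i (suc s) l p (proj₂ (∧-true eq)) j (≤∧≢⇒< s≤j s≢j) (subst (j <_) (+-suc s l) j<)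

  countB-none : ∀ i s l (p : Pos → Bool) → (∀ j → s ≤ j → j < s ℕ.+ l → p (i , j) ≡ false) → countB p (map (λ j → (i , j)) (iota s l)) ≡ 0
  countB-none i s zero    p h = refl
  countB-none i s (suc l) p h rewrite h s ≤-refl (m<m+n s (s≤s z≤n)) =
    countB-none i (suc s) l p (λ j s<j j< → h j (<⇒≤ s<j) (subst (j <_) (sym (+-suc s l)) j<))

  countB-first : ∀ i s l (p : Pos → Bool) → (∀ j → s < j → p (i , j) ≡ false) → countB p (map (λ j → (i , j)) (iota s (suc l))) ≡ (if p (i , s) then 1 else 0)
  countB-first i s l p h = trans (cong ((if p (i , s) then 1 else 0) ℕ.+_) (countB-none i (suc s) l p (λ j s<j _ → h j s<j))) (ℕₚ.+-identityʳ _)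

  countB-last : ∀ i s l (p : Pos → Bool) → (∀ j → j < s ℕ.+ l → p (i , j) ≡ false) → countB p (map (λ j → (i , j)) (iota s (suc l))) ≡ (if p (i , s ℕ.+ l) then 1 else 0)
  countB-last i s zero    p h = trans (ℕₚ.+-identityʳ _) (cong (λ t → if p (i , t) then 1 else 0) (sym (ℕₚ.+-identityʳ s)))
  countB-last i s (suc l) p h rewrite h s (m<m+n s (s≤s z≤n)) = trans (countB-last i (suc s) l p (λ j j< → h j (subst (j <_) (sym (+-suc s l)) j<)))
    (cong (λ t → if p (i , t) then 1 else 0) (sym (+-suc s l)))

  allB-get : ∀ i s (c : ℕ → ℕ → Bool) (f : ℕ → ℕ) vs → map f (iota s (length vs)) ≡ vs →
    ∀ (p : Pos → Bool) → (∀ j → p (i , j) ≡ c (f j) j) → ∀ (r : ℕ → List ℕ → Bool) →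
    (∀ s → r s [] ≡ true) → (∀ s v vs → r s (v ∷ vs) ≡ c v s ∧ r (suc s) vs) →
    allB p (map (λ j → (i , j)) (iota s (length vs))) ≡ r s vs
  allB-get i s c f []       eq p h r r[] r∷ = sym (r[] s)
  allB-get i s c f (v ∷ vs) eq p h r r[] r∷ = trans
    (cong₂ _∧_ (trans (h s) (cong (λ t → c t s) (Listₚ.∷-injectiveˡ eq))) (allB-get i (suc s) c f vs (Listₚ.∷-injectiveʳ eq) p h r r[] r∷))
    (sym (r∷ s v vs))

  rowVals : ℕ → Array → List ℕ
  rowVals i A = map (get A i) (iota (suc (i ∸ k)) (i ∸ (i ∸ k)))

  isMagog-rows : ∀ A → isMagog A ≡ allB (cond A) (rowsFrom 0 (suc n))
  isMagog-rows A = cong (allB (cond A)) positions-rows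

  minima-rows : ∀ A → minima A ≡ countB (isMin A) (rowsFrom 0 (suc n))
  minima-rows A = cong (countB (isMin A)) positions-rows

  maxima-rows : ∀ A → maxima A ≡ countB (isMax A) (rowsFrom 0 (suc n))
  maxima-rows A = cong (countB (isMax A)) positions-rows

lastOf-map : ∀ (f : ℕ → ℕ) s l → lastOf (f s) (map f (iota (suc s) l)) ≡ f (s ℕ.+ l)
lastOf-map f s zero    = cong f (sym (ℕₚ.+-identityʳ s))
lastOf-map f s (suc l) = trans (lastOf-map f (suc s) l) (cong f (sym (+-suc s l)))

length-map-iota : ∀ (f : ℕ → ℕ) s l → length (map f (iota s l)) ≡ l
length-map-iota f s l = trans (Listₚ.length-map f (iota s l)) (length-iota s l)

-- The conditions on a row in terms of the row below

module Rows (m n k₀ : ℕ) where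
  k : ℕ
  k = suc k₀

  open Arrays m n k public

  isPos-true : ∀ i j → 1 ≤ j → j ≤ i → i ≤ n → suc i ≤ j ℕ.+ k → isPos i j ≡ true
  isPos-true i j a b c d = cong₂ _∧_ (≤ᵇ-true a) (cong₂ _∧_ (≤ᵇ-true b) (cong₂ _∧_ (≤ᵇ-true c) (≤ᵇ-true d)))

  isPos-left : ∀ i j → j ℕ.+ k ≤ i → isPos i j ≡ false
  isPos-left i j p = trans (cong (λ c → (1 ≤ᵇ j) ∧ (j ≤ᵇ i) ∧ (i ≤ᵇ n) ∧ c) (≤ᵇ-false (s≤s p)))
    (trans (cong (λ c → (1 ≤ᵇ j) ∧ (j ≤ᵇ i) ∧ c) (∧-zeroʳ (i ≤ᵇ n)))
      (trans (cong ((1 ≤ᵇ j) ∧_) (∧-zeroʳ (j ≤ᵇ i))) (∧-zeroʳ (1 ≤ᵇ j))))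

  isPos-below : ∀ j → isPos (suc n) j ≡ false
  isPos-below j = trans (cong (λ c → (1 ≤ᵇ j) ∧ (j ≤ᵇ suc n) ∧ c ∧ (suc (suc n) ≤ᵇ j ℕ.+ k)) (≤ᵇ-false (n<1+n n)))
    (trans (cong ((1 ≤ᵇ j) ∧_) (∧-zeroʳ (j ≤ᵇ suc n))) (∧-zeroʳ (1 ≤ᵇ j)))

  rowB : ℕ → Array → ℕ → List ℕ → Bool
  rowB i A s []       = true
  rowB i A s (v ∷ vs) = local i s v A ∧ rowB i A (suc s) vs

  row-local : ∀ i s vs A → allB (cond (zipRow i s vs ++ A)) (map (λ j → (i , j)) (iota s (length vs))) ≡ rowB i A s vs
  row-local i s vs A = allB-get i s (λ v j → local i j v A) (get B i) vs (get-row i s vs A) (cond B)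
    (λ j → cong₂ (λ x y → (1 ≤ᵇ get B i j) ∧ (get B i j ≤ᵇ m ℕ.+ j) ∧ (isPos (suc i) j ⇒ᵇ (x ≤ᵇ get B i j)) ∧ (isPos (suc i) (suc j) ⇒ᵇ (get B i j ≤ᵇ y)))
      (get-skip i s vs A (suc i) j 1+n≢n) (get-skip i s vs A (suc i) (suc j) 1+n≢n))
    (rowB i A) (λ _ → refl) (λ _ _ _ → refl)
    where B = zipRow i s vs ++ A

  module _ (M : ℕ) (A : Array) where
    private
      N = suc M

    -- If position `(N , s)` lies outside the array, there is no entry below `v`, and the bound
    -- `1 ≤ v` takes over the role of the lower neighbour.
    local-inter : ∀ s v x → 1 ≤ v → v ≤ m ℕ.+ s → (isPos N s ≡ true × x ≡ get A N s) ⊎ (isPos N s ≡ false × x ≡ 1) → isPos N (suc s) ≡ true →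
      local M s v A ≡ (x ≤ᵇ v) ∧ (v ≤ᵇ get A N (suc s))
    local-inter s v x 1≤v v≤ (inj₁ (p , refl)) q rewrite ≤ᵇ-true 1≤v | ≤ᵇ-true v≤ | p | q = refl
    local-inter s v x 1≤v v≤ (inj₂ (p , refl)) q rewrite ≤ᵇ-true 1≤v | ≤ᵇ-true v≤ | p | q = refl

    rowB-inter : ∀ s l vs x → length vs ≡ l → InRange m s vs → (isPos N s ≡ true × x ≡ get A N s) ⊎ (isPos N s ≡ false × x ≡ 1) →
      (∀ j → s < j → j ≤ s ℕ.+ l → isPos N j ≡ true) → rowB M A s vs ≡ interB x (map (get A N) (iota (suc s) l)) vs
    rowB-inter s zero    []       x len r h pos = refl
    rowB-inter s (suc l) (v ∷ vs) x len ((1≤v , v≤) , r) h pos = cong₂ _∧_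
      (local-inter s v x 1≤v v≤ h here)
      (rowB-inter (suc s) l vs _ (suc-injective len) r (inj₁ (here , refl)) (λ j s<j j≤ → pos j (<-trans (n<1+n s) s<j) (subst (j ≤_) (sym (+-suc s l)) j≤)))
      where
      here : isPos N (suc s) ≡ true
      here = pos (suc s) ≤-refl (subst (suc s ≤_) (sym (+-suc s l)) (s≤s (m≤m+n s l)))

  max-row : ∀ A i s l → s ℕ.+ l ≡ i → countB (isMax A) (map (λ j → (i , j)) (iota s (suc l))) ≡ (if get A i i ≡ᵇ m ℕ.+ i then 1 else 0)
  max-row A i s l refl = trans (countB-last i s l (isMax A) (λ j j< → cong (_∧ (get A i j ≡ᵇ m ℕ.+ j)) (≡ᵇ-false (λ eq → <-irrefl (sym eq) j<))))
    (cong (λ c → if c ∧ (get A i i ≡ᵇ m ℕ.+ i) then 1 else 0) (≡ᵇ-refl i))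

  min-row-none : ∀ A i s l → suc i < s ℕ.+ k → countB (isMin A) (map (λ j → (i , j)) (iota s l)) ≡ 0
  min-row-none A i s l lt = countB-none i s l (isMin A) (λ j s≤j _ → cong (_∧ (get A i j ≡ᵇ 1)) (≡ᵇ-false (λ eq → <-irrefl eq (<-≤-trans lt (+-monoˡ-≤ k s≤j)))))

  min-row-first : ∀ A i s l → suc i ≡ s ℕ.+ k → countB (isMin A) (map (λ j → (i , j)) (iota s (suc l))) ≡ (if get A i s ≡ᵇ 1 then 1 else 0)
  min-row-first A i s l eq = trans (countB-first i s l (isMin A) (λ j s<j → cong (_∧ (get A i j ≡ᵇ 1)) (≡ᵇ-false (λ eq′ → <-irrefl (trans (sym eq) eq′) (+-monoˡ-< k s<j)))))
    (cong (λ c → if c ∧ (get A i s ≡ᵇ 1) then 1 else 0) (trans (cong (_≡ᵇ s ℕ.+ k) eq) (≡ᵇ-refl (s ℕ.+ k))))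

  cond-skip : ∀ i s vs A x j → i < x → cond (zipRow i s vs ++ A) (x , j) ≡ cond A (x , j)
  cond-skip i s vs A x j i<x rewrite get-skip i s vs A x j (λ { refl → <-irrefl refl i<x })
    | get-skip i s vs A (suc x) j (λ { refl → <-irrefl refl (<-trans i<x (n<1+n x)) })
    | get-skip i s vs A (suc x) (suc j) (λ { refl → <-irrefl refl (<-trans i<x (n<1+n x)) }) = refl

  isMax-skip : ∀ i s vs A x j → i < x → isMax (zipRow i s vs ++ A) (x , j) ≡ isMax A (x , j)
  isMax-skip i s vs A x j i<x rewrite get-skip i s vs A x j (λ { refl → <-irrefl refl i<x }) = refl

  isMin-skip : ∀ i s vs A x j → i < x → isMin (zipRow i s vs ++ A) (x , j) ≡ isMin A (x , j)
  isMin-skip i s vs A x j i<x rewrite get-skip i s vs A x j (λ { refl → <-irrefl refl i<x }) = refl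

  cond-bounds : ∀ A i j → cond A (i , j) ≡ true → 1 ≤ get A i j × get A i j ≤ m ℕ.+ j
  cond-bounds A i j eq = let p , q = ∧-true eq ; p₂ , _ = ∧-true {get A i j ≤ᵇ m ℕ.+ j} q in ≤ᵇ-sound p , ≤ᵇ-sound {get A i j} p₂

-- Induction over the rows of the trapezoids

module Chain (m n k₀ : ℕ) (k≤n : suc k₀ ≤ n) (S : Setting n (m ℕ.+ 2 ℕ.* n)) where
  open Setting S
  open RingKit series
  open Products series
  open BottomRow m n k₀ k≤n S
  open Rows m n k₀

  -- The minimum of row `N` is counted and its maximum is not: `Q` arrives together with the entry,
  -- but `P` only when the variable `X N` is removed in the step to the row above.
  weight : ℕ → ℕ → Array → Carrier
  weight N d A = P ^ countB (isMax A) (rowsFrom (suc N) d) * Q ^ countB (isMin A) (rowsFrom N (suc d))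

  coeff-^ : ∀ {x} t → Coefficient x → Coefficient (x ^ t)
  coeff-^ zero    h = coeff-1
  coeff-^ (suc t) h = coeff-* h (coeff-^ t h)

  coeff-weight : ∀ N d A → Coefficient (weight N d A)
  coeff-weight N d A = coeff-* (coeff-^ (countB (isMax A) (rowsFrom (suc N) d)) coeff-P) (coeff-^ (countB (isMin A) (rowsFrom N (suc d))) coeff-Q)

  -- The contribution of the rows N, …, n to the coefficient, the rows above N being accounted for by Ψ.
  value : ℕ → ℕ → Array → ℤ
  value N d A = ifℤ (allB (cond A) (rowsFrom N (suc d)) ∧ sortedLB (rowVals N A)) (κ (weight N d A * Ψ N d (rowVals N A)))

  total : ℕ → ℕ → ℤ
  total N d = Σc (rowsFrom N (suc d)) (value N d)

  if-power : ∀ x c → (if c then x else 1#) ≈ x ^ (if c then 1 else 0)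
  if-power x true  = ≈-sym (*-identityʳ x)
  if-power x false = ≈-refl

  module _ (M d : ℕ) (n≡ : n ≡ suc M ℕ.+ d) (A : Array) where
    private
      N = suc M
      s = suc (M ∸ k)
      L = M ∸ (M ∸ k)
      okA = allB (cond A) (rowsFrom N (suc d))
      n≡′ : n ≡ M ℕ.+ suc d
      n≡′ = trans n≡ (sym (+-suc M d))
      rest : M ∸ k ℕ.+ L ≡ M
      rest = m+[n∸m]≡n (m∸n≤m M k)

    -- The part of the step that is common to both shapes of rows. The test for sortedness in
    -- `value` loses nothing: no row interlaces with an unsorted row `N`, so both sides are 0 in
    -- this case, and a row `vs` that does interlace with row `N` is sorted.
    transition : ∀ x b (U : List ℕ → Carrier) → L ≡ length b → (okA ≡ true → 1 ≤ x) →
      (∀ vs → length vs ≡ L → InRange m s vs → rowB M A s vs ≡ interB x b vs) →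
      (∀ vs → length vs ≡ L → weight M (suc d) (zipRow M s vs ++ A) ≈ U vs) →
      (∀ vs → Coefficient (U vs)) →
      (okA ≡ true → sortedLB (rowVals N A) ≡ true → κ (weight N d A * Ψ N d (rowVals N A)) ≡ rsum x b (λ as → κ (U as * Ψ M (suc d) as))) →
      (∀ as → Inter x b as → sortedLB (rowVals N A) ≡ true) →
      value N d A ≡ rowSum m s L (λ vs → value M (suc d) (zipRow M s vs ++ A))
    transition x b U L≡ 1≤x row wt cU step so = trans (ifℤ-∧ okA (sortedLB (rowVals N A)) _) (trans (ifℤ-cong okA main)
      (sym (trans (rowSum-cong m s L entry) (trans (rowSum-ifℤ m s L okA (λ vs → ifℤ (interB x b vs) (F vs)))
        (ifℤ-cong okA (λ ok → trans (cong (λ t → rowSum m s t (λ vs → ifℤ (interB x b vs) (F vs))) L≡)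
          (rowSum-inter m s x b F (1≤x ok) (λ as int t → vanish M (suc d) (U as) as n≡′
            (trans (cong ((M ∸ k) ℕ.+_) (trans (Inter-length x b as int) (sym L≡))) rest)
            (Inter-sorted x b as int) (Inter-positive x b as (1≤x ok) int) (cU as) t))))))))
      where
      F : List ℕ → ℤ
      F vs = κ (U vs * Ψ M (suc d) vs)
      entry : ∀ vs → length vs ≡ L → InRange m s vs → value M (suc d) (zipRow M s vs ++ A) ≡ ifℤ okA (ifℤ (interB x b vs) (F vs))
      entry vs len r = trans (cong₂ ifℤ ok val) (trans (cong (λ c → ifℤ c (F vs)) (∧-comm (interB x b vs) okA)) (ifℤ-∧ okA (interB x b vs) (F vs)))
        where
        B = zipRow M s vs ++ A
        vals : rowVals M B ≡ vs
        vals = trans (cong (λ t → map (get B M) (iota s t)) (sym len)) (get-row M s vs A)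
        sorted : interB x b vs ≡ true → sortedLB vs ≡ true
        sorted eq = sortedLB-complete vs (Inter-sorted x b vs (interB-sound x b vs eq))
        absorb : ∀ p q t → (p ≡ true → t ≡ true) → (p ∧ q) ∧ t ≡ p ∧ q
        absorb true  q t h = trans (cong (q ∧_) (h refl)) (∧-identityʳ q)
        absorb false q t h = refl
        ok : allB (cond B) (rowsFrom M (suc (suc d))) ∧ sortedLB (rowVals M B) ≡ interB x b vs ∧ okA
        ok = trans (cong₂ _∧_ (trans (allB-++ (cond B) (rowPos M) (rowsFrom N (suc d))) (cong₂ _∧_
               (trans (cong (λ t → allB (cond B) (map (λ j → (M , j)) (iota s t))) (sym len)) (trans (row-local M s vs A) (row vs len r)))
               (allB-rows N (suc d) (λ x j N≤x → cond-skip M s vs A x j N≤x)))) (cong sortedLB vals))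
             (absorb (interB x b vs) okA (sortedLB vs) sorted)
        val : κ (weight M (suc d) B * Ψ M (suc d) (rowVals M B)) ≡ F vs
        val = κ-cong (*-cong (wt vs len) (reflexive (cong (Ψ M (suc d)) vals)))
      main : okA ≡ true → ifℤ (sortedLB (rowVals N A)) (κ (weight N d A * Ψ N d (rowVals N A))) ≡ rsum x b F
      main ok = by-case (sortedLB (rowVals N A)) refl
        where
        by-case : ∀ c → sortedLB (rowVals N A) ≡ c → ifℤ c (κ (weight N d A * Ψ N d (rowVals N A))) ≡ rsum x b F
        by-case true  eq = step ok eq
        by-case false eq = sym (rsum-zero x b (λ as int → ⊥-elim (false≢true (trans (sym eq) (so as int)))))
          where
          false≢true : false ≢ true
          false≢true ()

    weight-split : ∀ s′ l′ vs → N ∸ k ≡ s′ → N ∸ (N ∸ k) ≡ suc l′ → suc s′ ℕ.+ l′ ≡ N → ∀ e →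
      countB (isMin (zipRow M s vs ++ A)) (rowPos M) ≡ e →
      weight M (suc d) (zipRow M s vs ++ A) ≈ Q ^ e * (weight N d A * weightP N (get A N N))
    weight-split s′ l′ vs q≡ l≡ eN e min = begin
      P ^ countB (isMax B) (rowsFrom N (suc d)) * Q ^ countB (isMin B) (rowPos M ++ rowsFrom N (suc d))
        ≡⟨ cong₂ (λ x y → P ^ x * Q ^ y)
             (trans (countB-rows N (suc d) (λ x j N≤x → isMax-skip M s vs A x j N≤x)) (trans (countB-++ (isMax A) (rowPos N) (rowsFrom (suc N) d)) (cong (ℕ._+ mx) maxN)))
             (trans (countB-++ (isMin B) (rowPos M) (rowsFrom N (suc d))) (cong₂ ℕ._+_ min (countB-rows N (suc d) (λ x j N≤x → isMin-skip M s vs A x j N≤x)))) ⟩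
      P ^ (mN ℕ.+ mx) * Q ^ (e ℕ.+ mn)
        ≈⟨ *-cong (^-+ P mN mx) (^-+ Q e mn) ⟩
      P ^ mN * P ^ mx * (Q ^ e * Q ^ mn)
        ≈⟨ solve 4 (λ a b c d → a :* b :* (c :* d) := c :* (b :* d :* a)) ≈-refl (P ^ mN) (P ^ mx) (Q ^ e) (Q ^ mn) ⟩
      Q ^ e * (P ^ mx * Q ^ mn * P ^ mN)
        ≈⟨ *-congˡ (*-congˡ (≈-sym (if-power P (get A N N ≡ᵇ m ℕ.+ N)))) ⟩
      Q ^ e * (weight N d A * weightP N (get A N N)) ∎
      where
      B = zipRow M s vs ++ A
      mx = countB (isMax A) (rowsFrom (suc N) d)
      mn = countB (isMin A) (rowsFrom N (suc d))
      mN = if get A N N ≡ᵇ m ℕ.+ N then 1 else 0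
      maxN : countB (isMax A) (rowPos N) ≡ mN
      maxN = trans (cong₂ (λ x y → countB (isMax A) (map (λ j → (N , j)) (iota (suc x) y))) q≡ l≡) (max-row A N (suc s′) l′ eN)

    private
      row-bounds : okA ≡ true → ∀ j → suc (N ∸ k) ≤ j → j ≤ N → 1 ≤ get A N j × get A N j ≤ m ℕ.+ j
      row-bounds ok j lo hi = cond-bounds A N j (allB-iota N (suc (N ∸ k)) (N ∸ (N ∸ k)) (cond A)
        (proj₁ (∧-true (trans (sym (allB-++ (cond A) (rowPos N) (rowsFrom (suc N) d))) ok))) j lo
        (s≤s (subst (j ≤_) (sym (m+[n∸m]≡n (m∸n≤m N k))) hi)))

    transition-growing : N ≤ k → value N d A ≡ rowSum m s L (λ vs → value M (suc d) (zipRow M s vs ++ A))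
    transition-growing N≤k = transition x b (λ _ → weight N d A * weightP N (lastOf x b)) L≡ (λ ok → proj₁ (row-bounds ok 1 (s≤s (≤-reflexive N∸k)) (s≤s z≤n)))
            (λ vs len r → trans (cong (λ t → rowB M A t vs) s≡) (rowB-inter M A 1 M vs x (trans len L≡M) (subst (λ t → InRange m t vs) s≡ r)
              (inj₁ (pos 1 ≤-refl (s≤s z≤n) , refl)) (λ j 1<j j≤ → pos j (<⇒≤ 1<j) j≤)))
            (λ vs len → ≈-trans (weight-split 0 M vs N∸k (cong (N ∸_) N∸k) refl 0 (trans (cong₂ (λ t y → countB (isMin (zipRow M s vs ++ A)) (map (λ j → (M , j)) (iota t y))) s≡ L≡M)
                 (min-row-none (zipRow M s vs ++ A) M 1 M (s≤s N≤k))))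
              (≈-trans (*-identityˡ _) (*-congˡ (reflexive (cong (weightP N) (sym last≡))))))
            (λ _ → coeff-* (coeff-weight N d A) (coeff-weightP N (lastOf x b)))
            (λ ok so → trans (cong (λ t → κ (weight N d A * Ψ N d t)) vals)
              (step-growing M d n≡ (weight N d A) x b (coeff-weight N d A) N≤k (length-map-iota (get A N) 2 M) (sortedB-sound x b (trans (cong sortedLB (sym vals)) so))
                (subst (_≤ m ℕ.+ N) (sym last≡) (proj₂ (row-bounds ok N (s≤s (≤-trans (≤-reflexive N∸k) z≤n)) ≤-refl)))))
            (λ as int → trans (cong sortedLB vals) (sortedB-complete x b (Inter-Sorted x b as int)))
      where
      x = get A N 1
      b = map (get A N) (iota 2 M)
      N∸k : N ∸ k ≡ 0
      N∸k = m≤n⇒m∸n≡0 N≤k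
      M∸k : M ∸ k ≡ 0
      M∸k = m≤n⇒m∸n≡0 (≤-trans (n≤1+n M) N≤k)
      s≡ : s ≡ 1
      s≡ = cong suc M∸k
      L≡M : L ≡ M
      L≡M = cong (M ∸_) M∸k
      L≡ : L ≡ length b
      L≡ = trans L≡M (sym (length-map-iota (get A N) 2 M))
      last≡ : lastOf x b ≡ get A N N
      last≡ = lastOf-map (get A N) 1 M
      vals : rowVals N A ≡ x ∷ b
      vals = cong₂ (λ t y → map (get A N) (iota (suc t) y)) N∸k (cong (N ∸_) N∸k)
      pos : ∀ j → 1 ≤ j → j ≤ N → isPos N j ≡ true
      pos j 1≤j j≤N = isPos-true N j 1≤j j≤N (subst (N ≤_) (sym n≡) (m≤m+n N d)) (+-mono-≤ 1≤j N≤k)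

    transition-full : k ≤ M → value N d A ≡ rowSum m s L (λ vs → value M (suc d) (zipRow M s vs ++ A))
    transition-full k≤M = transition 1 (y ∷ b) (λ vs → weight N d A * rowWeight vs * weightP N (lastOf y b)) L≡ (λ _ → ≤-refl)
            (λ vs len r → rowB-inter M A s k vs 1 (trans len L≡k) r (inj₂ (isPos-left N s (≤-reflexive s+k) , refl))
              (λ j s<j j≤ → isPos-true N j (≤-trans (s≤s z≤n) s<j) (subst (j ≤_) s+k j≤) N≤n (subst (λ t → suc t ≤ j ℕ.+ k) s+k (+-monoˡ-≤ k s<j))))
            weights
            (λ vs → coeff-* (coeff-* (coeff-weight N d A) (coeff-rowWeight vs)) (coeff-weightP N (lastOf y b)))
            (λ ok so → trans (cong (λ t → κ (weight N d A * Ψ N d t)) vals)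
              (step-full M d n≡ (weight N d A) y b (coeff-weight N d A) k≤M (cong suc (length-map-iota (get A N) (suc (suc s)) k₀))
                (proj₁ (row-bounds ok (suc s) (s≤s (≤-reflexive N∸k)) s<N))
                (sortedB-sound y b (trans (cong sortedLB (sym vals)) so))
                (subst (_≤ m ℕ.+ N) (sym last≡) (proj₂ (row-bounds ok N (subst (λ t → suc t ≤ N) (sym N∸k) s<N) ≤-refl)))))
            (λ { (a ∷ as) (_ , _ , int) → trans (cong sortedLB vals) (sortedB-complete y b (Inter-Sorted y b as int)) })
      where
      y = get A N (suc s)
      b = map (get A N) (iota (suc (suc s)) k₀)
      N≤n : N ≤ n
      N≤n = subst (N ≤_) (sym n≡) (m≤m+n N d)
      N∸k : N ∸ k ≡ s
      N∸k = +-∸-assoc 1 k≤M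
      s+k : s ℕ.+ k ≡ N
      s+k = cong suc (m∸n+n≡m k≤M)
      s<N : s < N
      s<N = subst (s <_) s+k (m<m+n s (s≤s z≤n))
      L≡k : L ≡ k
      L≡k = m∸[m∸n]≡n k≤M
      lN : N ∸ (N ∸ k) ≡ k
      lN = m∸[m∸n]≡n (≤-trans k≤M (n≤1+n M))
      L≡ : L ≡ length (y ∷ b)
      L≡ = trans L≡k (cong suc (sym (length-map-iota (get A N) (suc (suc s)) k₀)))
      s+k₀ : suc s ℕ.+ k₀ ≡ N
      s+k₀ = trans (sym (+-suc s k₀)) s+k
      last≡ : lastOf y b ≡ get A N N
      last≡ = trans (lastOf-map (get A N) (suc s) k₀) (cong (get A N) s+k₀)
      vals : rowVals N A ≡ y ∷ b
      vals = cong₂ (λ t z → map (get A N) (iota (suc t) z)) N∸k lN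
      weights : ∀ vs → length vs ≡ L → weight M (suc d) (zipRow M s vs ++ A) ≈ weight N d A * rowWeight vs * weightP N (lastOf y b)
      weights []       len = ⊥-elim (1+n≢0 (sym (trans len L≡k)))
      weights (v ∷ vs) len = ≈-trans
        (weight-split s k₀ (v ∷ vs) N∸k lN s+k₀ (if v ≡ᵇ 1 then 1 else 0)
          (trans (cong (λ t → countB (isMin B) (map (λ j → (M , j)) (iota s t))) L≡k)
            (trans (min-row-first B M s k₀ (sym s+k)) (cong (λ t → if t ≡ᵇ 1 then 1 else 0) (Listₚ.∷-injectiveˡ (get-row M s (v ∷ vs) A))))))
        (≈-trans (solve 3 (λ q w p → q :* (w :* p) := w :* q :* p) ≈-refl (Q ^ (if v ≡ᵇ 1 then 1 else 0)) (weight N d A) (weightP N (get A N N)))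
          (*-cong (*-congˡ (≈-sym (if-power Q (v ≡ᵇ 1)))) (reflexive (cong (weightP N) (sym last≡)))))
        where B = zipRow M s (v ∷ vs) ++ A

  total-step : ∀ M d → n ≡ suc M ℕ.+ d → total (suc M) d ≡ total M (suc d)
  total-step M d n≡ = trans (Σc-cong (rowsFrom (suc M) (suc d)) pointwise)
    (sym (Σc-row M (suc (M ∸ k)) (M ∸ (M ∸ k)) (rowsFrom (suc M) (suc d)) (value M (suc d))))
    where
    pointwise : ∀ A → value (suc M) d A ≡ rowSum m (suc (M ∸ k)) (M ∸ (M ∸ k)) (λ vs → value M (suc d) (zipRow M (suc (M ∸ k)) vs ++ A))
    pointwise A with suc M ℕₚ.≤? k
    ... | yes N≤k = transition-growing M d n≡ A N≤k
    ... | no N≰k  = transition-full M d n≡ A (≤-pred (≰⇒> N≰k))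

  total-all : ∀ N d → n ≡ N ℕ.+ d → total N d ≡ total 0 n
  total-all zero    d refl = refl
  total-all (suc M) d n≡   = trans (total-step M d n≡) (total-all M (suc d) (trans n≡ (sym (+-suc M d))))

  -- The sum over increasing rows with entries up to `C` agrees with the sum over the bottom rows of
  -- arrays, as rows that violate a bound contribute nothing and no condition links row `n` to a row
  -- below.
  total-bottom : κ bottomSeries ≡ total n 0
  total-bottom = trans (κ-cong (≈-sym (*-identityˡ _))) (trans (bottom-row 1# coeff-1)
    (sym (trans (Σc-row n r L [] (value n 0)) (trans (cong (λ t → rowSum m r t (λ vs → value n 0 (zipRow n r vs ++ []))) L≡k)
      (trans (rowSum-cong m r k entry) (rowSum-sorted m (suc C) r k 1 F ≤-refl bound
        (λ as len so t → vanish n 0 (1# * rowWeight as) as (sym (ℕₚ.+-identityʳ n)) (trans (cong (q ℕ.+_) len) q+k)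
          (tail-sorted as so) (head-positive as so) (coeff-* coeff-1 (coeff-rowWeight as)) t)))))))
    where
    L = n ∸ (n ∸ k)
    L≡k : L ≡ k
    L≡k = m∸[m∸n]≡n k≤n
    q+k : q ℕ.+ k ≡ n
    q+k = m∸n+n≡m k≤n
    F : List ℕ → ℤ
    F as = κ (1# * rowWeight as * Ψ n 0 as)
    bound : m ℕ.+ (r ℕ.+ k) ≤ suc C
    bound = subst (λ t → m ℕ.+ suc t ≤ suc C) (sym q+k) (subst (_≤ suc C) (sym (+-suc m n)) (s≤s (+-monoʳ-≤ m (m≤m+n n (n ℕ.+ 0)))))
    tail-sorted : ∀ as → Sorted 1 as → SortedL as
    tail-sorted []       _       = tt
    tail-sorted (a ∷ as) (_ , h) = h
    head-positive : ∀ as → Sorted 1 as → Positive as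
    head-positive []       _       = tt
    head-positive (a ∷ as) (h , _) = h
    row-true : ∀ s vs → InRange m s vs → rowB n [] s vs ≡ true
    row-true s []       _ = refl
    row-true s (v ∷ vs) ((1≤v , v≤) , h) rewrite ≤ᵇ-true 1≤v | ≤ᵇ-true v≤ | isPos-below s | isPos-below (suc s) = row-true (suc s) vs h
    entry : ∀ vs → length vs ≡ k → InRange m r vs → value n 0 (zipRow n r vs ++ []) ≡ ifℤ (sortedB 1 vs) (F vs)
    entry []       ()  _
    entry (v ∷ vs) len h@((1≤v , _) , _) = cong₂ ifℤ
      (trans (cong₂ _∧_ (trans (allB-++ (cond B) (rowPos n) []) (trans (∧-identityʳ _)
          (trans (cong (λ t → allB (cond B) (map (λ j → (n , j)) (iota r t))) L≡) (trans (row-local n r (v ∷ vs) []) (row-true r (v ∷ vs) h)))))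
        (cong sortedLB vals)) (sym (cong (_∧ sortedB v vs) (≤ᵇ-true 1≤v))))
      (κ-cong (*-cong (*-congˡ (≈-trans (reflexive (cong (Q ^_) min)) (≈-sym (if-power Q (v ≡ᵇ 1))))) (reflexive (cong (Ψ n 0) vals))))
      where
      B = zipRow n r (v ∷ vs) ++ []
      L≡ : L ≡ length (v ∷ vs)
      L≡ = trans L≡k (sym len)
      vals : rowVals n B ≡ v ∷ vs
      vals = trans (cong (λ t → map (get B n) (iota r t)) L≡) (get-row n r (v ∷ vs) [])
      min : countB (isMin B) (rowsFrom n 1) ≡ (if v ≡ᵇ 1 then 1 else 0)
      min = trans (countB-++ (isMin B) (rowPos n) []) (trans (ℕₚ.+-identityʳ _)
        (trans (cong (λ t → countB (isMin B) (map (λ j → (n , j)) (iota r t))) L≡k)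
          (trans (min-row-first B n r k₀ (cong suc (sym q+k))) (cong (λ t → if t ≡ᵇ 1 then 1 else 0) (Listₚ.∷-injectiveˡ (get-row n r (v ∷ vs) []))))))

  module _ (a b : ℕ) (κ-monomial : ∀ u v → κ (P ^ u * Q ^ v * Π 1 n (λ p → X p ^ C)) ≡ ifℤ ((u ≡ᵇ a) ∧ (v ≡ᵇ b)) (+ 1)) where

    -- Above the first row all variables are pinned: `Ψ 0 n []` is `∏ X p ^ C`, and only the
    -- monomial of the weight is left to compare.
    total-top : total 0 n ≡ + magogCount a b
    total-top = trans (Σc-cong (rowsFrom 0 (suc n)) entry)
      (trans (sym (count-Σc (λ A → isMagog A ∧ (maxima A ≡ᵇ a) ∧ (minima A ≡ᵇ b)) (rowsFrom 0 (suc n))))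
        (cong (λ ps → + countB (λ A → isMagog A ∧ (maxima A ≡ᵇ a) ∧ (minima A ≡ᵇ b)) (candidates ps)) (sym positions-rows)))
      where
      entry : ∀ A → value 0 n A ≡ ifℤ (isMagog A ∧ (maxima A ≡ᵇ a) ∧ (minima A ≡ᵇ b)) (+ 1)
      entry A = trans (cong₂ ifℤ (trans (∧-identityʳ _) (sym (isMagog-rows A)))
          (trans (κ-cong (*-congˡ (solve 1 (λ x → con (+ 1) :* con (+ 1) :* (con (+ 1) :* (con (+ 1) :* con (+ 1) :* x)) := x) ≈-refl (Π 1 n (λ p → X p ^ C)))))
            (trans (κ-monomial (countB (isMax A) (rowsFrom 1 n)) (countB (isMin A) (rowsFrom 0 (suc n))))
              (cong₂ (λ u v → ifℤ ((u ≡ᵇ a) ∧ (v ≡ᵇ b)) (+ 1)) (sym (maxima-rows A)) (sym (minima-rows A))))))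
        (sym (ifℤ-∧ (isMagog A) ((maxima A ≡ᵇ a) ∧ (minima A ≡ᵇ b)) (+ 1)))

    κ-magog : κ bottomSeries ≡ + magogCount a b
    κ-magog = trans total-bottom (trans (total-all n 0 (sym (ℕₚ.+-identityʳ n))) total-top)

-- Monomials, inverses and exchanges of variables in power series

tabV : ∀ {A : Set} N → (ℕ → A) → Vec A N
tabV zero    f = []
tabV (suc N) f = f 0 ∷ tabV N (f ∘ suc)

tabV-cong : ∀ {A : Set} N {f g : ℕ → A} → (∀ i → i < N → f i ≡ g i) → tabV N f ≡ tabV N g
tabV-cong zero    p = refl
tabV-cong (suc N) p = cong₂ _∷_ (p 0 (s≤s z≤n)) (tabV-cong N (λ i i<N → p (suc i) (s≤s i<N)))

zipWith-tabV : ∀ {A B C : Set} (h : A → B → C) N f g → Vec.zipWith h (tabV N f) (tabV N g) ≡ tabV N (λ i → h (f i) (g i))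
zipWith-tabV h zero    f g = refl
zipWith-tabV h (suc N) f g = cong (h (f 0) (g 0) ∷_) (zipWith-tabV h N (f ∘ suc) (g ∘ suc))

map-tabV : ∀ {A B : Set} (h : A → B) N f → Vec.map h (tabV N f) ≡ tabV N (h ∘ f)
map-tabV h zero    f = refl
map-tabV h (suc N) f = cong (h (f 0) ∷_) (map-tabV h N (f ∘ suc))

replicate-tabV : ∀ {A : Set} N (x : A) → Vec.replicate N x ≡ tabV N (λ _ → x)
replicate-tabV zero    x = refl
replicate-tabV (suc N) x = cong (x ∷_) (replicate-tabV N x)

δ : ℕ → ℕ → ℕ
δ i j = if j ≡ᵇ i then 1 else 0

unitV-tabV : ∀ N i → unitV N i ≡ tabV N (δ i)
unitV-tabV zero    i       = refl
unitV-tabV (suc N) zero    = cong (1 ∷_) (replicate-tabV N 0)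
unitV-tabV (suc N) (suc i) = cong (0 ∷_) (unitV-tabV N i)

vecEq-sound : ∀ {N} (u v : Vec ℕ N) → vecEq u v ≡ true → u ≡ v
vecEq-sound []      []      _  = refl
vecEq-sound (a ∷ u) (b ∷ v) eq = let p , q = ∧-true eq in
  cong₂ _∷_ (≡ᵇ⇒≡ a b (subst T (sym p) tt)) (vecEq-sound u v q)

vecEq-refl : ∀ {N} (u : Vec ℕ N) → vecEq u u ≡ true
vecEq-refl []      = refl
vecEq-refl (a ∷ u) = cong₂ _∧_ (≡ᵇ-refl a) (vecEq-refl u)

vecEq-zeros : ∀ {N} (e : Vec ℕ N) → vecEq (Vec.replicate N 0) e ≡ isZeroV e
vecEq-zeros []          = refl
vecEq-zeros (zero ∷ e)  = vecEq-zeros e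
vecEq-zeros (suc _ ∷ e) = refl

vecEq-zerosʳ : ∀ {N} (e : Vec ℕ N) → vecEq e (Vec.replicate N 0) ≡ isZeroV e
vecEq-zerosʳ []      = refl
vecEq-zerosʳ (a ∷ e) = cong ((a ≡ᵇ 0) ∧_) (vecEq-zerosʳ e)

-- Series that do not involve the first variable.
Flat : ∀ {N} → PS (suc N) → Set
Flat f = ∀ i es → f (suc i ∷ es) ≡ + 0

module _ {N : ℕ} where
  private
    module C = Conv (psRing N)
  open C using (conv)

  *ₚ-cons : ∀ (f g : PS (suc N)) e es → (f *ₚ g) (e ∷ es) ≡ conv (cur f) (cur g) e es
  *ₚ-cons = *ₚ-conv (mulLaws N)

  0-cur : ∀ {f : ℕ → PS N} → (∀ i es → f i es ≡ + 0) → ∀ i → f i ≐ constₚ (+ 0)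
  0-cur p i es = trans (p i es) (sym (constₚ-0 es))

  *ₚ-flat : ∀ (f g : PS (suc N)) → Flat f → ∀ e es → (f *ₚ g) (e ∷ es) ≡ (cur f 0 *ₚ cur g e) es
  *ₚ-flat f g fl e es = trans (*ₚ-cons f g e es) (C.conv-head (cur f) (cur g) (0-cur fl) e es)

  conv-single : ∀ (f g : ℕ → PS N) a → (∀ i → i ≢ a → ∀ es → f i es ≡ + 0) → ∀ e es →
    conv f g e es ≡ (if a ≤ᵇ e then (f a *ₚ g (e ∸ a)) es else + 0)
  conv-single f g zero    p e       es = C.conv-head f g (0-cur (λ i → p (suc i) (λ ()))) e es
  conv-single f g (suc a) p zero    es = trans (MulLaws.cong* (mulLaws N) {g = g 0} (0-cur (λ _ → p 0 (λ ())) 0) (λ _ → refl) es) (trans (zeroˡ′ (g 0) es) (constₚ-0 es))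
    where zeroˡ′ = CommutativeRing.zeroˡ (psRing N)
  conv-single f g (suc a) p (suc e) es = trans (cong₂ ℤ._+_
      (trans (MulLaws.cong* (mulLaws N) {g = g (suc e)} (0-cur (λ _ → p 0 (λ ())) 0) (λ _ → refl) es) (trans (CommutativeRing.zeroˡ (psRing N) (g (suc e)) es) (constₚ-0 es)))
      (conv-single (f ∘ suc) g a (λ i i≢a → p (suc i) (i≢a ∘ suc-injective)) e es))
    (trans (ℤₚ.+-identityˡ _) (cong (λ c → if c then (f (suc a) *ₚ g (e ∸ a)) es else + 0) (sym (suc-≤ᵇ a e))))
    where
    suc-≤ᵇ : ∀ a e → (suc a ≤ᵇ suc e) ≡ (a ≤ᵇ e)
    suc-≤ᵇ zero    e = refl
    suc-≤ᵇ (suc a) e = refl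

monoₚ-off : ∀ {N} a (as : Vec ℕ N) i es → i ≢ a → monoₚ (a ∷ as) (i ∷ es) ≡ + 0
monoₚ-off a as i es p rewrite ≡ᵇ-false {a} {i} (p ∘ sym) = refl

monoₚ-on : ∀ {N} a (as : Vec ℕ N) es → monoₚ (a ∷ as) (a ∷ es) ≡ monoₚ as es
monoₚ-on a as es rewrite ≡ᵇ-refl a = refl

monoₚ-* : ∀ {N} (a : Vec ℕ N) F → monoₚ a *ₚ F ≐ shiftₚ a F
monoₚ-* []       F []       = trans (ℤₚ.+-identityʳ _) (ℤₚ.*-identityˡ (F []))
monoₚ-* {suc N} (a ∷ as) F (e ∷ es) = trans (*ₚ-cons (monoₚ (a ∷ as)) F e es)
  (trans (conv-single (cur (monoₚ (a ∷ as))) (cur F) a (λ i i≢a es → monoₚ-off a as i es i≢a) e es)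
    (trans (cong (λ z → if a ≤ᵇ e then z else + 0)
      (trans (MulLaws.cong* (mulLaws N) {g = cur F (e ∸ a)} (monoₚ-on a as) (λ _ → refl) es) (monoₚ-* as (cur F (e ∸ a)) es)))
      (shift-cons)))
  where
  shift-cons : (if a ≤ᵇ e then shiftₚ as (cur F (e ∸ a)) es else + 0) ≡ shiftₚ (a ∷ as) F (e ∷ es)
  shift-cons with a ≤ᵇ e | vsub es as
  ... | true  | just d  = refl
  ... | true  | nothing = refl
  ... | false | just d  = refl
  ... | false | nothing = refl

vsub-tabV : ∀ N f g → (∀ i → i < N → g i ≤ f i) → vsub (tabV N f) (tabV N g) ≡ just (tabV N (λ i → f i ∸ g i))
vsub-tabV zero    f g p = refl
vsub-tabV (suc N) f g p rewrite ≤ᵇ-true (p 0 (s≤s z≤n)) | vsub-tabV N (f ∘ suc) (g ∘ suc) (λ i i<N → p (suc i) (s≤s i<N)) = refl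

shiftₚ-tabV : ∀ N f g F → (∀ i → i < N → g i ≤ f i) → shiftₚ (tabV N g) F (tabV N f) ≡ F (tabV N (λ i → f i ∸ g i))
shiftₚ-tabV N f g F p rewrite vsub-tabV N f g p = refl

shiftₚ-mono : ∀ {N} (a b : Vec ℕ N) → shiftₚ a (monoₚ b) ≐ monoₚ (Vec.zipWith ℕ._+_ a b)
shiftₚ-mono []       []       []       = refl
shiftₚ-mono (a ∷ as) (b ∷ bs) (e ∷ es) with a ≤ᵇ e in eq | vsub es as | shiftₚ-mono as bs es
... | true  | just d  | ih = if-∧ (shifted a b e (≤ᵇ-sound eq)) ih
  where
  shifted : ∀ a b e → a ≤ e → (b ≡ᵇ e ∸ a) ≡ (a ℕ.+ b ≡ᵇ e)
  shifted zero    b e       _         = refl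
  shifted (suc a) b (suc e) (s≤s a≤e) = shifted a b e a≤e
  if-∧ : ∀ {p p′ q q′ : Bool} → p ≡ p′ → (if q then + 1 else + 0) ≡ (if q′ then + 1 else + 0) → (if p ∧ q then + 1 else + 0) ≡ (if p′ ∧ q′ then + 1 else + 0)
  if-∧ {true}  refl h = h
  if-∧ {false} refl h = refl
... | true  | nothing | ih = trans (sym (ifℤ-0 (a ℕ.+ b ≡ᵇ e))) (trans (cong (ifℤ (a ℕ.+ b ≡ᵇ e)) ih)
  (sym (ifℤ-∧ (a ℕ.+ b ≡ᵇ e) (vecEq (Vec.zipWith ℕ._+_ as bs) es) (+ 1))))
  where
  ifℤ-0 : ∀ c → ifℤ c (+ 0) ≡ + 0
  ifℤ-0 true  = refl
  ifℤ-0 false = refl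
... | false | _ | ih = sym (cong (λ c → if c ∧ vecEq (Vec.zipWith ℕ._+_ as bs) es then + 1 else + 0) (≡ᵇ-false (λ a+b≡e → absurd a b e a+b≡e eq)))
  where
  absurd : ∀ a b e → a ℕ.+ b ≡ e → (a ≤ᵇ e) ≡ false → ⊥
  absurd a b e refl eq with trans (sym eq) (≤ᵇ-true (m≤m+n a b))
  ... | ()

monoₚ-+ : ∀ N f g → monoₚ (tabV N f) *ₚ monoₚ (tabV N g) ≐ monoₚ (tabV N (λ i → f i ℕ.+ g i))
monoₚ-+ N f g e = trans (monoₚ-* (tabV N f) (monoₚ (tabV N g)) e)
  (trans (shiftₚ-mono (tabV N f) (tabV N g) e) (cong (λ v → monoₚ v e) (zipWith-tabV ℕ._+_ N f g)))

monoₚ-0 : ∀ {N} → monoₚ (Vec.replicate N 0) ≐ constₚ (+ 1)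
monoₚ-0 e = cong (λ c → if c then + 1 else + 0) (vecEq-zeros e)

varₚ : ∀ N → ℕ → PS N
varₚ N i = monoₚ (unitV N i)

varₚ-0 : ∀ {N} (F : PS (suc N)) e es → (varₚ (suc N) 0 *ₚ F) (suc e ∷ es) ≡ F (e ∷ es)
varₚ-0 {N} F e es = trans (*ₚ-cons (varₚ (suc N) 0) F (suc e) es)
  (trans (conv-single (cur (varₚ (suc N) 0)) (cur F) 1 (λ i i≢1 es → monoₚ-off 1 (Vec.replicate N 0) i es i≢1) (suc e) es)
    (trans (MulLaws.cong* (mulLaws N) {g = cur F e} monoₚ-0 (λ _ → refl) es) (MulLaws.one* (mulLaws N) (cur F e) es)))

varₚ-0-zero : ∀ {N} (F : PS (suc N)) es → (varₚ (suc N) 0 *ₚ F) (0 ∷ es) ≡ + 0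
varₚ-0-zero {N} F es = trans (*ₚ-cons (varₚ (suc N) 0) F 0 es)
  (conv-single (cur (varₚ (suc N) 0)) (cur F) 1 (λ i i≢1 es → monoₚ-off 1 (Vec.replicate N 0) i es i≢1) 0 es)

varₚ-suc : ∀ {N} i (F : PS (suc N)) e es → (varₚ (suc N) (suc i) *ₚ F) (e ∷ es) ≡ (varₚ N i *ₚ cur F e) es
varₚ-suc i F e es = *ₚ-flat (varₚ (suc _) (suc i)) F (λ _ _ → refl) e es

inv1pₚ-0 : ∀ N e es → inv1pₚ (suc N) 0 (e ∷ es) ≡ (if isZeroV es then negOnePowℕ e else + 0)
inv1pₚ-0 N e es = cong (λ c → if c then negOnePowℕ e else + 0)
  (trans (cong₂ _∧_ (trans (cong (e ≡ᵇ_) (ℕₚ.*-identityʳ e)) (≡ᵇ-refl e)) (cong (vecEq es) (zeros e N))) (vecEq-zerosʳ es))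
  where
  zeros : ∀ c N → Vec.map (c ℕ.*_) (Vec.replicate N 0) ≡ Vec.replicate N 0
  zeros c zero    = refl
  zeros c (suc N) = cong₂ _∷_ (ℕₚ.*-zeroʳ c) (zeros c N)

inv1pₚ-suc : ∀ N i es → inv1pₚ (suc N) (suc i) (0 ∷ es) ≡ inv1pₚ N i es
inv1pₚ-suc N i es = cong (λ c → if c ∧ vecEq es (Vec.map (nth es i ℕ.*_) (unitV N i)) then negOnePowℕ (nth es i) else + 0)
  (cong (0 ≡ᵇ_) (ℕₚ.*-zeroʳ (nth es i)))

inv1pₚ-flat : ∀ N i → Flat (inv1pₚ (suc N) (suc i))
inv1pₚ-flat N i e es = cong (λ c → if c ∧ vecEq es (Vec.map (nth es i ℕ.*_) (unitV N i)) then negOnePowℕ (nth es i) else + 0)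
  (cong (suc e ≡ᵇ_) (ℕₚ.*-zeroʳ (nth es i)))

-- In the variable itself, neighbouring coefficients cancel. With respect to any variable before it
-- the series is flat, which allows induction on the number of variables.
inv1pₚ-inverse : ∀ N i → i < N → inv1pₚ N i +ₚ (varₚ N i *ₚ inv1pₚ N i) ≐ constₚ (+ 1)
inv1pₚ-inverse (suc N) zero    _ (zero ∷ es)  = trans (cong₂ ℤ._+_ (inv1pₚ-0 N 0 es) (varₚ-0-zero (inv1pₚ (suc N) 0) es)) (ℤₚ.+-identityʳ _)
inv1pₚ-inverse (suc N) zero    _ (suc e ∷ es) = trans (cong₂ ℤ._+_ (inv1pₚ-0 N (suc e) es) (trans (varₚ-0 (inv1pₚ (suc N) 0) e es) (inv1pₚ-0 N e es))) (cancel (isZeroV es))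
  where
  cancel : ∀ c → (if c then ℤ.- negOnePowℕ e else + 0) ℤ.+ (if c then negOnePowℕ e else + 0) ≡ + 0
  cancel true  = ℤₚ.+-inverseˡ (negOnePowℕ e)
  cancel false = refl
inv1pₚ-inverse (suc N) (suc i) (s≤s i<N) (zero ∷ es)  = trans (cong₂ ℤ._+_ (inv1pₚ-suc N i es)
    (trans (varₚ-suc i (inv1pₚ (suc N) (suc i)) 0 es) (MulLaws.cong* (mulLaws N) {f = varₚ N i} (λ _ → refl) (inv1pₚ-suc N i) es)))
  (inv1pₚ-inverse N i i<N es)
inv1pₚ-inverse (suc N) (suc i) (s≤s i<N) (suc e ∷ es) = cong₂ ℤ._+_ (inv1pₚ-flat N i e es)
  (trans (varₚ-suc i (inv1pₚ (suc N) (suc i)) (suc e) es)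
    (trans (MulLaws.cong* (mulLaws N) {f = varₚ N i} (λ _ → refl) (λ es′ → trans (inv1pₚ-flat N i e es′) (sym (constₚ-0 es′))) es)
      (trans (CommutativeRing.zeroʳ (psRing N) (varₚ N i) es) (constₚ-0 es))))

geo2ₚ-0 : ∀ N j e es → geo2ₚ (suc N) 0 (suc j) (e ∷ es) ≡ monoₚ (tabV N (λ t → e ℕ.* δ j t)) es
geo2ₚ-0 N j e es = cong (λ c → if c then + 1 else + 0)
  (trans (cong₂ _∧_ (trans (cong (e ≡ᵇ_) (ℕₚ.*-identityʳ e)) (≡ᵇ-refl e)) (cong (vecEq es)
    (trans (cong (Vec.map (e ℕ.*_)) (trans (cong₂ (Vec.zipWith ℕ._+_) (replicate-tabV N 0) (unitV-tabV N j)) (zipWith-tabV ℕ._+_ N _ _))) (map-tabV (e ℕ.*_) N _))))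
    (vecEq-sym es _))
  where
  vecEq-sym : ∀ {N} (u v : Vec ℕ N) → vecEq u v ≡ vecEq v u
  vecEq-sym u v with vecEq u v in p | vecEq v u in q
  ... | true  | true  = refl
  ... | false | false = refl
  ... | true  | false = trans (sym (trans (cong (vecEq v) (vecEq-sound u v p)) (vecEq-refl v))) q
  ... | false | true  = trans (sym p) (trans (cong (vecEq u) (vecEq-sound v u q)) (vecEq-refl u))

geo2ₚ-suc : ∀ N i j es → geo2ₚ (suc N) (suc i) (suc j) (0 ∷ es) ≡ geo2ₚ N i j es
geo2ₚ-suc N i j es = cong (λ c → if c ∧ vecEq es (Vec.map (nth es i ℕ.*_) (Vec.zipWith ℕ._+_ (unitV N i) (unitV N j))) then + 1 else + 0)
  (cong (0 ≡ᵇ_) (ℕₚ.*-zeroʳ (nth es i)))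

geo2ₚ-flat : ∀ N i j → Flat (geo2ₚ (suc N) (suc i) (suc j))
geo2ₚ-flat N i j e es = cong (λ c → if c ∧ vecEq es (Vec.map (nth es i ℕ.*_) (Vec.zipWith ℕ._+_ (unitV N i) (unitV N j))) then + 1 else + 0)
  (cong (suc e ≡ᵇ_) (ℕₚ.*-zeroʳ (nth es i)))

-- When `i` is the first variable, the coefficient of its power `suc e` is `x_j` times that of its
-- power `e`; earlier variables do not occur and are stripped off.
geo2ₚ-inverse : ∀ N i j → i < j → j < N → geo2ₚ N i j ≐ constₚ (+ 1) +ₚ (varₚ N i *ₚ (varₚ N j *ₚ geo2ₚ N i j))
geo2ₚ-inverse (suc N) zero (suc j) _ (s≤s j<N) (zero ∷ es) = trans
  (trans (geo2ₚ-0 N j 0 es) (trans (cong (λ v → monoₚ v es) (sym (replicate-tabV N 0))) (monoₚ-0 es)))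
  (sym (trans (cong (ℤ._+_ (constₚ (+ 1) es)) (varₚ-0-zero _ es)) (ℤₚ.+-identityʳ _)))
geo2ₚ-inverse (suc N) zero (suc j) _ (s≤s j<N) (suc e ∷ es) = sym (trans (ℤₚ.+-identityˡ _)
  (trans (varₚ-0 (varₚ (suc N) (suc j) *ₚ geo2ₚ (suc N) 0 (suc j)) e es)
  (trans (varₚ-suc j (geo2ₚ (suc N) 0 (suc j)) e es)
  (trans (MulLaws.cong* (mulLaws N) (λ es′ → cong (λ v → monoₚ v es′) (unitV-tabV N j)) (geo2ₚ-0 N j e) es)
  (trans (monoₚ-+ N (δ j) (λ t → e ℕ.* δ j t) es) (sym (geo2ₚ-0 N j (suc e) es)))))))
geo2ₚ-inverse (suc N) (suc i) (suc j) (s≤s i<j) (s≤s j<N) (zero ∷ es) = trans (geo2ₚ-suc N i j es)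
  (trans (geo2ₚ-inverse N i j i<j j<N es) (cong (ℤ._+_ (constₚ (+ 1) es)) (sym
    (trans (varₚ-suc i (varₚ (suc N) (suc j) *ₚ geo2ₚ (suc N) (suc i) (suc j)) 0 es)
      (MulLaws.cong* (mulLaws N) {f = varₚ N i} (λ _ → refl) (λ es′ → trans (varₚ-suc j (geo2ₚ (suc N) (suc i) (suc j)) 0 es′)
        (MulLaws.cong* (mulLaws N) {f = varₚ N j} (λ _ → refl) (geo2ₚ-suc N i j) es′)) es)))))
geo2ₚ-inverse (suc N) (suc i) (suc j) (s≤s i<j) (s≤s j<N) (suc e ∷ es) = trans (geo2ₚ-flat N i j e es) (sym
  (trans (ℤₚ.+-identityˡ _) (trans (varₚ-suc i (varₚ (suc N) (suc j) *ₚ geo2ₚ (suc N) (suc i) (suc j)) (suc e) es)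
    (trans (MulLaws.cong* (mulLaws N) {f = varₚ N i} (λ _ → refl) (λ es′ → trans (varₚ-suc j (geo2ₚ (suc N) (suc i) (suc j)) (suc e) es′)
        (trans (MulLaws.cong* (mulLaws N) {f = varₚ N j} (λ _ → refl) (λ es″ → trans (geo2ₚ-flat N i j e es″) (sym (constₚ-0 es″))) es′)
          (CommutativeRing.zeroʳ (psRing N) (varₚ N j) es′))) es)
      (trans (CommutativeRing.zeroʳ (psRing N) (varₚ N i) es) (constₚ-0 es))))))

module Conv² (R : CommutativeRing 0ℓ 0ℓ) where
  open RingKit R
  open Conv R

  conv² : (ℕ → ℕ → Carrier) → (ℕ → ℕ → Carrier) → ℕ → ℕ → Carrier
  conv² f g zero    a = conv (f 0) (g 0) a
  conv² f g (suc b) a = conv (f 0) (g (suc b)) a + conv² (f ∘ suc) g b a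

  conv²-zero : ∀ f g b → conv² f g b 0 ≈ conv (λ i → f i 0) (λ i → g i 0) b
  conv²-zero f g zero    = ≈-refl
  conv²-zero f g (suc b) = +-congˡ (conv²-zero (f ∘ suc) g b)

  conv²-suc : ∀ f g b a → conv² f g b (suc a) ≈ conv (λ i → f i 0) (λ i → g i (suc a)) b + conv² (λ i j → f i (suc j)) g b a
  conv²-suc f g zero    a = ≈-refl
  conv²-suc f g (suc b) a = ≈-trans (+-congˡ (conv²-suc (f ∘ suc) g b a))
    (solve 4 (λ x y z w → (x :+ y) :+ (z :+ w) := (x :+ z) :+ (y :+ w)) ≈-refl _ _ _ _)

  -- Interchange of two sums. Series are arrays in their first two exponents, and exchanging these
  -- variables transposes the arrays, so this makes the exchange multiplicative.
  conv²-transpose : ∀ f g b a → conv² f g b a ≈ conv² (λ j i → f i j) (λ j i → g i j) a b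
  conv²-transpose f g b zero    = conv²-zero f g b
  conv²-transpose f g b (suc a) = ≈-trans (conv²-suc f g b a) (+-congˡ (conv²-transpose (λ i j → f i (suc j)) g b a))

swapV : ∀ {N} → ℕ → Vec ℕ N → Vec ℕ N
swapV zero    []          = []
swapV zero    (a ∷ [])    = a ∷ []
swapV zero    (a ∷ b ∷ e) = b ∷ a ∷ e
swapV (suc s) []          = []
swapV (suc s) (a ∷ e)     = a ∷ swapV s e

swapₚ : ∀ {N} → ℕ → PS N → PS N
swapₚ s F e = F (swapV s e)

module _ {N : ℕ} where
  private
    module C₁ = Conv (psRing (suc N))
    module C₀ = Conv (psRing N)
  open Conv² (psRing N)

  conv-conv² : ∀ (f g : ℕ → PS (suc N)) b a es → C₁.conv f g b (a ∷ es) ≡ conv² (λ i → cur (f i)) (λ i → cur (g i)) b a es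
  conv-conv² f g zero    a es = *ₚ-cons (f 0) (g 0) a es
  conv-conv² f g (suc b) a es = cong₂ ℤ._+_ (*ₚ-cons (f 0) (g (suc b)) a es) (conv-conv² (f ∘ suc) g b a es)

  swapₚ-head : ∀ (F G : PS (suc (suc N))) → swapₚ 0 (F *ₚ G) ≐ swapₚ 0 F *ₚ swapₚ 0 G
  swapₚ-head F G (a ∷ b ∷ es) = begin
    (F *ₚ G) (b ∷ a ∷ es)                              ≡⟨ *ₚ-cons F G b (a ∷ es) ⟩
    C₁.conv (cur F) (cur G) b (a ∷ es)                 ≡⟨ conv-conv² (cur F) (cur G) b a es ⟩
    conv² (λ i → cur (cur F i)) (λ i → cur (cur G i)) b a es
      ≡⟨ conv²-transpose (λ i → cur (cur F i)) (λ i → cur (cur G i)) b a es ⟩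
    conv² (λ j i → cur (cur F i) j) (λ j i → cur (cur G i) j) a b es
      ≡⟨ conv-conv² (cur (swapₚ 0 F)) (cur (swapₚ 0 G)) a b es ⟨
    C₁.conv (cur (swapₚ 0 F)) (cur (swapₚ 0 G)) a (b ∷ es) ≡⟨ *ₚ-cons (swapₚ 0 F) (swapₚ 0 G) a (b ∷ es) ⟨
    (swapₚ 0 F *ₚ swapₚ 0 G) (a ∷ b ∷ es)              ∎
    where open ≡.≡-Reasoning

swapₚ-* : ∀ {N} s (F G : PS N) → swapₚ s (F *ₚ G) ≐ swapₚ s F *ₚ swapₚ s G
swapₚ-* zero    F G []          = refl
swapₚ-* zero    F G (a ∷ [])    = trans (*ₚ-cons F G a []) (trans (Conv.conv-cong (psRing 0) (λ { i [] → refl }) (λ { i [] → refl }) a []) (sym (*ₚ-cons (swapₚ 0 F) (swapₚ 0 G) a [])))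
swapₚ-* zero    F G (a ∷ b ∷ e) = swapₚ-head F G (a ∷ b ∷ e)
swapₚ-* (suc s) F G []          = refl
swapₚ-* {suc N} (suc s) F G (a ∷ e) = trans (*ₚ-cons F G a (swapV s e)) (trans (go (cur F) (cur G) a) (sym (*ₚ-cons (swapₚ (suc s) F) (swapₚ (suc s) G) a e)))
  where
  open Conv (psRing N)
  go : ∀ (f g : ℕ → PS N) a → conv f g a (swapV s e) ≡ conv (λ i → swapₚ s (f i)) (λ i → swapₚ s (g i)) a e
  go f g zero    = swapₚ-* s (f 0) (g 0) e
  go f g (suc a) = cong₂ ℤ._+_ (swapₚ-* s (f 0) (g (suc a)) e) (go (f ∘ suc) g a)

isZeroV-swap : ∀ {N} s (e : Vec ℕ N) → isZeroV (swapV s e) ≡ isZeroV e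
isZeroV-swap zero    []          = refl
isZeroV-swap zero    (a ∷ [])    = refl
isZeroV-swap zero    (a ∷ b ∷ e) with a ≡ᵇ 0 | b ≡ᵇ 0
... | true  | true  = refl
... | true  | false = refl
... | false | true  = refl
... | false | false = refl
isZeroV-swap (suc s) []          = refl
isZeroV-swap (suc s) (a ∷ e)     = cong ((a ≡ᵇ 0) ∧_) (isZeroV-swap s e)

vecEq-swap : ∀ {N} s (u e : Vec ℕ N) → vecEq u (swapV s e) ≡ vecEq (swapV s u) e
vecEq-swap zero    []          []          = refl
vecEq-swap zero    (a ∷ [])    (b ∷ [])    = refl
vecEq-swap zero    (a ∷ c ∷ u) (b ∷ d ∷ e) with a ≡ᵇ d | c ≡ᵇ b
... | true  | true  = refl
... | true  | false = refl
... | false | true  = refl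
... | false | false = refl
vecEq-swap (suc s) []          []          = refl
vecEq-swap (suc s) (a ∷ u)     (b ∷ e)     = cong ((a ≡ᵇ b) ∧_) (vecEq-swap s u e)

swapV-replicate : ∀ N s (x : ℕ) → swapV s (Vec.replicate N x) ≡ Vec.replicate N x
swapV-replicate zero          zero    x = refl
swapV-replicate (suc zero)    zero    x = refl
swapV-replicate (suc (suc N)) zero    x = refl
swapV-replicate zero          (suc s) x = refl
swapV-replicate (suc N)       (suc s) x = cong (x ∷_) (swapV-replicate N s x)

swapV-unit-left : ∀ N s → suc s < N → swapV s (unitV N s) ≡ unitV N (suc s)
swapV-unit-left (suc (suc N)) zero    _         = refl
swapV-unit-left (suc N)       (suc s) (s≤s s<N) = cong (0 ∷_) (swapV-unit-left N s s<N)

swapV-unit-right : ∀ N s → suc s < N → swapV s (unitV N (suc s)) ≡ unitV N s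
swapV-unit-right (suc (suc N)) zero    _         = refl
swapV-unit-right (suc N)       (suc s) (s≤s s<N) = cong (0 ∷_) (swapV-unit-right N s s<N)

swapV-unit-other : ∀ N s i → i ≢ s → i ≢ suc s → swapV s (unitV N i) ≡ unitV N i
swapV-unit-other zero          zero    i             p q = refl
swapV-unit-other (suc zero)    zero    zero          p q = refl
swapV-unit-other (suc zero)    zero    (suc i)       p q = refl
swapV-unit-other (suc (suc N)) zero    zero          p q = ⊥-elim (p refl)
swapV-unit-other (suc (suc N)) zero    (suc zero)    p q = ⊥-elim (q refl)
swapV-unit-other (suc (suc N)) zero    (suc (suc i)) p q = refl
swapV-unit-other zero          (suc s) i             p q = refl
swapV-unit-other (suc N)       (suc s) zero          p q = cong (1 ∷_) (swapV-replicate N s 0)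
swapV-unit-other (suc N)       (suc s) (suc i)       p q = cong (0 ∷_) (swapV-unit-other N s i (p ∘ cong suc) (q ∘ cong suc))

swapₚ-var : ∀ N s i j → swapV s (unitV N i) ≡ unitV N j → swapₚ s (varₚ N i) ≐ varₚ N j
swapₚ-var N s i j eq e = cong (λ c → if c then + 1 else + 0) (trans (vecEq-swap s (unitV N i) e) (cong (λ u → vecEq u e) eq))

-- Degrees in a single variable

DegV : ∀ {N} → ℕ → ℕ → PS N → Set
DegV p d F = ∀ e → d < nth e p → F e ≡ + 0

module _ {N : ℕ} where
  open Conv (psRing N)

  conv-degree : ∀ (f g : ℕ → PS N) d d′ → (∀ i → d < i → ∀ es → f i es ≡ + 0) → (∀ i → d′ < i → ∀ es → g i es ≡ + 0) →
    ∀ e → d ℕ.+ d′ < e → ∀ es → conv f g e es ≡ + 0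
  conv-degree f g d d′ p q (suc e) lt es = cong₂ ℤ._+_
    (trans (MulLaws.cong* (mulLaws N) {f = f 0} (λ _ → refl) (0-cur {f = λ _ → g (suc e)} (λ _ → q (suc e) (≤-<-trans (m≤n+m d′ d) lt)) 0) es)
      (trans (CommutativeRing.zeroʳ (psRing N) (f 0) es) (constₚ-0 es)))
    (tail d p lt)
    where
    tail : ∀ d → (∀ i → d < i → ∀ es → f i es ≡ + 0) → d ℕ.+ d′ < suc e → conv (f ∘ suc) g e es ≡ + 0
    tail zero    p lt = trans (conv-zero (f ∘ suc) g (0-cur (λ i → p (suc i) (s≤s z≤n))) e es) (constₚ-0 es)
    tail (suc d) p lt = conv-degree (f ∘ suc) g d d′ (λ i d<i → p (suc i) (s≤s d<i)) q e (≤-pred lt) es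

DegV-* : ∀ {N} p d d′ (F G : PS N) → DegV p d F → DegV p d′ G → DegV p (d ℕ.+ d′) (F *ₚ G)
DegV-* {zero}  p       d d′ F G dF dG [] ()
DegV-* {suc N} zero    d d′ F G dF dG (e ∷ es) lt = trans (*ₚ-cons F G e es)
  (conv-degree (cur F) (cur G) d d′ (λ i d<i es → dF (i ∷ es) d<i) (λ i d<i es → dG (i ∷ es) d<i) e lt es)
DegV-* {suc N} (suc p) d d′ F G dF dG (e ∷ es) lt = trans (*ₚ-cons F G e es) (go (cur F) (cur G) (λ i es → dF (i ∷ es)) (λ i es → dG (i ∷ es)) e)
  where
  open Conv (psRing N)
  go : ∀ (f g : ℕ → PS N) → (∀ i → DegV p d (f i)) → (∀ i → DegV p d′ (g i)) → ∀ e → conv f g e es ≡ + 0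
  go f g df dg zero    = DegV-* p d d′ (f 0) (g 0) (df 0) (dg 0) es lt
  go f g df dg (suc e) = cong₂ ℤ._+_ (DegV-* p d d′ (f 0) (g (suc e)) (df 0) (dg (suc e)) es lt) (go (f ∘ suc) g (df ∘ suc) dg e)

DegV-mono : ∀ {N} p d (u : Vec ℕ N) → nth u p ≤ d → DegV p d (monoₚ u)
DegV-mono p d u u≤d e lt with vecEq u e in eq
... | false = refl
... | true  = ⊥-elim (<⇒≱ lt (subst (λ v → nth v p ≤ d) (vecEq-sound u e eq) u≤d))

DegV-1 : ∀ {N} p → DegV p 0 (constₚ {N} (+ 1))
DegV-1 {N} p e lt = trans (sym (monoₚ-0 e)) (DegV-mono p 0 (Vec.replicate N 0) (≤-reflexive (nth-zeros N p)) e lt)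
  where
  nth-zeros : ∀ N p → nth (Vec.replicate N 0) p ≡ 0
  nth-zeros zero    p       = refl
  nth-zeros (suc N) zero    = refl
  nth-zeros (suc N) (suc p) = nth-zeros N p

nth-unitV : ∀ N i p → nth (unitV N i) p ≤ δ i p
nth-unitV zero    i       p       = z≤n
nth-unitV (suc N) zero    zero    = ≤-refl
nth-unitV (suc N) zero    (suc p) = zeros N p
  where
  zeros : ∀ N p → nth (Vec.replicate N 0) p ≤ 0
  zeros zero    p       = z≤n
  zeros (suc N) zero    = z≤n
  zeros (suc N) (suc p) = zeros N p
nth-unitV (suc N) (suc i) zero    = z≤n
nth-unitV (suc N) (suc i) (suc p) = nth-unitV N i p

nth-map : ∀ {N} c (u : Vec ℕ N) p → nth (Vec.map (c ℕ.*_) u) p ≡ c ℕ.* nth u p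
nth-map c []      p       = sym (ℕₚ.*-zeroʳ c)
nth-map c (a ∷ u) zero    = refl
nth-map c (a ∷ u) (suc p) = nth-map c u p

δ-≢ : ∀ i p → p ≢ i → δ i p ≡ 0
δ-≢ i p ne = cong (λ c → if c then 1 else 0) (≡ᵇ-false ne)

δ≤1 : ∀ i p → δ i p ≤ 1
δ≤1 i p with p ≡ᵇ i
... | true  = ≤-refl
... | false = z≤n

DegV-inv1p : ∀ N i p → p ≢ i → DegV p 0 (inv1pₚ N i)
DegV-inv1p N i p ne e lt with vecEq e (Vec.map (nth e i ℕ.*_) (unitV N i)) in eq
... | false = refl
... | true  = ⊥-elim (<⇒≱ lt (≤-trans (≤-reflexive (trans (cong (λ v → nth v p) (vecEq-sound e _ eq)) (nth-map (nth e i) (unitV N i) p)))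
    (≤-trans (*-monoʳ-≤ (nth e i) (≤-trans (nth-unitV N i p) (≤-reflexive (δ-≢ i p ne)))) (≤-reflexive (ℕₚ.*-zeroʳ (nth e i))))))

varₚ-kill : ∀ {N} i t (H : PS N) → (∀ e → nth e i < t → H e ≡ + 0) → i < N → ∀ e → nth e i < suc t → (varₚ N i *ₚ H) e ≡ + 0
varₚ-kill {suc N} zero    t H h _         (zero ∷ es)  lt = varₚ-0-zero H es
varₚ-kill {suc N} zero    t H h _         (suc e ∷ es) lt = trans (varₚ-0 H e es) (h (e ∷ es) (≤-pred lt))
varₚ-kill {suc N} (suc i) t H h (s≤s i<N) (e ∷ es)     lt = trans (varₚ-suc i H e es) (varₚ-kill i t (cur H e) (λ es → h (e ∷ es)) i<N es lt)

constₚ-* : ∀ {N} c (F : PS N) e → (constₚ c *ₚ F) e ≡ c ℤ.* F e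
constₚ-* c F []       = ℤₚ.+-identityʳ _
constₚ-* c F (e ∷ es) = trans (*ₚ-flat (constₚ c) F (λ _ _ → refl) e es) (constₚ-* c (cur F e) es)

module Signs (R : CommutativeRing 0ℓ 0ℓ) where
  open RingKit R
  open Products R

  sg : ℕ → Carrier
  sg zero    = 1#
  sg (suc t) = - sg t

  sg-+ : ∀ s t → sg (s ℕ.+ t) ≈ sg s * sg t
  sg-+ zero    t = ≈-sym (*-identityˡ _)
  sg-+ (suc s) t = ≈-trans (-‿cong (sg-+ s t)) (-‿distribˡ-* _ _)

  sg-double : ∀ t → sg (t ℕ.+ t) ≈ 1#
  sg-double zero    = ≈-refl
  sg-double (suc t) = ≈-trans (-‿cong (≈-trans (reflexive (cong sg (+-suc t t))) (-‿cong (sg-double t)))) (-‿involutive 1#)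

  neg-^ : ∀ x t → (- x) ^ t ≈ sg t * x ^ t
  neg-^ x zero    = ≈-sym (*-identityˡ 1#)
  neg-^ x (suc t) = ≈-trans (*-congˡ (neg-^ x t)) (solve 3 (λ x s y → (:- x) :* (s :* y) := (:- s) :* (x :* y)) ≈-refl x (sg t) (x ^ t))

  sumℕ : ℕ → ℕ → (ℕ → ℕ) → ℕ
  sumℕ a zero    h = 0
  sumℕ a (suc l) h = h a ℕ.+ sumℕ (suc a) l h

  sumℕ-const : ∀ a l c → sumℕ a l (λ _ → c) ≡ l ℕ.* c
  sumℕ-const a zero    c = refl
  sumℕ-const a (suc l) c = cong (c ℕ.+_) (sumℕ-const (suc a) l c)

nth-++ : ∀ n c (v : Vec ℕ 2) p → p < n → nth (Vec.replicate n c Vec.++ v) p ≡ c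
nth-++ (suc n) c v zero    _         = refl
nth-++ (suc n) c v (suc p) (s≤s p<n) = nth-++ n c v p p<n

swapV-top : ∀ n c (v : Vec ℕ 2) s → suc s < n → swapV s (Vec.replicate n c Vec.++ v) ≡ Vec.replicate n c Vec.++ v
swapV-top (suc (suc n)) c v zero    _         = refl
swapV-top (suc n)       c v (suc s) (s≤s s<n) = cong (c ∷_) (swapV-top n c v s s<n)

negOnePowℕ-square : ∀ t → negOnePowℕ t ℤ.* negOnePowℕ t ≡ + 1
negOnePowℕ-square t = trans (sym (negOnePowℕ-+ t t)) (negOnePowℕ-double t)

vecEq-++ : ∀ n c (u v : Vec ℕ 2) → vecEq (Vec.replicate n c Vec.++ u) (Vec.replicate n c Vec.++ v) ≡ vecEq u v
vecEq-++ zero    c u v = refl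
vecEq-++ (suc n) c u v = trans (cong (_∧ vecEq (Vec.replicate n c Vec.++ u) (Vec.replicate n c Vec.++ v)) (≡ᵇ-refl c)) (vecEq-++ n c u v)

tabV-++ : ∀ {A : Set} n (c : A) (f : ℕ → A) → (∀ j → j < n → f j ≡ c) → tabV (n ℕ.+ 2) f ≡ Vec.replicate n c Vec.++ (f n ∷ f (suc n) ∷ [])
tabV-++ zero    c f p = refl
tabV-++ (suc n) c f p = cong₂ _∷_ (p 0 (s≤s z≤n)) (tabV-++ n c (f ∘ suc) (λ j j<n → p (suc j) (s≤s j<n)))

-- The ring of formal power series as a setting

module Instance (n C a b : ℕ) where
  N : ℕ
  N = n ℕ.+ 2

  open RingKit (psRing N)
  open Products (psRing N)
  open Signs (psRing N)

  n<N : ∀ {i} → i < n → i < N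
  n<N i<n = <-≤-trans i<n (m≤m+n n 2)

  top : Vec ℕ N
  top = Vec.replicate n C Vec.++ (a ∷ b ∷ [])

  -- The indices of the paper run from 1 to n; outside this range X i is 0.
  X I : ℕ → Carrier
  X zero    = 0#
  X (suc i) with i ℕ.<? n
  ... | yes _ = - varₚ N i
  ... | no _  = 0#
  I zero    = 1#
  I (suc i) with i ℕ.<? n
  ... | yes _ = inv1pₚ N i
  ... | no _  = 1#

  -- Sorting the indices makes the inverse available for both orders, while `geo2ₚ-inverse` asks for
  -- `i < j`.
  geo : ℕ → ℕ → Carrier
  geo i j with i ℕ.<? n | j ℕ.<? n | i ℕ.<? j
  ... | yes _ | yes _ | yes _ = geo2ₚ N i j
  ... | yes _ | yes _ | no _  = geo2ₚ N j i
  ... | _     | _     | _     = 1#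

  g : ℕ → ℕ → Carrier
  g zero    _       = 1#
  g (suc i) zero    = 1#
  g (suc i) (suc j) = geo i j

  P Q : Carrier
  P = varₚ N n
  Q = varₚ N (suc n)

  -- Each of the `n` variables contributes `(-1) ^ C` when a coefficient in `x i` is read as a
  -- coefficient in `X i = - x i`.
  κ : Carrier → ℤ
  κ F = negOnePowℕ (n ℕ.* C) ℤ.* F top

  -- Exchanges are numbered from 1, like the `X i`; the identity is a default value that satisfies
  -- the laws required of every index.
  σ : ℕ → Carrier → Carrier
  σ zero    F = F
  σ (suc s) F = swapₚ s F

  -- Index 0 belongs to no variable. The trivial predicate satisfies the rules for degrees there,
  -- and `κ-Deg` asks for `1 ≤ p`.
  Deg : ℕ → ℕ → Carrier → Set
  Deg zero    d F = ⊤
  Deg (suc p) d F = DegV p d F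

  X-in : ∀ i → i < n → X (suc i) ≡ - varₚ N i
  X-in i i<n with i ℕ.<? n
  ... | yes _  = refl
  ... | no i≮n = ⊥-elim (i≮n i<n)

  I-in : ∀ i → i < n → I (suc i) ≡ inv1pₚ N i
  I-in i i<n with i ℕ.<? n
  ... | yes _  = refl
  ... | no i≮n = ⊥-elim (i≮n i<n)

  g-in : ∀ i j → i < j → j < n → g (suc i) (suc j) ≡ geo2ₚ N i j
  g-in i j i<j j<n with i ℕ.<? n | j ℕ.<? n | i ℕ.<? j
  ... | yes _  | yes _  | yes _  = refl
  ... | yes _  | yes _  | no i≮j = ⊥-elim (i≮j i<j)
  ... | yes _  | no j≮n | _      = ⊥-elim (j≮n j<n)
  ... | no i≮n | _      | _      = ⊥-elim (i≮n (<-trans i<j j<n))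

  private
    drop-0 : ∀ x y → x ≈ 0# → (1# - x) * y ≈ y
    drop-0 x y p = ≈-trans (*-congʳ {x = y} (+-congˡ {x = 1#} (-‿cong p)))
      (solve 1 (λ y → (con (+ 1) :- con (+ 0)) :* y := y) ≈-refl y)

    X-inverse : ∀ i → (1# - X i) * I i ≈ 1#
    X-inverse zero    = drop-0 0# 1# ≈-refl
    X-inverse (suc i) with i ℕ.<? n
    ... | yes i<n = ≈-trans (solve 2 (λ v j → (con (+ 1) :- (:- v)) :* j := j :+ v :* j) ≈-refl (varₚ N i) (inv1pₚ N i)) (inv1pₚ-inverse N i (n<N i<n))
    ... | no _    = drop-0 0# 1# ≈-refl

    pair : ∀ i j → i < j → j < n → (1# - (- varₚ N i) * (- varₚ N j)) * geo2ₚ N i j ≈ 1#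
    pair i j i<j j<n = ≈-trans (solve 3 (λ x y t → (con (+ 1) :- (:- x) :* (:- y)) :* t := t :- x :* (y :* t)) ≈-refl (varₚ N i) (varₚ N j) (geo2ₚ N i j))
      (≈-trans (+-congʳ {x = - (varₚ N i * (varₚ N j * geo2ₚ N i j))} (geo2ₚ-inverse N i j i<j (n<N j<n)))
        (solve 1 (λ x → con (+ 1) :+ x :- x := con (+ 1)) ≈-refl (varₚ N i * (varₚ N j * geo2ₚ N i j))))

    XX-inverse : ∀ i j → i ≢ j → (1# - X i * X j) * g i j ≈ 1#
    XX-inverse zero    j       _ = drop-0 (0# * X j) 1# (zeroˡ (X j))
    XX-inverse (suc i) zero    _ = drop-0 (X (suc i) * 0#) 1# (zeroʳ (X (suc i)))
    XX-inverse (suc i) (suc j) i≢j with i ℕ.<? n | j ℕ.<? n | i ℕ.<? j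
    ... | yes i<n | yes j<n | yes i<j = pair i j i<j j<n
    ... | yes i<n | yes j<n | no i≮j  = ≈-trans (*-congʳ {x = geo2ₚ N j i} (+-congˡ {x = 1#} (-‿cong (*-comm (- varₚ N i) (- varₚ N j)))))
      (pair j i (≤∧≢⇒< (≮⇒≥ i≮j) (i≢j ∘ cong suc ∘ sym)) i<n)
    ... | yes _   | no _    | _       = drop-0 (- varₚ N i * 0#) 1# (zeroʳ (- varₚ N i))
    ... | no _    | yes _   | _       = drop-0 (0# * - varₚ N j) 1# (zeroˡ (- varₚ N j))
    ... | no _    | no _    | _       = drop-0 (0# * 0#) 1# (zeroˡ 0#)

    power-kill : ∀ i t x → i < n → ∀ e → nth e i < t → ((- varₚ N i) ^ t * x) e ≡ + 0
    power-kill i (suc t) x i<n e lt = trans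
      (solve 3 (λ v y x → (:- v) :* y :* x := :- (v :* (y :* x))) ≈-refl (varₚ N i) ((- varₚ N i) ^ t) x e)
      (cong ℤ.-_ (varₚ-kill i t ((- varₚ N i) ^ t * x) (power-kill i t x i<n) (n<N i<n) e lt))

    κ-X : ∀ p x → 1 ≤ p → p ≤ n → κ (X p ^ suc C * x) ≡ + 0
    κ-X (suc i) x _ i<n with i ℕ.<? n
    ... | yes _  = trans (cong (ℤ._*_ (negOnePowℕ (n ℕ.* C))) (power-kill i (suc C) x i<n top (≤-reflexive (cong suc (nth-++ n C (a ∷ b ∷ []) i i<n)))))
      (ℤₚ.*-zeroʳ (negOnePowℕ (n ℕ.* C)))
    ... | no i≮n = ⊥-elim (i≮n i<n)

    σ-cong : ∀ s {x y} → x ≈ y → σ s x ≈ σ s y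
    σ-cong zero    p e = p e
    σ-cong (suc s) p e = p (swapV s e)

    σ-+ : ∀ s x y → σ s (x + y) ≈ σ s x + σ s y
    σ-+ zero    x y e = refl
    σ-+ (suc s) x y e = refl

    σ-* : ∀ s x y → σ s (x * y) ≈ σ s x * σ s y
    σ-* zero    x y e = refl
    σ-* (suc s) x y   = swapₚ-* s x y

    σ-neg : ∀ s x → σ s (- x) ≈ - σ s x
    σ-neg zero    x e = refl
    σ-neg (suc s) x e = refl

    σ-const : ∀ s c → σ s (constₚ c) ≈ constₚ c
    σ-const zero    c e = refl
    σ-const (suc s) c e = cong (λ z → if z then c else + 0) (isZeroV-swap s e)

    σ-X : ∀ s i → 1 ≤ s → s < n → σ s (X i) ≈ X (τ s i)
    σ-X (suc s) zero    _ s<n = ≈-trans (σ-const (suc s) (+ 0)) (reflexive (cong X (sym (τ-other (suc s) 0 (λ ()) (λ ())))))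
    σ-X (suc s) (suc i) _ s<n = by-cases (i ℕ.≟ s) (i ℕ.≟ suc s)
      where
      moved : ∀ i j → i < n → j < n → swapV s (unitV N i) ≡ unitV N j → σ (suc s) (X (suc i)) ≈ X (suc j)
      moved i j i<n j<n eq = ≈-trans (reflexive (cong (σ (suc s)) (X-in i i<n)))
        (≈-trans {σ (suc s) (- varₚ N i)} (-‿cong (swapₚ-var N s i j eq)) (reflexive (sym (X-in j j<n))))
      s<n′ : s < n
      s<n′ = <-trans (n<1+n s) s<n
      by-cases : Dec (i ≡ s) → Dec (i ≡ suc s) → σ (suc s) (X (suc i)) ≈ X (τ (suc s) (suc i))
      by-cases (yes refl) _          = ≈-trans (moved s (suc s) s<n′ s<n (swapV-unit-left N s (n<N s<n))) (reflexive (cong X (sym (τ-left (suc s)))))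
      by-cases (no _)     (yes refl) = ≈-trans (moved (suc s) s s<n s<n′ (swapV-unit-right N s (n<N s<n))) (reflexive (cong X (sym (τ-right (suc s)))))
      by-cases (no p)     (no q)     = ≈-trans fixed (reflexive (cong X (sym (τ-other (suc s) (suc i) (p ∘ suc-injective) (q ∘ suc-injective)))))
        where
        fixed : σ (suc s) (X (suc i)) ≈ X (suc i)
        fixed with i ℕ.<? n
        ... | yes _ = -‿cong (swapₚ-var N s i i (swapV-unit-other N s i p q))
        ... | no _  = σ-const (suc s) (+ 0)

    σ-var : ∀ s i → s < n → n ≤ i → σ s (varₚ N i) ≈ varₚ N i
    σ-var zero    i s<n n≤i e = refl
    σ-var (suc s) i s<n n≤i   = swapₚ-var N s i i (swapV-unit-other N s i
      (λ { refl → <⇒≱ (<-trans (n<1+n s) s<n) n≤i }) (λ { refl → <⇒≱ s<n n≤i }))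

    κ-σ : ∀ s x → 1 ≤ s → s < n → κ (σ s x) ≡ κ x
    κ-σ (suc s) x _ s<n = cong (λ e → negOnePowℕ (n ℕ.* C) ℤ.* x e) (swapV-top n C (a ∷ b ∷ []) s s<n)

    Deg-cong : ∀ {p d x y} → x ≈ y → Deg p d x → Deg p d y
    Deg-cong {zero}  eq h      = tt
    Deg-cong {suc p} eq h e lt = trans (sym (eq e)) (h e lt)

    Deg-≤ : ∀ {p d e x} → d ≤ e → Deg p d x → Deg p e x
    Deg-≤ {zero}  d≤e h      = tt
    Deg-≤ {suc p} d≤e h e lt = h e (≤-<-trans d≤e lt)

    Deg-+ : ∀ {p d x y} → Deg p d x → Deg p d y → Deg p d (x + y)
    Deg-+ {zero}  h k      = tt
    Deg-+ {suc p} h k e lt = cong₂ ℤ._+_ (h e lt) (k e lt)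

    Deg-neg : ∀ {p d x} → Deg p d x → Deg p d (- x)
    Deg-neg {zero}  h      = tt
    Deg-neg {suc p} h e lt = cong ℤ.-_ (h e lt)

    Deg-* : ∀ {p d e x y} → Deg p d x → Deg p e y → Deg p (d ℕ.+ e) (x * y)
    Deg-* {zero}                  h k = tt
    Deg-* {suc p} {d} {e} {x} {y} h k = DegV-* p d e x y h k

    Deg-1 : ∀ {p} → Deg p 0 1#
    Deg-1 {zero}  = tt
    Deg-1 {suc p} = DegV-1 p

    Deg-0 : ∀ p d → Deg p d 0#
    Deg-0 zero    d      = tt
    Deg-0 (suc p) d e lt = constₚ-0 e

    Deg-X : ∀ p → Deg p 1 (X p)
    Deg-X zero = tt
    Deg-X (suc p) with p ℕ.<? n
    ... | yes _ = Deg-neg {suc p} {1} {varₚ N p} (DegV-mono p 1 (unitV N p) (≤-trans (nth-unitV N p p) (δ≤1 p p)))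
    ... | no _  = Deg-0 (suc p) 1

    DegV-var : ∀ p q → p ≢ q → DegV p 0 (varₚ N q)
    DegV-var p q ne = DegV-mono p 0 (unitV N q) (≤-trans (nth-unitV N q p) (≤-reflexive (δ-≢ q p ne)))

    Deg-X-≢ : ∀ {p q} → p ≢ q → Deg p 0 (X q)
    Deg-X-≢ {zero}          ne = tt
    Deg-X-≢ {suc p} {zero}  ne = Deg-0 (suc p) 0
    Deg-X-≢ {suc p} {suc q} ne with q ℕ.<? n
    ... | yes _ = Deg-neg {suc p} {0} {varₚ N q} (DegV-var p q (ne ∘ cong suc))
    ... | no _  = Deg-0 (suc p) 0

    Deg-I-≢ : ∀ {p q} → p ≢ q → Deg p 0 (I q)
    Deg-I-≢ {zero}          ne = tt
    Deg-I-≢ {suc p} {zero}  ne = DegV-1 p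
    Deg-I-≢ {suc p} {suc q} ne with q ℕ.<? n
    ... | yes _ = DegV-inv1p N q p (ne ∘ cong suc)
    ... | no _  = DegV-1 p

    Deg-var : ∀ {p} i → p ≤ n → n ≤ i → Deg p 0 (varₚ N i)
    Deg-var {zero}  i p≤n n≤i = tt
    Deg-var {suc p} i p≤n n≤i = DegV-var p i (λ { refl → <⇒≱ p≤n n≤i })

    κ-Deg : ∀ {p d x} → 1 ≤ p → p ≤ n → d < C → Deg p d x → κ x ≡ + 0
    κ-Deg {suc p} _ p<n d<C h = trans (cong (ℤ._*_ (negOnePowℕ (n ℕ.* C))) (h top (subst (_ <_) (sym (nth-++ n C (a ∷ b ∷ []) p p<n)) d<C)))
      (ℤₚ.*-zeroʳ (negOnePowℕ (n ℕ.* C)))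

  setting : Setting n C
  setting = record
    { series = psRing N ; X = X ; I = I ; g = g ; P = P ; Q = Q
    ; X-inverse = X-inverse ; XX-inverse = XX-inverse
    ; κ = κ ; κ-cong = λ p → cong (ℤ._*_ (negOnePowℕ (n ℕ.* C))) (p top)
    ; κ-+ = λ x y → ℤₚ.*-distribˡ-+ (negOnePowℕ (n ℕ.* C)) (x top) (y top)
    ; κ-neg = λ x → sym (ℤₚ.neg-distribʳ-* (negOnePowℕ (n ℕ.* C)) (x top))
    ; κ-X = κ-X
    ; σ = σ ; σ-cong = σ-cong ; σ-+ = σ-+ ; σ-* = σ-* ; σ-neg = σ-neg ; σ-1 = λ s → σ-const s (+ 1)
    ; σ-X = σ-X ; σ-P = λ s s<n → σ-var s n s<n ≤-refl ; σ-Q = λ s s<n → σ-var s (suc n) s<n (n≤1+n n)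
    ; κ-σ = κ-σ
    ; Deg = Deg
    ; Deg-cong = λ {p} {d} {x} {y} → Deg-cong {p} {d} {x} {y}
    ; Deg-≤ = λ {p} {d} {e} {x} → Deg-≤ {p} {d} {e} {x}
    ; Deg-+ = λ {p} {d} {x} {y} → Deg-+ {p} {d} {x} {y}
    ; Deg-neg = λ {p} {d} {x} → Deg-neg {p} {d} {x}
    ; Deg-* = λ {p} {d} {e} {x} {y} → Deg-* {p} {d} {e} {x} {y}
    ; Deg-1 = λ {p} → Deg-1 {p} ; Deg-X = Deg-X
    ; Deg-X-≢ = λ {p} {q} → Deg-X-≢ {p} {q} ; Deg-I-≢ = λ {p} {q} → Deg-I-≢ {p} {q}
    ; Deg-P = λ {p} p≤n → Deg-var {p} n p≤n ≤-refl ; Deg-Q = λ {p} p≤n → Deg-var {p} (suc n) p≤n (n≤1+n n)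
    ; κ-Deg = λ {p} {d} {x} → κ-Deg {p} {d} {x}
    }

  sg-const : ∀ t → sg t ≈ constₚ (negOnePowℕ t)
  sg-const zero    e = refl
  sg-const (suc t) e = trans (cong ℤ.-_ (sg-const t e)) (neg-if (isZeroV e))
    where
    neg-if : ∀ c → ℤ.- (if c then negOnePowℕ t else + 0) ≡ (if c then ℤ.- negOnePowℕ t else + 0)
    neg-if true  = refl
    neg-if false = refl

  κ-sg : ∀ F → κ (sg (n ℕ.* C) * F) ≡ F top
  κ-sg F = trans (cong (ℤ._*_ (negOnePowℕ (n ℕ.* C))) (trans (*-congʳ {x = F} (sg-const (n ℕ.* C)) top) (constₚ-* (negOnePowℕ (n ℕ.* C)) F top)))
    (trans (sym (ℤₚ.*-assoc (negOnePowℕ (n ℕ.* C)) (negOnePowℕ (n ℕ.* C)) (F top))) (trans (cong (ℤ._* F top) (negOnePowℕ-square (n ℕ.* C))) (ℤₚ.*-identityˡ (F top))))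

  var-^ : ∀ i t → varₚ N i ^ t ≈ monoₚ (tabV N (λ j → t ℕ.* δ i j))
  var-^ i zero    = ≈-trans (≈-sym monoₚ-0) (λ e → cong (λ u → monoₚ u e) (replicate-tabV N 0))
  var-^ i (suc t) = ≈-trans (*-cong (λ e → cong (λ u → monoₚ u e) (unitV-tabV N i)) (var-^ i t)) (monoₚ-+ N (δ i) (λ j → t ℕ.* δ i j))

  -- The exponent of variable `j` in `∏ x_i ^ h i` over `a ≤ i < a + l`, in the form in which
  -- multiplying out the monomials yields it.
  exponents : ℕ → ℕ → (ℕ → ℕ) → ℕ → ℕ
  exponents a zero    h j = 0
  exponents a (suc l) h j = h a ℕ.* δ a j ℕ.+ exponents (suc a) l h j

  exponents-out : ∀ a l h j → j < a ⊎ a ℕ.+ l ≤ j → exponents a l h j ≡ 0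
  exponents-out a zero    h j out = refl
  exponents-out a (suc l) h j out = cong₂ ℕ._+_ (trans (cong (h a ℕ.*_) (δ-≢ a j (ne out))) (ℕₚ.*-zeroʳ (h a))) (exponents-out (suc a) l h j (next out))
    where
    ne : j < a ⊎ a ℕ.+ suc l ≤ j → j ≢ a
    ne (inj₁ p) refl = <-irrefl refl p
    ne (inj₂ p) refl = <⇒≱ (m<m+n a (s≤s z≤n)) p
    next : j < a ⊎ a ℕ.+ suc l ≤ j → j < suc a ⊎ suc a ℕ.+ l ≤ j
    next (inj₁ p) = inj₁ (<-trans p (n<1+n a))
    next (inj₂ p) = inj₂ (subst (_≤ j) (+-suc a l) p)

  exponents-in : ∀ a l h j → a ≤ j → j < a ℕ.+ l → exponents a l h j ≡ h j
  exponents-in a zero    h j a≤j j< = ⊥-elim (<⇒≱ (subst (j <_) (ℕₚ.+-identityʳ a) j<) a≤j)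
  exponents-in a (suc l) h j a≤j j< with a ℕ.≟ j
  ... | yes refl = trans (cong₂ ℕ._+_ (trans (cong (λ c → h a ℕ.* (if c then 1 else 0)) (≡ᵇ-refl a)) (ℕₚ.*-identityʳ (h a))) (exponents-out (suc a) l h a (inj₁ (n<1+n a)))) (ℕₚ.+-identityʳ (h a))
  ... | no a≢j   = cong₂ ℕ._+_ (trans (cong (h a ℕ.*_) (δ-≢ a j (a≢j ∘ sym))) (ℕₚ.*-zeroʳ (h a)))
    (exponents-in (suc a) l h j (≤∧≢⇒< a≤j a≢j) (subst (j <_) (+-suc a l) j<))

  Π-X-mono : ∀ a l h → a ℕ.+ l ≤ n → Π (suc a) l (λ p → X p ^ h (p ∸ 1)) ≈ sg (sumℕ a l h) * monoₚ (tabV N (exponents a l h))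
  Π-X-mono a zero    h a≤ = ≈-trans (≈-trans (≈-sym monoₚ-0) (λ e → cong (λ u → monoₚ u e) (replicate-tabV N 0))) (≈-sym (*-identityˡ _))
  Π-X-mono a (suc l) h a≤ = begin
    X (suc a) ^ h a * Π (suc (suc a)) l (λ p → X p ^ h (p ∸ 1))
      ≈⟨ *-cong (≈-trans (reflexive (cong (_^ h a) (X-in a a<n))) (≈-trans (neg-^ (varₚ N a) (h a)) (*-congˡ {x = sg (h a)} (var-^ a (h a)))))
           (Π-X-mono (suc a) l h (subst (_≤ n) (+-suc a l) a≤)) ⟩
    sg (h a) * monoₚ u * (sg (sumℕ (suc a) l h) * monoₚ w)
      ≈⟨ solve 4 (λ s u t w → s :* u :* (t :* w) := s :* t :* (u :* w)) ≈-refl (sg (h a)) (monoₚ u) (sg (sumℕ (suc a) l h)) (monoₚ w) ⟩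
    sg (h a) * sg (sumℕ (suc a) l h) * (monoₚ u * monoₚ w)
      ≈⟨ *-cong (≈-sym (sg-+ (h a) (sumℕ (suc a) l h))) (monoₚ-+ N (λ j → h a ℕ.* δ a j) (exponents (suc a) l h)) ⟩
    sg (sumℕ a (suc l) h) * monoₚ (tabV N (exponents a (suc l) h)) ∎
    where
    u = tabV N (λ j → h a ℕ.* δ a j)
    w = tabV N (exponents (suc a) l h)
    a<n : a < n
    a<n = <-≤-trans (m<m+n a (s≤s z≤n)) a≤

  κ-monomial : ∀ u v → κ (P ^ u * Q ^ v * Π 1 n (λ p → X p ^ C)) ≡ ifℤ ((u ≡ᵇ a) ∧ (v ≡ᵇ b)) (+ 1)
  κ-monomial u v = trans (cong (ℤ._*_ (negOnePowℕ (n ℕ.* C))) (collect top)) (trans (κ-sg (monoₚ (tabV N f))) (cong (λ c → if c then + 1 else + 0)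
    (trans (cong (λ w → vecEq w top) f-top) (trans (vecEq-++ n C (u ∷ v ∷ []) (a ∷ b ∷ [])) (cong ((u ≡ᵇ a) ∧_) (∧-identityʳ (v ≡ᵇ b)))))))
    where
    E : ℕ → ℕ
    E = exponents 0 n (λ _ → C)
    f : ℕ → ℕ
    f j = u ℕ.* δ n j ℕ.+ v ℕ.* δ (suc n) j ℕ.+ E j
    δ-refl : ∀ i → δ i i ≡ 1
    δ-refl i = cong (λ c → if c then 1 else 0) (≡ᵇ-refl i)
    collect : P ^ u * Q ^ v * Π 1 n (λ p → X p ^ C) ≈ sg (n ℕ.* C) * monoₚ (tabV N f)
    collect = begin
      P ^ u * Q ^ v * Π 1 n (λ p → X p ^ C)
        ≈⟨ *-cong (≈-trans (*-cong (var-^ n u) (var-^ (suc n) v)) (monoₚ-+ N (λ j → u ℕ.* δ n j) (λ j → v ℕ.* δ (suc n) j)))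
             (≈-trans (Π-X-mono 0 n (λ _ → C) ≤-refl) (*-congʳ {x = monoₚ (tabV N E)} (reflexive (cong sg (sumℕ-const 0 n C))))) ⟩
      monoₚ (tabV N h) * (sg (n ℕ.* C) * monoₚ (tabV N E))
        ≈⟨ solve 3 (λ x s y → x :* (s :* y) := s :* (x :* y)) ≈-refl (monoₚ (tabV N h)) (sg (n ℕ.* C)) (monoₚ (tabV N E)) ⟩
      sg (n ℕ.* C) * (monoₚ (tabV N h) * monoₚ (tabV N E))
        ≈⟨ *-congˡ {x = sg (n ℕ.* C)} (monoₚ-+ N h E) ⟩
      sg (n ℕ.* C) * monoₚ (tabV N f) ∎
      where
      h = λ j → u ℕ.* δ n j ℕ.+ v ℕ.* δ (suc n) j
    below : ∀ j → j < n → f j ≡ C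
    below j j<n = cong₂ ℕ._+_ (cong₂ ℕ._+_ (trans (cong (u ℕ.*_) (δ-≢ n j (λ { refl → <-irrefl refl j<n }))) (ℕₚ.*-zeroʳ u))
        (trans (cong (v ℕ.*_) (δ-≢ (suc n) j (λ { refl → <-irrefl refl (<-trans (n<1+n n) j<n) }))) (ℕₚ.*-zeroʳ v)))
      (exponents-in 0 n (λ _ → C) j z≤n j<n)
    at-P : f n ≡ u
    at-P = trans (cong₂ ℕ._+_ (cong₂ ℕ._+_ (trans (cong (u ℕ.*_) (δ-refl n)) (ℕₚ.*-identityʳ u))
        (trans (cong (v ℕ.*_) (δ-≢ (suc n) n (1+n≢n ∘ sym))) (ℕₚ.*-zeroʳ v))) (exponents-out 0 n (λ _ → C) n (inj₂ ≤-refl)))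
      (trans (ℕₚ.+-identityʳ _) (ℕₚ.+-identityʳ u))
    at-Q : f (suc n) ≡ v
    at-Q = trans (cong₂ ℕ._+_ (cong₂ ℕ._+_ (trans (cong (u ℕ.*_) (δ-≢ n (suc n) 1+n≢n)) (ℕₚ.*-zeroʳ u))
        (trans (cong (v ℕ.*_) (δ-refl (suc n))) (ℕₚ.*-identityʳ v))) (exponents-out 0 n (λ _ → C) (suc n) (inj₂ (n≤1+n n))))
      (ℕₚ.+-identityʳ v)
    f-top : tabV N f ≡ Vec.replicate n C Vec.++ (u ∷ v ∷ [])
    f-top = trans (tabV-++ n C f below) (cong (λ w → Vec.replicate n C Vec.++ w) (cong₂ (λ x y → x ∷ y ∷ []) at-P at-Q))

-- The integrand of the theorem in terms of the path variables

module Paper (m n k₀ : ℕ) (k≤n : suc k₀ ≤ n) (S : Setting n (m ℕ.+ 2 ℕ.* n)) where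
  open Setting S
  open RingKit series
  open Products series
  open Signs series
  open BottomRow m n k₀ k≤n S

  private
    k = suc k₀

  -- The variables of the paper are x i = - X i.
  x : ℕ → Carrier
  x i = - X i

  xP xQ : ℕ → Carrier
  xP i = x i - P * (1# + x i)
  xQ i = x i - Q * (1# + x i)

  -- The factors of the integrand without their monomials in `x`. In `bodyA` the denominators are
  -- cleared by `x r ⋯ x n`: `1 + 1 / x r` becomes `1 + x r`, and `1 / x j - x r` becomes
  -- `1 - x j * x r`. A factor `1#` is what remains of a power of `x i`.
  bodyA bodyB bodyC bodyD bodyE body : Carrier
  bodyA = sg k * Q * (1# + x r) * Π (suc r) k₀ (λ j → 1# - x j * x r) + Π r k x
  bodyB = Π 1 q (λ i → I i ^ (i ℕ.+ k) * 1# * xP i * xQ i)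
  bodyC = Π r k (λ i → I i ^ (n ℕ.+ 1) * 1# * xP i)
  bodyD = pairsΠ 1 n (λ i j → (x i - x j) * (x i + x j + x i * x j))
  bodyE = pairsΠ r k g
  body  = bodyA * bodyB * bodyC * bodyD * bodyE

  private
    q+k : q ℕ.+ k ≡ n
    q+k = m∸n+n≡m k≤n

    split-n : ∀ f → Π 1 n f ≈ Π 1 q f * Π r k f
    split-n f = ≈-trans (reflexive (cong (λ t → Π 1 t f) (sym q+k))) (Π-split 1 q k f)

    Π-neg : ∀ a l f → Π a l (λ i → - f i) ≈ sg l * Π a l f
    Π-neg a zero    f = ≈-sym (*-identityˡ 1#)
    Π-neg a (suc l) f = ≈-trans (*-congˡ (Π-neg (suc a) l f)) (solve 3 (λ x s y → (:- x) :* (s :* y) := (:- s) :* (x :* y)) ≈-refl (f a) (sg l) (Π (suc a) l f))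

    sg-square : ∀ t → sg t * sg t ≈ 1#
    sg-square t = ≈-trans (≈-sym (sg-+ t t)) (sg-double t)

    A-eq : Q * ((1# - X r) * Π (suc r) k₀ (factor r)) + Π r k X ≈ sg k * bodyA
    A-eq = begin
      Q * ((1# - X r) * F) + Π r k X
        ≈⟨ +-cong (≈-sym (*-identityˡ _)) (≈-sym (*-identityˡ _)) ⟩
      1# * (Q * ((1# - X r) * F)) + 1# * Π r k X
        ≈⟨ +-cong (*-congʳ (≈-sym (sg-square k))) (*-congʳ (≈-sym (sg-square k))) ⟩
      sg k * sg k * (Q * ((1# - X r) * F)) + sg k * sg k * Π r k X
        ≈⟨ solve 5 (λ s q x f y → s :* s :* (q :* ((con (+ 1) :- x) :* f)) :+ s :* s :* y := s :* (s :* q :* (con (+ 1) :+ (:- x)) :* f :+ s :* y)) ≈-refl (sg k) Q (X r) F (Π r k X) ⟩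
      sg k * (sg k * Q * (1# + x r) * F + sg k * Π r k X)
        ≈⟨ *-congˡ (+-cong (*-congˡ (Π-cong′ (suc r) k₀ (λ j → solve 2 (λ x y → con (+ 1) :- x :* y := con (+ 1) :- (:- y) :* (:- x)) ≈-refl (X r) (X j))))
             (≈-sym (Π-neg r k X))) ⟩
      sg k * bodyA ∎
      where F = Π (suc r) k₀ (factor r)

    I-cancel : ∀ p t → (1# - X p) ^ t * I p ^ t ≈ 1#
    I-cancel p t = ≈-trans (≈-sym (*-^ (1# - X p) (I p) t)) (≈-trans (^-cong t (X-inverse p)) (1^ t))

    -- The power of `1 - X p` in `dead n p` reduces `I p ^ n` to `I p ^ (p + k)`. The factors with
    -- `P` and with `Q` both change sign when written in `x p`, and the signs cancel.
    B-factor : ∀ p → p ≤ q → 1 ≤ p → dead n p * (I p ^ n * (α p * X p ^ 0)) ≈ X p ^ suc p * (I p ^ (p ℕ.+ k) * 1# * xP p * xQ p)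
    B-factor p p≤q 1≤p = begin
      X p ^ suc p * (1# - X p) ^ t * (X p + Q * (1# - X p)) * (I p ^ n * (α p * 1#))
        ≈⟨ *-congˡ (*-congʳ (≈-trans (reflexive (cong (I p ^_) (sym (m∸n+n≡m (≤∸⇒+≤ p n k 1≤p p≤q))))) (^-+ (I p) t (p ℕ.+ k)))) ⟩
      X p ^ suc p * (1# - X p) ^ t * (X p + Q * (1# - X p)) * (I p ^ t * I p ^ (p ℕ.+ k) * (α p * 1#))
        ≈⟨ solve* 6 (λ y o b i j a → y ⊗ o ⊗ b ⊗ (i ⊗ j ⊗ a) ⊜ (o ⊗ i) ⊗ (y ⊗ (j ⊗ (b ⊗ a)))) ≈-refl
             (X p ^ suc p) ((1# - X p) ^ t) (X p + Q * (1# - X p)) (I p ^ t) (I p ^ (p ℕ.+ k)) (α p * 1#) ⟩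
      (1# - X p) ^ t * I p ^ t * (X p ^ suc p * (I p ^ (p ℕ.+ k) * ((X p + Q * (1# - X p)) * (α p * 1#))))
        ≈⟨ *-cong (I-cancel p t) (*-congˡ (solve 4 (λ x P Q j → j :* ((x :+ Q :* (con (+ 1) :- x)) :* ((x :+ P :* (con (+ 1) :- x)) :* con (+ 1)))
              := j :* con (+ 1) :* ((:- x) :- P :* (con (+ 1) :+ (:- x))) :* ((:- x) :- Q :* (con (+ 1) :+ (:- x)))) ≈-refl (X p) P Q (I p ^ (p ℕ.+ k)))) ⟩
      1# * (X p ^ suc p * (I p ^ (p ℕ.+ k) * 1# * xP p * xQ p))
        ≈⟨ *-identityˡ _ ⟩
      X p ^ suc p * (I p ^ (p ℕ.+ k) * 1# * xP p * xQ p) ∎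
      where t = n ∸ (p ℕ.+ k)

    -- Only the factor with `P` changes sign here, so the product over the `k` present paths has the
    -- sign `sg k`, which cancels against that of `A-eq`. The extra `I p` comes from the unfolding
    -- of the bottom row.
    C-factor : ∀ p → X p ^ (1 ℕ.+ p) * (I p * (I p ^ n * (α p * X p ^ 0))) ≈ X p ^ suc p * - (I p ^ (n ℕ.+ 1) * 1# * xP p)
    C-factor p = *-congˡ (≈-trans (solve 4 (λ i j x P → i :* (j :* ((x :+ P :* (con (+ 1) :- x)) :* con (+ 1)))
        := :- (i :* j :* con (+ 1) :* ((:- x) :- P :* (con (+ 1) :+ (:- x))))) ≈-refl (I p) (I p ^ n) (X p) P)
      (-‿cong (*-congʳ (*-congʳ (reflexive (cong (I p ^_) (ℕₚ.+-comm 1 n)))))))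

    B-eq : Π 1 q (dead n) * (Π 1 q (λ p → I p ^ n) * Π 1 q (λ p → α p * X p ^ 0)) ≈ Π 1 q (λ p → X p ^ suc p) * bodyB
    B-eq = ≈-trans (*-congˡ (≈-sym (Π-* 1 q _ _))) (≈-trans (≈-sym (Π-* 1 q _ _))
      (≈-trans (Π-cong 1 q (λ p 1≤p p<r → B-factor p (≤-pred p<r) 1≤p)) (Π-* 1 q _ _)))

    C-eq : Π r k (λ p → X p ^ (1 ℕ.+ p)) * (Π r k I * (Π r k (λ p → I p ^ n) * Π r k (λ p → α p * X p ^ 0))) ≈ Π r k (λ p → X p ^ suc p) * (sg k * bodyC)
    C-eq = ≈-trans (*-congˡ (≈-trans (*-congˡ (≈-sym (Π-* r k _ _))) (≈-sym (Π-* r k _ _)))) (≈-trans (≈-sym (Π-* r k _ _))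
      (≈-trans (Π-cong′ r k C-factor) (≈-trans (Π-* r k _ _) (*-congˡ (Π-neg r k _)))))

    D-eq : V n ≈ bodyD
    D-eq = pairsΠ-cong 1 n (λ i j _ _ _ → solve 2 (λ x y → (x :- y) :* (x :+ y :- x :* y) := ((:- x) :- (:- y)) :* ((:- x) :+ (:- y) :+ (:- x) :* (:- y))) ≈-refl (X i) (X j))

    regroup : ∀ d a y s g i₁ i₂ α₁ α₂ v → d * (a * (y * (s * g)) * (i₁ * i₂ * (α₁ * α₂ * v * 1#))) ≈ a * (d * (i₁ * α₁)) * (y * (s * (i₂ * α₂))) * v * g
    regroup d a y s g i₁ i₂ α₁ α₂ v = ≈-trans (*-congˡ (*-congˡ (*-congˡ (*-identityʳ _))))
      (solve* 10 (λ d a y s g i₁ i₂ α₁ α₂ v → d ⊗ (a ⊗ (y ⊗ (s ⊗ g)) ⊗ (i₁ ⊗ i₂ ⊗ (α₁ ⊗ α₂ ⊗ v))) ⊜ a ⊗ (d ⊗ (i₁ ⊗ α₁)) ⊗ (y ⊗ (s ⊗ (i₂ ⊗ α₂))) ⊗ v ⊗ g) ≈-refl d a y s g i₁ i₂ α₁ α₂ v)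

    assemble : ∀ s a m₁ b m₂ c d e → s * a * (m₁ * b) * (m₂ * (s * c)) * d * e ≈ s * s * (m₁ * m₂) * (a * b * c * d * e)
    assemble s a m₁ b m₂ c d e = solve* 8 (λ s a m₁ b m₂ c d e → s ⊗ a ⊗ (m₁ ⊗ b) ⊗ (m₂ ⊗ (s ⊗ c)) ⊗ d ⊗ e ⊜ s ⊗ s ⊗ (m₁ ⊗ m₂) ⊗ (a ⊗ b ⊗ c ⊗ d ⊗ e)) ≈-refl s a m₁ b m₂ c d e

  bottomSeries-body : bottomSeries ≈ Π 1 n (λ p → X p ^ suc p) * body
  bottomSeries-body = begin
    Π 1 q (dead n) * ((Q * ((1# - X r) * Π (suc r) k₀ (factor r)) + Π r k X) * (Π r k (λ i → X i ^ (1 ℕ.+ i)) * (Π r k I * bodyE))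
      * (Π 1 n (λ p → I p ^ n) * (Π 1 n (λ p → α p * X p ^ 0) * V n * 1#)))
      ≈⟨ *-congˡ (*-congˡ (*-cong (split-n _) (*-congʳ (*-congʳ (split-n _))))) ⟩
    Π 1 q (dead n) * ((Q * ((1# - X r) * Π (suc r) k₀ (factor r)) + Π r k X) * (Π r k (λ i → X i ^ (1 ℕ.+ i)) * (Π r k I * bodyE))
      * (Π 1 q (λ p → I p ^ n) * Π r k (λ p → I p ^ n) * (Π 1 q (λ p → α p * X p ^ 0) * Π r k (λ p → α p * X p ^ 0) * V n * 1#)))
      ≈⟨ regroup _ _ _ _ _ _ _ _ _ _ ⟩
    (Q * ((1# - X r) * Π (suc r) k₀ (factor r)) + Π r k X)
      * (Π 1 q (dead n) * (Π 1 q (λ p → I p ^ n) * Π 1 q (λ p → α p * X p ^ 0)))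
      * (Π r k (λ i → X i ^ (1 ℕ.+ i)) * (Π r k I * (Π r k (λ p → I p ^ n) * Π r k (λ p → α p * X p ^ 0)))) * V n * bodyE
      ≈⟨ *-congʳ (*-cong (*-cong (*-cong A-eq B-eq) C-eq) D-eq) ⟩
    sg k * bodyA * (Π 1 q (λ p → X p ^ suc p) * bodyB) * (Π r k (λ p → X p ^ suc p) * (sg k * bodyC)) * bodyD * bodyE
      ≈⟨ assemble _ _ _ _ _ _ _ _ ⟩
    sg k * sg k * (Π 1 q (λ p → X p ^ suc p) * Π r k (λ p → X p ^ suc p)) * body
      ≈⟨ *-congʳ (≈-trans (*-cong (sg-square k) (≈-sym (split-n _))) (*-identityˡ _)) ⟩
    Π 1 n (λ p → X p ^ suc p) * body ∎

-- Laurent series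

sumZ : ℕ → ℕ → (ℕ → ℤ) → ℤ
sumZ a zero    h = + 0
sumZ a (suc l) h = h a ℤ.+ sumZ (suc a) l h

sumZ-out : ∀ a l h → (∀ i → a ≤ i → i < a ℕ.+ l → h i ≡ + 0) → sumZ a l h ≡ + 0
sumZ-out a zero    h p = refl
sumZ-out a (suc l) h p = cong₂ ℤ._+_ (p a ≤-refl (m<m+n a (s≤s z≤n)))
  (sumZ-out (suc a) l h (λ i a<i i< → p i (<⇒≤ a<i) (subst (i <_) (sym (+-suc a l)) i<)))

sumZ-in : ∀ a l h j → a ≤ j → j < a ℕ.+ l → (∀ i → a ≤ i → i ≢ j → h i ≡ + 0) → sumZ a l h ≡ h j
sumZ-in a zero    h j a≤j j< p = ⊥-elim (<⇒≱ (subst (j <_) (ℕₚ.+-identityʳ a) j<) a≤j)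
sumZ-in a (suc l) h j a≤j j< p with a ℕ.≟ j
... | yes refl = trans (cong (ℤ._+_ (h a)) (sumZ-out (suc a) l h (λ i a<i _ → p i (<⇒≤ a<i) (λ { refl → <-irrefl refl a<i })))) (ℤₚ.+-identityʳ (h a))
... | no a≢j   = trans (cong₂ ℤ._+_ (p a ≤-refl a≢j) (sumZ-in (suc a) l h j (≤∧≢⇒< a≤j a≢j) (subst (j <_) (+-suc a l) j<) (λ i a<i → p i (<⇒≤ a<i)))) (ℤₚ.+-identityˡ (h j))

module Represent (N : ℕ) where
  open Laurent N
  open RingKit (psRing N)
  open Products (psRing N)
  open Signs (psRing N)

  -- A is x^f · F, where f lists the exponents of the shift.
  record _▷_,_ (A : LS N) (f : ℕ → ℤ) (F : PS N) : Set where
    constructor rep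
    field
      shift : sh A ≡ tabV N f
      series : bd A ≐ F
  infix 3 _▷_,_

  rep-cong : ∀ {A f f′ F F′} → A ▷ f , F → (∀ j → f j ≡ f′ j) → F ≐ F′ → A ▷ f′ , F′
  rep-cong (rep s b) p q = rep (trans s (tabV-cong N (λ j _ → p j))) (≈-trans b q)

  rep-series : ∀ {A f F F′} → A ▷ f , F → F ≐ F′ → A ▷ f , F′
  rep-series (rep s b) q = rep s (≈-trans b q)

  rep-* : ∀ {A B f g F G} → A ▷ f , F → B ▷ g , G → A *L B ▷ (λ j → f j ℤ.+ g j) , F * G
  rep-* {f = f} {g} (rep s b) (rep s′ b′) = rep (trans (cong₂ (Vec.zipWith ℤ._+_) s s′) (zipWith-tabV ℤ._+_ N f g)) (*-cong b b′)

  rep-neg : ∀ {A f F} → A ▷ f , F → -L A ▷ f , - F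
  rep-neg (rep s b) = rep s (-‿cong b)

  rep-fromPS : ∀ F → fromPS F ▷ (λ _ → + 0) , F
  rep-fromPS F = rep (replicate-tabV N (+ 0)) (λ _ → refl)

  rep-const : ∀ c → constL c ▷ (λ _ → + 0) , constₚ c
  rep-const c = rep-fromPS (constₚ c)

  rep-one : oneL ▷ (λ _ → + 0) , 1#
  rep-one = rep-const (+ 1)

  rep-xpow : ∀ i z → varPowL i z ▷ (λ j → + δ i j ℤ.* z) , 1#
  rep-xpow i z = rep (trans (cong (Vec.map (λ u → + u ℤ.* z)) (unitV-tabV N i)) (map-tabV (λ u → + u ℤ.* z) N (δ i))) (λ _ → refl)

  mono : (ℕ → ℕ) → PS N
  mono u = monoₚ (tabV N u)

  mono-0 : ∀ u → (∀ j → u j ≡ 0) → mono u ≈ 1#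
  mono-0 u p = ≈-trans (λ e → cong (λ w → monoₚ w e) (trans (tabV-cong N (λ j _ → p j)) (sym (replicate-tabV N 0)))) monoₚ-0

  -- The sum starts at the smaller shift in every variable; `u` and `v` are the exponents of the
  -- monomials that compensate each summand.
  rep-+ : ∀ {A B f g F G} h u v → A ▷ f , F → B ▷ g , G → (∀ j → f j ℤ.⊓ g j ≡ h j) → (∀ j → ℤ.∣ f j ℤ.- h j ∣ ≡ u j) → (∀ j → ℤ.∣ g j ℤ.- h j ∣ ≡ v j) →
    A +L B ▷ h , mono u * F + mono v * G
  rep-+ {A} {B} {f} {g} {F} {G} h u v (rep s b) (rep s′ b′) ph pu pv = rep min (+-cong (shifted {bd A} s b u pu) (shifted {bd B} s′ b′ v pv))
    where
    min : Vec.zipWith ℤ._⊓_ (sh A) (sh B) ≡ tabV N h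
    min = trans (cong₂ (Vec.zipWith ℤ._⊓_) s s′) (trans (zipWith-tabV ℤ._⊓_ N f g) (tabV-cong N (λ j _ → ph j)))
    shifted : ∀ {H c w} {K : PS N} → w ≡ tabV N c → H ≐ K → ∀ d → (∀ j → ℤ.∣ c j ℤ.- h j ∣ ≡ d j) →
      shiftₚ (Vec.zipWith (λ a b → ℤ.∣ a ℤ.- b ∣) w (Vec.zipWith ℤ._⊓_ (sh A) (sh B))) H ≐ mono d * K
    shifted {H} {c} eq q d p e = trans
      (cong (λ w → shiftₚ w H e) (trans (cong₂ (Vec.zipWith (λ a b → ℤ.∣ a ℤ.- b ∣)) eq min) (trans (zipWith-tabV _ N c h) (tabV-cong N (λ j _ → p j)))))
      (trans (sym (monoₚ-* (tabV N d) H e)) (*-congˡ {x = mono d} q e))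

  rep-+-same : ∀ {A B f F G} → A ▷ f , F → B ▷ f , G → A +L B ▷ f , F + G
  rep-+-same {f = f} {F} {G} a b = rep-series
    (rep-+ f (λ _ → 0) (λ _ → 0) a b (λ j → ℤₚ.⊓-idem (f j)) (λ j → cong ℤ.∣_∣ (ℤₚ.+-inverseʳ (f j))) (λ j → cong ℤ.∣_∣ (ℤₚ.+-inverseʳ (f j))))
    (+-cong (≈-trans (*-congʳ {x = F} (mono-0 _ (λ _ → refl))) (*-identityˡ F)) (≈-trans (*-congʳ {x = G} (mono-0 _ (λ _ → refl))) (*-identityˡ G)))

  rep-pow : ∀ {A F} t → A ▷ (λ _ → + 0) , F → powL A t ▷ (λ _ → + 0) , F ^ t
  rep-pow zero    a = rep-one
  rep-pow (suc t) a = rep-* a (rep-pow t a)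

  rep-prod : ∀ a l (f : ℕ → LS N) (h : ℕ → ℕ → ℤ) (F : ℕ → PS N) → (∀ i → a ≤ i → i < a ℕ.+ l → f i ▷ h i , F i) →
    prodL (iota a l) f ▷ (λ j → sumZ a l (λ i → h i j)) , Π a l F
  rep-prod a zero    f h F p = rep-one
  rep-prod a (suc l) f h F p = rep-* (p a ≤-refl (m<m+n a (s≤s z≤n)))
    (rep-prod (suc a) l f h F (λ i a<i i< → p i (<⇒≤ a<i) (subst (i <_) (sym (+-suc a l)) i<)))

  rep-row : ∀ i s l ys (f : ℕ × ℕ → LS N) (F : ℕ → PS N) {G} → (∀ j → s ≤ j → j < s ℕ.+ l → f (i , j) ▷ (λ _ → + 0) , F j) →
    prodL ys f ▷ (λ _ → + 0) , G → prodL (map (λ j → (i , j)) (iota s l) ++ ys) f ▷ (λ _ → + 0) , Π s l F * G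
  rep-row i s zero    ys f F {G} p q = rep-series q (≈-sym (*-identityˡ G))
  rep-row i s (suc l) ys f F {G} p q = rep-series
    (rep-* (p s ≤-refl (m<m+n s (s≤s z≤n)))
      (rep-row i (suc s) l ys f F (λ j s<j j< → p j (<⇒≤ s<j) (subst (j <_) (sym (+-suc s l)) j<)) q))
    (≈-sym (*-assoc (F s) (Π (suc s) l F) G))

  rep-pairs : ∀ a l b (f : ℕ × ℕ → LS N) (F : ℕ → ℕ → PS N) → suc b ≡ a ℕ.+ l →
    (∀ i j → a ≤ i → i < j → j ≤ b → f (i , j) ▷ (λ _ → + 0) , F i j) →
    prodL (concatMap (λ i → map (λ j → (i , j)) (range (suc i) b)) (iota a l)) f ▷ (λ _ → + 0) , pairsΠ a l F
  rep-pairs a zero    b f F eq p = rep-one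
  rep-pairs a (suc l) b f F eq p = subst (λ js → prodL (map (λ j → (a , j)) js ++ concatMap (λ i → map (λ j → (i , j)) (range (suc i) b)) (iota (suc a) l)) f ▷ (λ _ → + 0) , pairsΠ a (suc l) F)
    (sym (trans (range-iota (suc a) b) (cong (iota (suc a)) b∸a)))
    (rep-row a (suc a) l _ f (F a) (λ j a<j j< → p a j ≤-refl a<j (≤-pred (subst (j <_) (sym eq′) j<)))
      (rep-pairs (suc a) l b f F eq′ (λ i j a<i → p i j (<⇒≤ a<i))))
    where
    eq′ : suc b ≡ suc a ℕ.+ l
    eq′ = trans eq (+-suc a l)
    b∸a : b ∸ a ≡ l
    b∸a = trans (cong (_∸ suc a) eq′) (m+n∸m≡n (suc a) l)

toNatV-tabV : ∀ N e → toNatV (tabV N (λ j → + e j)) ≡ just (tabV N e)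
toNatV-tabV zero    e = refl
toNatV-tabV (suc N) e rewrite toNatV-tabV N (e ∘ suc) = refl

coeffL-▷ : ∀ {N A f F} → Represent._▷_,_ N A f F → ∀ t e → (∀ j → j < N → t j ℤ.- f j ≡ + e j) → Laurent.coeffL N A (tabV N t) ≡ F (tabV N e)
coeffL-▷ {N} {s ⊙ B} {f} {F} (Represent.rep sh≡ bd≡) t e p
  rewrite trans (cong (Vec.zipWith ℤ._-_ (tabV N t)) sh≡) (trans (zipWith-tabV ℤ._-_ N t f) (tabV-cong N p)) | toNatV-tabV N e = bd≡ (tabV N e)

-- The exponent enters only through its absolute value, which increases for non-negative `z` and
-- decreases for negative `z`; the parity changes in either case.
negOnePowℤ-suc : ∀ z → negOnePowℤ (z ℤ.+ + 1) ≡ ℤ.- negOnePowℤ z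
negOnePowℤ-suc (+ n)          = cong negOnePowℕ (ℕₚ.+-comm n 1)
negOnePowℤ-suc -[1+ zero ]    = refl
negOnePowℤ-suc -[1+ suc n ]   = sym (ℤₚ.neg-involutive _)

negOnePowℤ-+ : ∀ z t → negOnePowℤ (z ℤ.+ + t) ≡ negOnePowℤ z ℤ.* negOnePowℕ t
negOnePowℤ-+ z zero    = trans (cong negOnePowℤ (ℤₚ.+-identityʳ z)) (sym (ℤₚ.*-identityʳ _))
negOnePowℤ-+ z (suc t) = begin
  negOnePowℤ (z ℤ.+ + suc t)              ≡⟨ cong negOnePowℤ (trans (cong (λ u → z ℤ.+ + u) (ℕₚ.+-comm 1 t)) (sym (ℤₚ.+-assoc z (+ t) (+ 1)))) ⟩
  negOnePowℤ (z ℤ.+ + t ℤ.+ + 1)          ≡⟨ negOnePowℤ-suc (z ℤ.+ + t) ⟩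
  ℤ.- negOnePowℤ (z ℤ.+ + t)              ≡⟨ cong ℤ.-_ (negOnePowℤ-+ z t) ⟩
  ℤ.- (negOnePowℤ z ℤ.* negOnePowℕ t)     ≡⟨ ℤₚ.neg-distribʳ-* (negOnePowℤ z) (negOnePowℕ t) ⟩
  negOnePowℤ z ℤ.* negOnePowℕ (suc t)     ∎
  where open ≡.≡-Reasoning

-- `2 + 3 + ⋯ + (n + 1)`, the degree of `∏ X p ^ (p + 1)`.
sumTo : ℕ → ℕ
sumTo zero    = 0
sumTo (suc n) = sumTo n ℕ.+ (n ℕ.+ 2)

sumTo-binomial : ∀ n → sumTo n ≡ (suc n Comb.C 2) ℕ.+ n
sumTo-binomial zero    = refl
sumTo-binomial (suc n) = begin
  sumTo n ℕ.+ (n ℕ.+ 2)                   ≡⟨ cong (ℕ._+ (n ℕ.+ 2)) (sumTo-binomial n) ⟩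
  (suc n Comb.C 2) ℕ.+ n ℕ.+ (n ℕ.+ 2)         ≡⟨ rearrange (suc n Comb.C 2) n ⟩
  (suc n ℕ.+ (suc n Comb.C 2)) ℕ.+ suc n       ≡⟨ cong (λ t → (t ℕ.+ (suc n Comb.C 2)) ℕ.+ suc n) (sym (Comb.nC1≡n (suc n))) ⟩
  ((suc n Comb.C 1) ℕ.+ (suc n Comb.C 2)) ℕ.+ suc n ≡⟨ cong (ℕ._+ suc n) (Comb.nCk+nC[k+1]≡[n+1]C[k+1] (suc n) 1) ⟩
  (suc (suc n) Comb.C 2) ℕ.+ suc n             ∎
  where
  open ≡.≡-Reasoning
  rearrange : ∀ c n → c ℕ.+ n ℕ.+ (n ℕ.+ 2) ≡ (suc n ℕ.+ c) ℕ.+ suc n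
  rearrange = solve-∀

-- The sign of the paper cancels against the signs of ∏ x_i^(i+1) and of the extracted monomial.
sign-cancels : ∀ m n → negOnePowℤ (((+ m) ℤ.- (+ 1)) ℤ.* (+ n) ℤ.+ (+ (suc n Comb.C 2))) ≡ negOnePowℕ (n ℕ.* (m ℕ.+ 2 ℕ.* n)) ℤ.* negOnePowℕ (sumTo n)
sign-cancels m n = begin
  negOnePowℤ Z                                                       ≡⟨ sym (ℤₚ.*-identityʳ _) ⟩
  -- The exponents agree only modulo 2. Adding `n + n` removes the summand `- n` from the left one
  -- and makes it a natural number; adding `n * n + n * n` then makes both equal.
  negOnePowℤ Z ℤ.* + 1                                               ≡⟨ cong (ℤ._*_ (negOnePowℤ Z)) (sym (negOnePowℕ-double n)) ⟩
  negOnePowℤ Z ℤ.* negOnePowℕ (n ℕ.+ n)                              ≡⟨ sym (negOnePowℤ-+ Z (n ℕ.+ n)) ⟩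
  negOnePowℤ (Z ℤ.+ + (n ℕ.+ n))                                     ≡⟨ cong negOnePowℤ Z+ ⟩
  negOnePowℕ (m ℕ.* n ℕ.+ (suc n Comb.C 2) ℕ.+ n)                         ≡⟨ sym (ℤₚ.*-identityʳ _) ⟩
  negOnePowℕ (m ℕ.* n ℕ.+ (suc n Comb.C 2) ℕ.+ n) ℤ.* + 1                 ≡⟨ cong (ℤ._*_ (negOnePowℕ (m ℕ.* n ℕ.+ (suc n Comb.C 2) ℕ.+ n))) (sym (negOnePowℕ-double (n ℕ.* n))) ⟩
  negOnePowℕ (m ℕ.* n ℕ.+ (suc n Comb.C 2) ℕ.+ n) ℤ.* negOnePowℕ (n ℕ.* n ℕ.+ n ℕ.* n) ≡⟨ sym (negOnePowℕ-+ (m ℕ.* n ℕ.+ (suc n Comb.C 2) ℕ.+ n) (n ℕ.* n ℕ.+ n ℕ.* n)) ⟩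
  negOnePowℕ (m ℕ.* n ℕ.+ (suc n Comb.C 2) ℕ.+ n ℕ.+ (n ℕ.* n ℕ.+ n ℕ.* n)) ≡⟨ cong negOnePowℕ (trans (rearrange m n (suc n Comb.C 2)) (cong (n ℕ.* (m ℕ.+ 2 ℕ.* n) ℕ.+_) (sym (sumTo-binomial n)))) ⟩
  negOnePowℕ (n ℕ.* (m ℕ.+ 2 ℕ.* n) ℕ.+ sumTo n)                     ≡⟨ negOnePowℕ-+ (n ℕ.* (m ℕ.+ 2 ℕ.* n)) (sumTo n) ⟩
  negOnePowℕ (n ℕ.* (m ℕ.+ 2 ℕ.* n)) ℤ.* negOnePowℕ (sumTo n)        ∎
  where
  open ≡.≡-Reasoning
  c = suc n Comb.C 2
  Z = ((+ m) ℤ.- (+ 1)) ℤ.* (+ n) ℤ.+ (+ c)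
  rearrange : ∀ m n c → m ℕ.* n ℕ.+ c ℕ.+ n ℕ.+ (n ℕ.* n ℕ.+ n ℕ.* n) ≡ n ℕ.* (m ℕ.+ 2 ℕ.* n) ℕ.+ (c ℕ.+ n)
  rearrange = solve-∀
  open RingKit ℤₚ.+-*-commutativeRing using (solve; _:=_; _:+_; _:*_; _:-_; con)
  Z+ : Z ℤ.+ + (n ℕ.+ n) ≡ + (m ℕ.* n ℕ.+ c ℕ.+ n)
  Z+ = trans (solve 3 (λ m n c → (m :- con (+ 1)) :* n :+ c :+ (n :+ n) := m :* n :+ c :+ n) refl (+ m) (+ n) (+ c))
    (cong (λ t → t ℤ.+ + c ℤ.+ + n) (sym (ℤₚ.pos-* m n)))

-- Comparison with the constant term

module Final (m n k₀ : ℕ) (k≤n : suc k₀ ≤ n) (a b : ℕ) where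
  k : ℕ
  k = suc k₀

  open Instance n (m ℕ.+ 2 ℕ.* n) a b
  module H = RHS m n k
  open Laurent N
  open Represent N
  open RingKit (psRing N)
  open Products (psRing N)
  open Signs (psRing N)
  open BottomRow m n k₀ k≤n setting using (C; q; r; bottomSeries)
  open Paper m n k₀ k≤n setting

  private
    q+k : q ℕ.+ k ≡ n
    q+k = m∸n+n≡m k≤n

  rep-x : ∀ i → 1 ≤ i → i ≤ n → H.x i ▷ (λ _ → + 0) , x i
  rep-x (suc i) _ i<n = rep-series (rep-fromPS (varₚ N i))
    (≈-sym (≈-trans (-‿cong (reflexive (X-in i i<n))) (-‿involutive (varₚ N i))))

  rep-P : H.P ▷ (λ _ → + 0) , P
  rep-P = rep-fromPS P

  rep-Q : H.Q ▷ (λ _ → + 0) , Q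
  rep-Q = rep-fromPS Q

  rep-I : ∀ i → 1 ≤ i → i ≤ n → H.inv1p i ▷ (λ _ → + 0) , I i
  rep-I (suc i) _ i<n = rep-series (rep-fromPS (inv1pₚ N i)) (reflexive (sym (I-in i i<n)))

  rep-g : ∀ i j → 1 ≤ i → i < j → j ≤ n → H.geo2 i j ▷ (λ _ → + 0) , g i j
  rep-g (suc i) (suc j) _ (s≤s i<j) j<n = rep-series (rep-fromPS (geo2ₚ N i j)) (reflexive (sym (g-in i j i<j j<n)))

  rep-xP : ∀ i → 1 ≤ i → i ≤ n → H.x i -L H.P *L (oneL +L H.x i) ▷ (λ _ → + 0) , xP i
  rep-xP i 1≤i i≤n = rep-+-same (rep-x i 1≤i i≤n) (rep-neg (rep-* rep-P (rep-+-same rep-one (rep-x i 1≤i i≤n))))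

  rep-xQ : ∀ i → 1 ≤ i → i ≤ n → H.x i -L H.Q *L (oneL +L H.x i) ▷ (λ _ → + 0) , xQ i
  rep-xQ i 1≤i i≤n = rep-+-same (rep-x i 1≤i i≤n) (rep-neg (rep-* rep-Q (rep-+-same rep-one (rep-x i 1≤i i≤n))))

  zB zC : ℕ → ℤ
  zB i = (+ (i ℕ.+ 1)) ℤ.- (+ (m ℕ.+ 2 ℕ.* n))
  zC i = (+ (i ℕ.+ 2)) ℤ.- (+ (m ℕ.+ 2 ℕ.* n))

  at : (ℕ → ℤ) → ℕ → ℕ → ℤ
  at z i j = + δ (i ∸ 1) j ℤ.* z i

  rep-B : H.termB ▷ (λ j → sumZ 1 q (λ i → at zB i j)) , bodyB
  rep-B = subst (λ is → prodL is fB ▷ (λ j → sumZ 1 q (λ i → at zB i j)) , bodyB) (sym (range-iota 1 q))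
    (rep-prod 1 q fB (λ i j → at zB i j) _ factor)
    where
    fB : ℕ → LS N
    fB i = powL (H.inv1p i) (i ℕ.+ k) *L H.xpow i (zB i) *L (H.x i -L H.P *L (oneL +L H.x i)) *L (H.x i -L H.Q *L (oneL +L H.x i))
    factor : ∀ i → 1 ≤ i → i < suc q → fB i ▷ at zB i , (I i ^ (i ℕ.+ k) * 1# * xP i * xQ i)
    factor i 1≤i i<r = rep-cong (rep-* (rep-* (rep-* (rep-pow (i ℕ.+ k) (rep-I i 1≤i i≤n)) (rep-xpow (i ∸ 1) (zB i))) (rep-xP i 1≤i i≤n)) (rep-xQ i 1≤i i≤n))
      (λ j → trans (ℤₚ.+-identityʳ _) (trans (ℤₚ.+-identityʳ _) (ℤₚ.+-identityˡ (at zB i j)))) (λ _ → refl)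
      where
      i≤n : i ≤ n
      i≤n = ≤-trans (≤-pred i<r) (m∸n≤m n k)

  n∸q : suc n ∸ r ≡ k
  n∸q = trans (cong (_∸ q) (sym q+k)) (m+n∸m≡n q k)

  r+k : r ℕ.+ k ≡ suc n
  r+k = cong suc q+k

  rep-C : H.termC ▷ (λ j → sumZ r k (λ i → at zC i j)) , bodyC
  rep-C = subst (λ is → prodL is fC ▷ (λ j → sumZ r k (λ i → at zC i j)) , bodyC) (sym (trans (range-iota r n) (cong (iota r) n∸q)))
    (rep-prod r k fC (λ i j → at zC i j) _ factor)
    where
    fC : ℕ → LS N
    fC i = powL (H.inv1p i) (n ℕ.+ 1) *L H.xpow i (zC i) *L (H.x i -L H.P *L (oneL +L H.x i))
    factor : ∀ i → r ≤ i → i < r ℕ.+ k → fC i ▷ at zC i , (I i ^ (n ℕ.+ 1) * 1# * xP i)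
    factor i r≤i i< = rep-cong (rep-* (rep-* (rep-pow (n ℕ.+ 1) (rep-I i 1≤i i≤n)) (rep-xpow (i ∸ 1) (zC i))) (rep-xP i 1≤i i≤n))
      (λ j → trans (ℤₚ.+-identityʳ _) (ℤₚ.+-identityˡ (at zC i j))) (λ _ → refl)
      where
      1≤i = ≤-trans (s≤s z≤n) r≤i
      i≤n : i ≤ n
      i≤n = ≤-pred (subst (i <_) r+k i<)

  rep-D : H.termD ▷ (λ _ → + 0) , bodyD
  rep-D = subst (λ is → prodL (concatMap (λ i → map (λ j → (i , j)) (range (suc i) n)) is) fD ▷ (λ _ → + 0) , bodyD) (sym (range-iota 1 n))
    (rep-pairs 1 n n fD _ refl factor)
    where
    fD : ℕ × ℕ → LS N
    fD p = (H.x (proj₁ p) -L H.x (proj₂ p)) *L (H.x (proj₁ p) +L H.x (proj₂ p) +L H.x (proj₁ p) *L H.x (proj₂ p))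
    factor : ∀ i j → 1 ≤ i → i < j → j ≤ n → fD (i , j) ▷ (λ _ → + 0) , ((x i - x j) * (x i + x j + x i * x j))
    factor i j 1≤i i<j j≤n = rep-* (rep-+-same xi (rep-neg xj)) (rep-+-same (rep-+-same xi xj) (rep-* xi xj))
      where
      xi = rep-x i 1≤i (≤-trans (<⇒≤ i<j) j≤n)
      xj = rep-x j (≤-trans 1≤i (<⇒≤ i<j)) j≤n

  rep-E : H.termE ▷ (λ _ → + 0) , bodyE
  rep-E = subst (λ is → prodL (concatMap (λ i → map (λ j → (i , j)) (range (suc i) n)) is) fE ▷ (λ _ → + 0) , bodyE) (sym (trans (range-iota r n) (cong (iota r) n∸q)))
    (rep-pairs r k n fE g (sym r+k) (λ i j r≤i i<j j≤n → rep-g i j (≤-trans (s≤s z≤n) r≤i) i<j j≤n))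
    where
    fE : ℕ × ℕ → LS N
    fE p = H.geo2 (proj₁ p) (proj₂ p)

  private
    ones : ℕ → ℕ → ℕ → ℕ
    ones a l = exponents a l (λ _ → 1)

    sumZ-ones : ∀ a l j → sumZ (suc a) l (λ i → ℤ.- + δ (i ∸ 1) j) ≡ ℤ.- + ones a l j
    sumZ-ones a zero    j = refl
    sumZ-ones a (suc l) j = trans (cong (ℤ._+_ (ℤ.- + δ a j)) (sumZ-ones (suc a) l j))
      (trans (sym (ℤₚ.neg-distrib-+ (+ δ a j) (+ ones (suc a) l j))) (cong (λ t → ℤ.- + (t ℕ.+ ones (suc a) l j)) (sym (ℕₚ.*-identityˡ (δ a j)))))

    0⊓neg : ∀ d → + 0 ℤ.⊓ (ℤ.- + d) ≡ ℤ.- + d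
    0⊓neg zero    = refl
    0⊓neg (suc d) = refl

    neg⊓0 : ∀ d → (ℤ.- + d) ℤ.⊓ + 0 ≡ ℤ.- + d
    neg⊓0 zero    = refl
    neg⊓0 (suc d) = refl

    gap : ∀ d → ℤ.∣ + 0 ℤ.- (ℤ.- + d) ∣ ≡ d
    gap zero    = refl
    gap (suc d) = refl

    no-gap : ∀ d → ℤ.∣ (ℤ.- + d) ℤ.- (ℤ.- + d) ∣ ≡ 0
    no-gap d = cong ℤ.∣_∣ (ℤₚ.+-inverseʳ (ℤ.- + d))

    mono-x : ∀ i → i < n → mono (δ i) ≈ x (suc i)
    mono-x i i<n = ≈-trans (λ e → cong (λ u → monoₚ u e) (sym (unitV-tabV N i)))
      (≈-sym (≈-trans (-‿cong (reflexive (X-in i i<n))) (-‿involutive (varₚ N i))))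

    mono-Π : ∀ a l → a ℕ.+ l ≤ n → mono (ones a l) ≈ Π (suc a) l x
    mono-Π a zero    _  = mono-0 (ones a 0) (λ _ → refl)
    mono-Π a (suc l) a≤ = ≈-trans
      (λ e → cong (λ u → monoₚ u e) (tabV-cong N (λ j _ → cong (ℕ._+ ones (suc a) l j) (ℕₚ.*-identityˡ (δ a j)))))
      (≈-trans (≈-sym (monoₚ-+ N (δ a) (ones (suc a) l)))
        (*-cong (mono-x a (<-≤-trans (m<m+n a (s≤s z≤n)) a≤)) (mono-Π (suc a) l (subst (_≤ n) (+-suc a l) a≤))))

    unit-* : ∀ {u} F → (∀ j → u j ≡ 0) → mono u * F ≈ F
    unit-* {u} F p = ≈-trans (*-congʳ {x = F} (mono-0 u p)) (*-identityˡ F)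

  rep-inverse : ∀ i → H.xpow i (ℤ.- + 1) ▷ (λ j → ℤ.- + δ (i ∸ 1) j) , 1#
  rep-inverse i = rep-cong (rep-xpow (i ∸ 1) (ℤ.- + 1)) (λ j → trans (ℤₚ.*-comm (+ δ (i ∸ 1) j) (ℤ.- + 1)) (ℤₚ.-1*i≡-i (+ δ (i ∸ 1) j))) (λ _ → refl)

  -- The first summand has the shift -1 in the variables `x r, …, x n` and the summand 1 has none.
  -- The common shift is the former, and this multiplies the summand 1 by `x r ⋯ x n`.
  rep-A : H.termA ▷ (λ j → ℤ.- + ones q k j) , bodyA
  rep-A = rep-series (rep-+ (λ j → ℤ.- + ones q k j) (λ _ → 0) (ones q k) first rep-one
      (λ j → neg⊓0 (ones q k j)) (λ j → no-gap (ones q k j)) (λ j → gap (ones q k j)))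
    (+-cong (unit-* {λ _ → 0} bodyA₁ (λ _ → refl)) (≈-trans (*-identityʳ (mono (ones q k))) (mono-Π q k (≤-reflexive q+k))))
    where
    q<n : q < n
    q<n = subst (q <_) q+k (m<m+n q (s≤s z≤n))
    bodyA₁ : Carrier
    bodyA₁ = sg k * Q * (1# + x r) * Π (suc r) k₀ (λ j → 1# - x j * x r)
    rep-1+1/x : oneL +L H.xpow r (ℤ.- (+ 1)) ▷ (λ j → ℤ.- + δ q j) , (1# + x r)
    rep-1+1/x = rep-series (rep-+ (λ j → ℤ.- + δ q j) (δ q) (λ _ → 0) rep-one (rep-inverse r)
        (λ j → 0⊓neg (δ q j)) (λ j → gap (δ q j)) (λ j → no-gap (δ q j)))
      (≈-trans (+-cong (≈-trans (*-identityʳ (mono (δ q))) (mono-x q q<n)) (unit-* {λ _ → 0} 1# (λ _ → refl))) (+-comm (x r) 1#))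
    fA : ℕ → LS N
    fA j = H.xpow j (ℤ.- (+ 1)) -L H.x r
    factor : ∀ i → suc r ≤ i → i < suc r ℕ.+ k₀ → fA i ▷ (λ j → ℤ.- + δ (i ∸ 1) j) , (1# - x i * x r)
    factor (suc i) (s≤s r≤i) i< = rep-series (rep-+ (λ j → ℤ.- + δ i j) (λ _ → 0) (δ i) (rep-inverse (suc i)) (rep-neg (rep-x r (s≤s z≤n) q<n))
        (λ j → neg⊓0 (δ i j)) (λ j → no-gap (δ i j)) (λ j → gap (δ i j)))
      (+-cong (unit-* {λ _ → 0} 1# (λ _ → refl)) (≈-trans (*-congʳ {x = - x r} (mono-x i i<n)) (≈-sym (-‿distribʳ-* (x (suc i)) (x r)))))
      where
      i<n : i < n
      i<n = ≤-pred (subst (suc i <_) (trans (sym (+-suc r k₀)) r+k) i<)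
    n∸r : n ∸ r ≡ k₀
    n∸r = trans (cong (_∸ r) (trans (sym q+k) (+-suc q k₀))) (m+n∸m≡n r k₀)
    product : prodL (range (suc r) n) fA ▷ (λ j → sumZ (suc r) k₀ (λ i → ℤ.- + δ (i ∸ 1) j)) , Π (suc r) k₀ (λ j → 1# - x j * x r)
    product = subst (λ is → prodL is fA ▷ (λ j → sumZ (suc r) k₀ (λ i → ℤ.- + δ (i ∸ 1) j)) , Π (suc r) k₀ (λ j → 1# - x j * x r))
      (sym (trans (range-iota (suc r) n) (cong (iota (suc r)) n∸r)))
      (rep-prod (suc r) k₀ fA (λ i j → ℤ.- + δ (i ∸ 1) j) _ factor)
    first : constL (negOnePowℕ k) *L H.Q *L (oneL +L H.xpow r (ℤ.- (+ 1))) *L prodL (range (suc r) n) fA ▷ (λ j → ℤ.- + ones q k j) , bodyA₁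
    first = rep-cong (rep-* (rep-* (rep-* (rep-series (rep-const (negOnePowℕ k)) (≈-sym (sg-const k))) rep-Q) rep-1+1/x) product)
      (λ j → trans (cong (ℤ._+ sumZ (suc r) k₀ (λ i → ℤ.- + δ (i ∸ 1) j)) (ℤₚ.+-identityˡ (ℤ.- + δ q j))) (sumZ-ones q k j)) (λ _ → refl)

  shiftOf : ℕ → ℤ
  shiftOf j = + 0 ℤ.+ (ℤ.- + ones q k j) ℤ.+ sumZ 1 q (λ i → at zB i j) ℤ.+ sumZ r k (λ i → at zC i j) ℤ.+ + 0 ℤ.+ + 0

  rep-rhs : H.rhs ▷ shiftOf , (constₚ H.sign * body)
  rep-rhs = rep-series (rep-* (rep-* (rep-* (rep-* (rep-* (rep-const H.sign) rep-A) rep-B) rep-C) rep-D) rep-E)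
    (solve* 6 (λ s a b c d e → s ⊗ a ⊗ b ⊗ c ⊗ d ⊗ e ⊜ s ⊗ (a ⊗ b ⊗ c ⊗ d ⊗ e)) ≈-refl (constₚ H.sign) bodyA bodyB bodyC bodyD bodyE)

  entry : {A : Set} → (ℕ → A) → A → A → ℕ → A
  entry c u v j with j ℕ.<? n | j ℕ.≟ n
  ... | yes _ | _     = c j
  ... | no _  | yes _ = u
  ... | no _  | no _  = v

  entry-below : {A : Set} (c : ℕ → A) (u v : A) → ∀ j → j < n → entry c u v j ≡ c j
  entry-below c u v j j<n with j ℕ.<? n | j ℕ.≟ n
  ... | yes _  | _ = refl
  ... | no j≮n | _ = ⊥-elim (j≮n j<n)

  entry-vector : {A : Set} (c : A) (u v : A) → Vec.replicate n c Vec.++ (u ∷ v ∷ []) ≡ tabV N (entry (λ _ → c) u v)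
  entry-vector c u v = sym (trans (tabV-++ n c (entry (λ _ → c) u v) (entry-below (λ _ → c) u v))
    (cong (λ w → Vec.replicate n c Vec.++ w) (cong₂ (λ y z → y ∷ z ∷ []) at-n at-sn)))
    where
    at-n : entry (λ _ → c) u v n ≡ u
    at-n with n ℕ.<? n | n ℕ.≟ n
    ... | yes p | _     = ⊥-elim (<-irrefl refl p)
    ... | no _  | yes _ = refl
    ... | no _  | no ¬p = ⊥-elim (¬p refl)
    at-sn : entry (λ _ → c) u v (suc n) ≡ v
    at-sn with suc n ℕ.<? n | suc n ℕ.≟ n
    ... | yes p | _     = ⊥-elim (<-irrefl refl (<-trans (n<1+n n) p))
    ... | no _  | yes p = ⊥-elim (1+n≢n p)
    ... | no _  | no _  = refl

  -- What the power series part has to supply for the constant term in the `x` and the monomial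
  -- `P ^ a * Q ^ b`: the shifts of the integrand add up to `j + 2 - C` in the `x` with 0-based
  -- index `j`, and to 0 in `P` and `Q`.
  exponent : ℕ → ℕ
  exponent = entry (λ j → C ∸ (j ℕ.+ 2)) a b

  private
    1≤n : 1 ≤ n
    1≤n = ≤-trans (s≤s z≤n) k≤n

    j+2≤C : ∀ j → j < n → j ℕ.+ 2 ≤ C
    j+2≤C j j<n = ≤-trans (≤-reflexive (eq j)) (≤-trans (+-mono-≤ j<n (≤-trans 1≤n (m≤m+n n 0))) (m≤n+m (2 ℕ.* n) m))
      where
      eq : ∀ j → j ℕ.+ 2 ≡ suc j ℕ.+ 1
      eq j = +-suc j 1

    at-off : ∀ z i j → i ∸ 1 ≢ j → at z i j ≡ + 0
    at-off z i j ne = trans (cong (λ t → + t ℤ.* z i) (δ-≢ (i ∸ 1) j (ne ∘ sym))) (ℤₚ.*-zeroˡ (z i))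

    at-on : ∀ z j → at z (suc j) j ≡ z (suc j)
    at-on z j = trans (cong (λ c → + (if c then 1 else 0) ℤ.* z (suc j)) (≡ᵇ-refl j)) (ℤₚ.*-identityˡ (z (suc j)))

    pred-≢ : ∀ i j → 1 ≤ i → i ≢ suc j → i ∸ 1 ≢ j
    pred-≢ (suc i) j _ ne refl = ne refl

    sum-in : ∀ z p l j → p ≤ j → j < p ℕ.+ l → sumZ (suc p) l (λ i → at z i j) ≡ z (suc j)
    sum-in z p l j p≤j j< = trans (sumZ-in (suc p) l (λ i → at z i j) (suc j) (s≤s p≤j) (s≤s j<)
      (λ i p<i i≢ → at-off z i j (pred-≢ i j (≤-trans (s≤s z≤n) p<i) i≢))) (at-on z j)

    sum-out : ∀ z p l j → j < p ⊎ p ℕ.+ l ≤ j → sumZ (suc p) l (λ i → at z i j) ≡ + 0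
    sum-out z p l j out = sumZ-out (suc p) l _ (λ i p<i i< → at-off z i j (outside out i p<i i<))
      where
      outside : j < p ⊎ p ℕ.+ l ≤ j → ∀ i → suc p ≤ i → i < suc p ℕ.+ l → i ∸ 1 ≢ j
      outside (inj₁ j<p) (suc i) (s≤s p≤i) _        refl = <⇒≱ j<p p≤i
      outside (inj₂ p≤j) (suc i) _         (s≤s i<) refl = <⇒≱ i< p≤j

    minus : ∀ c d → c ≤ d → + 0 ℤ.- (+ c ℤ.- + d) ≡ + (d ∸ c)
    minus c d c≤d = trans (ℤₚ.+-identityˡ _) (trans (cong ℤ.-_ (trans (ℤₚ.m-n≡m⊖n c d) (ℤₚ.⊖-≤ c≤d))) (ℤₚ.neg-involutive (+ (d ∸ c))))

    collect : ∀ {x x′ y y′ z z′} → x ≡ x′ → y ≡ y′ → z ≡ z′ →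
      + 0 ℤ.+ (ℤ.- + x) ℤ.+ y ℤ.+ z ℤ.+ + 0 ℤ.+ + 0 ≡ (ℤ.- + x′) ℤ.+ y′ ℤ.+ z′
    collect {x} {y = y} {z = z} refl refl refl = trans (ℤₚ.+-identityʳ _) (trans (ℤₚ.+-identityʳ _) (cong (λ t → t ℤ.+ y ℤ.+ z) (ℤₚ.+-identityˡ (ℤ.- + x))))

    -- With `i = j + 1`, the absent paths have the shift `i + 1 - C` from `termB`. The present ones
    -- have `i + 2 - C` from `termC` and -1 from `termA`, which is the same.
    shift-below : ∀ j → j < n → shiftOf j ≡ + (j ℕ.+ 2) ℤ.- + C
    shift-below j j<n with j ℕₚ.<? q
    ... | yes j<q = trans (collect (exponents-out q k (λ _ → 1) j (inj₁ j<q)) (sum-in zB 0 q j z≤n j<q) (sum-out zC q k j (inj₁ j<q)))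
      (trans (ℤₚ.+-identityʳ _) (trans (ℤₚ.+-identityˡ _) (cong (λ t → + t ℤ.- + C) (sym (+-suc j 1)))))
    ... | no j≮q = trans (collect (exponents-in q k (λ _ → 1) j q≤j j<q+k) (sum-out zB 0 q j (inj₂ q≤j)) (sum-in zC q k j q≤j j<q+k))
      (sym (ℤₚ.+-assoc (ℤ.- + 1) (+ (suc j ℕ.+ 2)) (ℤ.- + C)))
      where
      q≤j = ≮⇒≥ j≮q
      j<q+k = subst (j <_) (sym q+k) j<n

    shift-above : ∀ j → n ≤ j → shiftOf j ≡ + 0
    shift-above j n≤j = collect (exponents-out q k (λ _ → 1) j (inj₂ q+k≤j)) (sum-out zB 0 q j (inj₂ (≤-trans (m≤m+n q k) q+k≤j))) (sum-out zC q k j (inj₂ q+k≤j))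
      where q+k≤j = subst (_≤ j) (sym q+k) n≤j

  shift-exponent : ∀ j → j < N → entry (λ _ → + 0) (+ a) (+ b) j ℤ.- shiftOf j ≡ + exponent j
  shift-exponent j j<N with j ℕ.<? n | j ℕ.≟ n
  ... | yes j<n | _        = trans (cong (λ t → + 0 ℤ.- t) (shift-below j j<n)) (minus (j ℕ.+ 2) C (j+2≤C j j<n))
  ... | no j≮n  | yes refl = trans (cong (λ t → + a ℤ.- t) (shift-above j ≤-refl)) (ℤₚ.+-identityʳ (+ a))
  ... | no j≮n  | no _     = trans (cong (λ t → + b ℤ.- t) (shift-above j (≮⇒≥ j≮n))) (ℤₚ.+-identityʳ (+ b))

  rhsCoeff-body : H.rhsCoeff a b ≡ H.sign ℤ.* body (tabV N exponent)
  rhsCoeff-body = trans (cong (coeffL H.rhs) (entry-vector (+ 0) (+ a) (+ b)))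
    (trans (coeffL-▷ rep-rhs (entry (λ _ → + 0) (+ a) (+ b)) exponent shift-exponent) (constₚ-* H.sign body (tabV N exponent)))

  private
    height : ℕ → ℕ
    height i = suc (suc i)

    sumℕ-snoc : ∀ a l h → sumℕ a (suc l) h ≡ sumℕ a l h ℕ.+ h (a ℕ.+ l)
    sumℕ-snoc a zero    h = trans (ℕₚ.+-identityʳ (h a)) (cong h (sym (ℕₚ.+-identityʳ a)))
    sumℕ-snoc a (suc l) h = trans (cong (h a ℕ.+_) (sumℕ-snoc (suc a) l h))
      (trans (sym (ℕₚ.+-assoc (h a) (sumℕ (suc a) l h) _)) (cong (λ t → sumℕ a (suc l) h ℕ.+ h t) (sym (+-suc a l))))

    sum-height : ∀ l → sumℕ 0 l height ≡ sumTo l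
    sum-height zero    = refl
    sum-height (suc l) = trans (sumℕ-snoc 0 l height) (cong₂ ℕ._+_ (sum-height l) (ℕₚ.+-comm 2 l))

    top-entry : top ≡ tabV N (entry (λ _ → C) a b)
    top-entry = entry-vector C a b

    w : ℕ → ℕ
    w = exponents 0 n height

    w≤ : ∀ j → j < N → w j ≤ entry (λ _ → C) a b j
    w≤ j _ with j ℕ.<? n | j ℕ.≟ n
    ... | yes j<n | _ = ≤-trans (≤-reflexive (trans (exponents-in 0 n height j z≤n j<n) (ℕₚ.+-comm 2 j))) (j+2≤C j j<n)
    ... | no j≮n  | yes _ = ≤-trans (≤-reflexive (exponents-out 0 n height j (inj₂ (≮⇒≥ j≮n)))) z≤n
    ... | no j≮n  | no _  = ≤-trans (≤-reflexive (exponents-out 0 n height j (inj₂ (≮⇒≥ j≮n)))) z≤n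

    w-exponent : ∀ j → j < N → entry (λ _ → C) a b j ∸ w j ≡ exponent j
    w-exponent j _ with j ℕ.<? n | j ℕ.≟ n
    ... | yes j<n | _ = cong (C ∸_) (trans (exponents-in 0 n height j z≤n j<n) (ℕₚ.+-comm 2 j))
    ... | no j≮n  | yes _ = cong (a ∸_) (exponents-out 0 n height j (inj₂ (≮⇒≥ j≮n)))
    ... | no j≮n  | no _  = cong (b ∸_) (exponents-out 0 n height j (inj₂ (≮⇒≥ j≮n)))

  -- The factor `∏ X p ^ (p + 1)` lowers the exponents of `top` to those that the constant term asks
  -- for, and contributes the sign of its degree.
  bottomSeries-top : bottomSeries top ≡ negOnePowℕ (sumTo n) ℤ.* body (tabV N exponent)
  bottomSeries-top = trans (series-eq top) (trans (constₚ-* (negOnePowℕ (sumTo n)) (mono w * body) top) (cong (ℤ._*_ (negOnePowℕ (sumTo n)))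
      (trans (monoₚ-* (tabV N w) body top) (trans (cong (shiftₚ (tabV N w) body) top-entry)
      (trans (shiftₚ-tabV N (entry (λ _ → C) a b) w body w≤) (cong body (tabV-cong N w-exponent)))))))
    where
    pred-height : ∀ p → 1 ≤ p → suc p ≡ height (p ∸ 1)
    pred-height (suc p) _ = refl
    series-eq : bottomSeries ≈ constₚ (negOnePowℕ (sumTo n)) * (mono w * body)
    series-eq = ≈-trans bottomSeries-body (≈-trans
      (*-congʳ {x = body} (≈-trans (Π-cong 1 n (λ p 1≤p _ → reflexive (cong (X p ^_) (pred-height p 1≤p)))) (Π-X-mono 0 n height ≤-refl)))
      (≈-trans (*-assoc (sg (sumℕ 0 n height)) (mono w) body)
        (*-congʳ {x = mono w * body} (≈-trans (reflexive (cong sg (sum-height n))) (sg-const (sumTo n))))))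

  rhsCoeff-κ : H.rhsCoeff a b ≡ κ bottomSeries
  rhsCoeff-κ = trans rhsCoeff-body (trans (cong (ℤ._* body (tabV N exponent)) (sign-cancels m n))
    (trans (ℤₚ.*-assoc (negOnePowℕ (n ℕ.* C)) (negOnePowℕ (sumTo n)) (body (tabV N exponent)))
      (cong (ℤ._*_ (negOnePowℕ (n ℕ.* C))) (sym bottomSeries-top))))

theorem4p3 : (m n k : ℕ) → 1 ≤ k → k ≤ n → (a b : ℕ) →
    RHS.rhsCoeff m n k a b ≡ + Magog.magogCount m n k a b
theorem4p3 m n (suc k) 1≤k k≤n a b = trans (Final.rhsCoeff-κ m n k k≤n a b)
  (Chain.κ-magog m n k k≤n setting a b κ-monomial)
  where open Instance n (m ℕ.+ 2 ℕ.* n) a b using (setting; κ-monomial)
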